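{- Fix an integer $k \ge 2$. As $n \to \infty$, the number of $k$-SAT functions on the $n$ Boolean variables $x_1,\dots,x_n$ is $(1+o(1))\,2^{n+\binom{n}{k}}$. Equivalently, a $1-o(1)$ fraction of all $k$-SAT functions on $n$ variables are unate.
   Context: Variables are $x_1,\dots,x_n$; a literal is $x_i$ (positive) or $\overline{x_i}$ (negative). A clause is a conjunction of $k$ literals using $k$ distinct variables. A $k$-SAT formula is a set of clauses; it represents the function $\{0,1\}^n\to\{0,1\}$ given by the disjunction (OR) of its clauses. A $k$-SAT function on $n$ variables is a function $\{0,1\}^n \to \{0,1\}$ represented by some $k$-SAT formula on $x_1,\dots,x_n$. A formula is unate if each variable appears in it only as a positive literal or only as a negative literal; a $k$-SAT function is unate if it is represented by some unate $k$-SAT formula. -}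

module Defs where

open import Data.Nat using (ℕ; zero; suc; _+_; _*_; _^_)
open import Data.Bool using (Bool; true; false; _∧_; _∨_; if_then_else_)
open import Data.Fin using (Fin)
open import Data.Vec using (Vec; []; _∷_; lookup)
open import Data.List using (List; []; _∷_; map; _++_; foldr)
open import Data.Product using (Σ; _×_; _,_; proj₁; proj₂; ∃)
open import Data.Vec.Relation.Unary.Unique.Propositional using (Unique)
open import Relation.Binary.PropositionalEquality using (_≡_)

-- A literal over variables x_1..x_n: (i , b) with b = true meaning the
-- positive literal x_i, b = false meaning the negated literal ¬x_i.
Literal : ℕ → Set
Literal n = Fin n × Bool

evalLit : ∀ {n} → Vec Bool n → Literal n → Bool
evalLit x (i , true)  = lookup x i
evalLit x (i , false) = Data.Bool.not (lookup x i)

record Clause (k n : ℕ) : Set where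
  constructor clause
  field
    lits     : Vec (Literal n) k
    distinct : Unique (Data.Vec.map proj₁ lits)
open Clause public

evalLits : ∀ {k n} → Vec Bool n → Vec (Literal n) k → Bool
evalLits x []       = true
evalLits x (l ∷ ls) = evalLit x l ∧ evalLits x ls

evalClause : ∀ {k n} → Clause k n → Vec Bool n → Bool
evalClause c x = evalLits x (lits c)

-- A k-SAT formula: a (finite) collection of clauses, given as a list
-- (repetitions/order are irrelevant to the function represented).
Formula : ℕ → ℕ → Set
Formula k n = List (Clause k n)

evalFormula : ∀ {k n} → Formula k n → Vec Bool n → Bool
evalFormula F x = foldr (λ c b → evalClause c x ∨ b) false F

allAssignments : (n : ℕ) → List (Vec Bool n)
allAssignments zero    = [] ∷ []
allAssignments (suc n) =
  map (false ∷_) (allAssignments n) ++ map (true ∷_) (allAssignments n)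

-- Truth table of a function {0,1}^n → {0,1}; it determines the function,
-- so functions {0,1}^n → {0,1} are identified with their truth tables.
truthTable : (n : ℕ) → (Vec Bool n → Bool) → List Bool
truthTable n f = map f (allAssignments n)

IsKSATFunction : ℕ → (n : ℕ) → List Bool → Set
IsKSATFunction k n T = Σ (Formula k n) λ F → T ≡ truthTable n (evalFormula F)

{-# OPTIONS --safe #-}
module Submission where

-- Lower bound: a sign vector and a family of k-sets covering every variable give pairwise
-- different unate functions.  Upper bound: every function has a minimal formula, in which each
-- clause has a witness satisfying it alone.  A container argument puts all but a negligible part
-- of the minimal formulas near a clause set without the configurations that minimality forbids;
-- a Turán inequality and its stability version show that such a formula has few literals
-- disagreeing with its best fitting sign vector, taken to be all-positive.  If a negative clause
-- is left, then in each of many disjoint blocks of k-sets at least one set is not a positive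
-- clause, which saves a constant number of bits per block, while the negative clauses cost less.
-- A variable negative in many clauses is removed: its links are counted by a 2-colouring of
-- their codimension-one faces, and the rest by induction on n.

-- Containers lose a factor 2^(L n^(k-1)), far too much for an error of 1 + o(1). They serve only to
-- discard formulas far from unate, where the gain is a constant proportion of n^k bits. Formulas
-- close to unate are compared with the all-positive ones directly, and there a single negative
-- clause must already pay for itself.
--
-- A container with q sign patterns on a set allows 1 + q states there. Relative to one bit per set,
-- an empty set gains 1 and a set with two patterns costs log2 3 - 1 < 3/5, so the Turán inequality
-- must keep the two-pattern sets below 5/3 times the empty ones. It is proved with 100/61; the gap
-- between 300 and 305 = 5 * 61 pays for all error terms.
--
-- Induction on n is forced by variables negative in many clauses: there the shadow argument for
-- clauses with one negative literal breaks down. It first yields a constant factor, and one further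
-- step makes it 1 + o(1).
--
-- Sets are represented by all their orderings, so that averaging over tuples is exact, and real
-- exponents are avoided by comparing powers, as in x^s * 2^u <= 2^(s * b).

open import Defs
open import Data.Nat using (ℕ; zero; suc; _+_; _*_; _^_; _≤_; _<_; _∸_; _⊔_; NonZero) renaming (z≤n to zn; s≤s to ss; >-nonZero to nn)
open import Data.Nat.Properties renaming (≤-trans to tr; ≤-reflexive to re; *-monoʳ-≤ to mo; module ≤-Reasoning to Re; *-monoˡ-≤ to mn; *-mono-≤ to m0; +-mono-≤ to m1; +-identityʳ to ie; ^-distribˡ-+-* to dr; m≤m+n to mm; +-monoʳ-≤ to m2; *-identityʳ to it; *-cancelˡ-≤ to ca; ^-monoˡ-≤ to m3; ≤-refl to rf; +-monoˡ-≤ to m4; m≤n+m to m5; ^-*-assoc to ao; *-zeroʳ to ze; *-assoc to ac; ≤ᵇ⇒≤ to aa; *-comm to c2; *-identityˡ to ii; *-distribˡ-+ to d0; n≤1+n to n2; <-irrefl to il; +-cancelʳ-≤ to c6; ^-monoʳ-≤ to m8; *-cancelʳ-≤ to cf; m^n>0 to m9; m+[n∸m]≡n to md; <⇒≤ to bf; <-≤-trans to t5)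
open import Data.Nat.DivMod using (_/_; m*n/n≡m; /-monoˡ-≤; m/n*n≤m)
open import Data.Nat.Combinatorics using (_C_; nCk+nC[k+1]≡[n+1]C[k+1]; k>n⇒nCk≡0; nCk≡nC[n∸k]; nCn≡1)
open import Data.Bool using (Bool; _∧_; _∨_; not; if_then_else_) renaming (true to tu; false to fa)
open import Data.Bool.Properties using (∧-identityʳ; ∨-assoc; ∨-comm; ∨-identityʳ; ∨-zeroʳ; ∧-distribˡ-∨) renaming (¬-not to n1; not-injective to nj; not-involutive to nl; ∧-zeroʳ to zr)
open import Data.Fin using (Fin; zero; suc; _↑ˡ_; _↑ʳ_; splitAt; punchOut) renaming (punchIn to pu)
open import Data.Unit using (⊤; tt)
open import Data.Empty using (⊥) renaming (⊥-elim to el)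
open import Data.Vec using (Vec; []; _∷_; _[_]≔_; insertAt; removeAt; replicate) renaming (lookup to lo; tabulate to tb; zipWith to zW)
open import Data.List using (List; []; _∷_; length; map; _++_; cartesianProductWith) renaming (allFin to al; cartesianProduct to ct; filterᵇ to fi; concatMap to cP)
open import Data.List.Properties using (length-++; length-map; ∷-injectiveˡ; ∷-injectiveʳ; map-cong; length-tabulate)
open import Data.List.Relation.Unary.Any using (index) renaming (there to th; here to he)
open import Data.List.Relation.Unary.Any.Properties using (lookup-index)
open import Data.List.Membership.Propositional.Properties using (∈-++⁻; ∈-lookup; ∈-cartesianProduct⁻; ∈-cartesianProductWith⁺; ∈-cartesianProductWith⁻) renaming (∈-allFin to aF; ∈-cartesianProduct⁺ to ci; ∈-map⁻ to ma; ∈-++⁺ʳ to ah; ∈-++⁺ˡ to ax; ∈-map⁺ to mp)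
open import Function.Bundles using (_⇔_; Equivalence)
open import Data.Product using (Σ; _×_; _,_; ∃) renaming (proj₁ to po; proj₂ to p0)
open import Data.Sum using (_⊎_) renaming (inj₂ to i0; inj₁ to i1)
open import Data.List.Relation.Unary.Unique.Propositional using (Unique)
open import Data.List.Relation.Unary.Unique.Propositional.Properties using (cartesianProduct⁺; map⁺; ++⁺)
open import Data.List.Membership.Propositional using (_∈_)
open import Data.Nat.Tactic.RingSolver using () renaming (solve-∀ to so)
open import Relation.Nullary using (Dec; does; yes; no; ¬_)
open import Function using (_∘_; _∋_; id)
open import Relation.Binary.PropositionalEquality renaming (trans to ta; cong to co; cong₂ to cn; subst to sb; module ≡-Reasoning to Ra)
open import Data.Nat.DivMod using (m≡m%n+[m/n]*n; m%n<n)
import Data.Fin as Fin′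
open import Data.List.Properties using (++-identityʳ)
import Data.Bool as Bool
import Data.Fin.Properties as Fin
import Data.Vec as Vec
import Data.Vec.Properties as Vec
import Data.Vec.Relation.Unary.All as VAll
import Data.Vec.Relation.Unary.All.Properties as VAll
import Data.Vec.Relation.Unary.AllPairs as VPairs
import Data.Vec.Relation.Unary.Unique.Propositional as VU
import Data.Vec.Relation.Unary.Unique.Propositional.Properties as VU
import Data.List as List
import Data.List.Relation.Unary.Unique.Propositional.Properties as Uniq
import Data.List.Relation.Unary.All as All
import Data.List.Relation.Unary.AllPairs as AllPairs
open import Data.Vec.Properties using () renaming (lookup∘update′ to Vu; lookup∘update to Ve; lookup-replicate to Vr; lookup∘tabulate to Vt; lookup-map to Vm)
open import Data.Vec using () renaming (map to Vc)

-- Families of k-sets and the functions they define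

-- A family of k-subsets of an n-set, organised along Pascal's rule: in
-- (P , Q) the sets of P contain the first element and those of Q do not.
Fa : ℕ -> ℕ -> Set
Fa zero    zero    = Bool
Fa zero(suc k)= ⊤
Fa(suc n)zero    = Fa n zero
Fa(suc n)(suc k)= Fa n k × Fa n(suc k)

-- The monotone function of the family: true when the set of true entries of the vector contains a
-- member.
c3 : ∀ n k -> Fa n k -> Vec Bool n -> Bool
c3 zero    zero    b       []       = b
c3 zero(suc k)_       []       = fa
c3(suc n)zero    P(_ ∷ zs)= c3 n zero P zs
c3(suc n)(suc k)(P , Q)(z ∷ zs)=(z ∧ c3 n k P zs)∨ c3 n(suc k)Q zs

wg : ∀{n}-> Vec Bool n -> ℕ
wg []           = 0
wg(tu  ∷ zs)= suc(wg zs)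
wg(fa ∷ zs)= wg zs

cg : ∀ n k(P : Fa n k)zs -> wg zs < k -> c3 n k P zs ≡ fa
cg zero(suc k)P       []           w<k       = refl
cg(suc n)(suc k)(P , Q)(tu  ∷ zs)(ss w<k)
 rewrite cg n k P zs w<k = cg n(suc k)Q zs(m≤n⇒m≤1+n w<k)
cg(suc n)(suc k)(P , Q)(fa ∷ zs)w<k       = cg n(suc k)Q zs w<k

-- No member of the family fits into fewer than k true entries, so at weight exactly k the function
-- is the membership test for that k-set.
cj : ∀ n k(P P′ : Fa n k)->
 (∀ zs -> wg zs ≡ k -> c3 n k P zs ≡ c3 n k P′ zs)-> P ≡ P′
cj zero    zero    P       P′        h = h [] refl
cj zero(suc k)P       P′        h = refl
cj(suc n)zero    P       P′        h =
 cj n zero P P′(\ zs w -> h(fa ∷ zs)w)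
cj(suc n)(suc k)(P , Q)(P′ , Q′)h = cn _,_
 (cj n k P P′ \ zs w -> ta(sym(atTop P Q zs w))(ta(h(tu ∷ zs)(co suc w))(atTop P′ Q′ zs w)))
 (cj n(suc k)Q Q′(\ zs w -> h(fa ∷ zs)w))
 where
 atTop : ∀(P : Fa n k)(Q : Fa n(suc k))zs -> wg zs ≡ k ->
  c3 n k P zs ∨ c3 n(suc k)Q zs ≡ c3 n k P zs
 atTop P Q zs w rewrite cg n(suc k)Q zs(ss(re w))= ∨-identityʳ _

-- Marks the variables at which the assignment agrees with the sign vector. For a fixed sign vector
-- it is an involution (`av`), so every agreement vector occurs.
a1 : ∀{n}-> Vec Bool n -> Vec Bool n -> Vec Bool n
a1 = Vec.zipWith(\ s x -> if s then x else not x)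

unate : ∀ n k -> Vec Bool n -> Fa n k -> Vec Bool n -> Bool
unate n k σ P x = c3 n k P(a1 σ x)

-- Clause lists representing the unate functions

lC : ∀{k n}-> Clause k n -> Clause k(suc n)
lC(clause ls d)= clause(Vc(\ l -> suc(po l), p0 l)ls)
 (sb VU.Unique(ta(sym(Vec.map-∘ suc po ls))(Vec.map-∘ po _ ls))
  (VU.map⁺ Fin.suc-injective d))

consClause : ∀{k n}-> Bool -> Clause k n -> Clause(suc k)(suc n)
consClause s c = clause((zero , s)∷ lits c′)(fh(lits c)VPairs.∷ distinct c′)
 where
 c′ = lC c
 fh : ∀{k n}(ls : Vec(Literal n)k)->
  VAll.All((Fin(suc n)∋ zero)≢_)(Vc po(Vc(\ l -> suc(po l), p0 l)ls))
 fh []       = VAll.[]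
 fh(l ∷ ls)=(\())VAll.∷ fh ls

evalLit-lift : ∀{n}b(x : Vec Bool n)l -> evalLit(b ∷ x)(suc(po l), p0 l)≡ evalLit x l
evalLit-lift b x(i , tu)= refl
evalLit-lift b x(i , fa)= refl

eC : ∀{k n}b(x : Vec Bool n)(c : Clause k n)->
 evalClause(lC c)(b ∷ x)≡ evalClause c x
eC b x(clause ls _)= go ls
 where
 go : ∀{k}(ls : Vec _ k)->
  evalLits(b ∷ x)(Vc(\ l -> suc(po l), p0 l)ls)≡ evalLits x ls
 go []       = refl
 go(l ∷ ls)= cn _∧_(evalLit-lift b x l)(go ls)

em : ∀{k n}b(x : Vec Bool n)(F : Formula k n)->
 evalFormula(map lC F)(b ∷ x)≡ evalFormula F x
em b x []      = refl
em b x(c ∷ F)= cn _∨_(eC b x c)(em b x F)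

es : ∀{k n}s b(x : Vec Bool n)(F : Formula k n)->
 evalFormula(map(consClause s)F)(b ∷ x)≡(if s then b else not b)∧ evalFormula F x
es s b x []      = sym(zr _)
es s b x(c ∷ F)= ta
 (cn _∨_(cn _∧_(head s)(eC b x c))(es s b x F))
 (sym(∧-distribˡ-∨(if s then b else not b)_ _))
 where
 head : ∀ s -> evalLit(b ∷ x)(zero , s)≡(if s then b else not b)
 head tu  = refl
 head fa = refl

e4 : ∀{k n}(F G : Formula k n)x ->
 evalFormula(F ++ G)x ≡ evalFormula F x ∨ evalFormula G x
e4 []      G x = refl
e4(c ∷ F)G x =
 ta(co(evalClause c x ∨_)(e4 F G x))(sym(∨-assoc(evalClause c x)_ _))

un : ∀ n k -> Vec Bool n -> Fa n k -> Formula k n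
un zero    zero    []      tu    = clause [] VPairs.[] ∷ []
un zero    zero    []      fa   = []
un zero(suc k)[]      _       = []
un(suc n)zero(s ∷ σ)P       = map lC(un n zero σ P)
un(suc n)(suc k)(s ∷ σ)(P , Q)=
 map(consClause s)(un n k σ P)++ map lC(un n(suc k)σ Q)

ev : ∀ n k σ P x -> evalFormula(un n k σ P)x ≡ unate n k σ P x
ev zero    zero    []      tu    []      = refl
ev zero    zero    []      fa   []      = refl
ev zero(suc k)[]      _       []      = refl
ev(suc n)zero(s ∷ σ)P(b ∷ x)=
 ta(em b x(un n zero σ P))(ev n zero σ P x)
ev(suc n)(suc k)(s ∷ σ)(P , Q)(b ∷ x)= ta
 (e4(map(consClause s)(un n k σ P))_(b ∷ x))
 (cn _∨_
  (ta(es s b x(un n k σ P))(co((if s then b else not b)∧_)(ev n k σ P x)))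
  (ta(em b x(un n(suc k)σ Q))(ev n(suc k)σ Q x)))

-- Recovering the signs and the family from the function

c1 : ∀ n k(P : Fa n k)zs i -> c3 n k P(zs Vec.[ i ]≔ fa)≡ tu ->
 c3 n k P(zs Vec.[ i ]≔ tu)≡ tu
c1(suc n)zero    P(z ∷ zs)zero    h = h
c1(suc n)zero    P(z ∷ zs)(suc i)h = c1 n zero P zs i h
c1(suc n)(suc k)(P , Q)(z ∷ zs)zero    h rewrite h = ∨-zeroʳ _
c1(suc n)(suc k)(P , Q)(fa ∷ zs)(suc i)h = c1 n(suc k)Q zs i h
c1(suc n)(suc k)(P , Q)(tu ∷ zs)(suc i)h
 with c3 n k P(zs Vec.[ i ]≔ fa)in eq
... | tu  rewrite c1 n k P zs i eq = refl
... | fa rewrite c1 n(suc k)Q zs i h = ∨-zeroʳ _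

iE : ∀ n k -> Fa n k -> Bool
iE zero    zero    b       = not b
iE zero(suc k)_       = tu
iE(suc n)zero    P       = iE n zero P
iE(suc n)(suc k)(P , Q)= iE n k P ∧ iE n(suc k)Q

-- True when no member of the family contains the given element; at k = 0 the only possible member
-- is the empty set, hence the constant.
a6 : ∀ n k -> Fin n -> Fa n k -> Bool
a6(suc n)zero    i       P       = tu
a6(suc n)(suc k)zero(P , Q)= iE n k P
a6(suc n)(suc k)(suc i)(P , Q)= a6 n k i P ∧ a6 n(suc k)i Q

∧-false : ∀ a b -> a ∧ b ≡ fa -> a ≡ fa ⊎ b ≡ fa
∧-false fa b h = i1 refl
∧-false tu  b h = i0 h

nm : ∀ n k(P : Fa n k)-> iE n k P ≡ fa ->
 ∃ \ zs -> wg zs ≡ k × c3 n k P zs ≡ tu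
nm zero    zero    tu    h = [] , refl , refl
nm(suc n)zero    P       h =
 let zs , w , c = nm n zero P h in fa ∷ zs , w , c
nm(suc n)(suc k)(P , Q)h with ∧-false(iE n k P)_ h
... | i1 hP = let zs , w , c = nm n k P hP in
 tu ∷ zs , co suc w , co(_∨ c3 n(suc k)Q zs)c
... | i0 hQ = let zs , w , c = nm n(suc k)Q hQ in fa ∷ zs , w , c

nv : ∀ n k i(P : Fa n k)-> a6 n k i P ≡ fa ->
 ∃ \ zs -> wg zs ≡ k × lo zs i ≡ tu × c3 n k P zs ≡ tu
nv(suc n)(suc k)zero(P , Q)h =
 let zs , w , c = nm n k P h in
 tu ∷ zs , co suc w , refl , co(_∨ c3 n(suc k)Q zs)c
nv(suc n)(suc k)(suc i)(P , Q)h with ∧-false(a6 n k i P)_ h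
... | i1 hP = let zs , w , l , c = nv n k i P hP in
 tu ∷ zs , co suc w , l , co(_∨ c3 n(suc k)Q zs)c
... | i0 hQ = let zs , w , l , c = nv n(suc k)i Q hQ in fa ∷ zs , w , l , c

we : ∀{n}(zs : Vec Bool n)i -> lo zs i ≡ tu ->
 suc(wg(zs Vec.[ i ]≔ fa))≡ wg zs
we(tu  ∷ zs)zero    h = refl
we(tu  ∷ zs)(suc i)h = co suc(we zs i h)
we(fa ∷ zs)(suc i)h = we zs i h

agree : Bool -> Bool -> Bool
agree s x = if s then x else not x

ak : ∀ s z -> agree s(agree s z)≡ z
ak tu  z     = refl
ak fa tu  = refl
ak fa fa = refl

av : ∀{n}(σ z : Vec Bool n)-> a1 σ(a1 σ z)≡ z
av []      []      = refl
av(s ∷ σ)(z ∷ zs)= cn _∷_(ak s z)(av σ zs)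

a4 : ∀{n}(σ z : Vec Bool n)i b ->
 a1 σ(z Vec.[ i ]≔ b)≡ a1 σ z Vec.[ i ]≔ agree(lo σ i)b
a4(s ∷ σ)(z ∷ zs)zero    b = refl
a4(s ∷ σ)(z ∷ zs)(suc i)b = co(_ ∷_)(a4 σ zs i b)

-- If P uses the variable i, flipping i from agreement to disagreement with σ
-- can turn the unate function of σ and P from true to false; a function that is unate with the
-- opposite sign at i never decreases there.
sign-determined : ∀ n k σ σ′(P P′ : Fa n k)->
 (∀ x -> unate n k σ P x ≡ unate n k σ′ P′ x)->
 ∀ i -> a6 n k i P ≡ fa -> lo σ i ≡ lo σ′ i
sign-determined n k σ σ′ P P′ s7 i used = dd(lo σ i)(lo σ′ i)refl refl
 where
 member = nv n k i P used
 z = po member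
 wz = po(p0 member)
 zi = po(p0(p0 member))
 cz = p0(p0(p0 member))
 at : Bool -> Vec Bool n
 at b = a1 σ(z Vec.[ i ]≔ b)
 value : ∀ b -> unate n k σ P(at b)≡ c3 n k P(z Vec.[ i ]≔ b)
 value b = co(c3 n k P)(av σ _)
 restore : z Vec.[ i ]≔ tu ≡ z
 restore = ta(co(z Vec.[ i ]≔_)(sym zi))(Vec.[]≔-lookup z i)
 high : unate n k σ P(at tu)≡ tu
 high = ta(value tu)(ta(co(c3 n k P)restore)cz)
 low : unate n k σ P(at fa)≡ fa
 low = ta(value fa)(cg n k P _(re(ta(we z i zi)wz)))
 ot : ∀ s s′ b -> lo σ i ≡ s -> lo σ′ i ≡ s′ -> unate n k σ P(at b)≡
  c3 n k P′(a1 σ′(a1 σ z)Vec.[ i ]≔ agree s′(agree s b))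
 ot _ _ b refl refl = ta(s7(at b))(co(c3 n k P′)
  (ta(co(a1 σ′)(a4 σ z i b))(a4 σ′(a1 σ z)i _)))
 ch : c3 n k P′(a1 σ′(a1 σ z)Vec.[ i ]≔ fa)≡ tu ->
  c3 n k P′(a1 σ′(a1 σ z)Vec.[ i ]≔ tu)≡ fa -> ⊥
 ch h l with ta(sym l)(c1 n k P′ _ i h)
 ... |()
 dd : ∀ s s′ -> lo σ i ≡ s -> lo σ′ i ≡ s′ -> lo σ i ≡ lo σ′ i
 dd tu  tu  e e′ = ta e(sym e′)
 dd fa fa e e′ = ta e(sym e′)
 dd tu  fa e e′ = el(ch
  (ta(sym(ot tu fa tu e e′))high)(ta(sym(ot tu fa fa e e′))low))
 dd fa tu  e e′ = el(ch
  (ta(sym(ot fa tu tu e e′))high)(ta(sym(ot fa tu fa e e′))low))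

Full : ∀ n k -> Fa n k -> Set
Full n k P = ∀ i -> a6 n k i P ≡ fa

-- Since every variable is used, `sign-determined` recovers the sign vector; with the signs known
-- the agreement vector is at free disposal, and `cj` recovers the family.
unate-injective : ∀ n k σ σ′(P P′ : Fa n k)-> Full n k P ->
 (∀ x -> unate n k σ P x ≡ unate n k σ′ P′ x)->(σ , P)≡(σ′ , P′)
unate-injective n k σ σ′ P P′ full s7 = cn _,_ σ≡σ′
 (cj n k P P′ \ zs _ -> ta(sym(co(c3 n k P)(av σ zs)))
  (ta(s7(a1 σ zs))(ta(co(\ τ -> c3 n k P′(a1 τ(a1 σ zs)))(sym σ≡σ′))
   (co(c3 n k P′)(av σ zs)))))
 where
 σ≡σ′ : σ ≡ σ′
 σ≡σ′ = ta(sym(Vec.tabulate∘lookup σ))(ta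
  (Vec.tabulate-cong(\ i -> sign-determined n k σ σ′ P P′ s7 i(full i)))(Vec.tabulate∘lookup σ′))

-- Counting the families that use every variable

bi : ℕ -> ℕ -> ℕ
bi n       zero    = 1
bi zero(suc k)= 0
bi(suc n)(suc k)= bi n k + bi n(suc k)

bn : ∀ n k -> bi n k ≡ n C k
bn n       zero    = sym(nC0≡1 n)
 where
 nC0≡1 : ∀ n -> n C 0 ≡ 1
 nC0≡1 zero    = refl
 nC0≡1(suc n)= ta(nCk≡nC[n∸k]{0}{suc n}zn)(nCn≡1(suc n))
bn zero(suc k)= sym(k>n⇒nCk≡0{zero}{suc k}(ss zn))
bn(suc n)(suc k)=
 ta(cn _+_(bn n k)(bn n(suc k)))(nCk+nC[k+1]≡[n+1]C[k+1] n k)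

fm : ∀ n k -> List(Fa n k)
fm zero    zero    = fa ∷ tu ∷ []
fm zero(suc k)= tt ∷ []
fm(suc n)zero    = fm n zero
fm(suc n)(suc k)= ct(fm n k)(fm n(suc k))

fu : ∀ n k -> Unique(fm n k)
fu zero    zero    =((\())All.∷ All.[])AllPairs.∷(All.[] AllPairs.∷ AllPairs.[])
fu zero(suc k)= All.[] AllPairs.∷ AllPairs.[]
fu(suc n)zero    = fu n zero
fu(suc n)(suc k)= cartesianProduct⁺(fu n k)(fu n(suc k))

c7 : ∀{A : Set}->(A -> Bool)-> List A -> ℕ
c7 p []       = 0
c7 p(x ∷ xs)=(if p x then 1 else 0)+ c7 p xs

count-++ : ∀{A : Set}p(xs ys : List A)-> c7 p(xs ++ ys)≡ c7 p xs + c7 p ys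
count-++ p []       ys = refl
count-++ p(x ∷ xs)ys = ta(co((if p x then 1 else 0)+_)(count-++ p xs ys))
 (sym(+-assoc(if p x then 1 else 0)_ _))

c8 : ∀{A B : Set}(p : A -> Bool)(q : B -> Bool)xs ys ->
 c7(\ xy -> p(po xy)∧ q(p0 xy))(ct xs ys)≡ c7 p xs * c7 q ys
c8 p q []       ys = refl
c8 p q(x ∷ xs)ys = ta(count-++ _(map(x ,_)ys)_)(ta
 (cn _+_(row ys)(c8 p q xs ys))
 (sym(*-distribʳ-+(c7 q ys)(if p x then 1 else 0)(c7 p xs))))
 where
 row : ∀ ys -> c7(\ xy -> p(po xy)∧ q(p0 xy))(map(x ,_)ys)≡(if p x then 1 else 0)* c7 q ys
 row []       = sym(ze(if p x then 1 else 0))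
 row(y ∷ ys)= ta(cn _+_(bit(p x))(row ys))
  (sym(d0(if p x then 1 else 0)(if q y then 1 else 0)(c7 q ys)))
  where
  bit : ∀ b ->(if b ∧ q y then 1 else 0)≡(if b then 1 else 0)*(if q y then 1 else 0)
  bit tu  = sym(ie _)
  bit fa = refl

ck : ∀{A : Set}(xs : List A)-> c7(\ _ -> tu)xs ≡ length xs
ck []       = refl
ck(x ∷ xs)= co suc(ck xs)

ld : ∀{A B : Set}(xs : List A)(ys : List B)->
 length(ct xs ys)≡ length xs * length ys
ld xs ys = ta(sym(ck(ct xs ys)))
 (ta(c8 _ _ xs ys)(cn _*_(ck xs)(ck ys)))

fn : ∀ n k -> length(fm n k)≡ 2 ^ bi n k
fn zero    zero    = refl
fn zero(suc k)= refl
fn(suc n)zero    = fn n zero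
fn(suc n)(suc k)= ta(ld(fm n k)_)
 (ta(cn _*_(fn n k)(fn n(suc k)))
  (sym(dr 2(bi n k)_)))

cy : ∀ n k -> c7(iE n k)(fm n k)≡ 1
cy zero    zero    = refl
cy zero(suc k)= refl
cy(suc n)zero    = cy n zero
cy(suc n)(suc k)= ta(c8(iE n k)_(fm n k)_)
 (cn _*_(cy n k)(cy n(suc k)))

count-cong : ∀{A : Set}{p q : A -> Bool}->(∀ x -> p x ≡ q x)-> ∀ xs -> c7 p xs ≡ c7 q xs
count-cong h []       = refl
count-cong h(x ∷ xs)= cn _+_(co(\ b -> if b then 1 else 0)(h x))(count-cong h xs)

-- A family avoiding i is an arbitrary family of k-subsets of the remaining n elements.
cx : ∀ n k i -> c7(a6(suc n)k i)(fm(suc n)k)≡ 2 ^ bi n k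
cx n       zero    i       = ta(ck(fm n zero))(fn n zero)
cx n(suc k)zero    = ta
 (count-cong(\ P -> sym(∧-identityʳ(iE n k(po P))))(fm(suc n)(suc k)))
 (ta(c8(iE n k)(\ _ -> tu)(fm n k)(fm n(suc k)))(ta
  (cn _*_(cy n k)(ta(ck(fm n(suc k)))(fn n(suc k))))
  (ie _)))
cx(suc n)(suc k)(suc i)= ta(c8(a6(suc n)k i)(a6(suc n)(suc k)i)(fm(suc n)k)_)
 (ta(cn _*_(cx n k i)(cx n(suc k)i))
  (sym(dr 2(bi n k)_)))

full? : ∀ n k(P : Fa n k)-> Dec(Full n k P)
full? n k P = Fin.all?(\ i -> a6 n k i P Bool.≟ fa)

full : ∀ n k -> Fa n k -> Bool
full n k P = does(full? n k P)

full-sound : ∀ n k P -> full n k P ≡ tu -> Full n k P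
full-sound n k P = witness(full? n k P)
 where
 witness : ∀{A : Set}(d : Dec A)-> does d ≡ tu -> A
 witness(yes a)_ = a

aY : ∀ n ->(Fin n -> ℕ)-> ℕ
aY zero    f = 0
aY(suc n)f = f zero + aY n(f ∘ suc)

sumFin-≤ : ∀ n f b ->(∀ i -> f i ≤ b)-> aY n f ≤ n * b
sumFin-≤ zero    f b h = zn
sumFin-≤(suc n)f b h = m1(h zero)(sumFin-≤ n(f ∘ suc)b(h ∘ suc))

sumFin-+ : ∀ n f g -> aY n(\ i -> f i + g i)≡ aY n f + aY n g
sumFin-+ zero    f g = refl
sumFin-+(suc n)f g rewrite sumFin-+ n(f ∘ suc)(g ∘ suc)= ic(f zero)(g zero)_ _
 where
 ic : ∀ a b c d ->(a + b)+(c + d)≡(a + c)+(b + d)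
 ic = so

≤-sumFin : ∀ n f i -> f i ≤ aY n f
≤-sumFin(suc n)f zero    = mm _ _
≤-sumFin(suc n)f(suc i)= tr(≤-sumFin n(f ∘ suc)i)(m5 _ _)

-- Union bound: a family that is not full avoids some variable.
fb : ∀ n k(Ps : List(Fa n k))->
 length Ps ≤ c7(full n k)Ps + aY n(\ i -> c7(a6 n k i)Ps)
fb n k []       = zn
fb n k(P ∷ Ps)= tr(m1 one(fb n k Ps))(re(ta
 (ic(bit(full n k P))_(c7(full n k)Ps)_)
 (co(bit(full n k P)+ c7(full n k)Ps +_)
  (sym(sumFin-+ n(\ i -> bit(a6 n k i P))(\ i -> c7(a6 n k i)Ps))))))
 where
 bit : Bool -> ℕ
 bit b = if b then 1 else 0
 ic : ∀ a b c d ->(a + b)+(c + d)≡(a + c)+(b + d)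
 ic = so
 one′ :(d : Dec(Full n k P))-> 1 ≤ bit(does d)+ aY n(\ i -> bit(a6 n k i P))
 one′(yes f)= ss zn
 one′(no ¬f)= let i , h = Fin.¬∀⟶∃¬ n _(\ i -> a6 n k i P Bool.≟ fa)¬f in
  tr(re(co bit(sym(n1 h))))(≤-sumFin n(\ i -> bit(a6 n k i P))i)
 one = one′(full? n k P)

-- Comparing lengths of lists, and the lower bound

au : ∀ n -> Unique(allAssignments n)
au zero    = All.[] AllPairs.∷ AllPairs.[]
au(suc n)= ++⁺(map⁺ Vec.∷-injectiveʳ(au n))
 (map⁺ Vec.∷-injectiveʳ(au n))apart
 where
 apart : ∀{x}-> x ∈ map(fa ∷_)(allAssignments n)× x ∈ map(tu ∷_)(allAssignments n)-> ⊥
 apart(p , q)with ma(fa ∷_)p | ma(tu ∷_)q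
 ... | _ , _ , refl | _ , _ ,()

ag : ∀{n}(x : Vec Bool n)-> x ∈ allAssignments n
ag []          = he refl
ag(fa ∷ x)= ax(mp(fa ∷_)(ag x))
ag(tu  ∷ x)= ah _(mp(tu ∷_)(ag x))

am : ∀ n -> length(allAssignments n)≡ 2 ^ n
am zero    = refl
am(suc n)= ta(length-++(map(fa ∷_)(allAssignments n)))(cn _+_
 (ta(length-map _(allAssignments n))(am n))
 (ta(ta(length-map _(allAssignments n))(am n))(sym(ie _))))

tT : ∀ n{f g : Vec Bool n -> Bool}-> truthTable n f ≡ truthTable n g -> ∀ x -> f x ≡ g x
tT n eq x = go(allAssignments n)eq(ag x)
 where
 go : ∀{f g : Vec Bool n -> Bool}xs -> map f xs ≡ map g xs -> x ∈ xs -> f x ≡ g x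
 go(y ∷ ys)eq(he refl)= ∷-injectiveˡ eq
 go(y ∷ ys)eq(th m)= go ys(∷-injectiveʳ eq)m

ul : ∀{A : Set}{xs : List A}-> Unique xs -> ∀ i j ->
 List.lookup xs i ≡ List.lookup xs j -> i ≡ j
ul(_ AllPairs.∷ _)zero    zero    eq = refl
ul(a AllPairs.∷ _)zero(suc j)eq = el(All.lookup a(∈-lookup j)eq)
ul(a AllPairs.∷ _)(suc i)zero    eq = el(All.lookup a(∈-lookup i)(sym eq))
ul(_ AllPairs.∷ u)(suc i)(suc j)eq = co suc(ul u i j eq)

-- R acts as an injection: every x has an image in ys and no y has two preimages. Positions of the
-- images in ys then give an injective map between finite types.
ih : ∀{A B : Set}{xs : List A}{ys : List B}(R : A -> B -> Set)-> Unique xs ->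
 (∀{x}-> x ∈ xs -> ∃ \ y -> y ∈ ys × R x y)->
 (∀{x x′ y}-> R x y -> R x′ y -> x ≡ x′)-> length xs ≤ length ys
ih{xs = xs}{ys}R u image inj = Fin.injective⇒≤{f = \ i -> index(po(p0(im i)))}\{i}{j}eq ->
 ul u i j(inj(p0(p0(im i)))
  (sb(R _)(ta(lookup-index(po(p0(im j))))(ta(co(List.lookup ys)(sym eq))
   (sym(lookup-index(po(p0(im i)))))))(p0(p0(im j)))))
 where
 im : ∀ i -> ∃ \ y -> y ∈ ys × R(List.lookup xs i)y
 im i = image(∈-lookup i)

f2 : ∀{A : Set}(p : A -> Bool)xs -> length(fi p xs)≡ c7 p xs
f2 p []       = refl
f2 p(x ∷ xs)with p x
... | tu  = co suc(f2 p xs)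
... | fa = f2 p xs

fl : ∀{A : Set}(p : A -> Bool)xs{x}-> x ∈ fi p xs -> x ∈ xs × p x ≡ tu
fl p(y ∷ ys)m with p y in eq
fl p(y ∷ ys)(he refl)| tu  = he refl , eq
fl p(y ∷ ys)(th m)| tu  = let a , b = fl p ys m in th a , b
fl p(y ∷ ys)m           | fa = let a , b = fl p ys m in th a , b

fq : ∀{A : Set}(p : A -> Bool){xs}-> Unique xs -> Unique(fi p xs)
fq p AllPairs.[] = AllPairs.[]
fq p{x ∷ xs}(a AllPairs.∷ u)with p x
... | tu  = All.tabulate(\ m -> All.lookup a(po(fl p xs m)))AllPairs.∷ fq p u
... | fa = fq p u

Is : ℕ -> ℕ -> List(List Bool)-> Set
Is k n L =(T : List Bool)->(T ∈ L)⇔ IsKSATFunction k n T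

unate-count : ∀ k n L -> Is k n L -> 2 ^ n * c7(full n k)(fm n k)≤ length L
unate-count k n L enum = tr(re(sym pairs-length))
 (ih(\ σP T -> Full n k(p0 σP)× T ≡ truthTable n(unate n k(po σP)(p0 σP)))
  (cartesianProduct⁺(au n)(fq(full n k)(fu n k)))
  image(\(f , e)(_ , e′)-> unate-injective n k _ _ _ _ f(tT n(ta(sym e)e′))))
 where
 p3 = ct(allAssignments n)(fi(full n k)(fm n k))
 pairs-length : length p3 ≡ 2 ^ n * c7(full n k)(fm n k)
 pairs-length = ta(ld(allAssignments n)_)
  (cn _*_(am n)(f2(full n k)(fm n k)))
 image : ∀{σP}-> σP ∈ p3 -> ∃ \ T -> T ∈ L × Full n k(p0 σP)×
  T ≡ truthTable n(unate n k(po σP)(p0 σP))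
 image{σ , P}m = let _ , mP = ∈-cartesianProduct⁻(allAssignments n)_ m in
  _ , Equivalence.from(enum _)(un n k σ P , map-cong(\ x -> sym(ev n k σ P x))_),
  full-sound n k P(p0(fl(full n k)(fm n k)mP)), refl

bp : ∀ k j -> 1 ≤ bi(k + j)k
bp zero    j = rf
bp(suc k)j = tr(bp k j)(mm _ _)

-- Crude but sufficient: the binomial only occurs as an exponent of 2, against a factor linear in n.
bl : ∀ k j -> suc j ≤ bi(suc k + j)(suc k)
bl k zero    = bp(suc k)0
bl k(suc j)= sb(\ t -> suc(suc j)≤ bi(suc t)(suc k))(sym(+-suc k j))
 (tr(m1(sb(\ t -> 1 ≤ bi t k)(+-suc k j)(bp k(suc j)))(bl k j))rf)

full-count : ∀ n k -> 2 ^ bi(suc n)(suc k)≤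
 c7(full(suc n)(suc k))(fm(suc n)(suc k))+ suc n * 2 ^ bi n(suc k)
full-count n k = tr(re(sym(fn(suc n)(suc k))))
 (tr(fb(suc n)(suc k)(fm(suc n)(suc k)))
  (m2(c7(full(suc n)(suc k))(fm(suc n)(suc k)))(sumFin-≤(suc n)_ _(\ i -> re(cx n(suc k)i)))))

d5 : ∀ y -> 2 * suc y ≤ 2 ^ suc y
d5 y = mo 2(n<2^n y)
 where
 n<2^n : ∀ y -> suc y ≤ 2 ^ y
 n<2^n zero    = rf
 n<2^n(suc y)= tr(m1(m9 2 y)(n<2^n y))(re(co(2 ^ y +_)(sym(ie _))))

linear≤2^ : ∀ a y -> a ≤ suc y -> a *(a + suc y)≤ 2 ^(a + suc y)
linear≤2^ a y a≤y = begin
 a *(a + suc y)≤⟨ m0(a≤2^a a)(m4(suc y)a≤y)⟩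
 2 ^ a *(suc y + suc y)≡⟨ co(\ t -> 2 ^ a *(suc y + t))(sym(ie(suc y)))⟩
 2 ^ a *(2 * suc y)≤⟨ mo(2 ^ a)(d5 y)⟩
 2 ^ a * 2 ^ suc y     ≡⟨ sym(dr 2 a(suc y))⟩
 2 ^(a + suc y)∎
 where
 open Re
 a≤2^a : ∀ a -> a ≤ 2 ^ a
 a≤2^a zero    = zn
 a≤2^a(suc a)= tr(mm(suc a)_)(d5 a)

-- Families avoiding one given variable are an exponentially small fraction of all families, so the
-- union bound over the variables leaves at least a fraction 1 - 1/m of full ones, and each of these
-- combines with 2^n sign vectors.
lower-bound : ∀ k m -> Σ ℕ \ N -> ∀ n -> N ≤ n -> ∀ L -> Is(suc(suc k))n L ->
 (m ∸ 1)* 2 ^(n + n C suc(suc k))≤ m * length L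
lower-bound k zero    = 0 , \ _ _ _ _ -> zn
lower-bound k m@(suc m′)= N , bound
 where
 -- With `j` as below, n is at most (3 + k)(j + 1), so m n <= a (j + 1). This is at most 2^(j + 1)
 -- because j >= 2a, and 2^(j + 1) is at most the ratio of all families to those avoiding a
 -- variable.
 a = m *(3 + k)
 N = 2 + k +(a + a)
 bound : ∀ n -> N ≤ n -> ∀ L -> Is(suc(suc k))n L ->
  m′ * 2 ^(n + n C suc(suc k))≤ m * length L
 bound n N≤n L enum = sb(\ n -> Is(suc(suc k))n L -> m′ * 2 ^(n + n C suc(suc k))≤ m * length L)
  (ta(co(2 + k +_)(ta(sym(+-assoc a a d))refl))(ta(sym(+-assoc(2 + k)(a + a)d))(md N≤n)))main enum
  where
  d = n ∸ N
  j = a +(a + d)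
  n₁ = suc k + j
  open Re
  main : Is(suc(suc k))(suc n₁)L -> m′ * 2 ^(suc n₁ + suc n₁ C suc(suc k))≤ m * length L
  main enum = begin
   m′ * 2 ^(suc n₁ + suc n₁ C suc(suc k))≡⟨ co(\ t -> m′ * 2 ^(suc n₁ + t))(sym(bn(suc n₁)(suc(suc k))))⟩
   m′ * 2 ^(suc n₁ + B)≡⟨ co(m′ *_)(dr 2(suc n₁)B)⟩
   m′ *(2 ^ suc n₁ * 2 ^ B)≡⟨ swap m′(2 ^ suc n₁)(2 ^ B)⟩
   2 ^ suc n₁ *(m′ * 2 ^ B)≤⟨ mo(2 ^ suc n₁)most ⟩
   2 ^ suc n₁ *(m * f)≡⟨ swap(2 ^ suc n₁)m f ⟩
   m *(2 ^ suc n₁ * f)≤⟨ mo m(unate-count(suc(suc k))(suc n₁)L enum)⟩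
   m * length L                             ∎
   where
   B = bi(suc n₁)(suc(suc k))
   f = c7(full(suc n₁)(suc(suc k)))(fm(suc n₁)(suc(suc k)))
   e = 2 ^ bi n₁(suc(suc k))
   swap : ∀ x y z -> x *(y * z)≡ y *(x * z)
   swap = so
   sx : suc n₁ ≤(3 + k)* suc j
   sx = tr(m2(2 + k)(mm j _))(re(expand k j))
    where
    expand : ∀ k j -> 2 + k +(j +(1 +(2 + k)* j))≡(3 + k)* suc j
    expand = so
   rare : m *(suc n₁ * e)≤ 2 ^ B
   rare = begin
    m *(suc n₁ * e)≤⟨ mo m(mn e sx)⟩
    m *((3 + k)* suc j * e)≡⟨ assoc m(3 + k)(suc j)e ⟩
    a * suc j * e                 ≡⟨ co(\ t -> a * t * e)(sym(+-suc a(a + d)))⟩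
    a *(a + suc(a + d))* e     ≤⟨ mn e(linear≤2^ a(a + d)(m≤n⇒m≤1+n(mm a d)))⟩
    2 ^(a + suc(a + d))* e     ≡⟨ co(\ t -> 2 ^ t * e)(+-suc a(a + d))⟩
    2 ^ suc j * e                 ≤⟨ mn e(m8 2(bl k j))⟩
    2 ^ bi n₁(suc k)* e   ≡⟨ sym(dr 2(bi n₁(suc k))_)⟩
    2 ^ B                         ∎
    where
    assoc : ∀ w x y z -> w *(x * y * z)≡ w * x * y * z
    assoc = so
   most : m′ * 2 ^ B ≤ m * f
   most = c6(2 ^ B)(m′ * 2 ^ B)(m * f)(begin
    m′ * 2 ^ B + 2 ^ B       ≡⟨ +-comm(m′ * 2 ^ B)(2 ^ B)⟩
    m * 2 ^ B                ≤⟨ mo m(full-count n₁(suc k))⟩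
    m *(f + suc n₁ * e)≡⟨ d0 m f _ ⟩
    m * f + m *(suc n₁ * e)≤⟨ m2(m * f)rare ⟩
    m * f + 2 ^ B            ∎)

-- Sums, counts and Boolean quantifiers over lists

bit : Bool -> ℕ
bit tu  = 1
bit fa = 0

sum : ∀{A : Set}-> List A ->(A -> ℕ)-> ℕ
sum []       f = 0
sum(x ∷ xs)f = f x + sum xs f

# : ∀{A : Set}-> List A ->(A -> Bool)-> ℕ
# xs p = sum xs(\ x -> bit(p x))

module _{A : Set}where

 sc : ∀(xs : List A){f g}->(∀ x -> f x ≡ g x)-> sum xs f ≡ sum xs g
 sc []       h = refl
 sc(x ∷ xs)h = cn _+_(h x)(sc xs h)

 sj : ∀(xs : List A){f g}->(∀{x}-> x ∈ xs -> f x ≤ g x)-> sum xs f ≤ sum xs g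
 sj []       h = zn
 sj(x ∷ xs)h = m1(h(he refl))(sj xs(h ∘ th))

 sm : ∀(xs : List A){f g}->(∀ x -> f x ≤ g x)-> sum xs f ≤ sum xs g
 sm xs h = sj xs(\{x}_ -> h x)

 s3 : ∀(xs : List A)f g -> sum xs(\ x -> f x + g x)≡ sum xs f + sum xs g
 s3 []       f g = refl
 s3(x ∷ xs)f g rewrite s3 xs f g = inter(f x)(g x)_ _
  where
  inter : ∀ a b c d ->(a + b)+(c + d)≡(a + c)+(b + d)
  inter = so

 s0 : ∀(xs : List A)c f -> sum xs(\ x -> c * f x)≡ c * sum xs f
 s0 []       c f = sym(ze c)
 s0(x ∷ xs)c f rewrite s0 xs c f = sym(d0 c(f x)_)

 sD : ∀(xs : List A)c f -> sum xs(\ x -> f x * c)≡ sum xs f * c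
 sD xs c f = ta(sc xs(\ x -> c2(f x)c))(ta(s0 xs c f)(c2 c _))

 sn : ∀(xs : List A)c -> sum xs(\ _ -> c)≡ length xs * c
 sn []       c = refl
 sn(x ∷ xs)c = co(c +_)(sn xs c)

 s2 : ∀(xs : List A){f}c ->(∀ x -> f x ≤ c)-> sum xs f ≤ length xs * c
 s2 xs c h = tr(sm xs h)(re(sn xs c))

 sum-++ : ∀(xs ys : List A)f -> sum(xs ++ ys)f ≡ sum xs f + sum ys f
 sum-++ []       ys f = refl
 sum-++(x ∷ xs)ys f = ta(co(f x +_)(sum-++ xs ys f))(sym(+-assoc(f x)_ _))

 sC : ∀{B : Set}(g : B -> A)(xs : List B)f -> sum(map g xs)f ≡ sum xs(f ∘ g)
 sC g []       f = refl
 sC g(x ∷ xs)f = co(f(g x)+_)(sC g xs f)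

 s4 : ∀{xs : List A}{x}f -> x ∈ xs -> f x ≤ sum xs f
 s4 f(he refl)= mm _ _
 s4 f(th m)= tr(s4 f m)(m5 _ _)

 sum-exists : ∀(xs : List A)f g -> sum xs f < sum xs g -> ∃ \ x -> x ∈ xs × f x < g x
 sum-exists(x ∷ xs)f g lt with f x <? g x
 ... | yes p = x , he refl , p
 ... | no ¬p with sum-exists xs f g(+-cancelˡ-<(f x)_ _(t5 lt(m4 _(≮⇒≥ ¬p))))
 ... | y , m , q = y , th m , q

 #-≤ : ∀(xs : List A)p -> # xs p ≤ length xs
 #-≤ xs p = tr(s2 xs 1(\ x -> bit≤1(p x)))(re(it _))
  where
  bit≤1 : ∀ b -> bit b ≤ 1
  bit≤1 tu  = rf
  bit≤1 fa = zn

s1 : ∀{A B : Set}(xs : List A)(ys : List B)(f : A -> B -> ℕ)->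
 sum xs(\ x -> sum ys(f x))≡ sum ys(\ y -> sum xs(\ x -> f x y))
s1 []       ys f = sym(ta(sn ys 0)(ze(length ys)))
s1(x ∷ xs)ys f = ta(co(sum ys(f x)+_)(s1 xs ys f))(sym(s3 ys(f x)_))

sr : ∀{A B C : Set}(h : A -> B -> C)xs ys f ->
 sum(cartesianProductWith h xs ys)f ≡ sum xs(\ x -> sum ys(\ y -> f(h x y)))
sr h []       ys f = refl
sr h(x ∷ xs)ys f = ta(sum-++(map(h x)ys)_ f)
 (cn _+_(sC(h x)ys f)(sr h xs ys f))

ad : ∀{a b}-> a ∧ b ≡ tu -> a ≡ tu
ad{tu}h = refl

ar : ∀{a b}-> a ∧ b ≡ tu -> b ≡ tu
ar{tu}h = h

ai : ∀{a b}-> a ≡ tu -> b ≡ tu -> a ∧ b ≡ tu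
ai refl refl = refl

te : ∀{b}-> b ≡ tu -> b ≡ fa -> ⊥
te refl()

b0 : ∀{a b}->(a ≡ tu -> b ≡ tu)-> bit a ≤ bit b
b0{tu}h rewrite h refl = rf
b0{fa}h = zn

bt : ∀{b m}-> 1 ≤ m -> bit b ≤ m
bt{tu}h = h
bt{fa}h = zn

bd : ∀ a b -> bit(a ∧ b)≡ bit a * bit b
bd tu  b = sym(ie _)
bd fa b = refl

m6 : ∀{A : Set}(xs : List A){p q : A -> Bool}->(∀ x -> p x ≡ tu -> q x ≡ tu)-> # xs p ≤ # xs q
m6 xs h = sm xs(\ x -> b0(h x))

#-or : ∀{A : Set}(xs : List A){p q r : A -> Bool}->(∀ x -> p x ≡ tu -> q x ≡ tu ⊎ r x ≡ tu)->
 # xs p ≤ # xs q + # xs r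
#-or xs{p}{q}{r}h = tr(sm xs one)(re(s3 xs _ _))
 where
 one : ∀ x -> bit(p x)≤ bit(q x)+ bit(r x)
 one x with p x in e
 ... | fa = zn
 ... | tu with h x e
 ... | i1 eq rewrite eq = ss zn
 ... | i0 eq rewrite eq = m5 1 _

a2 ay : ∀{A : Set}-> List A ->(A -> Bool)-> Bool
a2 []       p = tu
a2(x ∷ xs)p = p x ∧ a2 xs p
ay []       p = fa
ay(x ∷ xs)p = p x ∨ ay xs p

aB : ∀{A : Set}{xs : List A}{p x}-> a2 xs p ≡ tu -> x ∈ xs -> p x ≡ tu
aB h(he refl)= ad h
aB{p = p}h(th{x = y}m)= aB(ar{p y}h)m

a0 : ∀{A : Set}(xs : List A){p}->(∀{x}-> x ∈ xs -> p x ≡ tu)-> a2 xs p ≡ tu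
a0 []       h = refl
a0(x ∷ xs)h = ai(h(he refl))(a0 xs(h ∘ th))

an : ∀{A : Set}{xs : List A}{p x}-> x ∈ xs -> p x ≡ tu -> ay xs p ≡ tu
an(he refl)h rewrite h = refl
an{p = p}(th{x = y}m)h rewrite an{p = p}m h = ∨-zeroʳ(p y)

ae : ∀{A : Set}(xs : List A){p}-> ay xs p ≡ tu -> ∃ \ x -> x ∈ xs × p x ≡ tu
ae(x ∷ xs){p}h with p x in e
... | tu  = x , he refl , e
... | fa with ae xs h
... | y , m , q = y , th m , q

aq : ∀{A B : Set}(xs : List A)(ys : List B)(p : A -> B -> Bool)-> # xs(\ x -> ay ys(p x))≤ sum ys(\ y -> # xs(\ x -> p x y))
aq xs ys p = tr(sm xs(\ x -> one ys(p x)))(re(s1 xs ys(\ x y -> bit(p x y))))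
 where
 one : ∀{B : Set}(ys : List B)q -> bit(ay ys q)≤ # ys q
 one []       q = zn
 one(y ∷ ys)q with q y
 ... | tu  = ss zn
 ... | fa = one ys q

abstract
 le : ℕ -> ℕ -> Bool
 le m n = does(m ≤? n)

 lr : ∀{m n}-> le m n ≡ tu -> m ≤ n
 lr{m}{n}h = aa m n(sb Bool.T(sym h)tt)

 l4 : ∀{m n}-> m ≤ n -> le m n ≡ tu
 l4{m}{n}h with le m n | ≤⇒≤ᵇ h
 ... | tu | _ = refl

 la : ∀{m n}-> le m n ≡ fa -> n < m
 la{m}{n}h = ≰⇒>(\ p -> te(l4 p)h)

r2 : ∀{a b c : ℕ}-> a ≡ b -> a ≤ c -> b ≤ c
r2 refl h = h

rp : ∀{a b c : ℕ}-> b ≡ c -> a ≤ b -> a ≤ c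
rp refl h = h

bo : ∀ b -> b ≡ tu ⊎ b ≡ fa
bo tu  = i1 refl
bo fa = i0 refl

-- Tuples, overwriting of entries, and averaging

t0 : ∀{A : Set}-> List A -> ∀ k -> List(Vec A k)
t0 xs zero    = [] ∷ []
t0 xs(suc k)= cartesianProductWith _∷_ xs(t0 xs k)

tup : ∀ n k -> List(Vec(Fin n)k)
tup n = t0(al n)

pa : ∀ k -> List(Vec Bool k)
pa = t0(tu ∷ fa ∷ [])

∈-tups : ∀{A : Set}{xs : List A}->(∀ x -> x ∈ xs)-> ∀{k}(v : Vec A k)-> v ∈ t0 xs k
∈-tups h []      = he refl
∈-tups h(x ∷ v)= ∈-cartesianProductWith⁺ _∷_(h x)(∈-tups h v)

t1 : ∀{n k}(v : Vec(Fin n)k)-> v ∈ tup n k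
t1 = ∈-tups aF

b1 : ∀ b -> b ∈ tu ∷ fa ∷ []
b1 tu  = he refl
b1 fa = th(he refl)

pt : ∀{k}(p : Vec Bool k)-> p ∈ pa k
pt = ∈-tups b1

su : ∀{A : Set}(xs : List A)k f -> sum(t0 xs(suc k))f ≡ sum xs(\ x -> sum(t0 xs k)(\ v -> f(x ∷ v)))
su xs k f = sr _∷_ xs(t0 xs k)f

ln : ∀{A : Set}(xs : List A)-> length xs ≡ sum xs(\ _ -> 1)
ln xs = sym(ta(sn xs 1)(it _))

lh : ∀{A : Set}(xs : List A)k -> length(t0 xs k)≡ length xs ^ k
lh xs zero    = refl
lh xs(suc k)= ta(ln(t0 xs(suc k)))(ta(su xs k _)
 (ta(sc xs(\ _ -> ta(sym(ln(t0 xs k)))(lh xs k)))(sn xs _)))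

lf : ∀ n -> length(al n)≡ n
lf n = length-tabulate id

lg : ∀ n k -> length(tup n k)≡ n ^ k
lg n k = ta(lh(al n)k)(co(_^ k)(lf n))

sh : ∀{A : Set}(xs : List A){k}(s : Fin k)f ->
 sum(t0 xs k)(\ v -> sum xs(\ x -> f(v [ s ]≔ x)))≡ length xs * sum(t0 xs k)f
sh xs{suc k}zero f = ta(su xs k _)(ta
 (sc xs(\ y -> s1(t0 xs k)xs _))
 (ta(sn xs _)(co(length xs *_)(sym(su xs k f)))))
sh xs{suc k}(suc s)f = ta(su xs k _)(ta
 (sc xs(\ y -> sh xs s(\ v -> f(y ∷ v))))
 (ta(s0 xs(length xs)_)(co(length xs *_)(sym(su xs k f)))))

ud : ∀{A : Set}{K k}-> Vec A K -> Vec(Fin K)k -> Vec A k -> Vec A K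
ud ψ []       []      = ψ
ud ψ(s ∷ ix)(x ∷ v)= ud(ψ [ s ]≔ x)ix v

-- Overwriting fixed positions of a uniform tuple by uniform entries gives a uniform tuple. Each
-- single overwriting preserves uniformity, so the positions may repeat.
sT : ∀{A : Set}(xs : List A){K k}(ix : Vec(Fin K)k)f ->
 sum(t0 xs K)(\ ψ -> sum(t0 xs k)(\ v -> f(ud ψ ix v)))≡ length xs ^ k * sum(t0 xs K)f
sT xs{K}[]       f = ta(sc(t0 xs K)(\ ψ -> ie _))(sym(ie _))
sT xs{K}{suc k}(s ∷ ix)f = begin
 sum(t0 xs K)(\ ψ -> sum(t0 xs(suc k))(\ v -> f(ud ψ(s ∷ ix)v)))
  ≡⟨ sc(t0 xs K)(\ ψ -> su xs k _)⟩
 sum(t0 xs K)(\ ψ -> sum xs(\ x -> sum(t0 xs k)(\ v -> f(ud(ψ [ s ]≔ x)ix v))))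
  ≡⟨ sh xs s(\ ψ -> sum(t0 xs k)(\ v -> f(ud ψ ix v)))⟩
 length xs * sum(t0 xs K)(\ ψ -> sum(t0 xs k)(\ v -> f(ud ψ ix v)))
  ≡⟨ co(length xs *_)(sT xs ix f)⟩
 length xs *(length xs ^ k * sum(t0 xs K)f)≡⟨ sym(ac(length xs)_ _)⟩
 length xs ^ suc k * sum(t0 xs K)f ∎
 where open Ra

Ds : ∀{A : Set}{k}-> Vec A k -> Set
Ds v = ∀ i j -> lo v i ≡ lo v j -> i ≡ j

uo : ∀{A : Set}{K k}(ψ : Vec A K)(ix : Vec(Fin K)k)v s ->
 (∀ t -> s ≢ lo ix t)-> lo(ud ψ ix v)s ≡ lo ψ s
uo ψ []       []      s h = refl
uo ψ(r ∷ ix)(x ∷ v)s h = ta(uo(ψ [ r ]≔ x)ix v s(h ∘ suc))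
 (Vu(h zero)ψ x)

ui : ∀{A : Set}{K k}(ψ : Vec A K)(ix : Vec(Fin K)k)v -> Ds ix ->
 Vc(lo(ud ψ ix v))ix ≡ v
ui ψ []       []      d = refl
ui ψ(s ∷ ix)(x ∷ v)d = cn _∷_
 (ta(uo(ψ [ s ]≔ x)ix v s(\ t e -> \-absurd(d zero(suc t)e)))(Ve s ψ x))
 (ui(ψ [ s ]≔ x)ix v(\ i j e -> Fin.suc-injective(d(suc i)(suc j)e)))
 where
 \-absurd : ∀{n}{t : Fin n}-> Fin.zero ≡ suc t -> ⊥
 \-absurd()

eqF : ∀{n}-> Fin n -> Fin n -> Bool
eqF i j = does(i Fin.≟ j)

ee : ∀{n}{i j : Fin n}-> eqF i j ≡ tu -> i ≡ j
ee{i = i}{j}h with i Fin.≟ j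
... | yes e = e

eF : ∀{n}(i : Fin n)-> eqF i i ≡ tu
eF i with i Fin.≟ i
... | yes e = refl
... | no ne = el(ne refl)

ou : ∀{n k}-> Fin n -> Vec(Fin n)k -> Bool
ou x []      = fa
ou x(y ∷ v)= eqF x y ∨ ou x v

di : ∀{n k}-> Vec(Fin n)k -> Bool
di []      = tu
di(x ∷ v)= not(ou x v)∧ di v

ol : ∀{n k}(v : Vec(Fin n)k)i -> ou(lo v i)v ≡ tu
ol(x ∷ v)zero rewrite eF x = refl
ol(x ∷ v)(suc i)rewrite ol v i = ∨-zeroʳ _

oe : ∀{n k x}(v : Vec(Fin n)k)-> ou x v ≡ tu -> ∃ \ i -> x ≡ lo v i
oe{x = x}(y ∷ v)h with eqF x y in e
... | tu  = zero , ee e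
... | fa with oe v h
... | i , q = suc i , q

nt : ∀{b}-> not b ≡ tu -> b ≡ fa
nt{fa}h = refl

na : ∀{b}-> b ≡ fa -> not b ≡ tu
na refl = refl

dn : ∀{n k}(v : Vec(Fin n)k)-> di v ≡ tu -> Ds v
dn(x ∷ v)h zero    zero    e = refl
dn(x ∷ v)h zero(suc j)e =
 el(te(ta(co(\ y -> ou y v)e)(ol v j))(nt(ad h)))
dn(x ∷ v)h(suc i)zero    e =
 el(te(ta(co(\ y -> ou y v)(sym e))(ol v i))(nt(ad h)))
dn(x ∷ v)h(suc i)(suc j)e = co suc(dn v(ar{not(ou x v)}h)i j e)

dc : ∀{n k}(v : Vec(Fin n)k)-> Ds v -> di v ≡ tu
dc []      d = refl
dc(x ∷ v)d = ai fh(dc v(\ i j e -> Fin.suc-injective(d(suc i)(suc j)e)))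
 where
 fh : not(ou x v)≡ tu
 fh with ou x v in e
 ... | fa = refl
 ... | tu with oe v e
 ... | i , q with d zero(suc i)q
 ... |()

#-eqF : ∀{n}(x : Fin n)-> #(al n)(\ y -> eqF y x)≤ 1
#-eqF{n}x = go n(al n)(Uniq.allFin⁺ n)
 where
 go : ∀ m(xs : List(Fin n))-> Unique xs -> # xs(\ y -> eqF y x)≤ 1
 go m []       u = zn
 go m(y ∷ xs)(a AllPairs.∷ u)with eqF y x in e
 ... | fa = go m xs u
 ... | tu  = ss(re(n3 xs(\{z}z∈ q -> All.lookup a z∈(ta(ee e)(sym q)))))
  where
  n3 : ∀ xs ->(∀{z}-> z ∈ xs -> z ≢ x)-> # xs(\ y -> eqF y x)≡ 0
  n3 []       h = refl
  n3(z ∷ xs)h with eqF z x in e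
  ... | tu  = el(h(he refl)(ee e))
  ... | fa = n3 xs(h ∘ th)

os : ∀{n k}(v : Vec(Fin n)k)-> #(al n)(\ y -> ou y v)≤ k
os{n}[]  = re(ta(sn(al n)0)(ze(length(al n))))
os{n}(x ∷ v)= tr(#-or(al n)(\ y -> sl(eqF y x)(ou y v)))(m1(#-eqF x)(os v))
 where
 sl : ∀ a b -> a ∨ b ≡ tu -> a ≡ tu ⊎ b ≡ tu
 sl tu  b h = i1 refl
 sl fa b h = i0 h

-- Prepending an entry spoils a tuple only if the tail was spoilt or the entry is one of at most k
-- values; k * k generously bounds the number of colliding pairs.
ni : ∀ n k -> n * #(tup n k)(\ v -> not(di v))≤ k * k * n ^ k
ni n zero    = re(ze n)
ni n(suc k)= begin
 n * #(tup n(suc k))(\ v -> not(di v))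
  ≡⟨ co(n *_)(ta(su(al n)k _)(s1(al n)(tup n k)_))⟩
 n * sum(tup n k)(\ v -> #(al n)(\ x -> not(di(x ∷ v))))
  ≤⟨ mo n(sm(tup n k)(\ v -> tr(#-or(al n){q = \ x -> ou x v}{r = \ x -> not(di v)}(\ x -> sl(ou x v)(di v)))
   (m1(os v)(re(ta(sn(al n)_)(co(_* bit(not(di v)))(lf n)))))))⟩
 n * sum(tup n k)(\ v -> k + n * bit(not(di v)))
  ≡⟨ co(n *_)(ta(s3(tup n k)_ _)(cn _+_(ta(sn(tup n k)k)(co(_* k)(lg n k)))(s0(tup n k)n _)))⟩
 n *(n ^ k * k + n * #(tup n k)(\ v -> not(di v)))
  ≤⟨ mo n(m2 _(ni n k))⟩
 n *(n ^ k * k + k * k * n ^ k)≤⟨ mm _((1 + k)*(n * n ^ k))⟩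
 n *(n ^ k * k + k * k * n ^ k)+(1 + k)*(n * n ^ k)≡⟨ ri n k(n ^ k)⟩
 suc k * suc k * n ^ suc k ∎
 where
 open Re
 sl : ∀ a b -> not(not a ∧ b)≡ tu -> a ≡ tu ⊎ not b ≡ tu
 sl tu  b h = i1 refl
 sl fa b h = i0 h
 ri : ∀ n k m -> n *(m * k + k * k * m)+(1 + k)*(n * m)≡ suc k * suc k *(n * m)
 ri = so

-- Fibres of density below 1/(2Z) carry at most half of the mass; the others hold at most length ys
-- points each, so there must be many of them.
dense-fibres : ∀{A B : Set}(xs : List A)(ys : List B)(E : A -> B -> Bool)Z -> 1 ≤ length ys ->
 length xs * length ys ≤ Z * sum xs(\ x -> # ys(E x))->
 length xs ≤ 2 * Z * # xs(\ x -> le(length ys)(2 * Z * # ys(E x)))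
dense-fibres xs ys E Z 1≤Y d6 = cf X _ Y{{nn 1≤Y}}(c6(X * Y)_ _(begin
 X * Y + X * Y ≡⟨ co(X * Y +_)(sym(ie(X * Y)))⟩
 2 *(X * Y)≤⟨ mo 2 d6 ⟩
 2 *(Z * sum xs(\ x -> # ys(E x)))≡⟨ sym(ac 2 Z _)⟩
 2 * Z * sum xs(\ x -> # ys(E x))≡⟨ sym(s0 xs(2 * Z)_)⟩
 sum xs(\ x -> 2 * Z * # ys(E x))≤⟨ sm xs eh ⟩
 sum xs(\ x -> 2 * Z * Y * bit(gd x)+ Y)≡⟨ ta(s3 xs _ _)(cn _+_(s0 xs(2 * Z * Y)_)(sn xs Y))⟩
 2 * Z * Y * # xs gd + X * Y ≡⟨ co(_+ X * Y)(ri(2 * Z)Y(# xs gd))⟩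
 2 * Z * # xs gd * Y + X * Y ∎))
 where
 open Re
 X = length xs
 Y = length ys
 gd = \ x -> le Y(2 * Z * # ys(E x))
 ri : ∀ a b c -> a * b * c ≡ a * c * b
 ri = so
 eh : ∀ x -> 2 * Z * # ys(E x)≤ 2 * Z * Y * bit(gd x)+ Y
 eh x with gd x in e
 ... | tu  = tr(mo(2 * Z)(#-≤ ys(E x)))(tr(re(sym(it _)))(mm _ Y))
 ... | fa = tr(bf(la e))(m5 Y _)

-- Cubes in dense sets of tuples

mix : ∀{A : Set}{K}-> Vec Bool K -> Vec A K -> Vec A K -> Vec A K
mix []          []      []      = []
mix(tu  ∷ ε)(x ∷ φ)(y ∷ ψ)= x ∷ mix ε φ ψ
mix(fa ∷ ε)(x ∷ φ)(y ∷ ψ)= y ∷ mix ε φ ψ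

-- All 2^K mixtures of the two tuples lie in E (`cU`). Doubling one coordinate at a time replaces E
-- by the intersection of two of its slices, which is the shape of the induction in `cube-dense`.
cube : ∀{A : Set}{K}->(Vec A K -> Bool)-> Vec A K -> Vec A K -> Bool
cube E []      []      = E []
cube E(x ∷ φ)(y ∷ ψ)= cube(\ v -> E(x ∷ v)∧ E(y ∷ v))φ ψ

cU : ∀{A : Set}{K}E(φ ψ : Vec A K)-> cube E φ ψ ≡ tu -> ∀ ε -> E(mix ε φ ψ)≡ tu
cU E []      []      h []          = h
cU E(x ∷ φ)(y ∷ ψ)h(tu  ∷ ε)= ad(cU _ φ ψ h ε)
cU E(x ∷ φ)(y ∷ ψ)h(fa ∷ ε)= ar{E(x ∷ mix ε φ ψ)}(cU _ φ ψ h ε)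

cb : ℕ -> ℕ -> ℕ
cb zero    Z = Z
cb(suc K)Z = 2 *(8 * Z * Z * Z)* cb K(2 *(8 * Z * Z * Z))

sum-good : ∀{A : Set}(xs : List A)(f : A -> ℕ)X Y c d(gd : A -> Bool)-> X ≤ c * # xs gd ->
 (∀ x -> gd x ≡ tu -> Y ≤ d * f x)-> X * Y ≤ c * d * sum xs f
sum-good xs f X Y c d gd my eh = begin
 X * Y                                 ≤⟨ mn Y my ⟩
 c * # xs gd * Y                     ≡⟨ ac c _ Y ⟩
 c *(# xs gd * Y)≡⟨ co(c *_)(sym(sD xs Y _))⟩
 c * sum xs(\ x -> bit(gd x)* Y)≤⟨ mo c(sm xs one)⟩
 c * sum xs(\ x -> d * f x)≡⟨ co(c *_)(s0 xs d f)⟩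
 c *(d * sum xs f)≡⟨ sym(ac c d _)⟩
 c * d * sum xs f                      ∎
 where
 open Re
 one : ∀ x -> bit(gd x)* Y ≤ d * f x
 one x with gd x in e
 ... | tu  = tr(re(ie Y))(eh x e)
 ... | fa = zn

af : ∀{n}k -> 1 ≤ n -> 1 ≤ n ^ k
af{suc n}k _ = m9(suc n)k

-- Erdős's argument for complete multipartite hypergraphs. A fraction 1/(2Z) of the tails extends in
-- at least n/(2Z) ways, so a fraction 1/(8Z^3) of pairs of heads with a tail lies doubly in E.
-- Hence many pairs of slices have a dense intersection, and the induction hypothesis finds cubes in
-- it.
cube-dense : ∀ n K(E : Vec(Fin n)K -> Bool)Z -> 1 ≤ n -> n ^ K ≤ Z * #(tup n K)E ->
 n ^ K * n ^ K ≤ cb K Z * sum(tup n K)(\ φ -> #(tup n K)(cube E φ))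
cube-dense n zero    E Z n0 h = tr h(mo Z(mm _ _))
cube-dense n(suc K)E Z n0 h = begin
 n ^ suc K * n ^ suc K ≡⟨ ri n(n ^ K)⟩
 n * n *(n ^ K * n ^ K)≤⟨ sum-good p3 _(n * n)(n ^ K * n ^ K)(2 * Z′)(cb K(2 * Z′))_ good-pairs(\(x , y)g -> cube-dense n K _(2 * Z′)n0(fibre x y g))⟩
 2 * Z′ * cb K(2 * Z′)* sum p3(\(x , y)-> sum(tup n K)(\ φ -> #(tup n K)(cube(\ v -> E(x ∷ v)∧ E(y ∷ v))φ)))
  ≡⟨ co(cb(suc K)Z *_)rr ⟩
 cb(suc K)Z * sum(tup n(suc K))(\ φ -> #(tup n(suc K))(cube E φ))∎
 where
 open Re
 Z′ = 8 * Z * Z * Z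
 p3 = ct(al n)(al n)
 EE : Fin n × Fin n -> Vec(Fin n)K -> Bool
 EE(x , y)v = E(x ∷ v)∧ E(y ∷ v)
 lenp : length p3 ≡ n * n
 lenp = ta(ld(al n)(al n))(cn _*_(lf n)(lf n))
 ri : ∀ n m ->(n * m)*(n * m)≡ n * n *(m * m)
 ri = so
 deg : Vec(Fin n)K -> ℕ
 deg v = #(al n)(\ x -> E(x ∷ v))
 rc : Vec(Fin n)K -> Bool
 rc v = le n(2 * Z * deg v)
 many-rich : n ^ K ≤ 2 * Z * #(tup n K)rc
 many-rich = sb(_≤ 2 * Z * #(tup n K)rc)(lg n K)
  (sb(\ m -> length(tup n K)≤ 2 * Z * #(tup n K)(\ v -> le m(2 * Z * deg v)))(lf n)
  (dense-fibres(tup n K)(al n)(\ v x -> E(x ∷ v))Z(sb(1 ≤_)(sym(lf n))n0)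
  (begin
   length(tup n K)* length(al n)≡⟨ cn _*_(lg n K)(lf n)⟩
   n ^ K * n ≡⟨ c2(n ^ K)n ⟩
   n ^ suc K ≤⟨ h ⟩
   Z * #(tup n(suc K))E ≡⟨ co(Z *_)(ta(su(al n)K _)(s1(al n)(tup n K)_))⟩
   Z * sum(tup n K)deg ∎)))
 squares : sum(tup n K)(\ v -> deg v * deg v)≡ sum p3(\ xy -> #(tup n K)(EE xy))
 squares = ta(sc(tup n K)square)(ta(s1(tup n K)p3 _)refl)
  where
  square : ∀ v -> deg v * deg v ≡ sum p3(\ xy -> bit(EE xy v))
  square v = ta(sym(sD(al n)(deg v)_))(ta
   (sc(al n)(\ x -> ta(sym(s0(al n)(bit(E(x ∷ v)))(\ y -> bit(E(y ∷ v)))))(sc(al n)(\ y -> sym(bd(E(x ∷ v))_)))))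
   (sym(sr _,_(al n)(al n)_)))
 many-pairs : n * n * n ^ K ≤ Z′ * sum p3(\ xy -> #(tup n K)(EE xy))
 many-pairs = begin
  n * n * n ^ K ≡⟨ c2(n * n)_ ⟩
  n ^ K *(n * n)≤⟨ sum-good(tup n K)(\ v -> deg v * deg v)(n ^ K)(n * n)(2 * Z)(2 * Z *(2 * Z))rc many-rich
   (\ v g -> tr(m0(lr g)(lr g))(re(sq(2 * Z)(deg v))))⟩
  2 * Z *(2 * Z *(2 * Z))* sum(tup n K)(\ v -> deg v * deg v)≡⟨ cn _*_(eight Z)squares ⟩
  Z′ * sum p3(\ xy -> #(tup n K)(EE xy))∎
  where
  sq : ∀ a b ->(a * b)*(a * b)≡ a * a *(b * b)
  sq = so
  eight : ∀ Z -> 2 * Z *(2 * Z *(2 * Z))≡ 8 * Z * Z * Z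
  eight = so
 good-pairs : n * n ≤ 2 * Z′ * # p3(\ xy -> le(length(tup n K))(2 * Z′ * #(tup n K)(EE xy)))
 good-pairs = r2 lenp(dense-fibres p3(tup n K)EE Z′(sb(1 ≤_)(sym(lg n K))(af K n0))
  (r2(cn _*_(sym lenp)(sym(lg n K)))many-pairs))
 fibre : ∀ x y -> le(length(tup n K))(2 * Z′ * #(tup n K)(EE(x , y)))≡ tu ->
  n ^ K ≤ 2 * Z′ * #(tup n K)(\ v -> E(x ∷ v)∧ E(y ∷ v))
 fibre x y g = r2(lg n K)(lr g)
 rr : sum p3(\(x , y)-> sum(tup n K)(\ φ -> #(tup n K)(cube(\ v -> E(x ∷ v)∧ E(y ∷ v))φ)))
  ≡ sum(tup n(suc K))(\ φ -> #(tup n(suc K))(cube E φ))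
 rr = ta(sr _,_(al n)(al n)_)(sym(ta(su(al n)K _)
  (sc(al n)(\ x -> ta(sc(tup n K)(\ φ -> su(al n)K _))(s1(tup n K)(al n)_)))))

-- A coordinatewise choice between two independent uniform tuples is again uniform.
aV : ∀{A : Set}(xs : List A){K}(ε : Vec Bool K)f ->
 sum(t0 xs K)(\ φ -> sum(t0 xs K)(\ ψ -> f(mix ε φ ψ)))≡ length xs ^ K * sum(t0 xs K)f
aV xs []      f = ta(ie _)(sym(ie _))
aV xs{suc K}(b ∷ ε)f = ta(ta(su xs K _)(sc xs(\ x -> sc(t0 xs K)(\ φ -> su xs K _))))
 (ta(sI b)(ta(co(length xs *_)(ta(sc xs(\ x -> aV xs ε(\ v -> f(x ∷ v))))(s0 xs(length xs ^ K)(\ x -> sum(t0 xs K)(\ v -> f(x ∷ v))))))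
  (ta(sym(ac(length xs)_ _))(co(length xs ^ suc K *_)(sym(su xs K f))))))
 where
 ys = t0 xs K
 sI : ∀ b -> sum xs(\ x -> sum ys(\ φ -> sum xs(\ y -> sum ys(\ ψ -> f(mix(b ∷ ε)(x ∷ φ)(y ∷ ψ))))))≡
  length xs * sum xs(\ x -> sum ys(\ φ -> sum ys(\ ψ -> f(x ∷ mix ε φ ψ))))
 sI tu  = ta(sc xs(\ x -> ta(sc ys(\ φ -> sn xs _))(s0 ys(length xs)_)))(s0 xs(length xs)_)
 sI fa = ta(sn xs _)(co(length xs *_)(s1 ys xs _))

-- A formula as a set of signed tuples: `F v p` says that the clause on the variables v with signs p
-- belongs to F. A clause appears in all its orderings (`Mi.perm`).
Fo : ℕ -> ℕ -> Set
Fo n k = Vec(Fin n)k -> Vec Bool k -> Bool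

-- Pigeonhole, one question at a time: fixing each answer to its more frequent value costs a factor
-- 2 per question.
halve : ∀{O B : Set}(𝒢 : List O)(β : B -> O -> Bool)(bs : List B)(sel : O -> Bool)->
 ∃ \ se ->(∀ F -> se F ≡ tu -> sel F ≡ tu)× # 𝒢 sel ≤ 2 ^ length bs * # 𝒢 se ×
  (∀ F G -> se F ≡ tu -> se G ≡ tu -> ∀{b}-> b ∈ bs -> β b F ≡ β b G)
halve 𝒢 β []       sel = sel ,(\ _ h -> h), mm _ 0 , \ _ _ _ _()
halve{O}{B}𝒢 β(b ∷ bs)sel = cR(≤-total(# 𝒢 s₁)(# 𝒢 s₀))
 where
 s₁ s₀ : O -> Bool
 s₁ F = sel F ∧ β b F
 s₀ F = sel F ∧ not(β b F)
 Result = ∃ \ se ->(∀ F -> se F ≡ tu -> sel F ≡ tu)× # 𝒢 sel ≤ 2 * 2 ^ length bs * # 𝒢 se ×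
  (∀ F G -> se F ≡ tu -> se G ≡ tu -> ∀{c}-> c ∈ b ∷ bs -> β c F ≡ β c G)
 sl : # 𝒢 sel ≤ # 𝒢 s₁ + # 𝒢 s₀
 sl = #-or 𝒢(\ F h -> lem F h(β b F)refl)
  where
  lem : ∀ F -> sel F ≡ tu -> ∀ x -> β b F ≡ x -> s₁ F ≡ tu ⊎ s₀ F ≡ tu
  lem F h tu  e = i1(ai h e)
  lem F h fa e = i0(ai h(co not e))
 dbl : ∀ a c -> a * c + a * c ≡ 2 * a * c
 dbl = so
 use : ∀ s ->(∀ F -> s F ≡ tu -> sel F ≡ tu)-> # 𝒢 s₁ + # 𝒢 s₀ ≤ # 𝒢 s + # 𝒢 s ->
  (∀ F G -> s F ≡ tu -> s G ≡ tu -> β b F ≡ β b G)-> Result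
 use s imp h s7 with halve 𝒢 β bs s
 ... | s′ , imp′ , h3 , same′ = s′ ,(\ F q -> imp F(imp′ F q)),
  tr sl(tr h(tr(m1 h3 h3)(re(dbl(2 ^ length bs)(# 𝒢 s′))))),
  \{F G f g(he refl)-> s7 F G(imp′ F f)(imp′ G g); F G f g(th m)-> same′ F G f g m}
 cR : # 𝒢 s₁ ≤ # 𝒢 s₀ ⊎ # 𝒢 s₀ ≤ # 𝒢 s₁ -> Result
 cR(i1 h)= use s₀(\ F -> ad)(m4 _ h)
  (\ F G f g -> nj(ta(ar{sel F}f)(sym(ar{sel G}g))))
 cR(i0 h)= use s₁(\ F -> ad)(m2 _ h)(\ F G f g -> ta(ar{sel F}f)(sym(ar{sel G}g)))

aR : ∀{A : Set}(xs : List A)f -> 1 ≤ length xs -> ∃ \ x -> sum xs f ≤ length xs * f x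
aR(x ∷ [])f _ = x , rf
aR(x ∷ xs@(_ ∷ _))f _ with aR xs f(ss zn)
... | y , h with ≤-total(f x)(f y)
... | i1 p = y , m1 p h
... | i0 p = x , m2(f x)(tr h(mo(length xs)p))

popular : ∀{O B : Set}(𝒢 : List O)(ys : List B)(rel : O -> B -> Bool)(sel : O -> Bool)-> 1 ≤ length ys ->
 (∀{F}-> F ∈ 𝒢 -> sel F ≡ tu -> ay ys(rel F)≡ tu)->
 ∃ \ y -> # 𝒢 sel ≤ length ys * # 𝒢(\ F -> sel F ∧ rel F y)
popular 𝒢 ys rel sel ne h with aR ys(\ y -> # 𝒢(\ F -> sel F ∧ rel F y))ne
... | y , q = y , tr(tr(sj 𝒢(\{F}m -> b0(\ s -> let z , z∈ , e = ae ys(h m s)in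
 an{p = \ y -> sel F ∧ rel F y}z∈(ai s e))))(aq 𝒢 ys(\ F y -> sel F ∧ rel F y)))q

wi : ∀{A : Set}(xs : List A)p -> 1 ≤ # xs p -> ∃ \ x -> x ∈ xs × p x ≡ tu
wi(x ∷ xs)p h with p x in e
... | tu  = x , he refl , e
... | fa with wi xs p h
... | y , m , q = y , th m , q

aI : ∀{A : Set}(xs : List A)f g -> 1 ≤ length xs -> sum xs f ≤ sum xs g -> ∃ \ x -> x ∈ xs × f x ≤ g x
aI xs f g ne h with sum-exists xs f(\ x -> 1 + g x)
 (tr(ss h)(tr(m4(sum xs g)ne)(re(ta(co(_+ sum xs g)(ln xs))(sym(s3 xs _ g))))))
... | x , m , q = x , m , ≤-pred q

f1 : ∀{a}c b -> 1 ≤ a -> a ≤ c * b -> 1 ≤ b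
f1 c zero    1≤a h = el(il refl(t5 1≤a(tr h(re(ze c)))))
f1 c(suc b)_   _ = ss zn

-- Configurations of clauses and how a family avoiding them thins out

record Sl(K k : ℕ): Set where
 constructor slot
 field
  ix  : Vec(Fin K)k
  sg  : Vec Bool k
  inj : Ds ix
open Sl public

at : ∀{n K k}-> Sl K k -> Vec(Fin n)K -> Vec(Fin n)k
at c φ = Vc(lo φ)(ix c)

has : ∀{n K k}-> Fo n k -> Vec(Fin n)K -> Sl K k -> Bool
has F φ c = F(at c φ)(sg c)

-- The set of c′ is not contained in that of c. Once all vertices outside c are fixed, c′ therefore
-- passes through a fixed vertex.
Ap : ∀{K k}-> Sl K k -> Sl K k -> Set
Ap c c′ = ∃ \ t -> ∀ t′ -> lo(ix c′)t ≢ lo(ix c)t′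

-- Constants of `drop` for r clauses: 1/`td` is the density of copies that no member may exceed,
-- 1/`dD` the density guaranteed for the resulting places, and `dp` the number of bits lost. `sV`
-- counts the signed tuples through the fixed vertices.
td : ℕ -> ℕ -> ℕ -> ℕ
td Z Y zero    = 2 * Z
td Z Y(suc r)= 2 * td Z Y r * Y

dD : ℕ -> ℕ -> ℕ -> ℕ
dD Z Y zero    = 0
dD Z Y(suc r)= 2 * td Z Y r + dD Z Y r

sV : ℕ -> ℕ -> ℕ -> ℕ
sV n k K = K *(suc k *(n ^ k * 2 ^ suc k))

dp : ℕ -> ℕ -> ℕ -> ℕ -> ℕ
dp n k K r = r *(1 +(K * n + sV n k K))

n4 : ∀ n -> n ≤ 2 ^ n
n4 zero    = zn
n4(suc n)= tr(mm(suc n)_)(d5 n)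

record Rare{n k K}(𝒢 : List(Fo n(suc k)))(sel : Fo n(suc k)-> Bool)(E : Vec(Fin n)K -> Bool)
 (cs : List(Sl K(suc k)))(Y Z loss : ℕ): Set where
 field
  c      : Sl K(suc k)
  c∈     : c ∈ cs
  S      : Vec(Fin n)(suc k)-> Bool
  se   : Fo n(suc k)-> Bool
  sub    : ∀ F -> se F ≡ tu -> sel F ≡ tu
  my   : # 𝒢 sel ≤ 2 ^ loss * # 𝒢 se
  d6  : n ^ suc k ≤ Z * #(tup n(suc k))S
  inside : ∀ v -> S v ≡ tu -> ∃ \ φ -> E φ ≡ tu × at c φ ≡ v
  rare   : ∀{F}-> F ∈ 𝒢 -> se F ≡ tu -> Y * #(tup n(suc k))(\ v -> S v ∧ F v(sg c))≤ #(tup n(suc k))S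

-- If no member of a family contains many copies of a configuration all of whose
-- copies are pairwise on different sets, then on a dense set of places most of
-- the family uses some clause of the configuration rarely: with all vertices
-- outside one clause c fixed, the other clauses are read off the few clauses at
-- the fixed vertices.
drop : ∀{n k K}Z Y(𝒢 : List(Fo n(suc k)))(sel : Fo n(suc k)-> Bool)(E : Vec(Fin n)K -> Bool)
 (cs : List(Sl K(suc k)))-> AllPairs.AllPairs Ap cs -> 1 ≤ n -> 1 ≤ # 𝒢 sel -> n ^ K ≤ Z * #(tup n K)E ->
 (∀{F}-> F ∈ 𝒢 -> sel F ≡ tu ->
  td Z Y(length cs)* #(tup n K)(\ φ -> E φ ∧ a2 cs(has F φ))≤ n ^ K)->
 Rare 𝒢 sel E cs Y(dD Z Y(length cs))(dp n k K(length cs))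
drop{n}{k}{K}Z Y 𝒢 sel E [] _ n0 ne d6 few = a9(wi 𝒢 sel ne)
 where
 open Re
 e = #(tup n K)E
 dbl : ∀ a c -> a * c + a * c ≡ 2 * a * c
 dbl = so
 a9 :(∃ \ F -> F ∈ 𝒢 × sel F ≡ tu)-> _
 a9(F , F∈ , s)= el(il refl(t5(af K n0)(+-cancelˡ-≤(n ^ K)(n ^ K)0(begin
  n ^ K + n ^ K               ≤⟨ m1 d6 d6 ⟩
  Z * e + Z * e               ≡⟨ dbl Z e ⟩
  2 * Z * e                   ≡⟨ co(2 * Z *_)(sc(tup n K)(\ φ -> co bit(sym(∧-identityʳ(E φ)))))⟩
  2 * Z * #(tup n K)(\ φ -> E φ ∧ tu)≤⟨ few F∈ s ⟩
  n ^ K                       ≡⟨ sym(ie _)⟩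
  n ^ K + 0                   ∎))))
drop{n}{k}{K}Z Y 𝒢 sel E(c ∷ cs)(ap AllPairs.∷ aps)n0 ne d6 few =
 cR(≤-total(# 𝒢 sO)(# 𝒢 sbad))
 where
 Z₁ = td Z Y(length cs)
 O = Fo n(suc k)
 rt : O -> Vec(Fin n)K -> Bool
 rt F φ = E φ ∧ a2 cs(has F φ)
 -- Either most members have many copies of the remaining clauses, and then c is the rarely used
 -- one; or most do not, and the recursion continues without c.
 sO sbad : O -> Bool
 sO F = sel F ∧ le(n ^ K)(Z₁ * #(tup n K)(rt F))
 sbad F = sel F ∧ not(le(n ^ K)(Z₁ * #(tup n K)(rt F)))
 loss₁ = 1 +(K * n + sV n k K)
 Z′ = dD Z Y(length cs)
 Goal = Rare 𝒢 sel E(c ∷ cs)Y(2 * Z₁ + Z′)(loss₁ + dp n k K(length cs))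
 sl : # 𝒢 sel ≤ # 𝒢 sO + # 𝒢 sbad
 sl = #-or 𝒢(\ F h -> lem F h(le(n ^ K)(Z₁ * #(tup n K)(rt F)))refl)
  where
  lem : ∀ F -> sel F ≡ tu -> ∀ x -> le(n ^ K)(Z₁ * #(tup n K)(rt F))≡ x -> sO F ≡ tu ⊎ sbad F ≡ tu
  lem F h tu  e = i1(ai h e)
  lem F h fa e = i0(ai h(co not e))
 open Re
 badCase : # 𝒢 sel ≤ 2 * # 𝒢 sbad -> Goal
 badCase h = use(drop Z Y 𝒢 sbad E cs aps n0(f1 2(# 𝒢 sbad)ne h)d6
  (\{F}m s -> bf(la(nt(ar{sel F}s)))))
  where
  use : Rare 𝒢 sbad E cs Y Z′(dp n k K(length cs))-> Goal
  use r = record{c = R.c ; c∈ = th R.c∈ ; S = R.S ; se = R.se ; sub = \ F q -> ad(R.sub F q)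
   ; my = begin
    # 𝒢 sel ≤⟨ h ⟩
    2 * # 𝒢 sbad ≤⟨ m0(m8 2(ss(zn{K * n + sV n k K})))R.my ⟩
    2 ^ loss₁ *(2 ^ dp n k K(length cs)* # 𝒢 R.se)≡⟨ sym(ac(2 ^ loss₁)_ _)⟩
    2 ^ loss₁ * 2 ^ dp n k K(length cs)* # 𝒢 R.se ≡⟨ co(_* # 𝒢 R.se)(sym(dr 2 loss₁ _))⟩
    2 ^(loss₁ + dp n k K(length cs))* # 𝒢 R.se ∎
   ; d6 = tr R.d6(mn(#(tup n(suc k))R.S)(m5 Z′(2 * Z₁)))
   ; inside = R.inside ; rare = R.rare}
    where module R = Rare r
 p4 : O -> Vec(Fin n)K -> Vec(Fin n)(suc k)-> Bool
 p4 F ψ v = rt F(ud ψ(ix c)v)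
 used : O -> Vec(Fin n)K -> Vec(Fin n)(suc k)-> Bool
 used F ψ v = p4 F ψ v ∧ F v(sg c)
 -- Two demands on the context ψ, many places for c and few of them used by F, are merged into one
 -- inequality so that a single averaging finds ψ.
 fits : O -> Vec(Fin n)K -> Bool
 fits F ψ = le(n ^ suc k + 2 * Z₁ * Y * #(tup n(suc k))(used F ψ))(2 * Z₁ * #(tup n(suc k))(p4 F ψ))
 fit : ∀{F}-> F ∈ 𝒢 -> sO F ≡ tu -> ay(tup n K)(fits F)≡ tu
 fit{F}m s = fo(aI(tup n K)(\ ψ -> n ^ suc k + 2 * Z₁ * Y * #(tup n(suc k))(used F ψ))
  (\ ψ -> 2 * Z₁ * #(tup n(suc k))(p4 F ψ))(rp(sym(lg n K))(af K n0))(begin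
   sum(tup n K)(\ ψ -> n ^ suc k + 2 * Z₁ * Y * #(tup n(suc k))(used F ψ))
    ≡⟨ ta(s3(tup n K)_ _)(cn _+_(ta(sn(tup n K)_)(co(_* n ^ suc k)(lg n K)))(s0(tup n K)(2 * Z₁ * Y)_))⟩
   n ^ K * n ^ suc k + 2 * Z₁ * Y * sum(tup n K)(\ ψ -> #(tup n(suc k))(used F ψ))
    ≤⟨ m2 _(mo(2 * Z₁ * Y)(tr(sm(tup n K)(\ ψ -> m6(tup n(suc k))(bh ψ)))(re(tl(\ φ -> bit(E φ ∧ a2(c ∷ cs)(has F φ)))))))⟩
   n ^ K * n ^ suc k + 2 * Z₁ * Y *(n ^ suc k * #(tup n K)(\ φ -> E φ ∧ a2(c ∷ cs)(has F φ)))
    ≡⟨ co(n ^ K * n ^ suc k +_)(sJ(2 * Z₁ * Y)(n ^ suc k)_)⟩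
   n ^ K * n ^ suc k + n ^ suc k *(2 * Z₁ * Y * #(tup n K)(\ φ -> E φ ∧ a2(c ∷ cs)(has F φ)))
    ≤⟨ m2 _(mo(n ^ suc k)(few m(ad s)))⟩
   n ^ K * n ^ suc k + n ^ suc k * n ^ K ≡⟨ twice(n ^ K)(n ^ suc k)⟩
   2 *(n ^ suc k * n ^ K)≤⟨ mo 2(mo(n ^ suc k)(lr(ar{sel F}s)))⟩
   2 *(n ^ suc k *(Z₁ * #(tup n K)(rt F)))≡⟨ swap₂ 2(n ^ suc k)Z₁ _ ⟩
   2 * Z₁ *(n ^ suc k * #(tup n K)(rt F))≡⟨ co(2 * Z₁ *_)(sym(tl(\ φ -> bit(rt F φ))))⟩
   2 * Z₁ * sum(tup n K)(\ ψ -> #(tup n(suc k))(p4 F ψ))≡⟨ sym(s0(tup n K)(2 * Z₁)_)⟩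
   sum(tup n K)(\ ψ -> 2 * Z₁ * #(tup n(suc k))(p4 F ψ))∎))
  where
  fo :(∃ \ ψ -> ψ ∈ tup n K × n ^ suc k + 2 * Z₁ * Y * #(tup n(suc k))(used F ψ)≤ 2 * Z₁ * #(tup n(suc k))(p4 F ψ))-> ay(tup n K)(fits F)≡ tu
  fo(ψ , m′ , h)= an{p = fits F}m′(l4 h)
  tl : ∀ f -> sum(tup n K)(\ ψ -> sum(tup n(suc k))(\ v -> f(ud ψ(ix c)v)))≡ n ^ suc k * sum(tup n K)f
  tl f = ta(sT(al n)(ix c)f)(co(\ z -> z ^ suc k * sum(tup n K)f)(lf n))
  sJ : ∀ a b c -> a *(b * c)≡ b *(a * c)
  sJ = so
  swap₂ : ∀ a b c d -> a *(b *(c * d))≡ a * c *(b * d)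
  swap₂ = so
  twice : ∀ a b -> a * b + b * a ≡ 2 *(b * a)
  twice = so
  bh : ∀ ψ v -> used F ψ v ≡ tu -> E(ud ψ(ix c)v)∧ a2(c ∷ cs)(has F(ud ψ(ix c)v))≡ tu
  bh ψ v h = ai{E(ud ψ(ix c)v)}(ad{E(ud ψ(ix c)v)}(ad{p4 F ψ v}h))(ai
   (ta(co(\ u -> F u(sg c))(ui ψ(ix c)v(inj c)))(ar{p4 F ψ v}h))
   (ar{E(ud ψ(ix c)v)}(ad{p4 F ψ v}h)))
 goodCase : # 𝒢 sel ≤ 2 * # 𝒢 sO -> Goal
 goodCase h = context(popular 𝒢(tup n K)fits sO(rp(sym(lg n K))(af K n0))fit)
  where
  context :(∃ \ ψ -> # 𝒢 sO ≤ length(tup n K)* # 𝒢(\ F -> sO F ∧ fits F ψ))-> Goal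
  context(ψ , h0)= stars(halve 𝒢 β bs(\ F -> sO F ∧ fits F ψ))
   where
   -- The questions to be fixed: is the tuple u with a vertex of ψ inserted at position t, signed by
   -- p, a clause? Every clause other than c uses such a vertex, so the answers determine the set of
   -- places.
   Ix =(Fin K × Fin(suc k))×(Vec(Fin n)k × Vec Bool(suc k))
   bs : List Ix
   bs = ct(ct(al K)(al(suc k)))(ct(tup n k)(pa(suc k)))
   bs-length : length bs ≡ sV n k K
   bs-length = ta(ld(ct(al K)(al(suc k)))_)(ta(cn _*_
    (ta(ld(al K)_)(cn _*_(lf K)(lf(suc k))))
    (ta(ld(tup n k)_)(cn _*_(lg n k)(lh(tu ∷ fa ∷ [])(suc k)))))
    (ac K(suc k)_))
   β : Ix -> O -> Bool
   β((s , t),(u , p))F = F(insertAt u t(lo ψ s))p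
   stars :(∃ \ se ->(∀ F -> se F ≡ tu -> sO F ∧ fits F ψ ≡ tu)× # 𝒢(\ F -> sO F ∧ fits F ψ)≤ 2 ^ length bs * # 𝒢 se ×
    (∀ F G -> se F ≡ tu -> se G ≡ tu -> ∀{b}-> b ∈ bs -> β b F ≡ β b G))-> Goal
   stars(se , sub′ , many′ , s7)= finish(wi 𝒢 se ne′)
    where
    many″ : # 𝒢 sel ≤ 2 ^(loss₁ + dp n k K(length cs))* # 𝒢 se
    many″ = begin
     # 𝒢 sel ≤⟨ h ⟩
     2 * # 𝒢 sO ≤⟨ mo 2 h0 ⟩
     2 *(length(tup n K)* # 𝒢(\ F -> sO F ∧ fits F ψ))≤⟨ mo 2(m0(tr(re(lg n K))
      (tr(m3 K(n4 n))(re(ta(ao 2 n K)(co(2 ^_)(c2 n K))))))many′)⟩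
     2 *(2 ^(K * n)*(2 ^ length bs * # 𝒢 se))≡⟨ co(\ z -> 2 *(2 ^(K * n)*(2 ^ z * # 𝒢 se)))bs-length ⟩
     2 *(2 ^(K * n)*(2 ^ sV n k K * # 𝒢 se))≡⟨ assoc₃ 2(2 ^(K * n))(2 ^ sV n k K)(# 𝒢 se)⟩
     2 *(2 ^(K * n)* 2 ^ sV n k K)* # 𝒢 se ≡⟨ co(\ z -> 2 * z * # 𝒢 se)(sym(dr 2(K * n)_))⟩
     2 ^ loss₁ * # 𝒢 se ≤⟨ mn(# 𝒢 se)(m8 2(mm loss₁ _))⟩
     2 ^(loss₁ + dp n k K(length cs))* # 𝒢 se ∎
     where
     assoc₃ : ∀ a b c d -> a *(b *(c * d))≡ a *(b * c)* d
     assoc₃ = so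
    ne′ : 1 ≤ # 𝒢 se
    ne′ = f1(2 ^(loss₁ + dp n k K(length cs)))(# 𝒢 se)ne many″
    finish :(∃ \ F -> F ∈ 𝒢 × se F ≡ tu)-> Goal
    finish(F0 , F₀∈ , s₀)= record{c = c ; c∈ = he refl ; S = p4 F0 ψ ; se = se
     ; sub = \ F q -> ad(ad(sub′ F q)); my = many″
     ; d6 = tr(m+n≤o⇒m≤o _(fit₀ s₀))(mn(#(tup n(suc k))(p4 F0 ψ))(mm(2 * Z₁)Z′))
     ; inside = \ v q -> ud ψ(ix c)v , ad q , ui ψ(ix c)v(inj c)
     ; rare = \{F}F∈ q -> sb(\ z -> Y * z ≤ #(tup n(suc k))(p4 F0 ψ))
      (sc(tup n(suc k))(\ v -> co(\ z -> bit(z ∧ F v(sg c)))(aj F q v)))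
      (rp(sc(tup n(suc k))(\ v -> co bit(aj F q v)))
       (s9(tr(m5 _(n ^ suc k))(fit₀ q))))}
     where
     fit₀ : ∀{F}-> se F ≡ tu ->
      n ^ suc k + 2 * Z₁ * Y * #(tup n(suc k))(used F ψ)≤ 2 * Z₁ * #(tup n(suc k))(p4 F ψ)
     fit₀{F}q = lr(ar{sO F}(sub′ F q))
     pos : 1 ≤ 2 * Z₁
     pos = f1(#(tup n(suc k))(p4 F0 ψ))(2 * Z₁)(af(suc k)n0)
      (rp(c2(2 * Z₁)_)(m+n≤o⇒m≤o _(fit₀ s₀)))
     s9 : ∀{a b}-> 2 * Z₁ * Y * a ≤ 2 * Z₁ * b -> Y * a ≤ b
     s9{a}{b}q = ca(2 * Z₁){{nn pos}}(tr(re(sym(ac(2 * Z₁)Y a)))q)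
     aj : ∀ F -> se F ≡ tu -> ∀ v -> p4 F ψ v ≡ p4 F0 ψ v
     aj F q v = co(E φ ∧_)(all-cong cs(\{c′}c′∈ -> slot-agree c′(All.lookup ap c′∈)))
      where
      φ = ud ψ(ix c)v
      all-cong : ∀(xs : List(Sl K(suc k))){p p1}->(∀{x}-> x ∈ xs -> p x ≡ p1 x)-> a2 xs p ≡ a2 xs p1
      all-cong []       h = refl
      all-cong(x ∷ xs)h = cn _∧_(h(he refl))(all-cong xs(h ∘ th))
      slot-agree : ∀ c′ -> Ap c c′ -> has F φ c′ ≡ has F0 φ c′
      slot-agree c′(t , away)= ta(co(\ u -> F u(sg c′))shape)(ta
       (s7 F F0 q s₀(ci(ci(aF(lo(ix c′)t))(aF t))(ci(t1(removeAt(at c′ φ)t))(pt(sg c′)))))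
       (sym(co(\ u -> F0 u(sg c′))shape)))
       where
       shape : at c′ φ ≡ insertAt(removeAt(at c′ φ)t)t(lo ψ(lo(ix c′)t))
       shape = ta(sym(Vec.insertAt-removeAt(at c′ φ)t))(co(insertAt(removeAt(at c′ φ)t)t)
        (ta(Vm t(lo φ)(ix c′))(uo ψ(ix c)v(lo(ix c′)t)away)))
 cR : # 𝒢 sO ≤ # 𝒢 sbad ⊎ # 𝒢 sbad ≤ # 𝒢 sO -> Goal
 cR(i1 h)= badCase(tr sl(tr(m4 _ h)(re(co(# 𝒢 sbad +_)(sym(ie _))))))
 cR(i0 h)= goodCase(tr sl(tr(m2 _ h)(re(co(# 𝒢 sO +_)(sym(ie _))))))

-- Irredundant formulas and the configurations they exclude.

-- Minimality as it is used throughout: the witness w satisfies (v , p), and any clause satisfied by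
-- w lives on the set of v. Its signs are then forced by w, so it is the same clause.
record Mi{n k}(F : Fo n k): Set where
 field
  dist : ∀ v p -> F v p ≡ tu -> Ds v
  perm : ∀ v p v′ p1 -> F v p ≡ tu -> Ds v′ ->
   (∀ i -> ∃ \ j -> lo v′ i ≡ lo v j × lo p1 i ≡ lo p j)-> F v′ p1 ≡ tu
  wit  : ∀ v p -> F v p ≡ tu -> ∃ \(w : Fin n -> Bool)->(∀ i -> w(lo v i)≡ lo p i)×
   (∀ v′ p1 -> F v′ p1 ≡ tu ->(∀ i -> w(lo v′ i)≡ lo p1 i)-> ∀ i -> ∃ \ j -> lo v′ i ≡ lo v j)

record Co(k : ℕ): Set where
 constructor config
 field
  K         : ℕ
  sv     : List(Sl K k)
  apart     : AllPairs.AllPairs Ap sv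
  forbidden : ∀{n}{F : Fo n k}-> Mi F ->(φ : Vec(Fin n)K)-> Ds φ ->
   a2 sv(has F φ)≡ tu -> ⊥

-- Base vertices are doubled, and ε picks the first copy where it is true. A cube over a base set
-- supplies the clauses for all choices ε at once, so only base sets need to be shown sparse.
copyIx : ∀{K}-> Vec Bool K -> Fin K -> Fin(K + K)
copyIx{K}ε s = if lo ε s then s ↑ˡ K else K ↑ʳ s

aC : ∀{m n}(i : Fin m)(j : Fin n)-> i ↑ˡ n ≢ m ↑ʳ j
aC{m}{n}i j e with ta(sym(Fin.splitAt-↑ˡ m i n))(ta(co(splitAt m)e)(Fin.splitAt-↑ʳ m n j))
... |()

cJ : ∀{K}(ε ε′ : Vec Bool K)s s′ -> copyIx ε s ≡ copyIx ε′ s′ -> s ≡ s′ × lo ε s ≡ lo ε′ s′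
cJ{K}ε ε′ s s′ e with lo ε s | lo ε′ s′
... | tu  | tu  = Fin.↑ˡ-injective K s s′ e , refl
... | tu  | fa = el(aC s s′ e)
... | fa | tu  = el(aC s′ s(sym e))
... | fa | fa = Fin.↑ʳ-injective K s s′ e , refl

du : ∀{K k}-> Sl K k -> Vec Bool K -> Sl(K + K)k
du c ε = slot(Vc(copyIx ε)(ix c))(sg c)\ i j e -> inj c i j
 (po(cJ ε ε _ _(ta(sym(Vm i _(ix c)))(ta e(Vm j _(ix c))))))

lm : ∀{A : Set}{K}(ε : Vec Bool K)(φ ψ : Vec A K)s -> lo(mix ε φ ψ)s ≡(if lo ε s then lo φ s else lo ψ s)
lm(tu  ∷ ε)(x ∷ φ)(y ∷ ψ)zero    = refl
lm(fa ∷ ε)(x ∷ φ)(y ∷ ψ)zero    = refl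
lm(tu  ∷ ε)(x ∷ φ)(y ∷ ψ)(suc s)= lm ε φ ψ s
lm(fa ∷ ε)(x ∷ φ)(y ∷ ψ)(suc s)= lm ε φ ψ s

lookup-copyIx : ∀{n K}(φ ψ : Vec(Fin n)K)ε s -> lo(φ Vec.++ ψ)(copyIx ε s)≡ lo(mix ε φ ψ)s
lookup-copyIx{K = K}φ ψ ε s = ta(cR(lo ε s))(sym(lm ε φ ψ s))
 where
 cR : ∀ b -> lo(φ Vec.++ ψ)(if b then s ↑ˡ K else K ↑ʳ s)≡(if b then lo φ s else lo ψ s)
 cR tu  = Vec.lookup-++ˡ φ ψ s
 cR fa = Vec.lookup-++ʳ φ ψ s

aN : ∀{n K k}(c : Sl K k)ε(φ ψ : Vec(Fin n)K)-> at(du c ε)(φ Vec.++ ψ)≡ at c(mix ε φ ψ)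
aN c ε φ ψ = ta(sym(Vec.map-∘ _ _(ix c)))(Vec.map-cong(lookup-copyIx φ ψ ε)(ix c))

-- Different sets: either a different base vertex or a different copy of it.
a3 : ∀{K k}(c c′ : Sl K k)ε ε′ t ->
 (∀ t′ -> lo(ix c′)t ≡ lo(ix c)t′ -> lo ε′(lo(ix c′)t)≢ lo ε(lo(ix c′)t))->
 Ap(du c ε)(du c′ ε′)
a3 c c′ ε ε′ t h = t , \ t′ e ->
 let s7 , cp = cJ ε′ ε _ _(ta(sym(Vm t _(ix c′)))(ta e(Vm t′ _(ix c))))in
 h t′ s7(ta cp(co(lo ε)(sym s7)))

eqB : Bool -> Bool -> Bool
eqB tu  b = b
eqB fa b = not b

eB : ∀ a b -> eqB a b ≡ tu -> a ≡ b
eB tu  tu  h = refl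
eB fa fa h = refl

ef : ∀ a b -> eqB a b ≡ fa -> b ≡ not a
ef tu  fa h = refl
ef fa tu  h = refl

e6 : ∀ a -> eqB a a ≡ tu
e6 tu  = refl
e6 fa = refl

aT : ∀ K -> Vec Bool K
aT K = replicate K tu

shift : ∀{K k}-> Sl K k -> Fin k -> Vec Bool K
shift{K}c t = aT K [ lo(ix c)t ]≔ fa

sG : ∀{K k}-> Sl K k -> Fin k -> Sl(K + K)k
sG c t = du c(shift c t)

-- The star of c: the clause on first copies, and for each t the clause with only its t-th vertex
-- moved to the second copy. These k + 1 clauses control the witness of c on both copies.
aP : ∀{K k}-> Sl K k -> List(Sl(K + K)k)
aP{K}{k}c = du c(aT K)∷ map(sG c)(al k)

star-apart : ∀{K k}(c : Sl K k)-> AllPairs.AllPairs Ap(aP c)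
star-apart{K}{k}c = All.tabulate f5 AllPairs.∷ others(al k)(Uniq.allFin⁺ k)
 where
 off : ∀ t -> lo(aT K [ lo(ix c)t ]≔ fa)(lo(ix c)t)≡ fa
 off t = Ve(lo(ix c)t)(aT K)fa
 f5 : ∀{x}-> x ∈ map(sG c)(al k)-> Ap(du c(aT K))x
 f5 m with ma(sG c)m
 ... | t , _ , refl = a3 c c(aT K)(shift c t)t(\ t′ e q -> te(ta q(Vr(lo(ix c)t)tu))(off t))
 others : ∀ ts -> Unique ts -> AllPairs.AllPairs Ap(map(sG c)ts)
 others []       _ = AllPairs.[]
 others(t ∷ ts)(a AllPairs.∷ u)= All.tabulate aE AllPairs.∷ others ts u
  where
  aE : ∀{x}-> x ∈ map(sG c)ts -> Ap(sG c t)x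
  aE m with ma(sG c)m
  ... | t′ , t′∈ , refl = a3 c c(shift c t)(shift c t′)t′(\ _ _ q -> te(ta q
   (ta(Vu(\ e -> All.lookup a t′∈(sym(inj c _ _ e)))(aT K)fa)(Vr(lo(ix c)t′)tu)))(off t′))

mix-all : ∀{A : Set}{K}(φ ψ : Vec A K)-> mix(aT K)φ ψ ≡ φ
mix-all []      []      = refl
mix-all(x ∷ φ)(y ∷ ψ)= co(x ∷_)(mix-all φ ψ)

mix-one : ∀{A : Set}{K}(φ ψ : Vec A K)s -> mix(aT K [ s ]≔ fa)φ ψ ≡ φ [ s ]≔ lo ψ s
mix-one(x ∷ φ)(y ∷ ψ)zero    = co(y ∷_)(mix-all φ ψ)
mix-one(x ∷ φ)(y ∷ ψ)(suc s)= co(x ∷_)(mix-one φ ψ s)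

++-disjoint : ∀{A : Set}{a b}(φ : Vec A a)(ψ : Vec A b)-> Ds(φ Vec.++ ψ)-> ∀ s t -> lo φ s ≢ lo ψ t
++-disjoint{a = a}{b}φ ψ d s t e = aC s t(d _ _(ta(Vec.lookup-++ˡ φ ψ s)(ta e(sym(Vec.lookup-++ʳ φ ψ t)))))

record Forced{n K k}(F : Fo n k)(c : Sl K k)(φ ψ : Vec(Fin n)K): Set where
 field
  w     : Fin n -> Bool
  sat   : ∀ t -> w(lo φ(lo(ix c)t))≡ lo(sg c)t
  unsat : ∀ t -> w(lo ψ(lo(ix c)t))≡ not(lo(sg c)t)
  oy  : ∀ v p -> F v p ≡ tu ->(∀ i -> w(lo v i)≡ lo p i)-> ∀ i -> ∃ \ t -> lo v i ≡ lo φ(lo(ix c)t)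

-- The witness of a clause falsifies the copy of each of its literals.
forced-raw : ∀{n K k}{F : Fo n k}-> Mi F ->(c : Sl K k)(φ ψ : Vec(Fin n)K)-> Ds(φ Vec.++ ψ)->
 a2(aP c)(has F(φ Vec.++ ψ))≡ tu -> Forced F c φ ψ
forced-raw{n}{K}{k}{F}M c φ ψ d h = build(Mi.wit M(at c φ)(sg c)F0)
 where
 F0 : F(at c φ)(sg c)≡ tu
 F0 = ta(co(\ v -> F v(sg c))(sym(ta(aN c(aT K)φ ψ)(co(at c)(mix-all φ ψ)))))(aB{xs = aP c}h(he refl))
 F₁ : ∀ t -> F(at c(φ [ lo(ix c)t ]≔ lo ψ(lo(ix c)t)))(sg c)≡ tu
 F₁ t = ta(co(\ v -> F v(sg c))(sym(ta(aN c(shift c t)φ ψ)(co(at c)(mix-one φ ψ(lo(ix c)t))))))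
  (aB{xs = aP c}h(th(mp(sG c)(aF t))))
 lk : ∀{A : Set}(ω : Vec A K)t -> lo(Vc(lo ω)(ix c))t ≡ lo ω(lo(ix c)t)
 lk ω t = Vm t(lo ω)(ix c)
 build :(∃ \(w : Fin n -> Bool)->(∀ i -> w(lo(at c φ)i)≡ lo(sg c)i)×
  (∀ v′ p1 -> F v′ p1 ≡ tu ->(∀ i -> w(lo v′ i)≡ lo p1 i)-> ∀ i -> ∃ \ j -> lo v′ i ≡ lo(at c φ)j))-> Forced F c φ ψ
 build(w , sat , oy)= record{w = w ; sat = sat′ ; unsat = \ t -> unsat t(bo(eqB(lo(sg c)t)(w(lo ψ(lo(ix c)t)))))
  ; oy = \ v p f q i -> let j , e = oy v p f q i in j , ta e(lk φ j)}
  where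
  sat′ : ∀ t -> w(lo φ(lo(ix c)t))≡ lo(sg c)t
  sat′ t = ta(co w(sym(lk φ t)))(sat t)
  unsat : ∀ t -> eqB(lo(sg c)t)(w(lo ψ(lo(ix c)t)))≡ tu ⊎ eqB(lo(sg c)t)(w(lo ψ(lo(ix c)t)))≡ fa ->
   w(lo ψ(lo(ix c)t))≡ not(lo(sg c)t)
  unsat t(i0 e)= ef(lo(sg c)t)_ e
  -- If the literal also held at the second copy, w would satisfy the shifted clause, whose t-th
  -- vertex is not a vertex of c.
  unsat t(i1 e)= el(++-disjoint φ ψ d _ _(ta(sym(ta at-t(lk φ j)))refl))
   where
   s = lo(ix c)t
   φ′ = φ [ s ]≔ lo ψ s
   all-sat : ∀ i -> w(lo(at c φ′)i)≡ lo(sg c)i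
   all-sat i with i Fin.≟ t
   ... | yes refl = ta(co w(ta(lk φ′ t)(Ve s φ _)))(sym(eB _ _ e))
   ... | no i≢t = ta(co w(ta(lk φ′ i)(Vu(\ q -> i≢t(inj c _ _ q))φ _)))(sat′ i)
   hit = oy(at c φ′)(sg c)(F₁ t)all-sat t
   j = po hit
   at-t : lo ψ s ≡ lo(at c φ)j
   at-t = ta(sym(ta(lk φ′ t)(Ve s φ _)))(p0 hit)

abstract
 forced : ∀{n K k}{F : Fo n k}-> Mi F ->(c : Sl K k)(φ ψ : Vec(Fin n)K)-> Ds(φ Vec.++ ψ)->
  a2(aP c)(has F(φ Vec.++ ψ))≡ tu -> Forced F c φ ψ
 forced = forced-raw

Al : ∀{A : Set}{R : A -> A -> Set}xs{ys}-> AllPairs.AllPairs R xs -> AllPairs.AllPairs R ys ->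
 (∀{x y}-> x ∈ xs -> y ∈ ys -> R x y)-> AllPairs.AllPairs R(xs ++ ys)
Al []       _ b h = b
Al{R = R}(x ∷ xs){ys}(a AllPairs.∷ as)b h = All.tabulate(\ m -> ce(∈-++⁻ xs m))AllPairs.∷ Al xs as b(\ m -> h(th m))
 where
 ce : ∀{y}-> y ∈ xs ⊎ y ∈ ys -> R x y
 ce(i1 m)= All.lookup a m
 ce(i0 m)= h(he refl)m

-- Another clause with suitably chosen copies is satisfied on the vertices it
-- shares with c.
module _{n K k}{F : Fo n k}{c : Sl K k}{φ ψ : Vec(Fin n)K}(fc : Forced F c φ ψ)where
 open Forced fc
 follower :(c′ : Sl K k)(ε : Vec Bool K)->
  (∀ u t -> lo(ix c′)u ≡ lo(ix c)t -> lo ε(lo(ix c′)u)≡ eqB(lo(sg c)t)(lo(sg c′)u))->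
  has F(φ Vec.++ ψ)(du c′ ε)≡ tu ->
  (∀ u ->(∃ \ t -> lo(ix c′)u ≡ lo(ix c)t)⊎ w(lo(mix ε φ ψ)(lo(ix c′)u))≡ lo(sg c′)u)->
  ∀ u -> ∃ \ t -> lo(mix ε φ ψ)(lo(ix c′)u)≡ lo φ(lo(ix c)t)
 follower c′ ε εok h cond u = let t , e = oy v(sg c′)(ta(co(\ u -> F u(sg c′))(sym(aN c′ ε φ ψ)))h)sat-all u in
  t , ta(sym(Vm u(lo(mix ε φ ψ))(ix c′)))e
  where
  v = at c′(mix ε φ ψ)
  sat-all : ∀ u -> w(lo v u)≡ lo(sg c′)u
  sat-all u = ta(co w(Vm u(lo(mix ε φ ψ))(ix c′)))(one(cond u))
   where
   s = lo(ix c′)u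
   one :(∃ \ t -> s ≡ lo(ix c)t)⊎ w(lo(mix ε φ ψ)s)≡ lo(sg c′)u -> w(lo(mix ε φ ψ)s)≡ lo(sg c′)u
   one(i0 e)= e
   one(i1(t , e))= ta(co w(lm ε φ ψ s))(ta(co(\ b -> w(if b then lo φ s else lo ψ s))(εok u t e))
    (lem(eqB(lo(sg c)t)(lo(sg c′)u))refl))
    where
    lem : ∀ b -> eqB(lo(sg c)t)(lo(sg c′)u)≡ b -> w(if b then lo φ s else lo ψ s)≡ lo(sg c′)u
    lem tu  q = ta(ta(co(w ∘ lo φ)e)(sat t))(eB _ _ q)
    lem fa q = ta(ta(co(w ∘ lo ψ)e)(unsat t))(sym(ef _ _ q))

i2 : ∀{k}-> Vec Bool k -> Sl k k
i2{k}p = slot(Vec.allFin k)p(\ i j e -> ta(sym(Vec.lookup-allFin i))(ta e(Vec.lookup-allFin j)))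

-- Two patterns on one set that differ in at least two places.
pC : ∀{k}(p q : Vec Bool k)i j -> i ≢ j -> eqB(lo p i)(lo q i)≡ fa ->
 eqB(lo p j)(lo q j)≡ fa -> Co k
pC{k}p q i j i≢j pi pj = config(k + k)cs ap forb
 where
 -- q takes the first copy where it agrees with p and the second where it differs. The witness of p
 -- falsifies the literals of p on second copies, hence satisfies those of q there. Two differences
 -- are needed for `Ap`, since a shifted star clause may itself contain one of the second copies.
 ε = zW eqB p q
 c0 = i2 p
 c5 = du(i2 q)ε
 cs = aP c0 ++ c5 ∷ []
 εt : ∀ t -> lo ε t ≡ eqB(lo p t)(lo q t)
 εt t = Vec.lookup-zipWith eqB t p q
 idx : ∀ t -> lo(Vec.allFin k)t ≡ t
 idx = Vec.lookup-allFin
 far : ∀ ε′ t -> lo ε t ≡ fa -> lo ε′ t ≡ tu -> Ap(du c0 ε′)c5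
 far ε′ t e e′ = a3 c0(i2 q)ε′ ε t(\ _ _ q -> te
  (ta(ta(co(lo ε)(sym(idx t)))q)(ta(co(lo ε′)(idx t))e′))e)
 shift-far : ∀ t -> Dec(t ≡ i)-> Ap(sG c0 t)c5
 shift-far t(yes refl)= far(shift c0 t)j(ta(εt j)pj)(ta(Vu(\ e -> i≢j(sym(ta e(idx t))))(aT k)fa)(Vr j tu))
 shift-far t(no t≢i)= far(shift c0 t)i(ta(εt i)pi)(ta(Vu(\ e -> t≢i(sym(ta e(idx t))))(aT k)fa)(Vr i tu))
 last : ∀{x y}-> x ∈ aP c0 -> y ∈ c5 ∷ [] -> Ap x y
 last(he refl)(he refl)= far(aT k)i(ta(εt i)pi)(Vr i tu)
 last(th m)(he refl)with ma(sG c0)m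
 ... | t , _ , refl = shift-far t(t Fin.≟ i)
 ap = Al(aP c0)(star-apart c0)(All.[] AllPairs.∷ AllPairs.[])last
 forb : ∀{n}{F : Fo n k}-> Mi F ->(Φ : Vec(Fin n)(k + k))-> Ds Φ -> a2 cs(has F Φ)≡ tu -> ⊥
 forb{n}{F}M Φ d h with Vec.splitAt k Φ
 ... | φ , ψ , refl = ++-disjoint φ ψ d _ i(sym(ta(sym vi)(p0 hit)))
  where
  fc = forced M c0 φ ψ d(a0(aP c0)(\ m -> aB{xs = cs}h(ax m)))
  hit = follower fc(i2 q)ε(\ u t e -> ta(co(lo ε)(idx u))(ta(εt u)(co(\ x -> eqB(lo p x)(lo q u))(ta(sym(idx u))(ta e(idx t))))))
   (aB{xs = cs}h(ah(aP c0)(he refl)))(\ u -> i1(u , refl))i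
  vi : lo(mix ε φ ψ)(lo(Vec.allFin k)i)≡ lo ψ i
  vi = ta(co(lo(mix ε φ ψ))(idx i))(ta(lm ε φ ψ i)(co(\ b -> if b then lo φ i else lo ψ i)(ta(εt i)pi)))

-- On z ∷ v: the set v with its i-th entry replaced by z.
rl : ∀{k}-> Fin k -> Vec(Fin(suc k))k
rl{k}i = tb suc [ i ]≔ zero

rI : ∀{k}(i : Fin k)-> lo(rl i)i ≡ zero
rI i = Ve i(tb suc)zero

rm : ∀{k}(i : Fin k){t}-> t ≢ i -> lo(rl i)t ≡ suc t
rm i{t}h = ta(Vu h(tb suc)zero)(Vt suc t)

rv : ∀{k}(i t : Fin k)->(t ≡ i × lo(rl i)t ≡ zero)⊎(t ≢ i × lo(rl i)t ≡ suc t)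
rv i t with t Fin.≟ i
... | yes refl = i1(refl , rI i)
... | no h     = i0(h , rm i h)

ra : ∀{k}-> Fin k -> Vec Bool k -> Sl(suc k)k
ra i p = slot(rl i)p d
 where
 d : Ds(rl i)
 d s t e with rv i s | rv i t
 ... | i1(a , _)| i1(b , _)= ta a(sym b)
 ... | i1(_ , a)| i0(_ , b)= el(s8(ta(sym a)(ta e b)))
  where
  s8 : ∀{k}{t : Fin k}-> zero ≢ suc t
  s8()
 ... | i0(_ , a)| i1(_ , b)= el(s8(ta(sym b)(ta(sym e)a)))
  where
  s8 : ∀{k}{t : Fin k}-> zero ≢ suc t
  s8()
 ... | i0(_ , a)| i0(_ , b)= Fin.suc-injective(ta(sym a)(ta e b))

keepSlot : ∀{k}-> Vec Bool k -> Sl(suc k)k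
keepSlot p = slot(tb suc)p(\ s t e -> Fin.suc-injective(ta(sym(Vt suc s))(ta e(Vt suc t))))

-- A clause on v[j:=z], and clauses on v[i:=z] and v with opposite signs at the
-- vertex of v missing from the first one.
ti : ∀{k}(i j : Fin k)(p q r : Vec Bool k)-> i ≢ j -> eqB(lo q j)(lo r j)≡ fa -> Co k
ti{k}i j p q r i≢j qr = config(suc k + suc k)cs ap forb
 where
 aQ ε₃ : Vec Bool(suc k)
 aQ = eqB(lo p j)(lo q i)∷(zW eqB p q [ j ]≔ tu)
 ε₃ = tu ∷(zW eqB p r [ j ]≔ tu)
 c0 c5 c₃ : Sl(suc k)k
 c0 = ra j p
 c5 = ra i q
 c₃ = keepSlot r
 d₂ = du c5 aQ
 d₃ = du c₃ ε₃
 cs = aP c0 ++ d₂ ∷ d₃ ∷ []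
 s8 : ∀{k}{t : Fin k}-> zero ≢ suc t
 s8()
 no-j : ∀ t -> suc j ≢ lo(rl j)t
 no-j t e with rv j t
 ... | i1(_ , b)= s8(ta(sym b)(sym e))
 ... | i0(a , b)= a(sym(Fin.suc-injective(ta e b)))
 tab : ∀ t -> lo(tb{n = k}suc)t ≡ suc t
 tab = Vt suc
 away₂ : ∀ ε -> Ap(du c0 ε)d₂
 away₂ ε = a3 c0 c5 ε aQ j(\ t e -> el(no-j t(ta(sym(rm i(\ q -> i≢j(sym q))))e)))
 away₃ : ∀ ε -> Ap(du c0 ε)d₃
 away₃ ε = a3 c0 c₃ ε ε₃ j(\ t e -> el(no-j t(ta(sym(tab j))e)))
 apart₂₃ : Ap d₂ d₃
 apart₂₃ = a3 c5 c₃ aQ ε₃ i(\ t e -> el(no-i t(ta(sym(tab i))e)))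
  where
  no-i : ∀ t -> suc i ≢ lo(rl i)t
  no-i t e with rv i t
  ... | i1(_ , b)= s8(ta(sym b)(sym e))
  ... | i0(a , b)= a(sym(Fin.suc-injective(ta e b)))
 last : ∀{x y}-> x ∈ aP c0 -> y ∈ d₂ ∷ d₃ ∷ [] -> Ap x y
 last(he refl)(he refl)= away₂(aT(suc k))
 last(he refl)(th(he refl))= away₃(aT(suc k))
 last(th m)m′ with ma(sG c0)m
 last(th m)(he refl)| t , _ , refl = away₂(shift c0 t)
 last(th m)(th(he refl))| t , _ , refl = away₃(shift c0 t)
 ap = Al(aP c0)(star-apart c0)((apart₂₃ All.∷ All.[])AllPairs.∷ All.[] AllPairs.∷ AllPairs.[])last
 off-j : ∀ s t -> t ≢ j -> lo(zW eqB p s [ j ]≔ tu)t ≡ eqB(lo p t)(lo s t)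
 off-j s t h = ta(Vu h(zW eqB p s)tu)(Vec.lookup-zipWith eqB t p s)
 ok₂ : ∀ u t -> lo(rl i)u ≡ lo(rl j)t -> lo aQ(lo(rl i)u)≡ eqB(lo p t)(lo q u)
 ok₂ u t e with rv i u | rv j t
 ... | i1(refl , a)| i1(refl , b)= co(lo aQ)a
 ... | i1(_ , a)| i0(_ , b)= el(s8(ta(sym a)(ta e b)))
 ... | i0(_ , a)| i1(_ , b)= el(s8(ta(sym b)(ta(sym e)a)))
 ... | i0(_ , a)| i0(t≢j , b)with Fin.suc-injective(ta(sym a)(ta e b))
 ... | refl = ta(co(lo aQ)a)(off-j q u t≢j)
 ok₃ : ∀ u t -> lo(tb suc)u ≡ lo(rl j)t -> lo ε₃(lo(tb suc)u)≡ eqB(lo p t)(lo r u)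
 ok₃ u t e with rv j t
 ... | i1(_ , b)= el(s8(ta(sym b)(ta(sym e)(tab u))))
 ... | i0(t≢j , b)with Fin.suc-injective(ta(sym(tab u))(ta e b))
 ... | refl = ta(co(lo ε₃)(tab u))(off-j r u t≢j)
 forb : ∀{n}{F : Fo n k}-> Mi F ->(Φ : Vec(Fin n)(suc k + suc k))-> Ds Φ -> a2 cs(has F Φ)≡ tu -> ⊥
 forb{n}{F}M Φ d h with Vec.splitAt(suc k)Φ
 -- The vertex y is not in the first clause, so nothing prescribes the value of its witness there;
 -- whichever value it takes completes one of the other two clauses, both of which contain y.
 ... | φ , ψ , refl = dd(bo(eqB(lo q j)(w y)))
  where
  fc = forced M c0 φ ψ d(a0(aP c0)(\ m -> aB{xs = cs}h(ax m)))
  open Forced fc using(w)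
  y = lo φ(suc j)
  keep : ∀ s b -> lo(mix(b ∷(zW eqB p s [ j ]≔ tu))φ ψ)(suc j)≡ y
  keep s b = ta(lm(b ∷(zW eqB p s [ j ]≔ tu))φ ψ(suc j))
   (co(\ c -> if c then y else lo ψ(suc j))(Ve j(zW eqB p s)tu))
  a9 :(∃ \ t -> y ≡ lo φ(lo(rl j)t))-> ⊥
  a9(t , e)= no-j t(Fin.↑ˡ-injective(suc k)_ _(d _ _(ta(Vec.lookup-++ˡ φ ψ(suc j))(ta e(sym(Vec.lookup-++ˡ φ ψ _))))))
  jj : lo(rl i)j ≡ suc j
  jj = rm i(\ q -> i≢j(sym q))
  cond₂ : eqB(lo q j)(w y)≡ tu -> ∀ u ->(∃ \ t -> lo(rl i)u ≡ lo(rl j)t)⊎ w(lo(mix aQ φ ψ)(lo(rl i)u))≡ lo q u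
  cond₂ e u = go(rv i u)(u Fin.≟ j)
   where
   go :(u ≡ i × lo(rl i)u ≡ zero)⊎(u ≢ i × lo(rl i)u ≡ suc u)-> Dec(u ≡ j)->(∃ \ t -> lo(rl i)u ≡ lo(rl j)t)⊎ w(lo(mix aQ φ ψ)(lo(rl i)u))≡ lo q u
   go(i1(_ , a))_ = i1(j , ta a(sym(rI j)))
   go(i0(_ , a))(no u≢j)= i1(u , ta a(sym(rm j u≢j)))
   go(i0(_ , a))(yes z)= i0(ta(co w(ta(co(lo(mix aQ φ ψ))(ta a(co suc z)))(keep q(lo aQ zero))))(ta(sym(eB _ _ e))(co(lo q)(sym z))))
  cond₃ : eqB(lo q j)(w y)≡ fa -> ∀ u ->(∃ \ t -> lo(tb suc)u ≡ lo(rl j)t)⊎ w(lo(mix ε₃ φ ψ)(lo(tb suc)u))≡ lo r u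
  cond₃ e u = go(u Fin.≟ j)
   where
   go : Dec(u ≡ j)->(∃ \ t -> lo(tb suc)u ≡ lo(rl j)t)⊎ w(lo(mix ε₃ φ ψ)(lo(tb suc)u))≡ lo r u
   go(no u≢j)= i1(u , ta(tab u)(sym(rm j u≢j)))
   go(yes z)= i0(ta(co w(ta(co(lo(mix ε₃ φ ψ))(ta(tab u)(co suc z)))(keep r tu)))(ta(ta(ef(lo q j)_ e)(sym(ef _ _ qr)))(co(lo r)(sym z))))
  dd : eqB(lo q j)(w y)≡ tu ⊎ eqB(lo q j)(w y)≡ fa -> ⊥
  dd(i1 e)= a9(let t , z = follower fc c5 aQ ok₂(aB{xs = cs}h(ah(aP c0)(he refl)))(cond₂ e)j in
   t , ta(sym(ta(co(lo(mix aQ φ ψ))jj)(keep q(lo aQ zero))))z)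
  dd(i0 e)= a9(let t , z = follower fc c₃ ε₃ ok₃(aB{xs = cs}h(ah(aP c0)(th(he refl))))(cond₃ e)j in
   t , ta(sym(ta(co(lo(mix ε₃ φ ψ))(tab j))(keep r tu)))z)

-- Containers for families of irredundant formulas.

eqP : ∀{k}-> Vec Bool k -> Vec Bool k -> Bool
eqP []      []      = tu
eqP(a ∷ p)(b ∷ q)= eqB a b ∧ eqP p q

et : ∀{k}(p q : Vec Bool k)-> eqP p q ≡ tu -> p ≡ q
et []      []      h = refl
et(a ∷ p)(b ∷ q)h = cn _∷_(eB a b(ad h))(et p q(ar{eqB a b}h))

eP : ∀{k}(p : Vec Bool k)-> eqP p p ≡ tu
eP []      = refl
eP(a ∷ p)= ai(e6 a)(eP p)

sP : ∀{k}(s : Vec Bool k)f -> sum(pa k)(\ p -> bit(eqP p s)* f p)≡ f s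
sP []      f = ta(ie _)(ie _)
sP{suc k}(tu ∷ s)f = ta(su(tu ∷ fa ∷ [])k _)(ta
 (cn _+_(sP s(\ p -> f(tu ∷ p)))(ta(ie _)(ta(sn(pa k)0)(ze(length(pa k))))))(ie _))
sP{suc k}(fa ∷ s)f = ta(su(tu ∷ fa ∷ [])k _)(ta
 (cn _+_(ta(sn(pa k)0)(ze(length(pa k))))(ta(ie _)(sP s(\ p -> f(fa ∷ p)))))refl)

sx : ∀{n k}-> Fo n k -> ℕ
sx{n}{k}Q = sum(tup n k)(\ v -> #(pa k)(Q v))

exc : ∀{n k}-> Fo n k -> Fo n k -> ℕ
exc Q F = sx(\ v p -> F v p ∧ not(Q v p))

copies : ∀{n k}-> Fo n k ->(Γ : Co k)-> Vec(Fin n)(Co.K Γ)-> Bool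
copies Q Γ φ = di φ ∧ a2(Co.sv Γ)(has Q φ)

remove : ∀{n k}-> Fo n k ->(Vec(Fin n)k -> Bool)-> Vec Bool k -> Fo n k
remove Q S s v p = Q v p ∧ not(eqP p s ∧ S v)

module _{n k}(Q : Fo n k)(S : Vec(Fin n)k -> Bool)(s : Vec Bool k)where
 size-remove :(∀ v -> S v ≡ tu -> Q v s ≡ tu)-> sx(remove Q S s)+ #(tup n k)S ≡ sx Q
 size-remove h = ta(sym(s3(tup n k)_ _))(sc(tup n k)eh)
  where
  lem : ∀ q e b ->(e ≡ tu -> b ≡ tu -> q ≡ tu)-> bit(q ∧ not(e ∧ b))+ bit e * bit b ≡ bit q
  lem q tu  tu  h rewrite h refl refl = refl
  lem q tu  fa h rewrite ∧-identityʳ q = ie _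
  lem q fa b     h rewrite ∧-identityʳ q = ie _
  eh : ∀ v -> #(pa k)(remove Q S s v)+ bit(S v)≡ #(pa k)(Q v)
  eh v = ta(co(#(pa k)(remove Q S s v)+_)(sym(sP s(\ _ -> bit(S v)))))
   (ta(sym(s3(pa k)_ _))(sc(pa k)(\ p -> lem(Q v p)(eqP p s)(S v)
    (\ e b -> ta(co(Q v)(et p s e))(h v b)))))

 exc-remove : ∀ F -> exc(remove Q S s)F ≤ exc Q F + #(tup n k)(\ v -> S v ∧ F v s)
 exc-remove F = tr(sm(tup n k)eh)(re(s3(tup n k)_ _))
  where
  lem : ∀ f q e b -> bit(f ∧ not(q ∧ not(e ∧ b)))≤ bit(f ∧ not q)+ bit e * bit(b ∧ f)
  lem fa q     e     b     = zn
  lem tu  fa e     b     = ss zn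
  lem tu  tu  tu  tu  = rf
  lem tu  tu  tu  fa = rf
  lem tu  tu  fa b     = rf
  eh : ∀ v -> #(pa k)(\ p -> F v p ∧ not(remove Q S s v p))≤ #(pa k)(\ p -> F v p ∧ not(Q v p))+ bit(S v ∧ F v s)
  eh v = tr(sm(pa k)(\ p -> lem(F v p)(Q v p)(eqP p s)(S v)))(re(ta(s3(pa k)_ _)
   (co(#(pa k)(\ p -> F v p ∧ not(Q v p))+_)(sP s(\ p -> bit(S v ∧ F v p))))))

record Cn{n k}(𝒢 : List(Fo n k))(sel : Fo n k -> Bool)(Cs : List(Co k))(Y Z loss : ℕ): Set where
 field
  Q      : Fo n k
  se   : Fo n k -> Bool
  sub    : ∀ F -> se F ≡ tu -> sel F ≡ tu
  my   : # 𝒢 sel ≤ 2 ^ loss * # 𝒢 se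
  few    : ∀{F}-> F ∈ 𝒢 -> se F ≡ tu -> Y * exc Q F ≤ 2 ^ k * n ^ k
  bc : ∀{Γ}-> Γ ∈ Cs -> Z * #(tup n(Co.K Γ))(copies Q Γ)< n ^ Co.K Γ

module _{k}(Cs : List(Co(suc k)))(Y Z : ℕ)where
 maxDensity = sum Cs(\ Γ -> dD Z Y(length(Co.sv Γ)))

 sL : ℕ -> ℕ
 sL n = sum Cs(\ Γ -> dp n k(Co.K Γ)(length(Co.sv Γ)))

 module _{n}(n0 : 1 ≤ n)(𝒢 : List(Fo n(suc k)))(minimal : ∀{F}-> F ∈ 𝒢 -> Mi F)where
  -- As long as a configuration is dense in Q, `drop` yields a dense set of places where most of the
  -- family rarely uses a certain sign pattern, and these signed tuples are deleted from Q. Each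
  -- round deletes a constant proportion of n^k, so `fuel` bounds the rounds; the new exceptions are
  -- at most 1/Y of what was deleted, which the last hypothesis records as a potential.
  iterate : ∀ fuel(Q : Fo n(suc k))(sel : Fo n(suc k)-> Bool)-> 1 ≤ # 𝒢 sel ->
   maxDensity * sx Q ≤ fuel * n ^ suc k ->
   (∀{F}-> F ∈ 𝒢 -> sel F ≡ tu -> Y * exc Q F + sx Q ≤ 2 ^ suc k * n ^ suc k)->
   Cn 𝒢 sel Cs Y Z(fuel * sL n)
  iterate fuel Q sel ne budget inv = dd(bo(ay Cs dense?))
   where
   dense? : Co(suc k)-> Bool
   dense? Γ = le(n ^ Co.K Γ)(Z * #(tup n(Co.K Γ))(copies Q Γ))
   dd : ay Cs dense? ≡ tu ⊎ ay Cs dense? ≡ fa -> Cn 𝒢 sel Cs Y Z(fuel * sL n)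
   dd(i0 e)= record{Q = Q ; se = sel ; sub = \ _ h -> h
    ; my = tr(mm _ 0)(mn(# 𝒢 sel)(m9 2(fuel * sL n)))
    ; few = \ m h -> tr(mm _ _)(inv m h)
    ; bc = \{Γ}Γ∈ -> la(n1(\ t -> te(an{p = dense?}Γ∈ t)e))}
   dd(i1 e)= fo(ae Cs e)
    where
    fo :(∃ \ Γ -> Γ ∈ Cs × dense? Γ ≡ tu)-> Cn 𝒢 sel Cs Y Z(fuel * sL n)
    fo(Γ , Γ∈ , dC)= use(drop Z Y 𝒢 sel(copies Q Γ)sv apart n0 ne(lr dC)
     (\{F}F∈ s -> tr(re(ta(co(td Z Y(length sv)*_)(n3 F∈))(ze(td Z Y(length sv)))))zn))
     where
     open Co Γ
     n3 : ∀{F}-> F ∈ 𝒢 -> #(tup n K)(\ φ -> copies Q Γ φ ∧ a2 sv(has F φ))≡ 0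
     n3{F}F∈ = ta(sc(tup n K)(\ φ -> co bit(n1(\ h -> forbidden(minimal F∈)φ
      (dn φ(ad{di φ}(ad{copies Q Γ φ}h)))(ar{copies Q Γ φ}h)))))
      (ta(sn(tup n K)0)(ze(length(tup n K))))
     use : Rare 𝒢 sel(copies Q Γ)sv Y(dD Z Y(length sv))(dp n k K(length sv))->
      Cn 𝒢 sel Cs Y Z(fuel * sL n)
     use r = next fuel budget
      where
      module R = Rare r
      Q′ = remove Q R.S(sg R.c)
      inQ : ∀ v -> R.S v ≡ tu -> Q v(sg R.c)≡ tu
      inQ v h = let φ , e , a = R.inside v h in
       sb(\ u -> Q u(sg R.c)≡ tu)a(aB{xs = sv}{p = has Q φ}(ar{di φ}e)R.c∈)
      sl = size-remove Q R.S(sg R.c)inQ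
      gain : maxDensity * sx Q′ + n ^ suc k ≤ maxDensity * sx Q
      gain = begin
       maxDensity * sx Q′ + n ^ suc k ≤⟨ m2 _(tr R.d6(mn(#(tup n(suc k))R.S)(s4(\ Γ -> dD Z Y(length(Co.sv Γ)))Γ∈)))⟩
       maxDensity * sx Q′ + maxDensity * #(tup n(suc k))R.S ≡⟨ sym(d0 maxDensity(sx Q′)_)⟩
       maxDensity *(sx Q′ + #(tup n(suc k))R.S)≡⟨ co(maxDensity *_)sl ⟩
       maxDensity * sx Q ∎
       where open Re
      inv′ : ∀{F}-> F ∈ 𝒢 -> R.se F ≡ tu -> Y * exc Q′ F + sx Q′ ≤ 2 ^ suc k * n ^ suc k
      inv′{F}F∈ s = begin
       Y * exc Q′ F + sx Q′ ≤⟨ m4(sx Q′)(mo Y(exc-remove Q R.S(sg R.c)F))⟩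
       Y *(exc Q F + u)+ sx Q′ ≡⟨ ri Y(exc Q F)u(sx Q′)⟩
       Y * exc Q F +(sx Q′ + Y * u)≤⟨ m2(Y * exc Q F)(m2(sx Q′)(R.rare F∈ s))⟩
       Y * exc Q F +(sx Q′ + #(tup n(suc k))R.S)≡⟨ co(Y * exc Q F +_)sl ⟩
       Y * exc Q F + sx Q ≤⟨ inv F∈(R.sub F s)⟩
       2 ^ suc k * n ^ suc k ∎
       where
       open Re
       u = #(tup n(suc k))(\ v -> R.S v ∧ F v(sg R.c))
       ri : ∀ a b c d -> a *(b + c)+ d ≡ a * b +(d + a * c)
       ri = so
      next : ∀ fuel -> maxDensity * sx Q ≤ fuel * n ^ suc k -> Cn 𝒢 sel Cs Y Z(fuel * sL n)
      next zero    b = el(il refl(t5(af(suc k)n0)(tr(m5 _ _)(tr gain b))))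
      next(suc f)b = combine(iterate f Q′ R.se(f1(2 ^ dp n k K(length sv))(# 𝒢 R.se)ne R.my)
       (c6(n ^ suc k)_ _(tr gain(tr b(re(+-comm(n ^ suc k)_)))))inv′)
       where
       combine : Cn 𝒢 R.se Cs Y Z(f * sL n)-> Cn 𝒢 sel Cs Y Z(suc f * sL n)
       combine c = record{Q = D.Q ; se = D.se ; sub = \ F h -> R.sub F(D.sub F h)
        ; my = begin
         # 𝒢 sel ≤⟨ R.my ⟩
         2 ^ dp n k K(length sv)* # 𝒢 R.se ≤⟨ m0(m8 2(s4(\ Γ -> dp n k(Co.K Γ)(length(Co.sv Γ)))Γ∈))D.my ⟩
         2 ^ sL n *(2 ^(f * sL n)* # 𝒢 D.se)≡⟨ sym(ac(2 ^ sL n)_ _)⟩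
         2 ^ sL n * 2 ^(f * sL n)* # 𝒢 D.se ≡⟨ co(_* # 𝒢 D.se)(sym(dr 2(sL n)_))⟩
         2 ^(suc f * sL n)* # 𝒢 D.se ∎
        ; few = D.few ; bc = D.bc}
        where
        open Re
        module D = Cn c

  container : ∀ sel -> 1 ≤ # 𝒢 sel -> Cn 𝒢 sel Cs Y Z(maxDensity * 2 ^ suc k * sL n)
  container sel ne = iterate(maxDensity * 2 ^ suc k)(\ _ _ -> tu)sel ne
   (re(ta(co(maxDensity *_)full-size)(sym(ac maxDensity _ _))))
   (\{F}_ _ -> re(ta(cn _+_(ta(co(Y *_)(n3 F))(ze Y))refl)full-size))
   where
   full-size : sx{n}{suc k}(\ _ _ -> tu)≡ 2 ^ suc k * n ^ suc k
   full-size = ta(sc(tup n(suc k))(\ _ -> ta(sym(ln(pa(suc k))))(lh(tu ∷ fa ∷ [])(suc k))))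
    (ta(sn(tup n(suc k))(2 ^ suc k))(ta(co(_* 2 ^ suc k)(lg n(suc k)))(c2(n ^ suc k)_)))
   n3 : ∀ F -> exc{n}{suc k}(\ _ _ -> tu)F ≡ 0
   n3 F = ta(sc(tup n(suc k))(\ v -> ta(sc(pa(suc k))(\ p -> co bit(zr(F v p))))
    (ta(sn(pa(suc k))0)(ze(length(pa(suc k)))))))(ta(sn(tup n(suc k))0)(ze(length(tup n(suc k)))))

-- The loss is of lower order than the number of sets.
aJ : ∀{k}(Cs : List(Co(suc(suc k))))-> ∃ \ L -> ∀ Y Z n -> 1 ≤ n -> sL Cs Y Z n ≤ L * n ^ suc k
aJ{k}Cs = sum Cs unit , \ Y Z n n0 -> tr(sm Cs(eh n n0))(re(sD Cs(n ^ suc k)unit))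
 where
 unit : Co(suc(suc k))-> ℕ
 unit Γ = length(Co.sv Γ)*(1 +(Co.K Γ + Co.K Γ *(suc(suc k)* 2 ^ suc(suc k))))
 eh : ∀ n -> 1 ≤ n -> ∀ Γ -> dp n(suc k)(Co.K Γ)(length(Co.sv Γ))≤ unit Γ * n ^ suc k
 eh n n0 Γ = tr(mo r(m1(af(suc k)n0)(m4 _(mo K n≤))))
  (re(ri r K(n ^ suc k)(suc(suc k))(2 ^ suc(suc k))))
  where
  r = length(Co.sv Γ)
  K = Co.K Γ
  n≤ : n ≤ n ^ suc k
  n≤ = tr(re(sym(it n)))(mo n(af k n0))
  ri : ∀ r K m a b -> r *(m +(K * m + K *(a *(m * b))))≡ r *(1 +(K + K *(a * b)))* m
  ri = so

aS : ∀{A : Set}(xs : List A)a b f ->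
 sum(t0 xs(a + b))f ≡ sum(t0 xs a)(\ u -> sum(t0 xs b)(\ v -> f(u Vec.++ v)))
aS xs zero    b f = sym(ie _)
aS xs(suc a)b f = ta(su xs(a + b)f)(ta
 (sc xs(\ x -> aS xs a b(\ v -> f(x ∷ v))))(sym(su xs a _)))

-- Sparse configurations have sparse bases: a dense base would contain many cubes.
sparse-base : ∀{n k}K₀(E : Vec(Fin n)K₀ -> Bool)(cs : List(Sl(K₀ + K₀)k))(Q : Fo n k)Z Z′ ->
 (∀ φ ψ -> cube E φ ψ ≡ tu -> a2 cs(has Q(φ Vec.++ ψ))≡ tu)->
 2 * cb K₀ Z ≤ Z′ -> 1 ≤ n -> Z′ *((K₀ + K₀)*(K₀ + K₀))≤ n ->
 Z′ * #(tup n(K₀ + K₀))(\ φ -> di φ ∧ a2 cs(has Q φ))< n ^(K₀ + K₀)-> Z * #(tup n K₀)E < n ^ K₀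
sparse-base{n}{k}K₀ E cs Q Z Z′ contain Z≤ n0 big bc = ≰⇒> \ d6 -> il refl(begin-strict
 2 *(U * n)≤⟨ mo 2(mn n(r2(sym(dr n K₀ K₀))(cube-dense n K₀ E Z n0 d6)))⟩
 2 *(cd * cubes * n)≡⟨ rg cd cubes n ⟩
 2 * cd * cubes * n        ≤⟨ mn n(m0 Z≤ sl)⟩
 Z′ *(gd + bad)* n     ≡⟨ rn Z′ gd bad n ⟩
 Z′ * gd * n + Z′ *(n * bad)<⟨ +-mono-<-≤(*-monoˡ-< n{{nn n0}}bc)(mo Z′(ni n(K₀ + K₀)))⟩
 U * n + Z′ *((K₀ + K₀)*(K₀ + K₀)* U)≡⟨ co(U * n +_)(sym(ac Z′ _ U))⟩
 U * n + Z′ *((K₀ + K₀)*(K₀ + K₀))* U ≤⟨ m2(U * n)(mn U big)⟩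
 U * n + n * U             ≡⟨ r4 U n ⟩
 2 *(U * n)∎)
 where
 open Re
 U = n ^(K₀ + K₀)
 cd = cb K₀ Z
 cubes = sum(tup n K₀)(\ φ -> #(tup n K₀)(cube E φ))
 gd = #(tup n(K₀ + K₀))(\ φ -> di φ ∧ a2 cs(has Q φ))
 bad = #(tup n(K₀ + K₀))(\ φ -> not(di φ))
 rg : ∀ a b c -> 2 *(a * b * c)≡ 2 * a * b * c
 rg = so
 rn : ∀ a b c d -> a *(b + c)* d ≡ a * b * d + a *(d * c)
 rn = so
 r4 : ∀ a b -> a * b + b * a ≡ 2 *(a * b)
 r4 = so
 -- A cube with a repeated vertex is not a legal copy. Such tuples are a fraction O(1/n), absorbed
 -- through `big`.
 sl : cubes ≤ gd + bad
 sl = tr(sm(tup n K₀)(\ φ -> sm(tup n K₀)(\ ψ -> one φ ψ)))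
  (re(ta(sym(aS(al n)K₀ K₀ _))(s3(tup n(K₀ + K₀))_ _)))
  where
  one : ∀ φ ψ -> bit(cube E φ ψ)≤ bit(di(φ Vec.++ ψ)∧ a2 cs(has Q(φ Vec.++ ψ)))+ bit(not(di(φ Vec.++ ψ)))
  one φ ψ = lem(cube E φ ψ)(di(φ Vec.++ ψ))(contain φ ψ)
   where
   lem : ∀ a b{c}->(a ≡ tu -> c ≡ tu)-> bit a ≤ bit(b ∧ c)+ bit(not b)
   lem fa b h = zn
   lem tu tu h rewrite h refl = ss zn
   lem tu fa h = ss zn

aH : ∀{K k}(c : Sl K k){x}-> x ∈ aP c -> ∃ \ ε -> x ≡ du c ε
aH{K}c(he refl)= aT K , refl
aH c(th m)with ma(sG c)m
... | t , _ , e = shift c t , e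

dl : ∀{n K k}(Q : Fo n k)(E : Vec(Fin n)K -> Bool)(c : Sl K k)->
 (∀ φ -> E φ ≡ tu -> has Q φ c ≡ tu)-> ∀ φ ψ -> cube E φ ψ ≡ tu -> ∀ ε -> has Q(φ Vec.++ ψ)(du c ε)≡ tu
dl Q E c h φ ψ cu ε = ta(co(\ v -> Q v(sg c))(aN c ε φ ψ))(h _(cU E φ ψ cu ε))

p3 : ∀{n k}-> Fo n k ->(p q : Vec Bool k)-> Vec(Fin n)k -> Bool
p3 Q p q v = Q v p ∧ Q v q

t3 : ∀{n k}-> Fo n k ->(i j : Fin k)(p q r : Vec Bool k)-> Vec(Fin n)(suc k)-> Bool
t3 Q i j p q r(z ∷ v)= Q(v [ j ]≔ z)p ∧ Q(v [ i ]≔ z)q ∧ Q v r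

-- All that the Turán and stability arguments need to know about a container.
record Sa{n k}(Q : Fo n k)(Z : ℕ): Set where
 field
  pf : ∀ p q i j -> i ≢ j -> eqB(lo p i)(lo q i)≡ fa -> eqB(lo p j)(lo q j)≡ fa ->
   Z * #(tup n k)(p3 Q p q)< n ^ k
  tf : ∀ i j p q r -> i ≢ j -> eqB(lo q j)(lo r j)≡ fa ->
   Z * #(tup n(suc k))(t3 Q i j p q r)< n ^ suc k

at-id : ∀{n k}(p : Vec Bool k)(v : Vec(Fin n)k)-> at(i2 p)v ≡ v
at-id p v = ta(Vec.map-cong(\ _ -> refl)(Vec.allFin _))(Vec.map-lookup-allFin v)

at-keep : ∀{n k}(p : Vec Bool k)z(v : Vec(Fin n)k)-> at(keepSlot p)(z ∷ v)≡ v
at-keep p z v = ta(sym(Vec.tabulate-∘(lo(z ∷ v))suc))(Vec.tabulate∘lookup v)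

at-replace : ∀{n k}i(p : Vec Bool k)z(v : Vec(Fin n)k)-> at(ra i p)(z ∷ v)≡ v [ i ]≔ z
at-replace i p z v = ta(Vec.map-[]≔(lo(z ∷ v))(tb suc)i)(co(_[ i ]≔ z)(at-keep p z v))

module _{n k}(Q : Fo n k)where
 pair-contain : ∀ p q i j a b c φ ψ -> cube(p3 Q p q)φ ψ ≡ tu ->
  a2(Co.sv(pC p q i j a b c))(has Q(φ Vec.++ ψ))≡ tu
 pair-contain p q i j a b c φ ψ cu = a0(Co.sv(pC p q i j a b c))(\ m -> ce(∈-++⁻(aP(i2 p))m))
  where
  ce : ∀{x}-> x ∈ aP(i2 p)⊎ x ∈ du(i2 q)(zW eqB p q)∷ [] -> has Q(φ Vec.++ ψ)x ≡ tu
  ce(i1 m)with aH(i2 p)m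
  ... | ε , refl = dl Q(p3 Q p q)(i2 p)(\ v h -> ta(co(\ u -> Q u p)(at-id p v))(ad h))φ ψ cu ε
  ce(i0(he refl))= dl Q(p3 Q p q)(i2 q)(\ v h -> ta(co(\ u -> Q u q)(at-id q v))(ar{Q v p}h))φ ψ cu(zW eqB p q)

 t8 : ∀ i j p q r a b φ ψ -> cube(t3 Q i j p q r)φ ψ ≡ tu ->
  a2(Co.sv(ti i j p q r a b))(has Q(φ Vec.++ ψ))≡ tu
 t8 i j p q r a b φ ψ cu = a0 cs(\ m -> ce(∈-++⁻(aP(ra j p))m))
  where
  cs = Co.sv(ti i j p q r a b)
  T = t3 Q i j p q r
  in₁ : ∀ u -> T u ≡ tu -> has Q u(ra j p)≡ tu
  in₁(z ∷ v)h = ta(co(\ u -> Q u p)(at-replace j p z v))(ad h)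
  in₂ : ∀ u -> T u ≡ tu -> has Q u(ra i q)≡ tu
  in₂(z ∷ v)h = ta(co(\ u -> Q u q)(at-replace i q z v))(ad(ar{Q(v [ j ]≔ z)p}h))
  in₃ : ∀ u -> T u ≡ tu -> has Q u(keepSlot r)≡ tu
  in₃(z ∷ v)h = ta(co(\ u -> Q u r)(at-keep r z v))(ar{Q(v [ i ]≔ z)q}(ar{Q(v [ j ]≔ z)p}h))
  ce : ∀{x}-> x ∈ aP(ra j p)⊎ x ∈ _ -> has Q(φ Vec.++ ψ)x ≡ tu
  ce(i1 m)with aH(ra j p)m
  ... | ε , refl = dl Q T(ra j p)in₁ φ ψ cu ε
  ce(i0(he refl))= dl Q T(ra i q)in₂ φ ψ cu(eqB(lo p j)(lo q i)∷(zW eqB p q [ j ]≔ tu))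
  ce(i0(th(he refl)))= dl Q T(keepSlot r)in₃ φ ψ cu(tu ∷(zW eqB p r [ j ]≔ tu))

pairGuard : ∀{k}(p q : Vec Bool k)i j -> Dec(i ≡ j)-> Dec(eqB(lo p i)(lo q i)≡ fa)->
 Dec(eqB(lo p j)(lo q j)≡ fa)-> List(Co k)
pairGuard p q i j(no a)(yes b)(yes c)= pC p q i j a b c ∷ []
pairGuard p q i j _      _       _       = []

pairList : ∀ k -> List(Co k)
pairList k = cP(\ p -> cP(\ q -> cP(\ i -> cP(\ j -> pairGuard p q i j(i Fin.≟ j)
 (eqB(lo p i)(lo q i)Bool.≟ fa)(eqB(lo p j)(lo q j)Bool.≟ fa))(al k))(al k))(pa k))(pa k)

tg : ∀{k}i j(p q r : Vec Bool k)-> Dec(i ≡ j)-> Dec(eqB(lo q j)(lo r j)≡ fa)-> List(Co k)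
tg i j p q r(no a)(yes b)= ti i j p q r a b ∷ []
tg i j p q r _      _       = []

triangleList : ∀ k -> List(Co k)
triangleList k = cP(\ p -> cP(\ q -> cP(\ r -> cP(\ i -> cP(\ j -> tg i j p q r(i Fin.≟ j)
 (eqB(lo q j)(lo r j)Bool.≟ fa))(al k))(al k))(pa k))(pa k))(pa k)

cM : ∀{A B : Set}(f : A -> List B){xs x y}-> x ∈ xs -> y ∈ f x -> y ∈ cP f xs
cM f{x ∷ xs}(he refl)m = ax m
cM f{x ∷ xs}(th p)m = ah(f x)(cM f p m)

∈-pairList : ∀{k}(p q : Vec Bool k)i j -> i ≢ j -> eqB(lo p i)(lo q i)≡ fa -> eqB(lo p j)(lo q j)≡ fa ->
 ∃ \ a -> ∃ \ b -> ∃ \ c -> pC p q i j a b c ∈ pairList k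
∈-pairList{k}p q i j a b c = let a′ , b′ , c′ , m = gu(i Fin.≟ j)(eqB(lo p i)(lo q i)Bool.≟ fa)(eqB(lo p j)(lo q j)Bool.≟ fa)in
 a′ , b′ , c′ , cM _(pt p)(cM _(pt q)(cM _(aF i)(cM _(aF j)m)))
 where
 gu : ∀ d₁ d₂ d₃ -> ∃ \ a -> ∃ \ b -> ∃ \ c -> pC p q i j a b c ∈ pairGuard p q i j d₁ d₂ d₃
 gu(yes z)_ _ = el(a z)
 gu(no _)(no z)_ = el(z b)
 gu(no _)(yes _)(no z)= el(z c)
 gu(no a′)(yes b′)(yes c′)= a′ , b′ , c′ , he refl

tL : ∀{k}(i j : Fin k)p q r -> i ≢ j -> eqB(lo q j)(lo r j)≡ fa ->
 ∃ \ a -> ∃ \ b -> ti i j p q r a b ∈ triangleList k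
tL{k}i j p q r a b = let a′ , b′ , m = gu(i Fin.≟ j)(eqB(lo q j)(lo r j)Bool.≟ fa)in
 a′ , b′ , cM _(pt p)(cM _(pt q)(cM _(pt r)(cM _(aF i)(cM _(aF j)m))))
 where
 gu : ∀ d₁ d₂ -> ∃ \ a -> ∃ \ b -> ti i j p q r a b ∈ tg i j p q r d₁ d₂
 gu(yes z)_ = el(a z)
 gu(no _)(no z)= el(z b)
 gu(no a′)(yes b′)= a′ , b′ , he refl

record Sp{n k}(𝒢 : List(Fo n k))(sel : Fo n k -> Bool)(Y Z loss : ℕ): Set where
 field
  Q      : Fo n k
  se   : Fo n k -> Bool
  sub    : ∀ F -> se F ≡ tu -> sel F ≡ tu
  my   : # 𝒢 sel ≤ 2 ^ loss * # 𝒢 se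
  few    : ∀{F}-> F ∈ 𝒢 -> se F ≡ tu -> Y * exc Q F ≤ 2 ^ k * n ^ k
  bc : Sa Q Z

-- The loss exponent is one below the clause width, because each round of the container argument
-- only fixes the clauses through boundedly many vertices.
sF : ∀ k Y Z -> ∃ \ L -> ∃ \ N -> ∀ n -> N ≤ n ->(𝒢 : List(Fo n(suc(suc k))))->(∀{F}-> F ∈ 𝒢 -> Mi F)->
 ∀ sel -> 1 ≤ # 𝒢 sel -> Sp 𝒢 sel Y Z(L * n ^ suc k)
sF k Y Z = L , N , main
 where
 k₂ = suc(suc k)
 Cs = pairList k₂ ++ triangleList k₂
 Z′ = 2 * cb k₂ Z + 2 * cb(suc k₂)Z
 L₁ = po(aJ Cs)
 L = maxDensity Cs Y Z′ * 2 ^ k₂ * L₁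
 N = suc(Z′ *((k₂ + k₂)*(k₂ + k₂))+ Z′ *((suc k₂ + suc k₂)*(suc k₂ + suc k₂)))
 main : ∀ n -> N ≤ n ->(𝒢 : List(Fo n k₂))->(∀{F}-> F ∈ 𝒢 -> Mi F)-> ∀ sel -> 1 ≤ # 𝒢 sel -> Sp 𝒢 sel Y Z(L * n ^ suc k)
 main n N≤n 𝒢 minimal sel ne = use(container Cs Y Z′ n0 𝒢 minimal sel ne)
  where
  n0 = tr(ss zn)N≤n
  use : Cn 𝒢 sel Cs Y Z′(maxDensity Cs Y Z′ * 2 ^ k₂ * sL Cs Y Z′ n)-> Sp 𝒢 sel Y Z(L * n ^ suc k)
  use c = record{Q = Q ; se = se ; sub = sub
   ; my = tr my(mn(# 𝒢 se)(m8 2(tr(mo(maxDensity Cs Y Z′ * 2 ^ k₂)(p0(aJ Cs)Y Z′ n n0))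
    (re(sym(ac(maxDensity Cs Y Z′ * 2 ^ k₂)L₁(n ^ suc k)))))))
   ; few = few
   ; bc = record
    {pf = \ p q i j a b c -> let a′ , b′ , c′ , m = ∈-pairList p q i j a b c in
     sparse-base k₂(p3 Q p q)(Co.sv(pC p q i j a′ b′ c′))Q Z Z′(pair-contain Q p q i j a′ b′ c′)(mm(2 * cb k₂ Z)_)n0
      (tr(tr(mm _ _)(n2 _))N≤n)(bc(ax m))
    ; tf = \ i j p q r a b -> let a′ , b′ , m = tL i j p q r a b in
     sparse-base(suc k₂)(t3 Q i j p q r)(Co.sv(ti i j p q r a′ b′))Q Z Z′(t8 Q i j p q r a′ b′)(m5 _(2 * cb k₂ Z))n0
      (tr(tr(m5 _(Z′ *((k₂ + k₂)*(k₂ + k₂))))(n2 _))N≤n)(bc(ah(pairList k₂)m))}}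
   where open Cn c

-- Reordering of tuples and symmetric containers

infixl 8 _⊙_
_⊙_ : ∀{A : Set}{k l}-> Vec A k -> Vec(Fin k)l -> Vec A l
v ⊙ π = Vc(lo v)π

lu : ∀{A : Set}{k l}(v : Vec A k)(π : Vec(Fin k)l)i -> lo(v ⊙ π)i ≡ lo v(lo π i)
lu v π i = Vm i(lo v)π

⊙-assoc : ∀{A : Set}{k l m}(v : Vec A k)(ρ : Vec(Fin k)l)(π : Vec(Fin l)m)-> v ⊙ ρ ⊙ π ≡ v ⊙(ρ ⊙ π)
⊙-assoc v ρ π = ta(Vec.map-cong(lu v ρ)π)(Vec.map-∘(lo v)(lo ρ)π)

d1 : ∀{A : Set}{k l}(v : Vec A k)(π : Vec(Fin k)l)-> Ds v -> Ds π -> Ds(v ⊙ π)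
d1 v π dv dπ i j e = dπ i j(dv _ _(ta(sym(lu v π i))(ta e(lu v π j))))

lx : ∀{A : Set}{k}{u v : Vec A k}->(∀ i -> lo u i ≡ lo v i)-> u ≡ v
lx{u = u}{v}h = ta(sym(Vec.tabulate∘lookup u))(ta(Vec.tabulate-cong h)(Vec.tabulate∘lookup v))

sum-⊙ : ∀{A : Set}(xs : List A){k}(π : Vec(Fin k)k)-> Ds π -> 1 ≤ length xs -> ∀ f ->
 sum(t0 xs k)(\ v -> f(v ⊙ π))≡ sum(t0 xs k)f
sum-⊙ xs{k}π d ne f = *-cancelˡ-≡ _ _(length xs ^ k){{nn(af k ne)}}(ta
 (sym(sT xs π(\ v -> f(v ⊙ π))))(ta
 (sc(t0 xs k)(\ ψ -> sc(t0 xs k)(\ v -> co f(ui ψ π v d))))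
 (ta(sn(t0 xs k)_)(co(_* sum(t0 xs k)f)(lh xs k)))))

-- The intersection of all reorderings of Q. Formulas are closed under reordering, so a clause
-- outside the closure is, after some reordering, outside Q; the exceptions grow by at most the
-- factor k^k.
sy : ∀{n k}-> Fo n k -> Fo n k
sy{n}{k}Q v p = a2(tup k k)(\ π -> not(di π)∨ Q(v ⊙ π)(p ⊙ π))

Sy : ∀{n k}-> Fo n k -> Set
Sy{n}{k}Q = ∀ v p(π : Vec(Fin k)k)-> Ds π -> Q v p ≡ tu -> Q(v ⊙ π)(p ⊙ π)≡ tu

module _{n k}(Q : Fo n k)where
 closure-elim : ∀{v p}-> sy Q v p ≡ tu -> ∀ π -> Ds π -> Q(v ⊙ π)(p ⊙ π)≡ tu
 closure-elim{v}{p}h π d = strip(dc π d)(aB{xs = tup k k}{p = \ π -> not(di π)∨ Q(v ⊙ π)(p ⊙ π)}h(t1 π))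
  where
  strip : ∀{a b}-> a ≡ tu -> not a ∨ b ≡ tu -> b ≡ tu
  strip refl h = h

 cD : ∀ v p -> sy Q v p ≡ tu -> Q v p ≡ tu
 cD v p h = subst₂(\ v p -> Q v p ≡ tu)(Vec.map-lookup-allFin v)(Vec.map-lookup-allFin p)
  (closure-elim{v}{p}h(Vec.allFin k)(Sl.inj(i2 p)))

 closure-sym : Sy(sy Q)
 closure-sym v p ρ dρ h = a0(tup k k)(\{π}_ -> ce(di π)refl)
  where
  ce : ∀{π}b -> di π ≡ b -> not b ∨ Q(v ⊙ ρ ⊙ π)(p ⊙ ρ ⊙ π)≡ tu
  ce fa e = refl
  ce{π}tu e = subst₂(\ v p -> Q v p ≡ tu)(sym(⊙-assoc v ρ π))(sym(⊙-assoc p ρ π))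
   (closure-elim{v}{p}h(ρ ⊙ π)(d1 ρ π dρ(dn π e)))

 exc-closure : 1 ≤ n -> ∀{F}-> Mi F -> exc(sy Q)F ≤ k ^ k * exc Q F
 exc-closure n0{F}M = begin
  exc(sy Q)F ≤⟨ sm(tup n k)(\ v -> tr(m6(pa k)(one v))(aq(pa k)(tup k k)(\ p π -> di π ∧ bad(v ⊙ π)(p ⊙ π))))⟩
  sum(tup n k)(\ v -> sum(tup k k)(\ π -> #(pa k)(\ p -> di π ∧ bad(v ⊙ π)(p ⊙ π))))≡⟨ s1(tup n k)(tup k k)_ ⟩
  sum(tup k k)(\ π -> sum(tup n k)(\ v -> #(pa k)(\ p -> di π ∧ bad(v ⊙ π)(p ⊙ π))))≤⟨ s2(tup k k)(exc Q F)(\ π -> eh π(di π)refl)⟩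
  length(tup k k)* exc Q F ≡⟨ co(_* exc Q F)(lg k k)⟩
  k ^ k * exc Q F ∎
  where
  open Re
  bad : Fo n k
  bad v p = F v p ∧ not(Q v p)
  eh : ∀ π b -> di π ≡ b -> sum(tup n k)(\ v -> #(pa k)(\ p -> b ∧ bad(v ⊙ π)(p ⊙ π)))≤ exc Q F
  eh π fa e = tr(re(ta(sc(tup n k)(\ v -> ta(sn(pa k)0)(ze(length(pa k)))))
   (ta(sn(tup n k)0)(ze(length(tup n k))))))zn
  eh π tu e = re(ta(sc(tup n k)(\ v -> sum-⊙(tu ∷ fa ∷ [])π(dn π e)(ss zn)(\ p -> bit(bad(v ⊙ π)p))))
   (sum-⊙(al n)π(dn π e)(rp(sym(lf n))n0)(\ v -> #(pa k)(bad v))))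
  one : ∀ v p -> F v p ∧ not(sy Q v p)≡ tu -> ay(tup k k)(\ π -> di π ∧ bad(v ⊙ π)(p ⊙ π))≡ tu
  one v p h = fix(bo(ay(tup k k)(\ π -> di π ∧ bad(v ⊙ π)(p ⊙ π))))
   where
   fv = ad{F v p}h
   A = ay(tup k k)(\ π -> di π ∧ bad(v ⊙ π)(p ⊙ π))
   fix : A ≡ tu ⊎ A ≡ fa -> A ≡ tu
   fix(i1 e)= e
   fix(i0 e)= el(te(a0(tup k k)(\{π}m -> ce π(di π)refl m))(nt(ar{F v p}h)))
    where
    ce : ∀ π d -> di π ≡ d -> π ∈ tup k k -> not d ∨ Q(v ⊙ π)(p ⊙ π)≡ tu
    ce π fa dπ m = refl
    ce π tu  dπ m = n1(\ q -> te(an{p = \ π -> di π ∧ bad(v ⊙ π)(p ⊙ π)}m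
     (ai dπ(ai(Mi.perm M v p(v ⊙ π)(p ⊙ π)fv(d1 v π(Mi.dist M v p fv)(dn π dπ))
      (\ i -> lo π i , lu v π i , lu p π i))(na q))))e)

 aK : ∀{Z}-> Sa Q Z -> Sa(sy Q)Z
 aK{Z}sp = record
  {pf = \ p q i j a b c -> ≤-<-trans(mo Z(m6(tup n k)(\ v h -> ai(cD v p(ad h))(cD v q(ar{sy Q v p}h)))))
   (Sa.pf sp p q i j a b c)
  ; tf = \ i j p q r a b -> ≤-<-trans(mo Z(m6(tup n(suc k))(\{(z ∷ v)h -> ai(cD _ p(ad h))
   (ai(cD _ q(ad(ar{sy Q(v [ j ]≔ z)p}h)))(cD v r(ar{sy Q(v [ i ]≔ z)q}(ar{sy Q(v [ j ]≔ z)p}h))))})))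
   (Sa.tf sp i j p q r a b)}

sw : ∀{k}-> Fin k -> Fin k -> Vec(Fin k)k
sw i j = Vec.allFin _ [ i ]≔ j [ j ]≔ i

lw : ∀{k}(i j t : Fin k)->(t ≡ j × lo(sw i j)t ≡ i)⊎(t ≡ i × t ≢ j × lo(sw i j)t ≡ j)⊎(t ≢ i × t ≢ j × lo(sw i j)t ≡ t)
lw{k}i j t with t Fin.≟ j | t Fin.≟ i
... | yes refl | _ = i1(refl , Ve t(Vec.allFin k [ i ]≔ t)i)
... | no a | yes refl = i0(i1(refl , a , ta(Vu a(Vec.allFin k [ t ]≔ j)t)(Ve t(Vec.allFin k)j)))
... | no a | no b = i0(i0(b , a , ta(Vu a(Vec.allFin k [ i ]≔ j)i)(ta(Vu b(Vec.allFin k)j)(Vec.lookup-allFin t))))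

sd : ∀{k}(i j : Fin k)-> Ds(sw i j)
sd i j s t e with lw i j s | lw i j t
... | i1(a , _)| i1(b , _)= ta a(sym b)
... | i1(a , x)| i0(i1(b , c , y))= el(c(ta b(ta(sym x)(ta e y))))
... | i1(a , x)| i0(i0(b , c , y))= el(b(ta(sym y)(ta(sym e)x)))
... | i0(i1(b , c , y))| i1(a , x)= el(c(ta b(ta(sym x)(ta(sym e)y))))
... | i0(i1(a , _))| i0(i1(b , _))= ta a(sym b)
... | i0(i1(a , c , x))| i0(i0(b , d , y))= el(d(ta(sym y)(ta(sym e)x)))
... | i0(i0(b , c , y))| i1(a , x)= el(b(ta(sym y)(ta e x)))
... | i0(i0(b , d , y))| i0(i1(a , c , x))= el(d(ta(sym y)(ta e x)))
... | i0(i0(_ , _ , x))| i0(i0(_ , _ , y))= ta(sym x)(ta e y)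

-- The Turán problem for containers.

fp : ∀{k}-> Fin k -> Vec Bool k -> Vec Bool k
fp j p = p [ j ]≔ not(lo p j)

sK : ∀{A : Set}n(g : Fin n -> A)(f : A -> ℕ)-> sum(List.tabulate g)f ≡ sum(al n)(f ∘ g)
sK zero    g f = refl
sK(suc n)g f = co(f(g zero)+_)(ta(sK n(g ∘ suc)f)(sym(sK n suc(f ∘ g))))

sM : ∀ n(f : Fin(suc n)-> ℕ)-> sum(al(suc n))f ≡ f zero + sum(al n)(f ∘ suc)
sM n f = co(f zero +_)(sK n suc f)

sz : ∀{A : Set}(xs : List A){f : A -> ℕ}->(∀ x -> f x ≡ 0)-> sum xs f ≡ 0
sz xs h = ta(sc xs h)(ta(sn xs 0)(ze(length xs)))

sum-eqF : ∀{n}(i : Fin n)(f : Fin n -> ℕ)-> sum(al n)(\ j -> bit(eqF i j)* f j)≡ f i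
sum-eqF{suc n}zero    f = ta(sM n(\ j -> bit(eqF zero j)* f j))(ta(cn _+_(ie(f zero))(sz(al n)(\ _ -> refl)))(ie _))
sum-eqF{suc n}(suc i)f = ta(sM n(\ j -> bit(eqF(suc i)j)* f j))(ta(sc(al n)(\ j -> co(\ b -> bit b * f(suc j))(sI j)))(sum-eqF i(f ∘ suc)))
 where
 sI : ∀ j -> eqF(suc i)(suc j)≡ eqF i j
 sI j with i Fin.≟ j
 ... | yes _ = refl
 ... | no _  = refl

neq : ∀{n}-> Fin n -> Fin n -> ℕ
neq i j = bit(not(eqF i j))

sum-neq : ∀{n}(i : Fin n)(f : Fin n -> ℕ)-> sum(al n)(\ j -> neq i j * f j)+ f i ≡ sum(al n)f
sum-neq{n}i f = ta(co(sum(al n)(\ j -> neq i j * f j)+_)(sym(sum-eqF i f)))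
 (ta(sym(s3(al n)_ _))(sc(al n)(\ j -> lem(eqF i j)(f j))))
 where
 lem : ∀ b x -> bit(not b)* x + bit b * x ≡ x
 lem tu  x = ie x
 lem fa x = ta(ie(x + 0))(ie x)

sum-neq-const : ∀{m}(i : Fin(suc m))c -> sum(al(suc m))(\ j -> neq i j * c)≡ m * c
sum-neq-const{m}i c = +-cancelʳ-≡ c _ _(ta(sum-neq i(\ _ -> c))(ta(sn(al(suc m))c)
 (ta(co(_* c)(lf(suc m)))(+-comm c(m * c)))))

eqF-sym : ∀{n}(i j : Fin n)-> eqF i j ≡ eqF j i
eqF-sym i j with i Fin.≟ j | j Fin.≟ i
... | yes _ | yes _ = refl
... | no _  | no _  = refl
... | yes e | no h  = el(h(sym e))
... | no h  | yes e = el(h(sym e))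

-- Exchanging the i-th entry of v with the extra vertex is a bijection on the pairs (v , z).
sN : ∀{n k}(i : Fin k)(h : Vec(Fin n)k -> Fin n -> ℕ)->
 sum(tup n k)(\ v -> sum(al n)(h v))≡ sum(tup n k)(\ v -> sum(al n)(\ z -> h(v [ i ]≔ z)(lo v i)))
sN{n}{suc k}zero h = ta(su(al n)k _)(ta(sc(al n)(\ x -> s1(tup n k)(al n)_))
 (ta(s1(al n)(al n)_)(ta(sc(al n)(\ z -> s1(al n)(tup n k)_))(sym(su(al n)k _)))))
sN{n}{suc k}(suc i)h = ta(su(al n)k _)(ta(sc(al n)(\ x -> sN i(\ v -> h(x ∷ v))))
 (sym(su(al n)k _)))

dq : ∀ x y -> 2 *(x * y)≤ x * x + y * y
dq x y with ≤-total x y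
... | i1 h = go x y h
 where
 go : ∀ x y -> x ≤ y -> 2 *(x * y)≤ x * x + y * y
 go x y h with y ∸ x | md h
 ... | d | refl = tr(mm _(d * d))(re(ri x d))
  where
  ri : ∀ x d -> 2 *(x *(x + d))+ d * d ≡ x * x +(x + d)*(x + d)
  ri = so
... | i0 h with x ∸ y | md h
... | d | refl = tr(mm _(d * d))(re(ri y d))
 where
 ri : ∀ y d -> 2 *((y + d)* y)+ d * d ≡(y + d)*(y + d)+ y * y
 ri = so

-- The form a x^2 - c x y + b y^2 has nonpositive discriminant; multiplying by 4a completes the
-- square and reduces it to `dq`.
wa : ∀ a b c x y -> 1 ≤ a -> c * c ≤ 4 *(a * b)-> c *(x * y)≤ a *(x * x)+ b *(y * y)
wa a b c x y 1≤a h = ca(4 * a){{nn(tr 1≤a(mm a _))}}(begin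
 4 * a *(c *(x * y))≡⟨ r1 a c x y ⟩
 2 *((2 * a * x)*(c * y))≤⟨ dq(2 * a * x)(c * y)⟩
 (2 * a * x)*(2 * a * x)+(c * y)*(c * y)≡⟨ r0 a c x y ⟩
 4 *(a * a)*(x * x)+ c * c *(y * y)≤⟨ m2(4 *(a * a)*(x * x))(mn(y * y)h)⟩
 4 *(a * a)*(x * x)+ 4 *(a * b)*(y * y)≡⟨ r3 a b x y ⟩
 4 * a *(a *(x * x)+ b *(y * y))∎)
 where
 open Re
 r1 : ∀ a c x y -> 4 * a *(c *(x * y))≡ 2 *((2 * a * x)*(c * y))
 r1 = so
 r0 : ∀ a c x y ->(2 * a * x)*(2 * a * x)+(c * y)*(c * y)≡ 4 *(a * a)*(x * x)+ c * c *(y * y)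
 r0 = so
 r3 : ∀ a b x y -> 4 *(a * a)*(x * x)+ 4 *(a * b)*(y * y)≡ 4 * a *(a *(x * x)+ b *(y * y))
 r3 = so

-- On a line with d edges and e non-edges, of which s and t are directed along
-- and across the line.
lq : ∀ a b₁ b₂ c0 c5 d e s t -> 1 ≤ a -> c0 * c0 ≤ 4 *(a * b₁)-> c5 * c5 ≤ 4 *(a * b₂)-> s + t ≤ d ->
 (d + e)*(c0 * s + c5 * t)≤ a *((d + e)* e)+(b₁ *(d * s)+ b₂ *(d * t))+ a *((d + e)*(s + t))
lq a b₁ b₂ c0 c5 zero e zero zero 1≤a h0 h1 le₀ = tr(re(z e c0 c5))zn
 where
 z : ∀ e c0 c5 -> e *(c0 * 0 + c5 * 0)≡ 0
 z = so
lq a b₁ b₂ c0 c5 d@(suc _)e s t 1≤a h0 h1 le₀ = ca d(begin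
 d *(n *(c0 * s + c5 * t))≡⟨ r1 d n c0 c5 s t ⟩
 s *(c0 *(n * d))+ t *(c5 *(n * d))≤⟨ m1(mo s(wa a b₁ c0 n d 1≤a h0))(mo t(wa a b₂ c5 n d 1≤a h1))⟩
 s *(a *(n * n)+ b₁ *(d * d))+ t *(a *(n * n)+ b₂ *(d * d))≡⟨ r0 a b₁ b₂ d e s t ⟩
 (s + t)*(a *(n * e))+(a *(n * d)*(s + t)+(b₁ *(d * s)+ b₂ *(d * t))* d)≤⟨ m4 _(mn(a *(n * e))le₀)⟩
 d *(a *(n * e))+(a *(n * d)*(s + t)+(b₁ *(d * s)+ b₂ *(d * t))* d)≡⟨ r3 a b₁ b₂ d e s t ⟩
 d *(a *(n * e)+(b₁ *(d * s)+ b₂ *(d * t))+ a *(n *(s + t)))∎)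
 where
 open Re
 n = d + e
 r1 : ∀ d n c0 c5 s t -> d *(n *(c0 * s + c5 * t))≡ s *(c0 *(n * d))+ t *(c5 *(n * d))
 r1 = so
 r0 : ∀ a b₁ b₂ d e s t -> s *(a *((d + e)*(d + e))+ b₁ *(d * d))+ t *(a *((d + e)*(d + e))+ b₂ *(d * d))≡
  (s + t)*(a *((d + e)* e))+(a *((d + e)* d)*(s + t)+(b₁ *(d * s)+ b₂ *(d * t))* d)
 r0 = so
 r3 : ∀ a b₁ b₂ d e s t -> d *(a *((d + e)* e))+(a *((d + e)* d)*(s + t)+(b₁ *(d * s)+ b₂ *(d * t))* d)≡
  d *(a *((d + e)* e)+(b₁ *(d * s)+ b₂ *(d * t))+ a *((d + e)*(s + t)))
 r3 = so

neqB : ∀ a{b}-> b ≡ not a -> not(eqB a b)≡ tu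
neqB tu  refl = refl
neqB fa refl = refl

aD : ∀{A : Set}(xs : List A)-> Unique xs -> ∀ f{e}->(∀{x y}-> f x ≡ tu -> f y ≡ tu -> x ≡ y)->(∀{x}-> f x ≡ tu -> e ≡ tu)-> # xs f ≤ bit e
aD []       _ f h g = zn
aD(x ∷ xs)(a AllPairs.∷ u)f{e}h g with f x in eq
... | fa = aD xs u f h g
... | tu  = re(ta(co suc(n3 xs a))(sym(co bit(g eq))))
 where
 n3 : ∀ ys -> All.All(x ≢_)ys -> # ys f ≡ 0
 n3 []       _ = refl
 n3(y ∷ ys)(b All.∷ bs)with f y in e₂
 ... | tu  = el(b(h eq e₂))
 ... | fa = n3 ys bs

-- The container as a hypergraph: a tuple is an edge if it carries a pattern, and directed at j if
-- it carries two patterns differing just at j. Tuples with two patterns differing in two places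
-- (`mb`) are negligible and kept apart.
module St{n k : ℕ}(Q : Fo n k)where
 ed : Vec(Fin n)k -> Bool
 ed v = ay(pa k)(Q v)

 dA : Fin k -> Vec(Fin n)k -> Bool
 dA j v = ay(pa k)(\ p -> Q v p ∧ Q v(fp j p))

 df : Fin k -> Fin k -> Vec Bool k -> Vec Bool k -> Bool
 df i j p q = not(eqF i j)∧ not(eqB(lo p i)(lo q i))∧ not(eqB(lo p j)(lo q j))

 mb : Vec(Fin n)k -> Bool
 mb v = ay(pa k)\ p -> ay(pa k)\ q -> ay(al k)\ i -> ay(al k)\ j -> df i j p q ∧(Q v p ∧ Q v q)

 dir : Fin k -> Vec(Fin n)k -> Bool
 dir j v = dA j v ∧ not(mb v)

 mr : ∀{v}p q i j -> i ≢ j -> lo q i ≡ not(lo p i)-> lo q j ≡ not(lo p j)->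
  Q v p ≡ tu -> Q v q ≡ tu -> mb v ≡ tu
 mr{v}p q i j i≢j ei ej hp hq = an{p = \ p -> ay(pa k)\ q -> ay(al k)\ i -> ay(al k)\ j -> df i j p q ∧(Q v p ∧ Q v q)}(pt p)
  (an{p = \ q -> ay(al k)\ i -> ay(al k)\ j -> df i j p q ∧(Q v p ∧ Q v q)}(pt q)
  (an{p = \ i -> ay(al k)\ j -> df i j p q ∧(Q v p ∧ Q v q)}(aF i)
  (an{p = \ j -> df i j p q ∧(Q v p ∧ Q v q)}(aF j)(ai(ai(na(n1(\ h -> i≢j(ee h))))(ai(neqB(lo p i)ei)(neqB(lo p j)ej)))(ai hp hq)))))

 opposite : ∀{v}j -> dA j v ≡ tu -> ∀ b -> ∃ \ p -> Q v p ≡ tu × lo p j ≡ not b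
 opposite{v}j h b = use(ae(pa k)h)
  where
  use :(∃ \ p -> p ∈ pa k × Q v p ∧ Q v(fp j p)≡ tu)-> ∃ \ p -> Q v p ≡ tu × lo p j ≡ not b
  use(p , _ , q)= ce(bo(eqB(lo p j)b))
   where
   ce : eqB(lo p j)b ≡ tu ⊎ eqB(lo p j)b ≡ fa -> ∃ \ p -> Q v p ≡ tu × lo p j ≡ not b
   ce(i1 e)= fp j p , ar{Q v p}q , ta(Ve j p _)(co not(eB _ _ e))
   ce(i0 e)= p , ad q , ta(sym(nl _))(co not(sym(ef _ _ e)))

 dir-unique : ∀{v}i j -> dir i v ≡ tu -> dir j v ≡ tu -> i ≡ j
 dir-unique{v}i j hi hj = ce(i Fin.≟ j)
  where
  ce : Dec(i ≡ j)-> i ≡ j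
  ce(yes e)= e
  ce(no i≢j)= el(te(build(ae(pa k)(ad hi)))(nt(ar{dA i v}hi)))
   where
   build :(∃ \ p -> p ∈ pa k × Q v p ∧ Q v(fp i p)≡ tu)-> mb v ≡ tu
   build(p , _ , q)= let r , hr , er = opposite j(ad hj)(lo p j)in p5 r hr er(bo(eqB(lo p i)(lo r i)))
    where
    p5 : ∀ r -> Q v r ≡ tu -> lo r j ≡ not(lo p j)-> eqB(lo p i)(lo r i)≡ tu ⊎ eqB(lo p i)(lo r i)≡ fa -> mb v ≡ tu
    p5 r hr er(i0 e)= mr p r i j i≢j(ef _ _ e)er(ad q)hr
    p5 r hr er(i1 e)= mr(fp i p)r i j i≢j
     (ta(sym(eB _ _ e))(ta(sym(nl _))(co not(sym(Ve i p _)))))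
     (ta er(co not(sym(Vu(\ z -> i≢j(sym z))p _))))(ar{Q v p}q)hr

 dir-edge : ∀{v}j -> dir j v ≡ tu -> ed v ≡ tu
 dir-edge{v}j h = let p , m , q = ae(pa k)(ad h)in an{p = Q v}m(ad q)

 sum-dir : ∀ v -> sum(al k)(\ j -> bit(dir j v))≤ bit(ed v)
 sum-dir v = aD(al k)(Uniq.allFin⁺ k)(\ j -> dir j v)(\{i}{j}-> dir-unique i j)(\{j}-> dir-edge j)

 non de mc : ℕ
 non      = #(tup n k)(\ v -> not(ed v))
 de = sum(al k)(\ j -> #(tup n k)(dir j))
 mc   = #(tup n k)mb

 deg : Fin k -> Vec(Fin n)k -> ℕ
 deg i v = #(al n)(\ z -> ed(v [ i ]≔ z))

 -- The situation excluded by `ti`: v carries both signs at j while v[j := z] and v[i := z] are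
 -- edges. Whatever sign the latter has at its j-th vertex, v carries the opposite one.
 va : Fin k -> Fin k -> Vec(Fin n)k -> Fin n -> Bool
 va i j v z = not(eqF i j)∧(dA j v ∧(ed(v [ j ]≔ z)∧ ed(v [ i ]≔ z)))

 cH : Fin k -> Fin k -> Vec Bool k -> Vec Bool k -> Vec Bool k -> Vec(Fin n)(suc k)-> Bool
 cH i j p q r u =(not(eqF i j)∧ not(eqB(lo q j)(lo r j)))∧ t3 Q i j p q r u

 ch : Fin k -> Fin k -> Vec(Fin n)(suc k)-> Bool
 ch i j u = ay(pa k)(\ p -> ay(pa k)(\ q -> ay(pa k)(\ r -> cH i j p q r u)))

 clash-intro : ∀ i j p q r{z v}-> i ≢ j -> lo r j ≡ not(lo q j)-> Q(v [ j ]≔ z)p ≡ tu -> Q(v [ i ]≔ z)q ≡ tu -> Q v r ≡ tu ->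
  ch i j(z ∷ v)≡ tu
 clash-intro i j p q r{z}{v}i≢j er hp hq hr = an{p = \ p -> ay(pa k)(\ q -> ay(pa k)(\ r -> cH i j p q r(z ∷ v)))}(pt p)
  (an{p = \ q -> ay(pa k)(\ r -> cH i j p q r(z ∷ v))}(pt q)(an{p = \ r -> cH i j p q r(z ∷ v)}(pt r)
  (ai(ai(na(n1(\ h -> i≢j(ee h))))(neqB(lo q j)er))(ai hp(ai hq hr)))))

 vo : ℕ
 vo = sum(al k)\ i -> sum(al k)\ j -> sum(tup n k)\ v -> #(al n)(va i j v)

module _{n k : ℕ}{Q : Fo n k}{Z}(sp : Sa Q Z)where
 open St Q
 p7 : ∀{A : Set}(xs : List A){f g : A -> ℕ}->(∀ x -> Z * f x ≡ g x)-> Z * sum xs f ≡ sum xs g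
 p7 xs{f}h = ta(sym(s0 xs Z f))(sc xs h)

 bu : ∀{A : Set}(xs : List A)m -> length xs ≡ m -> ∀{f c}->(∀ x -> f x ≤ c)-> sum xs f ≤ m * c
 bu xs m refl h = s2 xs _ h

 clash-few : ∀ i j -> Z * #(tup n(suc k))(ch i j)≤ 2 ^ k *(2 ^ k *(2 ^ k * n ^ suc k))
 clash-few i j = begin
  Z * #(tup n(suc k))(ch i j)≤⟨ mo Z(tr(aq(tup n(suc k))(pa k)(\ u p -> ay(pa k)(\ q -> ay(pa k)(\ r -> cH i j p q r u))))
   (sm(pa k)(\ p -> tr(aq(tup n(suc k))(pa k)(\ u q -> ay(pa k)(\ r -> cH i j p q r u)))
   (sm(pa k)(\ q -> aq(tup n(suc k))(pa k)(\ u r -> cH i j p q r u))))))⟩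
  Z * sum(pa k)(\ p -> sum(pa k)(\ q -> sum(pa k)(\ r -> #(tup n(suc k))(cH i j p q r))))
   ≡⟨ p7(pa k)(\ p -> p7(pa k)(\ q -> sym(s0(pa k)Z _)))⟩
  sum(pa k)(\ p -> sum(pa k)(\ q -> sum(pa k)(\ r -> Z * #(tup n(suc k))(cH i j p q r))))
   ≤⟨ bu(pa k)(2 ^ k)len(\ p -> bu(pa k)(2 ^ k)len(\ q -> bu(pa k)(2 ^ k)len(\ r -> one p q r)))⟩
  2 ^ k *(2 ^ k *(2 ^ k * n ^ suc k))∎
  where
  open Re
  len = lh(tu ∷ fa ∷ [])k
  one : ∀ p q r -> Z * #(tup n(suc k))(cH i j p q r)≤ n ^ suc k
  one p q r = guard(not(eqF i j)∧ not(eqB(lo q j)(lo r j)))refl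
   where
   guard : ∀ b -> not(eqF i j)∧ not(eqB(lo q j)(lo r j))≡ b -> Z * #(tup n(suc k))(\ u -> b ∧ t3 Q i j p q r u)≤ n ^ suc k
   guard fa e = tr(re(ta(co(Z *_)(sz(tup n(suc k))(\ _ -> refl)))(ze Z)))zn
   guard tu  e = bf(Sa.tf sp i j p q r(\{refl -> te(eF i)(nt(ad e))})(nt(ar{not(eqF i j)}e)))

 violations-few : Z * vo ≤ k *(k *(2 ^ k *(2 ^ k *(2 ^ k * n ^ suc k))))
 violations-few = tr(mo Z(sm(al k)(\ i -> sm(al k)(\ j -> eh i j))))
  (tr(re(p7(al k)(\ i -> sym(s0(al k)Z _))))
  (bu(al k)k(lf k)(\ i -> bu(al k)k(lf k)(\ j -> clash-few i j))))
  where
  eh : ∀ i j -> sum(tup n k)(\ v -> #(al n)(va i j v))≤ #(tup n(suc k))(ch i j)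
  eh i j = tr(sm(tup n k)(\ v -> m6(al n)(find v)))(re(ta(s1(tup n k)(al n)_)(sym(su(al n)k _))))
   where
   find : ∀ v z -> va i j v z ≡ tu -> ch i j(z ∷ v)≡ tu
   find v z h = build(ae(pa k)(ad{ed(v [ j ]≔ z)}(ar{dA j v}h1)))(ae(pa k)(ar{ed(v [ j ]≔ z)}(ar{dA j v}h1)))
    where
    h1 = ar{not(eqF i j)}h
    build :(∃ \ p -> p ∈ pa k × Q(v [ j ]≔ z)p ≡ tu)->(∃ \ q -> q ∈ pa k × Q(v [ i ]≔ z)q ≡ tu)-> ch i j(z ∷ v)≡ tu
    build(p , p∈ , hp)(q , q∈ , hq)= let r , hr , er = opposite j(ad{dA j v}h1)(lo q j)in
     clash-intro i j p q r(\{refl -> te(eF i)(nt(ad h))})er hp hq hr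

 multis-few : Z * mc ≤ 2 ^ k *(2 ^ k *(k *(k * n ^ k)))
 multis-few = begin
  Z * mc ≤⟨ mo Z(tr(aq(tup n k)(pa k)_)(sm(pa k)(\ p -> tr(aq(tup n k)(pa k)_)
   (sm(pa k)(\ q -> tr(aq(tup n k)(al k)_)(sm(al k)(\ i -> aq(tup n k)(al k)_)))))))⟩
  Z * sum(pa k)(\ p -> sum(pa k)(\ q -> sum(al k)(\ i -> sum(al k)(\ j -> pr p q i j))))
   ≡⟨ p7(pa k)(\ p -> p7(pa k)(\ q -> p7(al k)(\ i -> sym(s0(al k)Z _))))⟩
  sum(pa k)(\ p -> sum(pa k)(\ q -> sum(al k)(\ i -> sum(al k)(\ j -> Z * pr p q i j))))
   ≤⟨ bu(pa k)(2 ^ k)len(\ p -> bu(pa k)(2 ^ k)len(\ q -> bu(al k)k(lf k)(\ i -> bu(al k)k(lf k)(\ j -> one p q i j))))⟩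
  2 ^ k *(2 ^ k *(k *(k * n ^ k)))∎
  where
  open Re
  pr : Vec Bool k -> Vec Bool k -> Fin k -> Fin k -> ℕ
  pr p q i j = #(tup n k)(\ v -> df i j p q ∧(Q v p ∧ Q v q))
  len = lh(tu ∷ fa ∷ [])k
  one : ∀ p q i j -> Z * pr p q i j ≤ n ^ k
  one p q i j = guard(df i j p q)refl
   where
   guard : ∀ b -> df i j p q ≡ b -> Z * #(tup n k)(\ v -> b ∧(Q v p ∧ Q v q))≤ n ^ k
   guard fa e = tr(re(ta(co(Z *_)(sz(tup n k)(\ _ -> refl)))(ze Z)))zn
   guard tu  e = bf(Sa.pf sp p q i j(\{refl -> te(eF i)(nt(ad e))})
    (nt(ad(ar{not(eqF i j)}e)))(nt(ar{not(eqB(lo p i)(lo q i))}(ar{not(eqF i j)}e))))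

module TuranSums{n m : ℕ}(n0 : 1 ≤ n)(Q : Fo n(suc m))where
 open St Q public
 k = suc m
 fs = al k
 ts = tup n k
 zs = al n

 Σ² :(Fin k -> Vec(Fin n)k -> ℕ)-> ℕ
 Σ² f = sum fs(\ i -> sum ts(f i))

 Σ²-+ : ∀ f g -> Σ²(\ i v -> f i v + g i v)≡ Σ² f + Σ² g
 Σ²-+ f g = ta(sc fs(\ i -> s3 ts(f i)(g i)))(s3 fs(\ i -> sum ts(f i))(\ i -> sum ts(g i)))

 aG : ∀ c f -> Σ²(\ i v -> c * f i v)≡ c * Σ² f
 aG c f = ta(sc fs(\ i -> s0 ts c(f i)))(s0 fs c(\ i -> sum ts(f i)))

 S₁ S₂ : ℕ
 S₁ = Σ²(\ i v -> bit(dir i v)* deg i v)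
 S₂ = Σ²(\ i v -> sum fs(\ j -> neq i j *(bit(dir j v)* deg i v)))

 bk : ∀(X : Fin k -> ℕ)-> sum fs(\ i -> sum fs(\ j -> neq i j * X j))≡ m * sum fs X
 bk X = ta(s1 fs fs(\ i j -> neq i j * X j))(ta(sc fs(\ j -> ta(sc fs(\ i -> co(\ b -> bit(not b)* X j)(eqF-sym i j)))(sum-neq-const j(X j))))(s0 fs m X))

 -- A directed edge A → x excludes, for each z and i ∈ A, one of A + z and A - i + x + z.
 tails-and-sides : m * S₁ + S₂ ≤ m *(n * de)+ vo
 tails-and-sides = begin
  m * S₁ + S₂ ≡⟨ co(_+ S₂)(sym(bk(\ j -> sum ts(\ v -> bit(dir j v)* deg j v))))⟩
  sum fs(\ i -> sum fs(\ j -> neq i j * sum ts(\ v -> bit(dir j v)* deg j v)))+ S₂ ≡⟨ sym(s3 fs f₁ f₂)⟩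
  sum fs(\ i -> sum fs(\ j -> neq i j * sum ts(\ v -> bit(dir j v)* deg j v))+ sum ts(\ v -> sum fs(\ j -> neq i j *(bit(dir j v)* deg i v))))
   ≡⟨ sc fs(\ i -> ta(cn _+_(sc fs(\ j -> sym(s0 ts(neq i j)(\ v -> bit(dir j v)* deg j v))))(s1 ts fs(\ v j -> h1 i j v)))(ta(sym(s3 fs(\ j -> sum ts(h0 i j))(\ j -> sum ts(h1 i j))))(sc fs(\ j -> sym(s3 ts(h0 i j)(h1 i j))))))⟩
  sum fs(\ i -> sum fs(\ j -> sum ts(\ v -> neq i j *(bit(dir j v)* deg j v)+ neq i j *(bit(dir j v)* deg i v))))
   ≤⟨ sm fs(\ i -> sm fs(\ j -> sm ts(\ v -> one i j v)))⟩
  sum fs(\ i -> sum fs(\ j -> sum ts(\ v -> neq i j *(n * bit(dir j v))+ # zs(va i j v))))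
   ≡⟨ ta(sc fs(\ i -> ta(sc fs(\ j -> s3 ts(h₃ i j)(h₄ i j)))(s3 fs(\ j -> sum ts(h₃ i j))(\ j -> sum ts(h₄ i j)))))(s3 fs(\ i -> sum fs(\ j -> sum ts(h₃ i j)))(\ i -> sum fs(\ j -> sum ts(h₄ i j))))⟩
  sum fs(\ i -> sum fs(\ j -> sum ts(\ v -> neq i j *(n * bit(dir j v)))))+ vo
   ≡⟨ co(_+ vo)(ta(sc fs(\ i -> sc fs(\ j -> ta(s0 ts(neq i j)(\ v -> n * bit(dir j v)))(co(neq i j *_)(s0 ts n(\ v -> bit(dir j v)))))))(ta(bk(\ j -> n * # ts(dir j)))(co(m *_)(s0 fs n(\ j -> # ts(dir j))))))⟩
  m *(n * de)+ vo ∎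
  where
  open Re
  h0 h1 h₃ h₄ : Fin k -> Fin k -> Vec(Fin n)k -> ℕ
  h0 i j v = neq i j *(bit(dir j v)* deg j v)
  h1 i j v = neq i j *(bit(dir j v)* deg i v)
  h₃ i j v = neq i j *(n * bit(dir j v))
  h₄ i j v = # zs(va i j v)
  f₁ f₂ : Fin k -> ℕ
  f₁ i = sum fs(\ j -> neq i j * sum ts(\ v -> bit(dir j v)* deg j v))
  f₂ i = sum ts(\ v -> sum fs(\ j -> h1 i j v))
  one : ∀ i j v -> neq i j *(bit(dir j v)* deg j v)+ neq i j *(bit(dir j v)* deg i v)≤ neq i j *(n * bit(dir j v))+ # zs(va i j v)
  one i j v = go(eqF i j)(dir j v)refl refl
   where
   go : ∀ a b -> eqF i j ≡ a -> dir j v ≡ b -> bit(not a)*(bit b * deg j v)+ bit(not a)*(bit b * deg i v)≤ bit(not a)*(n * bit b)+ # zs(va i j v)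
   go tu  b e h = zn
   go fa fa e h = zn
   go fa tu e h = begin
    1 *(1 * deg j v)+ 1 *(1 * deg i v)≡⟨ r1(deg j v)(deg i v)⟩
    deg j v + deg i v ≡⟨ sym(s3 zs _ _)⟩
    sum zs(\ z -> bit(ed(v [ j ]≔ z))+ bit(ed(v [ i ]≔ z)))≤⟨ sm zs(\ z -> lem(ed(v [ j ]≔ z))(ed(v [ i ]≔ z))e(ad{dA j v}h))⟩
    sum zs(\ z -> 1 + bit(va i j v z))≡⟨ ta(s3 zs _ _)(co(_+ # zs(va i j v))(ta(sym(ln zs))(lf n)))⟩
    n + # zs(va i j v)≡⟨ co(_+ # zs(va i j v))(r0 n)⟩
    1 *(n * 1)+ # zs(va i j v)∎
    where
    r1 : ∀ a b -> 1 *(1 * a)+ 1 *(1 * b)≡ a + b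
    r1 = so
    r0 : ∀ a -> a ≡ 1 *(a * 1)
    r0 = so
    lem : ∀ a b{c}-> c ≡ fa -> dA j v ≡ tu -> bit a + bit b ≤ 1 + bit(not c ∧(dA j v ∧(a ∧ b)))
    lem tu  tu  refl q rewrite q = rf
    lem tu  fa refl q = ss zn
    lem fa tu  refl q = ss zn
    lem fa fa refl q = zn

 a5 across : Fin k -> Vec(Fin n)k -> ℕ
 a5  i u = # zs(\ z -> dir i(u [ i ]≔ z))
 across i u = sum zs(\ z -> sum fs(\ j -> neq i j * bit(dir j(u [ i ]≔ z))))

 gaps : Fin k -> Vec(Fin n)k -> ℕ
 gaps i u = # zs(\ z -> not(ed(u [ i ]≔ z)))

 deg-update : ∀ i u z -> deg i(u [ i ]≔ z)≡ deg i u
 deg-update i u z = sc zs(\ y -> co(bit ∘ ed)(Vec.[]≔-idempotent u i))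

 l5 : ∀ i(f : Vec(Fin n)k -> ℕ)-> sum ts(\ u -> sum zs(\ z -> f(u [ i ]≔ z)))≡ n * sum ts f
 l5 i f = ta(sh(al n)i f)(co(_* sum ts f)(lf n))

 Σ-gaps : Σ² gaps ≡ k *(n * non)
 Σ-gaps = ta(sc fs(\ i -> l5 i(\ v -> bit(not(ed v)))))(ta(sn fs(n * non))(co(_*(n * non))(lf k)))

 Σ-along : Σ² a5 ≡ n * de
 Σ-along = ta(sc fs(\ i -> l5 i(\ v -> bit(dir i v))))(s0 fs n(\ i -> # ts(dir i)))

 Σ-across : Σ² across ≡ n *(m * de)
 Σ-across = ta(sc fs(\ i -> l5 i(\ v -> sum fs(\ j -> neq i j * bit(dir j v)))))(ta(s0 fs n(\ i -> sum ts(\ v -> sum fs(\ j -> neq i j * bit(dir j v)))))(co(n *_)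
  (ta(sc fs(\ i -> ta(s1 ts fs(\ v j -> neq i j * bit(dir j v)))(sc fs(\ j -> s0 ts(neq i j)(\ v -> bit(dir j v))))))(bk(\ j -> # ts(dir j))))))

 Σ-deg-along : Σ²(\ i u -> deg i u * a5 i u)≡ n * S₁
 Σ-deg-along = ta(sc fs(\ i -> ta(sc ts(\ u -> ta(sym(s0 zs(deg i u)(\ z -> bit(dir i(u [ i ]≔ z)))))
  (sc zs(\ z -> ta(co(_* bit(dir i(u [ i ]≔ z)))(sym(deg-update i u z)))(c2(deg i(u [ i ]≔ z))_)))))(l5 i(\ v -> bit(dir i v)* deg i v))))(s0 fs n(\ i -> sum ts(\ v -> bit(dir i v)* deg i v)))

 Σ-deg-across : Σ²(\ i u -> deg i u * across i u)≡ n * S₂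
 Σ-deg-across = ta(sc fs(\ i -> ta(sc ts(\ u -> ta(sym(s0 zs(deg i u)(\ z -> sum fs(\ j -> neq i j * bit(dir j(u [ i ]≔ z))))))
  (sc zs(\ z -> ta(sym(s0 fs(deg i u)(\ j -> neq i j * bit(dir j(u [ i ]≔ z)))))(sc fs(\ j ->
   ta(ri(deg i u)(neq i j)(bit(dir j(u [ i ]≔ z))))(co(\ d -> neq i j *(bit(dir j(u [ i ]≔ z))* d))(sym(deg-update i u z)))))))))
  (l5 i(\ v -> sum fs(\ j -> neq i j *(bit(dir j v)* deg i v))))))(s0 fs n(\ i -> sum ts(\ v -> sum fs(\ j -> neq i j *(bit(dir j v)* deg i v)))))
  where
  ri : ∀ a b c -> a *(b * c)≡ b *(c * a)
  ri = so

 deg-gaps : ∀ i u -> deg i u + gaps i u ≡ n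
 deg-gaps i u = ta(sym(s3 zs _ _))(ta(sc zs(\ z -> lem(ed(u [ i ]≔ z))))(ta(sym(ln zs))(lf n)))
  where
  lem : ∀ b -> bit b + bit(not b)≡ 1
  lem tu  = refl
  lem fa = refl

 along-across : ∀ i u -> a5 i u + across i u ≤ deg i u
 along-across i u = tr(re(sym(s3 zs _ _)))(sm zs(\ z -> tr
  (re(ta(+-comm(bit(dir i(u [ i ]≔ z)))_)(sum-neq i(\ j -> bit(dir j(u [ i ]≔ z))))))(sum-dir(u [ i ]≔ z))))

 -- `lq` summed over all lines, a line varying one entry. The value of τ is 1 for small k, where
 -- directions along and across the line both enter, and 0 for large k, where only those along it
 -- do.
 line-sum : ∀ τ a b₁ b₂ c0 c5 -> τ ≤ 1 -> 1 ≤ a -> c0 * c0 ≤ 4 *(a * b₁)-> c5 * c5 ≤ 4 *(a * b₂)->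
  n *(c0 * de + c5 *(τ *(m * de)))≤ a *(n *(k * non))+(b₁ * S₁ + b₂ *(τ * S₂))+ a *(n *(de + τ *(m * de)))
 line-sum τ a b₁ b₂ c0 c5 τ≤1 1≤a h0 h1 = ca n{{nn n0}}(begin
  n *(n *(c0 * de + c5 *(τ *(m * de))))≡⟨ r1 n c0 c5 de(τ *(m * de))⟩
  n *(c0 *(n * de)+ c5 *(n *(τ *(m * de))))≡⟨ sym lhs ⟩
  Σ²(\ i u -> n *(c0 * a5 i u + c5 * X i u))≤⟨ sm fs(\ i -> sm ts(\ u -> eh i u))⟩
  Σ²(\ i u -> a *(n * gaps i u)+(b₁ *(deg i u * a5 i u)+ b₂ *(deg i u * X i u))+ a *(n *(a5 i u + X i u)))≡⟨ rhs ⟩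
  a *(n *(k *(n * non)))+(b₁ *(n * S₁)+ b₂ *(n *(τ * S₂)))+ a *(n *(n * de + n *(τ *(m * de))))≡⟨ r0 n a b₁ b₂(k * non)S₁(τ * S₂)de(τ *(m * de))k non ⟩
  n *(a *(n *(k * non))+(b₁ * S₁ + b₂ *(τ * S₂))+ a *(n *(de + τ *(m * de))))∎)
  where
  open Re
  X : Fin k -> Vec(Fin n)k -> ℕ
  X i u = τ * across i u
  swap : ∀ a b c -> a *(b * c)≡ b *(a * c)
  swap = so
  ΣX : Σ² X ≡ n *(τ *(m * de))
  ΣX = ta(aG τ across)(ta(co(τ *_)Σ-across)(swap τ n _))
  ΣdX : Σ²(\ i u -> deg i u * X i u)≡ n *(τ * S₂)
  ΣdX = ta(sc fs(\ i -> sc ts(\ u -> swap(deg i u)τ _)))(ta(aG τ(\ i u -> deg i u * across i u))(ta(co(τ *_)Σ-deg-across)(swap τ n _)))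
  r1 : ∀ n a b x y -> n *(n *(a * x + b * y))≡ n *(a *(n * x)+ b *(n * y))
  r1 = so
  r0 : ∀ n a b c w x y z t k l -> a *(n *(k *(n * l)))+(b *(n * x)+ c *(n * y))+ a *(n *(n * z + n * t))≡
   n *(a *(n *(k * l))+(b * x + c * y)+ a *(n *(z + t)))
  r0 = so
  lhs : Σ²(\ i u -> n *(c0 * a5 i u + c5 * X i u))≡ n *(c0 *(n * de)+ c5 *(n *(τ *(m * de))))
  lhs = ta(aG n(\ i u -> c0 * a5 i u + c5 * X i u))(co(n *_)(ta(Σ²-+(\ i u -> c0 * a5 i u)(\ i u -> c5 * X i u))(cn _+_(ta(aG c0 a5)(co(c0 *_)Σ-along))(ta(aG c5 X)(co(c5 *_)ΣX)))))
  rhs : Σ²(\ i u -> a *(n * gaps i u)+(b₁ *(deg i u * a5 i u)+ b₂ *(deg i u * X i u))+ a *(n *(a5 i u + X i u)))≡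
   a *(n *(k *(n * non)))+(b₁ *(n * S₁)+ b₂ *(n *(τ * S₂)))+ a *(n *(n * de + n *(τ *(m * de))))
  ds dt : Fin k -> Vec(Fin n)k -> ℕ
  ds i u = deg i u * a5 i u
  dt i u = deg i u * X i u
  rhs = ta(Σ²-+(\ i u -> a *(n * gaps i u)+(b₁ * ds i u + b₂ * dt i u))(\ i u -> a *(n *(a5 i u + X i u))))(cn _+_
   (ta(Σ²-+(\ i u -> a *(n * gaps i u))(\ i u -> b₁ * ds i u + b₂ * dt i u))(cn _+_
    (ta(aG a(\ i u -> n * gaps i u))(co(a *_)(ta(aG n gaps)(co(n *_)Σ-gaps))))
    (ta(Σ²-+(\ i u -> b₁ * ds i u)(\ i u -> b₂ * dt i u))(cn _+_(ta(aG b₁ ds)(co(b₁ *_)Σ-deg-along))(ta(aG b₂ dt)(co(b₂ *_)ΣdX))))))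
   (ta(aG a(\ i u -> n *(a5 i u + X i u)))(co(a *_)(ta(aG n(\ i u -> a5 i u + X i u))(co(n *_)(ta(Σ²-+ a5 X)(cn _+_ Σ-along ΣX)))))))
  eh : ∀ i u -> n *(c0 * a5 i u + c5 * X i u)≤ a *(n * gaps i u)+(b₁ *(deg i u * a5 i u)+ b₂ *(deg i u * X i u))+ a *(n *(a5 i u + X i u))
  eh i u = sb(\ N -> N *(c0 * a5 i u + c5 * X i u)≤ a *(N * gaps i u)+(b₁ *(deg i u * a5 i u)+ b₂ *(deg i u * X i u))+ a *(N *(a5 i u + X i u)))
   (deg-gaps i u)(lq a b₁ b₂ c0 c5(deg i u)(gaps i u)(a5 i u)(X i u)1≤a h0 h1(tr(m2(a5 i u)(tr(mn(across i u)τ≤1)(re(ii _))))(along-across i u)))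

 -- With b₁ = m A^2 and b₂ = A^2 the quadratic terms of `line-sum` become A^2 (m S₁ + S₂), exactly
 -- what `tails-and-sides` bounds. The parameter A/q remains to be optimised, and `cond` is the
 -- resulting numerical requirement.
 small-turan : ∀ q A B -> 1 ≤ q -> B * B ≤ m *(A * A)->
  61 *(q * q * k)+ 100 *(q * q * k + m *(A * A))≤ 100 *(2 * q *(B + m * A))->
  61 *(n * de)≤ 100 *(n * non)+ 100 *(A * A)* vo
 small-turan q A B 1≤q hB cond = ca(q * q * k){{nn(m0(m0 1≤q 1≤q)(ss zn))}}(begin
  q * q * k *(61 * nD)≡⟨ ring₀(q * q * k)nD ⟩
  61 *(q * q * k)* nD ≤⟨ c6(100 *(q * q * k + m *(A * A))* nD)_ _(begin
   61 *(q * q * k)* nD + 100 *(q * q * k + m *(A * A))* nD ≡⟨ sym(*-distribʳ-+ nD(61 *(q * q * k))_)⟩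
   (61 *(q * q * k)+ 100 *(q * q * k + m *(A * A)))* nD ≤⟨ mn nD cond ⟩
   100 *(2 * q *(B + m * A))* nD ≡⟨ rg q B m A n de ⟩
   100 *(n *(2 * q * B * de + 2 * q * A *(1 *(m * de))))≤⟨ mo 100(line-sum 1(q * q)(m *(A * A))(A * A)(2 * q * B)(2 * q * A)rf(m0 1≤q 1≤q)
    (tr(re(sq q B))(tr(mo(4 *(q * q))hB)(re(assoc q(m *(A * A))))))(re(sq′ q A)))⟩
   100 *(q * q *(n *(k * non))+(m *(A * A)* S₁ + A * A *(1 * S₂))+ q * q *(n *(de + 1 *(m * de))))
    ≤⟨ mo 100(m4(q * q *(n *(de + 1 *(m * de))))(m2(q * q *(n *(k * non)))(begin
     m *(A * A)* S₁ + A * A *(1 * S₂)≡⟨ rn m(A * A)S₁ S₂ ⟩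
     A * A *(m * S₁ + S₂)≤⟨ mo(A * A)tails-and-sides ⟩
     A * A *(m * nD + vo)∎)))⟩
   100 *(q * q *(n *(k * non))+ A * A *(m * nD + vo)+ q * q *(n *(de + 1 *(m * de))))≡⟨ r4(q * q)n m non(A * A)de vo ⟩
   q * q * k *(100 *(n * non))+ 100 *(A * A)* vo + 100 *(q * q * k + m *(A * A))* nD ∎)⟩
  q * q * k *(100 *(n * non))+ 100 *(A * A)* vo ≤⟨ m2(q * q * k *(100 *(n * non)))(tr(re(sym(ii _)))(mn(100 *(A * A)* vo)(m0(m0 1≤q 1≤q)(ss(zn{m})))))⟩
  q * q * k *(100 *(n * non))+ q * q * k *(100 *(A * A)* vo)≡⟨ sym(d0(q * q * k)_ _)⟩
  q * q * k *(100 *(n * non)+ 100 *(A * A)* vo)∎)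
  where
  open Re
  nD = n * de
  ring₀ : ∀ a b -> a *(61 * b)≡ 61 * a * b
  ring₀ = so
  rg : ∀ q B m A n D -> 100 *(2 * q *(B + m * A))*(n * D)≡ 100 *(n *(2 * q * B * D + 2 * q * A *(1 *(m * D))))
  rg = so
  rn : ∀ m a s t -> m * a * s + a *(1 * t)≡ a *(m * s + t)
  rn = so
  r4 : ∀ q n m non A D V -> 100 *(q *(n *(suc m * non))+ A *(m *(n * D)+ V)+ q *(n *(D + 1 *(m * D))))≡
   q * suc m *(100 *(n * non))+ 100 * A * V + 100 *(q * suc m + m * A)*(n * D)
  r4 = so
  sq : ∀ q B -> 2 * q * B *(2 * q * B)≡ 4 *(q * q)*(B * B)
  sq = so
  assoc : ∀ q x -> 4 *(q * q)* x ≡ 4 *(q * q * x)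
  assoc = so
  sq′ : ∀ q A -> 2 * q * A *(2 * q * A)≡ 4 *(q * q *(A * A))
  sq′ = so

replace-swap : ∀{A : Set}{k}(u : Vec A k)w i i′ -> i ≢ i′ -> u [ i ]≔ w [ i′ ]≔ lo u i ≡(u [ i′ ]≔ w)⊙ sw i i′
replace-swap u w i i′ ne = lx(\ t -> ta(lhs t(lw i i′ t))(sym(lu(u [ i′ ]≔ w)(sw i i′)t)))
 where
 lhs : ∀ t -> _ -> lo(u [ i ]≔ w [ i′ ]≔ lo u i)t ≡ lo(u [ i′ ]≔ w)(lo(sw i i′)t)
 lhs t(i1(refl , e))= ta(Ve t(u [ i ]≔ w)_)(sym(ta(co(lo(u [ t ]≔ w))e)(Vu ne u w)))
 lhs t(i0(i1(refl , a , e)))= ta(Vu a(u [ t ]≔ w)_)(ta(Ve t u w)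
  (sym(ta(co(lo(u [ i′ ]≔ w))e)(Ve i′ u w))))
 lhs t(i0(i0(a , b , e)))= ta(Vu b(u [ i ]≔ w)_)(ta(Vu a u w)
  (sym(ta(co(lo(u [ i′ ]≔ w))e)(Vu b u w))))

module LargeTuran{n m : ℕ}(n0 : 1 ≤ n)(Q : Fo n(suc m))(symQ : Sy Q)where
 open TuranSums n0 Q public

 edge-sym : ∀ v π -> Ds π -> ed v ≡ tu -> ed(v ⊙ π)≡ tu
 edge-sym v π d h = let p , _ , q = ae(pa k)h in an{p = Q(v ⊙ π)}(pt(p ⊙ π))(symQ v p π d q)

 -- In the (k+1)-set formed by u and w: the subset omitting the i-th vertex of u is directed at its
 -- j-th vertex, and the subset omitting that head is an edge.
 vd : Vec(Fin n)k -> Fin n -> Fin k × Fin k -> Bool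
 vd u w(i , j)= not(eqF i j)∧(dir j(u [ i ]≔ w)∧ ed(u [ i ]≔ w [ j ]≔ lo u i))

 ijs = ct fs fs

 vio : Vec(Fin n)k -> Fin n -> ℕ
 vio u w = sum fs(\ i -> sum fs(\ i′ -> sum fs(\ j -> bit(va i′ j(u [ i ]≔ w)(lo u i)))))

 module _ u w(clean : vio u w ≡ 0)where
  clean-at : ∀ i i′ j -> va i′ j(u [ i ]≔ w)(lo u i)≡ fa
  clean-at i i′ j = n1(\ h -> il refl(t5(rp(sym(co bit h))(rf{1}))(tr(s4(\ j -> bit(va i′ j(u [ i ]≔ w)(lo u i)))(aF j))
   (tr(s4(\ i′ -> sum fs(\ j -> bit(va i′ j(u [ i ]≔ w)(lo u i))))(aF i′))
   (tr(s4(\ i -> sum fs(\ i′ -> sum fs(\ j -> bit(va i′ j(u [ i ]≔ w)(lo u i)))))(aF i))(re clean))))))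

  nonedge : ∀{i j}i′ -> vd u w(i , j)≡ tu -> i′ ≢ j -> ed(u [ i ]≔ w [ i′ ]≔ lo u i)≡ tu -> ⊥
  nonedge{i}{j}i′ h ne e = te(ai(na(n1(\ q -> ne(ee q))))(ai(ad{dA j(u [ i ]≔ w)}(ad{dir j(u [ i ]≔ w)}h1))
   (ai(ar{dir j(u [ i ]≔ w)}h1)e)))(clean-at i i′ j)
   where h1 = ar{not(eqF i j)}h

  other-edge : ∀{i j}i′ -> vd u w(i , j)≡ tu -> ed(u [ i′ ]≔ w)≡ tu -> i′ ≢ i -> i′ ≡ j
  other-edge{i}{j}i′ h e ne = ce(i′ Fin.≟ j)
   where
   ce : Dec(i′ ≡ j)-> i′ ≡ j
   ce(yes q)= q
   ce(no q)= el(nonedge i′ h q(sb(\ v -> ed v ≡ tu)(sym(replace-swap u w i i′(\ z -> ne(sym z))))(edge-sym _(sw i i′)(sd i i′)e)))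

  valid-edge : ∀{i j}-> vd u w(i , j)≡ tu -> ed(u [ i ]≔ w)≡ tu
  valid-edge{i}{j}h = dir-edge j(ad{dir j(u [ i ]≔ w)}(ar{not(eqF i j)}h))

  valid-ne : ∀{i j}-> vd u w(i , j)≡ tu -> i ≢ j
  valid-ne{i}h refl = te(eF i)(nt(ad{not(eqF i i)}h))

  -- Without violations, a directed edge whose companion omitting the head is an edge makes all
  -- other k-subsets of the (k+1)-set non-edges. Two valid pairs therefore involve the same two
  -- edges, in the same or in exchanged roles.
  pairs-valid : ∀{i j i′ j′}-> vd u w(i , j)≡ tu -> vd u w(i′ , j′)≡ tu ->(i ≡ i′ × j ≡ j′)⊎(j ≡ i′ × i ≡ j′)
  pairs-valid{i}{j}{i′}{j′}h h3 = ce(i′ Fin.≟ i)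
   where
   ce : Dec(i′ ≡ i)-> _
   ce(yes refl)= case₂(j′ Fin.≟ j)
    where
    case₂ : Dec(j′ ≡ j)-> _
    case₂(yes e)= i1(refl , sym e)
    case₂(no q)= el(nonedge j′ h q(ar{dir j′(u [ i′ ]≔ w)}(ar{not(eqF i′ j′)}h3)))
   ce(no ne)with other-edge i′ h(valid-edge h3)ne
   ... | refl = i0(refl , other-edge i h3(valid-edge h)(\ q -> ne(sym q)))

  valid-nonedge : ∀{i j}-> vd u w(i , j)≡ tu -> ed u ≡ fa
  valid-nonedge{i}{j}h = n1(\ e -> nonedge i h(valid-ne h)(sb(\ v -> ed v ≡ tu)(sym(ta(Vec.[]≔-idempotent u i)(Vec.[]≔-lookup u i)))e))

  valid-count : # ijs(vd u w)≤ 2 * bit(not(ed u))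
  valid-count = ce(# ijs(vd u w))refl
   where
   ce : ∀ x -> # ijs(vd u w)≡ x -> # ijs(vd u w)≤ 2 * bit(not(ed u))
   ce zero    e = tr(re e)zn
   ce(suc _)e = use(wi ijs(vd u w)(rp(sym e)(ss zn)))
    where
    use :(∃ \ ij -> ij ∈ ijs × vd u w ij ≡ tu)-> # ijs(vd u w)≤ 2 * bit(not(ed u))
    use((i , j), _ , h)= begin
     # ijs(vd u w)≤⟨ sm ijs(\{(i′ , j′)-> one i′ j′(bo(vd u w(i′ , j′)))})⟩
     sum ijs(\(i′ , j′)-> is i j i′ j′ + is j i i′ j′)≡⟨ ta(s3 ijs(\(i′ , j′)-> is i j i′ j′)(\(i′ , j′)-> is j i i′ j′))(cn _+_(tl i j)(tl j i))⟩
     2 ≡⟨ co(\ b -> 2 * bit(not b))(sym(valid-nonedge{i}{j}h))⟩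
     2 * bit(not(ed u))∎
     where
     open Re
     is : Fin k -> Fin k -> Fin k -> Fin k -> ℕ
     is i j i′ j′ = bit(eqF i i′)*(bit(eqF j j′)* 1)
     tl : ∀ i j -> sum ijs(\(i′ , j′)-> is i j i′ j′)≡ 1
     tl i j = ta(sr _,_ fs fs _)(ta(sc fs(\ i′ -> ta(s0 fs(bit(eqF i i′))(\ j′ -> bit(eqF j j′)* 1))(co(bit(eqF i i′)*_)(sum-eqF j(\ _ -> 1)))))(sum-eqF i(\ _ -> 1)))
     one : ∀ i′ j′ -> vd u w(i′ , j′)≡ tu ⊎ vd u w(i′ , j′)≡ fa -> bit(vd u w(i′ , j′))≤ is i j i′ j′ + is j i i′ j′
     one i′ j′(i0 q)= tr(re(co bit q))zn
     one i′ j′(i1 q)= go(pairs-valid h q)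
      where
      go :(i ≡ i′ × j ≡ j′)⊎(j ≡ i′ × i ≡ j′)-> bit(vd u w(i′ , j′))≤ is i j i′ j′ + is j i i′ j′
      go(i1(refl , refl))= tr(bt rf)(tr(re(sym(cn(\ a b -> bit a *(bit b * 1))(eF i)(eF j))))(mm(is i j i j)(is j i i j)))
      go(i0(refl , refl))= tr(bt rf)(tr(re(sym(cn(\ a b -> bit a *(bit b * 1))(eF j)(eF i))))(m5(is j i j i)(is i j j i)))

 -- Reindexing by `sN` charges each directed edge with its companion to a pair (u , w) where u is a
 -- non-edge, and `valid-count` admits two per pair. Pairs with a violation get the trivial bound k
 -- * k.
 tails : m * S₁ ≤ 2 *(n * non)+ k * k *(k * vo)
 tails = begin
  m * S₁ ≡⟨ sym(bk(\ j -> sum ts(\ v -> bit(dir j v)* deg j v)))⟩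
  sum fs(\ i -> sum fs(\ j -> neq i j * sum ts(\ v -> bit(dir j v)* deg j v)))≡⟨ sc fs(\ i -> sc fs(\ j -> expand i j))⟩
  sum fs(\ i -> sum fs(\ j -> sum ts(\ u -> # zs(\ w -> vd u w(i , j)))))≡⟨ rr ⟩
  sum ts(\ u -> sum zs(\ w -> # ijs(vd u w)))≤⟨ sm ts(\ u -> sm zs(\ w -> bound u w(vio u w)refl))⟩
  sum ts(\ u -> sum zs(\ w -> 2 * bit(not(ed u))+ k * k * vio u w))≡⟨ ta(sc ts(\ u -> ta(s3 zs(\ _ -> 2 * bit(not(ed u)))(\ w -> k * k * vio u w))(cn _+_(ta(sn zs _)(ta(co(_*(2 * bit(not(ed u))))(lf n))(ri n(bit(not(ed u))))))(s0 zs(k * k)(vio u)))))(s3 ts(\ u -> 2 * n * bit(not(ed u)))(\ u -> k * k * sum zs(vio u)))⟩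
  sum ts(\ u -> 2 * n * bit(not(ed u)))+ sum ts(\ u -> k * k * sum zs(vio u))≡⟨ cn _+_(ta(s0 ts(2 * n)(\ u -> bit(not(ed u))))(ac 2 n non))(ta(s0 ts(k * k)(\ u -> sum zs(vio u)))(co(k * k *_)total-vio))⟩
  2 *(n * non)+ k * k *(k * vo)∎
  where
  open Re
  ri : ∀ n x -> n *(2 * x)≡ 2 * n * x
  ri = so
  expand : ∀ i j -> neq i j * sum ts(\ v -> bit(dir j v)* deg j v)≡ sum ts(\ u -> # zs(\ w -> vd u w(i , j)))
  expand i j = ta(sym(s0 ts(neq i j)(\ v -> bit(dir j v)* deg j v)))(ta(sc ts(\ v -> ta(co(neq i j *_)(sym(s0 zs(bit(dir j v))(\ z -> bit(ed(v [ j ]≔ z))))))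
   (ta(sym(s0 zs(neq i j)(\ z -> bit(dir j v)* bit(ed(v [ j ]≔ z)))))(sc zs(\ z -> sym(ta(bd(not(eqF i j))_)(co(neq i j *_)(bd(dir j v)_))))))))
   (sN i(\ v z -> bit(not(eqF i j)∧(dir j v ∧ ed(v [ j ]≔ z))))))
  rr : sum fs(\ i -> sum fs(\ j -> sum ts(\ u -> # zs(\ w -> vd u w(i , j)))))≡ sum ts(\ u -> sum zs(\ w -> # ijs(vd u w)))
  rr = ta(sym(sr _,_ fs fs(\ ij -> sum ts(\ u -> # zs(\ w -> vd u w ij)))))(ta(s1 ijs ts(\ ij u -> # zs(\ w -> vd u w ij)))
   (sc ts(\ u -> s1 ijs zs(\ ij w -> bit(vd u w ij)))))
  bound : ∀ u w x -> vio u w ≡ x -> # ijs(vd u w)≤ 2 * bit(not(ed u))+ k * k * x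
  bound u w zero    e = tr(valid-count u w e)(mm _ _)
  bound u w(suc x)e = tr(#-≤ ijs(vd u w))(tr(re(ta(ld fs fs)(cn _*_(lf k)(lf k))))
   (tr(tr(re(sym(it(k * k))))(mo(k * k)(ss(zn{x}))))(m5 _(2 * bit(not(ed u))))))
  total-vio : sum ts(\ u -> sum zs(vio u))≡ k * vo
  total-vio = ta(sc ts(\ u -> s1 zs fs(\ w i -> body u w i)))(ta(s1 ts fs(\ u i -> sum zs(\ w -> body u w i)))
   (ta(sc fs(\ i -> ta(sym(sN i(\ v z -> sum fs(\ i′ -> sum fs(\ j -> bit(va i′ j v z))))))(flat i)))
   (ta(sn fs vo)(co(_* vo)(lf k)))))
   where
   body : Vec(Fin n)k -> Fin n -> Fin k -> ℕ
   body u w i = sum fs(\ i′ -> sum fs(\ j -> bit(va i′ j(u [ i ]≔ w)(lo u i))))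
   flat : ∀(i : Fin k)-> sum ts(\ v -> sum zs(\ z -> sum fs(\ i′ -> sum fs(\ j -> bit(va i′ j v z)))))≡ vo
   flat i = ta(sc ts(\ v -> ta(s1 zs fs _)(sc fs(\ i′ -> s1 zs fs _))))
    (ta(s1 ts fs(\ v i′ -> sum fs(\ j -> # zs(va i′ j v))))(sc fs(\ i′ -> s1 ts fs(\ v j -> # zs(va i′ j v)))))

 -- `line-sum` with a = 200, b₁ = 100 k m and coefficient 244 k + 200 on the left; the discriminant
 -- condition is precisely `cond`, which holds from k = 9 on.
 large-turan :(244 * k + 200)*(244 * k + 200)≤ 80000 *(k * m)->
  61 *(n * de)≤ 100 *(n * non)+ 100 *(k * k *(k * vo))
 large-turan cond = ca(4 * k)(c6(200 * nD)_ _(begin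
  4 * k *(61 * nD)+ 200 * nD ≡⟨ r1 k nD ⟩
  (244 * k + 200)* nD ≡⟨ r0 n(244 * k + 200)de(m * de)⟩
  n *((244 * k + 200)* de + 0 *(0 *(m * de)))≤⟨ line-sum 0 200(100 *(k * m))0(244 * k + 200)0 zn(ss zn)(tr cond(re(r3(k * m))))zn ⟩
  200 *(n *(k * non))+(100 *(k * m)* S₁ + 0 *(0 * S₂))+ 200 *(n *(de + 0 *(m * de)))≡⟨ r5 n k m non S₁ de ⟩
  200 *(n *(k * non))+ 100 * k *(m * S₁)+ 200 * nD ≤⟨ m4(200 * nD)(m2(200 *(n *(k * non)))(mo(100 * k)tails))⟩
  200 *(n *(k * non))+ 100 * k *(2 *(n * non)+ k * k *(k * vo))+ 200 * nD ≤⟨ m4(200 * nD)(tr(mm(200 *(n *(k * non))+ 100 * k *(2 *(n * non)+ k * k *(k * vo)))(300 * k *(k * k *(k * vo))))(re(r₅ n k non(k * k *(k * vo)))))⟩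
  4 * k *(100 *(n * non)+ 100 *(k * k *(k * vo)))+ 200 * nD ∎))
  where
  open Re
  nD = n * de
  r1 : ∀ k x -> 4 * k *(61 * x)+ 200 * x ≡(244 * k + 200)* x
  r1 = so
  r0 : ∀ n a d e -> a *(n * d)≡ n *(a * d + 0 *(0 * e))
  r0 = so
  r3 : ∀ x -> 80000 * x ≡ 4 *(200 *(100 * x))
  r3 = so
  r5 : ∀ n k m non S D -> 200 *(n *(k * non))+(100 *(k * m)* S + 0)+ 200 *(n *(D + 0))≡ 200 *(n *(k * non))+ 100 * k *(m * S)+ 200 *(n * D)
  r5 = so
  r₅ : ∀ n k non x -> 200 *(n *(k * non))+ 100 * k *(2 *(n * non)+ x)+ 300 * k * x ≡ 4 * k *(100 *(n * non)+ 100 * x)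
  r₅ = so

abstract
 tn : ℕ -> ℕ
 tn k = 2500 + 100 *(k * k * k)

 tC : ∀ A k -> A ≤ 5 -> 100 *(A * A)≤ tn k
 tC A k h = tr(mo 100(m0 h h))(mm 2500(100 *(k * k * k)))

 t7 : ∀ k -> 100 *(k * k * k)≤ tn k
 t7 k = m5(100 *(k * k * k))2500

-- k ≤ 8 by the degree inequality (with rational approximations A/q of
-- 1 + 1/√(k-1)), k ≥ 9 by counting (k+1)-sets.
turan : ∀{n m}-> 1 ≤ n -> 1 ≤ m ->(Q : Fo n(suc m))-> Sy Q ->
 61 *(n * St.de Q)≤ 100 *(n * St.non Q)+ tn(suc m)* St.vo Q
turan{n}{m}n0 1≤m Q symQ = go m refl
 where
 open LargeTuran n0 Q symQ
 weaken : ∀ c -> c ≤ tn k -> 61 *(n * de)≤ 100 *(n * non)+ c * vo -> 61 *(n * de)≤ 100 *(n * non)+ tn k * vo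
 weaken c h q = tr q(m2(100 *(n * non))(mn vo h))
 Goal = 61 *(n * de)≤ 100 *(n * non)+ tn k * vo
 s9 : ∀ q A B -> 1 ≤ q -> A ≤ 5 -> B * B ≤ m *(A * A)-> 61 *(q * q * k)+ 100 *(q * q * k + m *(A * A))≤ 100 *(2 * q *(B + m * A))-> Goal
 s9 q A B 1≤q A≤ h0 h1 = weaken(100 *(A * A))(tC A k A≤)(small-turan q A B 1≤q h0 h1)
 go : ∀ m′ -> m ≡ m′ -> Goal
 go 0 refl = el(il refl 1≤m)
 -- The numbers are q, A, B, where B is a lower approximation of A times the square root of m. Both
 -- numerical conditions are decided by evaluation.
 go 1 refl = s9 1 2 2 rf(mm 2 3)(aa _ _ tt)(aa _ _ tt)
 go 2 refl = s9 2 3 4(ss zn)(mm 3 2)(aa _ _ tt)(aa _ _ tt)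
 go 3 refl = s9 2 3 5(ss zn)(mm 3 2)(aa _ _ tt)(aa _ _ tt)
 go 4 refl = s9 2 3 6(ss zn)(mm 3 2)(aa _ _ tt)(aa _ _ tt)
 go 5 refl = s9 2 3 6(ss zn)(mm 3 2)(aa _ _ tt)(aa _ _ tt)
 go 6 refl = s9 2 3 7(ss zn)(mm 3 2)(aa _ _ tt)(aa _ _ tt)
 go 7 refl = s9 3 4 10(ss zn)(mm 4 1)(aa _ _ tt)(aa _ _ tt)
 go(suc(suc(suc(suc(suc(suc(suc(suc x))))))))refl = weaken(100 *(k * k * k))(t7 k)
  (rp(co(100 *(n * non)+_)(ri k vo))(large-turan(tr(mm _(20464 *(x * x)+ 190752 * x + 19184))(re(big x)))))
  where
  ri : ∀ k v -> 100 *(k * k *(k * v))≡ 100 *(k * k * k)* v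
  ri = so
  big : ∀ x ->(244 *(9 + x)+ 200)*(244 *(9 + x)+ 200)+(20464 *(x * x)+ 190752 * x + 19184)≡ 80000 *((9 + x)*(8 + x))
  big = so

-- Stability: a nearly complete container is nearly unate.

-- While the mask still takes entry i from v, the entry b_i is independent of the mixture, so the
-- mixture together with b_i is uniform.
sum-mix-at : ∀ n{m}(ε : Vec Bool m)i -> lo ε i ≡ tu ->(f : Vec(Fin n)m -> Fin n -> ℕ)->
 n * sum(tup n m)(\ v -> sum(tup n m)(\ b -> f(mix ε v b)(lo b i)))≡ n ^ m * sum(tup n m)(\ u -> sum(al n)(f u))
sum-mix-at n{suc m}(tu ∷ ε)zero _ f = ta(co(n *_)(ta(su zs m _)(ta(sc zs(\ x -> ta(sc ts(\ v -> ta(su zs m _)refl))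
 (ta(s1 ts zs _)(sc zs(\ y -> ta(aV zs ε(\ u -> f(x ∷ u)y))(co(\ l -> l ^ m * sum ts(\ u -> f(x ∷ u)y))(lf n)))))))
 (ta(sc zs(\ x -> ta(s0 zs(n ^ m)(\ y -> sum ts(\ u -> f(x ∷ u)y)))(co(n ^ m *_)(s1 zs ts(\ y u -> f(x ∷ u)y)))))(ta(s0 zs(n ^ m)(\ x -> sum ts(\ u -> sum zs(f(x ∷ u)))))refl)))))
 (ta(sym(ac n(n ^ m)_))(co(n ^ suc m *_)(sym(su zs m _))))
 where
 zs = al n
 ts = tup n m
sum-mix-at n{suc m}(c ∷ ε)(suc i)h f = ta(co(n *_)(ta(su zs m _)(sc zs(\ x -> sc ts(\ v -> su zs m _)))))(ta(co(n *_)(sI c))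
 (ta(co(n *_)(ta(sym(s0 zs n _))(sc zs(\ x -> sum-mix-at n ε i h(\ u -> f(x ∷ u))))))
 (ta(co(n *_)(s0 zs(n ^ m)_))(ta(sym(ac n(n ^ m)_))(co(n ^ suc m *_)(sym(su zs m _)))))))
 where
 zs = al n
 ts = tup n m
 sI : ∀ c -> sum zs(\ x -> sum ts(\ v -> sum zs(\ y -> sum ts(\ b -> f(mix(c ∷ ε)(x ∷ v)(y ∷ b))(lo b i)))))≡
  n * sum zs(\ x -> sum ts(\ v -> sum ts(\ b -> f(x ∷ mix ε v b)(lo b i))))
 sI tu = ta(sc zs(\ x -> ta(sc ts(\ v -> ta(sn zs _)(co(_* sum ts(\ b -> f(x ∷ mix ε v b)(lo b i)))(lf n))))(s0 ts n _)))(s0 zs n _)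
 sI fa = ta(sn zs _)(cn _*_(lf n)(s1 ts zs _))

module Stability{n m : ℕ}(n0 : 1 ≤ n)(Q : Fo n(suc m))(symQ : Sy Q)where
 open LargeTuran n0 Q symQ
 ms = tup n m

 -- A bad step of a walk that replaces entry suc i by z. In a good step both replacements are edges
 -- and there is no clash, so every pattern of the new tuple gives the first vertex the sign it had
 -- before (`step-good`).
 sZ : Fin m -> Vec(Fin n)k -> Fin n -> Bool
 sZ i v z = not(ed(v [ suc i ]≔ z))∨(not(ed(v [ zero ]≔ z))∨ ch(suc i)zero(z ∷ v))

 step-good : ∀ i v z r -> sZ i v z ≡ fa -> Q v r ≡ tu ->
  ed(v [ suc i ]≔ z)≡ tu ×(∀ q -> Q(v [ suc i ]≔ z)q ≡ tu -> lo q zero ≡ lo r zero)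
 step-good i v z r h hr = sl(ed(v [ suc i ]≔ z))(ed(v [ zero ]≔ z))(ch(suc i)zero(z ∷ v))refl refl refl h
  where
  sl : ∀ a b c -> ed(v [ suc i ]≔ z)≡ a -> ed(v [ zero ]≔ z)≡ b -> ch(suc i)zero(z ∷ v)≡ c -> not a ∨(not b ∨ c)≡ fa ->
   ed(v [ suc i ]≔ z)≡ tu ×(∀ q -> Q(v [ suc i ]≔ z)q ≡ tu -> lo q zero ≡ lo r zero)
  sl tu tu fa ea eb ec _ = ea , \ q hq -> ce q hq(bo(eqB(lo q zero)(lo r zero)))
   where
   ce : ∀ q -> Q(v [ suc i ]≔ z)q ≡ tu -> eqB(lo q zero)(lo r zero)≡ tu ⊎ eqB(lo q zero)(lo r zero)≡ fa -> lo q zero ≡ lo r zero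
   ce q hq(i1 e)= eB _ _ e
   ce q hq(i0 e)= let p , _ , hp = ae(pa k)eb in el(te(clash-intro(suc i)zero p q r(\())(ef _ _ e)hp hq hr)ec)

 cG : ℕ
 cG = sum(al m)(\ i -> #(tup n(suc k))(ch(suc i)zero))

 ph : List(Fin m)-> Vec Bool m -> Fin n -> Vec(Fin n)m -> Vec(Fin n)m -> Bool
 ph []       ε x v b = fa
 ph(i ∷ is)ε x v b = sZ i(x ∷ mix ε v b)(lo b i)∨ ph is(ε [ i ]≔ fa)x v b

 aE : List(Fin m)-> Vec Bool m -> Vec Bool m
 aE []       ε = ε
 aE(i ∷ is)ε = aE is(ε [ i ]≔ fa)

 mx : ∀{k}(ε : Vec Bool k)(v b : Vec(Fin n)k)i -> mix(ε [ i ]≔ fa)v b ≡ mix ε v b [ i ]≔ lo b i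
 mx(tu  ∷ ε)(x ∷ v)(y ∷ b)zero    = refl
 mx(fa ∷ ε)(x ∷ v)(y ∷ b)zero    = refl
 mx(tu  ∷ ε)(x ∷ v)(y ∷ b)(suc i)= co(x ∷_)(mx ε v b i)
 mx(fa ∷ ε)(x ∷ v)(y ∷ b)(suc i)= co(y ∷_)(mx ε v b i)

 oa : ∀{a b}-> a ∨ b ≡ fa -> a ≡ fa × b ≡ fa
 oa{fa}h = refl , h

 path-good : ∀ is ε x v b r -> ph is ε x v b ≡ fa -> Q(x ∷ mix ε v b)r ≡ tu ->
  ed(x ∷ mix(aE is ε)v b)≡ tu ×(∀ q -> Q(x ∷ mix(aE is ε)v b)q ≡ tu -> lo q zero ≡ lo r zero)⊎ is ≡ []
 path-good []       ε x v b r h hr = i0 refl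
 path-good(i ∷ is)ε x v b r h hr = i1(next(step-good i(x ∷ mix ε v b)(lo b i)r(po(oa h))hr))
  where
  u = mix ε v b [ i ]≔ lo b i
  e : mix(ε [ i ]≔ fa)v b ≡ u
  e = mx ε v b i
  next : ed(x ∷ u)≡ tu ×(∀ q -> Q(x ∷ u)q ≡ tu -> lo q zero ≡ lo r zero)->
   ed(x ∷ mix(aE(i ∷ is)ε)v b)≡ tu ×(∀ q -> Q(x ∷ mix(aE(i ∷ is)ε)v b)q ≡ tu -> lo q zero ≡ lo r zero)
  next(eu , s7)= use(ae(pa k)eu)
   where
   use :(∃ \ q -> q ∈ pa k × Q(x ∷ u)q ≡ tu)-> _
   use(q , _ , hq)= d2(path-good is(ε [ i ]≔ fa)x v b q(p0(oa{sZ i(x ∷ mix ε v b)(lo b i)}h))(sb(\ u -> Q(x ∷ u)q ≡ tu)(sym e)hq))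
    where
    d2 : ed(x ∷ mix(aE is(ε [ i ]≔ fa))v b)≡ tu ×(∀ q′ -> Q(x ∷ mix(aE is(ε [ i ]≔ fa))v b)q′ ≡ tu -> lo q′ zero ≡ lo q zero)⊎ is ≡ [] ->
     ed(x ∷ mix(aE is(ε [ i ]≔ fa))v b)≡ tu ×(∀ q -> Q(x ∷ mix(aE is(ε [ i ]≔ fa))v b)q ≡ tu -> lo q zero ≡ lo r zero)
    d2(i1(e′ , s′))= e′ , \ q′ h3 -> ta(s′ q′ h3)(s7 q hq)
    d2(i0 refl)= sb(\ u -> ed(x ∷ u)≡ tu)(sym e)eu , \ q′ h3 -> s7 q′(sb(\ u -> Q(x ∷ u)q′ ≡ tu)e h3)

 bads : Fin m -> ℕ
 bads i = sum ts(\ v -> # zs(sZ i v))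

 -- Union bound over the steps. Each step sees a uniform tuple and an independent uniform
 -- replacement, because its coordinate has not yet been replaced.
 path-count : ∀ is ε -> Unique is ->(∀{i}-> i ∈ is -> lo ε i ≡ tu)->
  n * sum zs(\ x -> sum ms(\ v -> # ms(ph is ε x v)))≤ n ^ m * sum is bads
 path-count [] ε _ _ = tr(re(ta(co(n *_)(sz zs(\ x -> sz ms(\ v -> sz ms(\ _ -> refl)))))(ze n)))zn
 path-count(i ∷ is)ε(a AllPairs.∷ u)h = begin
  n * sum zs(\ x -> sum ms(\ v -> # ms(ph(i ∷ is)ε x v)))≤⟨ mo n(sm zs(\ x -> sm ms(\ v -> #-or ms(\ b -> sl(sZ i(x ∷ mix ε v b)(lo b i))))))⟩
  n * sum zs(\ x -> sum ms(\ v -> A x v + R x v))≡⟨ co(n *_)(ta(sc zs(\ x -> s3 ms(A x)(R x)))(s3 zs(\ x -> sum ms(A x))(\ x -> sum ms(R x))))⟩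
  n *(sum zs(\ x -> sum ms(A x))+ sum zs(\ x -> sum ms(R x)))≡⟨ d0 n(sum zs(\ x -> sum ms(A x)))_ ⟩
  n * sum zs(\ x -> sum ms(A x))+ n * sum zs(\ x -> sum ms(R x))≤⟨ m1(re f5)(path-count is(ε [ i ]≔ fa)u(\{j}j∈ -> ta(Vu(\ e -> All.lookup a j∈(sym e))ε fa)(h(th j∈))))⟩
  n ^ m * bads i + n ^ m * sum is bads ≡⟨ sym(d0(n ^ m)(bads i)_)⟩
  n ^ m * sum(i ∷ is)bads ∎
  where
  open Re
  A R : Fin n -> Vec(Fin n)m -> ℕ
  A x v = # ms(\ b -> sZ i(x ∷ mix ε v b)(lo b i))
  R x v = # ms(ph is(ε [ i ]≔ fa)x v)
  sl : ∀ a{b}-> a ∨ b ≡ tu -> a ≡ tu ⊎ b ≡ tu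
  sl tu  h = i1 refl
  sl fa h = i0 h
  f5 : n * sum zs(\ x -> sum ms(A x))≡ n ^ m * bads i
  f5 = ta(sym(s0 zs n(\ x -> sum ms(A x))))(ta(sc zs(\ x -> sum-mix-at n ε i(h(he refl))(\ u z -> bit(sZ i(x ∷ u)z))))
   (ta(s0 zs(n ^ m)(\ x -> sum ms(\ u -> # zs(sZ i(x ∷ u)))))(co(n ^ m *_)(sym(su zs m _)))))

 bads-bound : ∀ i -> bads i ≤ 2 *(n * non)+ #(tup n(suc k))(ch(suc i)zero)
 bads-bound i = begin
  bads i ≤⟨ sm ts(\ v -> tr(#-or zs(\ z -> sl(not(ed(v [ suc i ]≔ z)))))(m2(# zs(\ z -> not(ed(v [ suc i ]≔ z))))(#-or zs(\ z -> sl(not(ed(v [ zero ]≔ z)))))))⟩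
  sum ts(\ v -> gaps(suc i)v +(gaps zero v + # zs(\ z -> ch(suc i)zero(z ∷ v))))≡⟨ ta(s3 ts(gaps(suc i))_)(cn _+_(l5(suc i)(\ v -> bit(not(ed v))))(ta(s3 ts(gaps zero)(\ v -> # zs(\ z -> ch(suc i)zero(z ∷ v))))(cn _+_(l5 zero(\ v -> bit(not(ed v))))(ta(s1 ts zs _)(sym(su zs k _))))))⟩
  n * non +(n * non + #(tup n(suc k))(ch(suc i)zero))≡⟨ ri(n * non)_ ⟩
  2 *(n * non)+ #(tup n(suc k))(ch(suc i)zero)∎
  where
  open Re
  ri : ∀ a b -> a +(a + b)≡ 2 * a + b
  ri = so
  sl : ∀ a{b}-> a ∨ b ≡ tu -> a ≡ tu ⊎ b ≡ tu
  sl tu  h = i1 refl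
  sl fa h = i0 h

 -- The sign of x as seen from the reference set b.
 τ : Vec(Fin n)m -> Fin n -> Bool
 τ b x = ay(pa k)(\ p -> Q(x ∷ b)p ∧ lo p zero)

 wn : Fin k -> Vec(Fin n)m -> Vec(Fin n)k -> Bool
 wn j b v = ay(pa k)(\ p -> Q v p ∧ not(eqB(lo p j)(τ b(lo v j))))

 mt :(Fin n -> Bool)-> Vec(Fin n)k -> Bool
 mt σ v = ay(pa k)(\ p -> Q v p ∧ ay(al k)(\ j -> not(eqB(lo p j)(σ(lo v j)))))

 -- Walking from v to the reference b without a bad step would carry the sign of x unchanged, so a
 -- sign differing from the one seen at b betrays a bad step.
 wrong-path : 1 ≤ m -> ∀ b v -> wn zero b v ≡ tu -> ph(al m)(aT m)(Vec.head v)(Vec.tail v)b ≡ tu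
 wrong-path 1≤m b(x ∷ v)h = use(ae(pa k)h)
  where
  use :(∃ \ p -> p ∈ pa k × Q(x ∷ v)p ∧ not(eqB(lo p zero)(τ b x))≡ tu)-> ph(al m)(aT m)x v b ≡ tu
  use(p , _ , hp)= n1(\ gd -> clashing(path-good(al m)(aT m)x v b p gd(sb(\ u -> Q(x ∷ u)p ≡ tu)(sym(mix-all v b))(ad hp))))
   where
   final : ∀ is ε t -> t ∈ is ⊎ lo ε t ≡ fa -> lo(aE is ε)t ≡ fa
   final []       ε t(i0 e)= e
   final(i ∷ is)ε t(i1(he refl))= final is(ε [ t ]≔ fa)t(i0(Ve t ε fa))
   final(i ∷ is)ε t(i1(th m))= final is(ε [ i ]≔ fa)t(i1 m)
   final(i ∷ is)ε t(i0 e)with t Fin.≟ i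
   ... | yes refl = final is(ε [ t ]≔ fa)t(i0(Ve t ε fa))
   ... | no ne    = final is(ε [ i ]≔ fa)t(i0(ta(Vu ne ε fa)e))
   end : mix(aE(al m)(aT m))v b ≡ b
   end = lx(\ t -> ta(lm(aE(al m)(aT m))v b t)(co(\ c -> if c then lo v t else lo b t)(final(al m)(aT m)t(i1(aF t)))))
   clashing : _ -> ⊥
   clashing(i0 e)= il refl(tr 1≤m(re(ta(sym(lf m))(co length e))))
   clashing(i1(e , s7))= te(ta(sym agree-τ)refl)(nt(ar{Q(x ∷ v)p}hp))
    where
    ends : ∀ q -> Q(x ∷ b)q ≡ tu -> lo q zero ≡ lo p zero
    ends q hq = s7 q(sb(\ u -> Q(x ∷ u)q ≡ tu)(sym end)hq)
    eb : ed(x ∷ b)≡ tu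
    eb = sb(\ u -> ed(x ∷ u)≡ tu)end e
    τ-sign : ∀ s -> lo p zero ≡ s -> τ b x ≡ s
    τ-sign tu  e₀ = let q , m , hq = ae(pa k)eb in an{p = \ p -> Q(x ∷ b)p ∧ lo p zero}m(ai hq(ta(ends q hq)e₀))
    τ-sign fa e₀ = n1(\ t -> let q , m , hq = ae(pa k)t in te(ar{Q(x ∷ b)q}hq)(ta(ends q(ad hq))e₀))
    agree-τ : tu ≡ eqB(lo p zero)(τ b x)
    agree-τ = sym(ta(co(eqB(lo p zero))(τ-sign(lo p zero)refl))(e6(lo p zero)))

 wrong-swap : ∀ j b v -> wn j b v ≡ tu -> wn zero b(v ⊙ sw zero j)≡ tu
 wrong-swap j b v h = use(ae(pa k)h)
  where
  π = sw zero j
  π0 : ∀(c : Fin k)-> lw zero j zero ≡ lw zero j zero -> lo π zero ≡ j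
  π0 c _ = ce(lw zero j zero)
   where
   ce : _ -> lo π zero ≡ j
   ce(i1(e , q))= ta q e
   ce(i0(i1(_ , _ , q)))= q
   ce(i0(i0(a , _ , q)))= el(a refl)
  use :(∃ \ p -> p ∈ pa k × Q v p ∧ not(eqB(lo p j)(τ b(lo v j)))≡ tu)-> wn zero b(v ⊙ π)≡ tu
  use(p , _ , hp)= an{p = \ p -> Q(v ⊙ π)p ∧ not(eqB(lo p zero)(τ b(lo(v ⊙ π)zero)))}(pt(p ⊙ π))
   (ai(symQ v p π(sd zero j)(ad hp))(ta(cn(\ a c -> not(eqB a(τ b c)))
    (ta(lu p π zero)(co(lo p)(π0 zero refl)))(ta(lu v π zero)(co(lo v)(π0 zero refl))))(ar{Q v p}hp)))

 misfit-count : 1 ≤ m -> n * sum ms(\ b -> # ts(mt(τ b)))≤ k *(n ^ m * sum(al m)bads)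
 misfit-count 1≤m = begin
  n * sum ms(\ b -> # ts(mt(τ b)))≤⟨ mo n(sm ms(\ b -> tr(m6 ts(\ v -> spread b v))(tr(aq ts fs(\ v j -> wn j b v))(sm fs(\ j -> moved b j)))))⟩
  n * sum ms(\ b -> sum fs(\ j -> # ts(wn zero b)))≡⟨ co(n *_)(ta(sc ms(\ b -> ta(sn fs(# ts(wn zero b)))(co(_* # ts(wn zero b))(lf k))))(s0 ms k(\ b -> # ts(wn zero b))))⟩
  n *(k * sum ms(\ b -> # ts(wn zero b)))≡⟨ swap₃ n k _ ⟩
  k *(n * sum ms(\ b -> # ts(wn zero b)))≤⟨ mo k(mo n(sm ms(\ b -> m6 ts(wrong-path 1≤m b))))⟩
  k *(n * sum ms(\ b -> # ts(\ v -> ph(al m)(aT m)(Vec.head v)(Vec.tail v)b)))≡⟨ co(\ x -> k *(n * x))rr ⟩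
  k *(n * sum zs(\ x -> sum ms(\ v -> # ms(ph(al m)(aT m)x v))))≤⟨ mo k(path-count(al m)(aT m)(Uniq.allFin⁺ m)(\{i}_ -> Vr i tu))⟩
  k *(n ^ m * sum(al m)bads)∎
  where
  open Re
  swap₃ : ∀ a b c -> a *(b * c)≡ b *(a * c)
  swap₃ = so
  spread : ∀ b v -> mt(τ b)v ≡ tu -> ay fs(\ j -> wn j b v)≡ tu
  spread b v h = let p , m₁ , q = ae(pa k)h ; j , m₂ , r = ae(al k)(ar{Q v p}q)in
   an{p = \ j -> wn j b v}m₂(an{p = \ p -> Q v p ∧ not(eqB(lo p j)(τ b(lo v j)))}m₁(ai(ad q)r))
  moved : ∀ b j -> # ts(wn j b)≤ # ts(wn zero b)
  moved b j = tr(m6 ts(wrong-swap j b))(re(sum-⊙(al n)(sw zero j)(sd zero j)(rp(sym(lf n))n0)(\ v -> bit(wn zero b v))))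
  rr : sum ms(\ b -> # ts(\ v -> ph(al m)(aT m)(Vec.head v)(Vec.tail v)b))≡ sum zs(\ x -> sum ms(\ v -> # ms(ph(al m)(aT m)x v)))
  rr = ta(s1 ms ts _)(su zs m _)

 -- The sign vector is the view from a reference tuple b that does no worse than the average over
 -- all b.
 stability : 1 ≤ m -> ∃ \ σ -> n * # ts(mt σ)≤ k *(m *(2 *(n * non))+ cG)
 stability 1≤m = p5(aI ms(\ b -> n * # ts(mt(τ b)))(\ _ -> X)(rp(sym(lg n m))(af m n0))(begin
  sum ms(\ b -> n * # ts(mt(τ b)))≡⟨ s0 ms n _ ⟩
  n * sum ms(\ b -> # ts(mt(τ b)))≤⟨ misfit-count 1≤m ⟩
  k *(n ^ m * sum(al m)bads)≤⟨ mo k(mo(n ^ m)(tr(sm(al m)bads-bound)(re(ta(s3(al m)(\ _ -> 2 *(n * non))_)(co(_+ cG)(ta(sn(al m)(2 *(n * non)))(co(_*(2 *(n * non)))(lf m))))))))⟩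
  k *(n ^ m *(m *(2 *(n * non))+ cG))≡⟨ swap₃ k(n ^ m)_ ⟩
  n ^ m * X ≡⟨ sym(ta(sn ms X)(co(_* X)(lg n m)))⟩
  sum ms(\ _ -> X)∎))
  where
  open Re
  X = k *(m *(2 *(n * non))+ cG)
  swap₃ : ∀ a b c -> a *(b * c)≡ b *(a * c)
  swap₃ = so
  p5 :(∃ \ b -> b ∈ ms × n * # ts(mt(τ b))≤ X)-> ∃ \ σ -> n * # ts(mt σ)≤ X
  p5(b , _ , h)= τ b , h

-- Increasing tuples, and sums over sets versus sums over tuples.

ks : ∀ n k -> List(Vec(Fin n)k)
ks n       zero    = [] ∷ []
ks zero(suc k)= []
ks(suc n)(suc k)= map(\ v -> zero ∷ Vc suc v)(ks n k)++ map(Vc suc)(ks n(suc k))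

l1 : ∀ n k -> length(ks n k)≡ bi n k
l1 n       zero    = refl
l1 zero(suc k)= refl
l1(suc n)(suc k)= ta(length-++(map _(ks n k)))(cn _+_
 (ta(length-map _(ks n k))(l1 n k))(ta(length-map _(ks n(suc k)))(l1 n(suc k))))

sum-ksets : ∀ n k f -> sum(ks(suc n)(suc k))f ≡
 sum(ks n k)(\ v -> f(zero ∷ Vc suc v))+ sum(ks n(suc k))(\ v -> f(Vc suc v))
sum-ksets n k f = ta(sum-++(map _(ks n k))_ f)(cn _+_(sC _(ks n k)f)(sC _(ks n(suc k))f))

sU : ∀ n k(f : Vec(Fin(suc n))k -> ℕ)-> sum(tup n k)(\ v -> f(Vc suc v))≤ sum(tup(suc n)k)f
sU n zero    f = rf
sU n(suc k)f = begin
 sum(tup n(suc k))(\ v -> f(Vc suc v))≡⟨ su(al n)k _ ⟩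
 sum(al n)(\ x -> sum(tup n k)(\ v -> f(suc x ∷ Vc suc v)))≤⟨ sm(al n)(\ x -> sU n k(\ v -> f(suc x ∷ v)))⟩
 sum(al n)(\ x -> sum(tup(suc n)k)(\ v -> f(suc x ∷ v)))≤⟨ m5 _(sum(tup(suc n)k)(\ v -> f(zero ∷ v)))⟩
 _ ≡⟨ sym(sM n(\ x -> sum(tup(suc n)k)(\ v -> f(x ∷ v))))⟩
 sum(al(suc n))(\ x -> sum(tup(suc n)k)(\ v -> f(x ∷ v)))≡⟨ sym(su(al(suc n))k f)⟩
 sum(tup(suc n)(suc k))f ∎
 where open Re

sk : ∀ n k(f : Vec(Fin n)k -> ℕ)-> sum(ks n k)f ≤ sum(tup n k)f
sk n       zero    f = rf
sk zero(suc k)f = zn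
sk(suc n)(suc k)f = begin
 sum(ks(suc n)(suc k))f ≡⟨ sum-ksets n k f ⟩
 sum(ks n k)(\ v -> f(zero ∷ Vc suc v))+ sum(ks n(suc k))(\ v -> f(Vc suc v))
  ≤⟨ m1(tr(sk n k _)(sU n k(\ v -> f(zero ∷ v))))(tr(sk n(suc k)_)(tr(re(su(al n)k _))(sm(al n)(\ x -> sU n k(\ v -> f(suc x ∷ v))))))⟩
 sum(tup(suc n)k)(\ v -> f(zero ∷ v))+ sum(al n)(\ x -> sum(tup(suc n)k)(\ v -> f(suc x ∷ v)))≡⟨ sym(sM n(\ x -> sum(tup(suc n)k)(\ v -> f(x ∷ v))))⟩
 sum(al(suc n))(\ x -> sum(tup(suc n)k)(\ v -> f(x ∷ v)))≡⟨ sym(su(al(suc n))k f)⟩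
 sum(tup(suc n)(suc k))f ∎
 where open Re

-- Functions of the underlying set, with value 0 on tuples with a repetition.
record Se{n k}(g : Vec(Fin n)k -> ℕ): Set where
 field
  sB : ∀ v i j -> g(v ⊙ sw i j)≡ g v
  vn   : ∀ v -> di v ≡ fa -> g v ≡ 0

swapIx-suc : ∀{k}(i j t : Fin k)-> lo(sw(suc i)(suc j))(suc t)≡ suc(lo(sw i j)t)
swapIx-suc i j t = ce(lw i j t)(lw(suc i)(suc j)(suc t))
 where
 ce : _ -> _ -> lo(sw(suc i)(suc j))(suc t)≡ suc(lo(sw i j)t)
 ce(i1(_ , a))(i1(_ , b))= ta b(co suc(sym a))
 ce(i1(e , a))(i0(i1(_ , b , _)))= el(b(co suc e))
 ce(i1(e , a))(i0(i0(_ , b , _)))= el(b(co suc e))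
 ce(i0(i1(_ , x , a)))(i1(e , b))= el(x(Fin.suc-injective e))
 ce(i0(i1(_ , x , a)))(i0(i1(_ , _ , b)))= ta b(co suc(sym a))
 ce(i0(i1(e , x , a)))(i0(i0(y , _ , b)))= el(y(co suc e))
 ce(i0(i0(_ , x , a)))(i1(e , b))= el(x(Fin.suc-injective e))
 ce(i0(i0(x , _ , a)))(i0(i1(e , _ , b)))= el(x(Fin.suc-injective e))
 ce(i0(i0(_ , _ , a)))(i0(i0(_ , _ , b)))= ta b(co suc(sym a))

cons-swap : ∀{A : Set}{k}(x : A)(v : Vec A k)i j ->(x ∷ v)⊙ sw(suc i)(suc j)≡ x ∷(v ⊙ sw i j)
cons-swap x v i j = lx \{zero -> ta(lu(x ∷ v)(sw(suc i)(suc j))zero)(co(lo(x ∷ v))fixed);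
 (suc t)-> ta(lu(x ∷ v)(sw(suc i)(suc j))(suc t))(ta(co(lo(x ∷ v))(swapIx-suc i j t))(sym(lu v(sw i j)t)))}
 where
 fixed : lo(sw(suc i)(suc j))zero ≡ zero
 fixed = refl

first-two : ∀{A : Set}{k}(x y : A)(v : Vec A k)->(x ∷ y ∷ v)⊙ sw zero(suc zero)≡ y ∷ x ∷ v
first-two x y v = co(\ w -> y ∷ x ∷ w)(ta(sym(Vec.tabulate-∘(lo(x ∷ y ∷ v))(\ t -> suc(suc t))))(Vec.tabulate∘lookup v))

sH : ∀{A : Set}{k}(v : Vec A k)i j -> v ⊙ sw i j ⊙ sw i j ≡ v
sH v i j = lx(\ t -> ta(lu(v ⊙ sw i j)(sw i j)t)(ta(lu v(sw i j)_)(co(lo v)(twice t(lw i j t)))))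
 where
 at-i : lo(sw i j)i ≡ j
 at-i = ce(lw i j i)
  where
  ce : _ -> lo(sw i j)i ≡ j
  ce(i1(e , a))= ta a e
  ce(i0(i1(_ , _ , a)))= a
  ce(i0(i0(x , _ , _)))= el(x refl)
 at-j : lo(sw i j)j ≡ i
 at-j = Ve j(Vec.allFin _ [ i ]≔ j)i
 twice : ∀ t -> _ -> lo(sw i j)(lo(sw i j)t)≡ t
 twice t(i1(e , a))= ta(co(lo(sw i j))a)(ta at-i(sym e))
 twice t(i0(i1(e , _ , a)))= ta(co(lo(sw i j))a)(ta at-j(sym e))
 twice t(i0(i0(_ , _ , a)))= ta(co(lo(sw i j))a)a

aU : ∀ n k(h : Vec(Fin(suc n))k -> ℕ)->(∀ v -> ou zero v ≡ tu -> h v ≡ 0)->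
 sum(tup(suc n)k)h ≡ sum(tup n k)(\ v -> h(Vc suc v))
aU n zero    h z = refl
aU n(suc k)h z = ta(su(al(suc n))k h)(ta(sM n(\ x -> sum(tup(suc n)k)(\ v -> h(x ∷ v))))(ta
 (co(_+ sum(al n)(\ x -> sum(tup(suc n)k)(\ v -> h(suc x ∷ v))))(sz(tup(suc n)k)(\ v -> z(zero ∷ v)refl)))
 (ta(sc(al n)(\ x -> aU n k(\ v -> h(suc x ∷ v))(\ v q -> z(suc x ∷ v)q)))(sym(su(al n)k _)))))

set-cons : ∀{n k}{g : Vec(Fin n)(suc k)-> ℕ}-> Se g -> ∀ x -> Se(\ v -> g(x ∷ v))
set-cons{g = g}G x = record
 {sB = \ v i j -> ta(co g(sym(cons-swap x v i j)))(Se.sB G(x ∷ v)(suc i)(suc j))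
 ; vn = \ v h -> Se.vn G(x ∷ v)(ta(co(not(ou x v)∧_)h)(zr _))}

-- A tuple that counts contains the vertex zero at most once, and by symmetry it may be moved to the
-- front from any of its places.
split-zero : ∀ n k(g : Vec(Fin(suc n))k -> ℕ)-> Se g -> ∀ k′(e : k ≡ suc k′)->
 sum(tup(suc n)k)g ≡ sum(tup n k)(\ v -> g(Vc suc v))+ suc k′ * sum(tup n k′)(\ v -> g(sb(Vec(Fin(suc n)))(sym e)(zero ∷ Vc suc v)))
split-zero n(suc k)g G .k refl = begin
 sum(tup(suc n)(suc k))g ≡⟨ su(al(suc n))k g ⟩
 sum(al(suc n))(\ x -> sum(tup(suc n)k)(\ v -> g(x ∷ v)))≡⟨ sM n(\ x -> sum(tup(suc n)k)(\ v -> g(x ∷ v)))⟩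
 sum(tup(suc n)k)(\ v -> g(zero ∷ v))+ sum(al n)(\ x -> sum(tup(suc n)k)(\ v -> g(suc x ∷ v)))≡⟨ cn _+_
  (aU n k(\ v -> g(zero ∷ v))(\ v h -> Se.vn G(zero ∷ v)(co(\ b -> not b ∧ di v)h)))(rt k refl)⟩
 T +(sum(tup n(suc k))(\ v -> g(Vc suc v))+ k * T)≡⟨ ri T _(k * T)⟩
 sum(tup n(suc k))(\ v -> g(Vc suc v))+ suc k * T ∎
 where
 open Ra
 T = sum(tup n k)(\ v -> g(zero ∷ Vc suc v))
 ri : ∀ a b c -> a +(b + c)≡ b +(a + c)
 ri = so
 rt : ∀ k₀ -> k ≡ k₀ -> sum(al n)(\ x -> sum(tup(suc n)k)(\ v -> g(suc x ∷ v)))≡ sum(tup n(suc k))(\ v -> g(Vc suc v))+ k * T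
 rt zero    refl = ta(sym(ie _))(co(_+ 0)(sym(su(al n)0 _)))
 rt(suc k′)refl = ta(sc(al n)(\ x -> split-zero n(suc k′)(\ v -> g(suc x ∷ v))(set-cons G(suc x))k′ refl))
  (ta(s3(al n)(\ x -> sum(tup n(suc k′))(\ v -> g(suc x ∷ Vc suc v)))(\ x -> suc k′ * sum(tup n k′)(\ v -> g(suc x ∷ zero ∷ Vc suc v))))(cn _+_(sym(su(al n)(suc k′)_))
  (ta(s0(al n)(suc k′)(\ x -> sum(tup n k′)(\ v -> g(suc x ∷ zero ∷ Vc suc v))))(co(suc k′ *_)(ta(sc(al n)(\ x -> sc(tup n k′)(\ v ->
   ta(sym(Se.sB G(suc x ∷ zero ∷ Vc suc v)zero(suc zero)))(co g(first-two(suc x)zero(Vc suc v))))))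
   (sym(su(al n)k′ _)))))))

map-⊙ : ∀{A B : Set}(f : A -> B){k l}(v : Vec A k)(π : Vec(Fin k)l)-> Vc f(v ⊙ π)≡ Vc f v ⊙ π
map-⊙ f v π = ta(sym(Vec.map-∘ f(lo v)π))(Vec.map-cong(\ i -> sym(Vm i f v))π)

set-suc : ∀{n k}{g : Vec(Fin(suc n))k -> ℕ}-> Se g -> Se(\ v -> g(Vc suc v))
set-suc{g = g}G = record
 {sB = \ v i j -> ta(co g(map-⊙ suc v(sw i j)))(Se.sB G(Vc suc v)i j)
 ; vn = \ v h -> Se.vn G(Vc suc v)(ta(dm v)h)}
 where
 eqF-suc : ∀{n}(x y : Fin n)-> eqF(suc x)(suc y)≡ eqF x y
 eqF-suc x y with x Fin.≟ y
 ... | yes _ = refl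
 ... | no _  = refl
 occurs-map : ∀{n k}(x : Fin n)(v : Vec(Fin n)k)-> ou(suc x)(Vc suc v)≡ ou x v
 occurs-map x []      = refl
 occurs-map x(y ∷ v)= cn _∨_(eqF-suc x y)(occurs-map x v)
 dm : ∀{n k}(v : Vec(Fin n)k)-> di(Vc suc v)≡ di v
 dm []      = refl
 dm(x ∷ v)= cn(\ a b -> not a ∧ b)(occurs-map x v)(dm v)

abstract
 ft : ℕ -> ℕ
 ft zero    = 1
 ft(suc k)= suc k * ft k

 factorial-zero : ft 0 ≡ 1
 factorial-zero = refl

 f8 : ∀ k -> ft(suc k)≡ suc k * ft k
 f8 k = refl

 f0 : ∀ k -> 1 ≤ ft k
 f0 zero    = rf
 f0(suc k)= tr(f0 k)(mm _ _)

tp : ∀ n k(g : Vec(Fin n)k -> ℕ)-> Se g -> sum(tup n k)g ≡ ft k * sum(ks n k)g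
tp n       zero    g G = sym(ta(co(_* sum(ks n 0)g)factorial-zero)(ie _))
tp zero(suc k)g G = sym(ze(ft(suc k)))
tp(suc n)(suc k)g G = begin
 sum(tup(suc n)(suc k))g ≡⟨ split-zero n(suc k)g G k refl ⟩
 sum(tup n(suc k))(\ v -> g(Vc suc v))+ suc k * sum(tup n k)(\ v -> g(zero ∷ Vc suc v))
  ≡⟨ cn(\ a b -> a + suc k * b)(tp n(suc k)_(set-suc G))(tp n k _(set-suc(set-cons G zero)))⟩
 ft(suc k)* B + suc k *(ft k * A)≡⟨ co(\ f -> f * B + suc k *(ft k * A))(f8 k)⟩
 suc k * ft k * B + suc k *(ft k * A)≡⟨ ri(suc k)(ft k)A B ⟩
 suc k * ft k *(A + B)≡⟨ co(_*(A + B))(sym(f8 k))⟩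
 ft(suc k)*(A + B)≡⟨ co(ft(suc k)*_)(sym(sum-ksets n k g))⟩
 ft(suc k)* sum(ks(suc n)(suc k))g ∎
 where
 open Ra
 A = sum(ks n k)(\ v -> g(zero ∷ Vc suc v))
 B = sum(ks n(suc k))(\ v -> g(Vc suc v))
 ri : ∀ k f a b -> k * f * b + k *(f * a)≡ k * f *(a + b)
 ri = so

-- Counting families of formulas by local states.

pd : ∀{A : Set}-> List A ->(A -> ℕ)-> ℕ
pd []       f = 1
pd(x ∷ xs)f = f x * pd xs f

pm : ∀{A : Set}(xs : List A){f g}->(∀ x -> f x ≤ g x)-> pd xs f ≤ pd xs g
pm []       h = rf
pm(x ∷ xs)h = m0(h x)(pm xs h)

prod-^ : ∀{A : Set}(xs : List A)c f -> pd xs(\ x -> c ^ f x)≡ c ^ sum xs f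
prod-^ []       c f = refl
prod-^(x ∷ xs)c f = ta(co(c ^ f x *_)(prod-^ xs c f))(sym(dr c(f x)_))

db : ∀ a b m ->(a * b)^ m ≡ a ^ m * b ^ m
db a b zero    = refl
db a b(suc m)= ta(co(a * b *_)(db a b m))(ri a b(a ^ m)(b ^ m))
 where
 ri : ∀ a b c d -> a * b *(c * d)≡ a * c *(b * d)
 ri = so

prod-pow : ∀{A : Set}(xs : List A)m f -> pd xs f ^ m ≡ pd xs(\ x -> f x ^ m)
prod-pow []       m f = ^-zeroˡ m
prod-pow(x ∷ xs)m f = ta(db(f x)_ m)(co(f x ^ m *_)(prod-pow xs m f))

prod-* : ∀{A : Set}(xs : List A)f g -> pd xs(\ x -> f x * g x)≡ pd xs f * pd xs g
prod-* []       f g = refl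
prod-*(x ∷ xs)f g = ta(co(f x * g x *_)(prod-* xs f g))(ri(f x)(g x)_ _)
 where
 ri : ∀ a b c d -> a * b *(c * d)≡ a * c *(b * d)
 ri = so

pn : ∀{A : Set}(xs : List A)c -> pd xs(\ _ -> c)≡ c ^ length xs
pn []       c = refl
pn(x ∷ xs)c = co(c *_)(pn xs c)

-- F is an exception at i if its state there is not ok; classes on which all
-- states are constant have at most X members.
module _{O I A : Set}(_≟_ :(a b : A)-> Dec(a ≡ b))(𝒢 : List O)(st : I -> O -> A)(s5 : I -> List A)
 (ok : I -> A -> Bool)(t X : ℕ)(1≤t : 1 ≤ t)where

 -- Exponential weighting: allowed states weigh 1 and the others 1/t. A member with at most m
 -- exceptions has weight at least t^-m, while the total weight factors over the places. The power
 -- of t on the left clears denominators.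
 near : ∀(Ss : List I)m(sel : O -> Bool)->
  (∀{F i}-> F ∈ 𝒢 -> sel F ≡ tu -> i ∈ Ss -> st i F ∈ s5 i)->
  (∀{F}-> F ∈ 𝒢 -> sel F ≡ tu -> # Ss(\ i -> not(ok i(st i F)))≤ m)->
  (∀ se ->(∀ F -> se F ≡ tu -> sel F ≡ tu)->
   (∀{F G i}-> F ∈ 𝒢 -> G ∈ 𝒢 -> se F ≡ tu -> se G ≡ tu -> i ∈ Ss -> st i F ≡ st i G)-> # 𝒢 se ≤ X)->
  # 𝒢 sel * t ^ length Ss ≤ X * t ^ m * pd Ss(\ i -> t * #(s5 i)(ok i)+ #(s5 i)(\ a -> not(ok i a)))
 near [] m sel cov few leaf = tr(re(it _))(tr(leaf sel(\ _ h -> h)(\ _ _ _ _()))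
  (tr(tr(re(sym(it X)))(mo X(af m 1≤t)))(re(sym(it _)))))
 near(i ∷ Ss)m sel cov few leaf = begin
  # 𝒢 sel * t ^ suc L ≤⟨ mn(t ^ suc L)sl ⟩
  sum(s5 i)(\ a -> # 𝒢(cls a))* t ^ suc L ≡⟨ sym(sD(s5 i)(t ^ suc L)_)⟩
  sum(s5 i)(\ a -> # 𝒢(cls a)* t ^ suc L)≤⟨ sm(s5 i)(\ a -> eh a(bo(ok i a)))⟩
  sum(s5 i)(\ a ->(t * bit(ok i a)+ bit(not(ok i a)))*(X * t ^ m * P))≡⟨ ta(sD(s5 i)(X * t ^ m * P)_)(co(_*(X * t ^ m * P))(ta(s3(s5 i)_ _)(co(_+ #(s5 i)(\ a -> not(ok i a)))(s0(s5 i)t _))))⟩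
  (t * #(s5 i)(ok i)+ #(s5 i)(\ a -> not(ok i a)))*(X * t ^ m * P)≡⟨ ri(t * #(s5 i)(ok i)+ #(s5 i)(\ a -> not(ok i a)))(X * t ^ m)P ⟩
  X * t ^ m *((t * #(s5 i)(ok i)+ #(s5 i)(\ a -> not(ok i a)))* P)∎
  where
  open Re
  L = length Ss
  P = pd Ss(\ i -> t * #(s5 i)(ok i)+ #(s5 i)(\ a -> not(ok i a)))
  ri : ∀ a b c -> a *(b * c)≡ b *(a * c)
  ri = so
  is : A -> O -> Bool
  is a F = does(st i F ≟ a)
  cls : A -> O -> Bool
  cls a F = sel F ∧ is a F
  is-true : ∀{a F}-> is a F ≡ tu -> st i F ≡ a
  is-true{a}{F}h with st i F ≟ a
  ... | yes e = e
  is-refl : ∀ F -> is(st i F)F ≡ tu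
  is-refl F with st i F ≟ st i F
  ... | yes e = refl
  ... | no ne = el(ne refl)
  sl : # 𝒢 sel ≤ sum(s5 i)(\ a -> # 𝒢(cls a))
  sl = tr(sj 𝒢(\{F}m -> b0(\ s -> an{p = \ a -> cls a F}(cov m s(he refl))(ai s(is-refl F)))))(aq 𝒢(s5 i)(\ F a -> cls a F))
  rec : ∀ a m′ ->(∀{F}-> F ∈ 𝒢 -> cls a F ≡ tu -> # Ss(\ i -> not(ok i(st i F)))≤ m′)-> # 𝒢(cls a)* t ^ L ≤ X * t ^ m′ * P
  rec a m′ few′ = near Ss m′(cls a)(\ m s i∈ -> cov m(ad s)(th i∈))few′
   (\ se sub s7 -> leaf se(\ F h -> ad(sub F h))(\{F∈ G∈ f g(he refl)->
    ta(is-true(ar{sel _}(sub _ f)))(sym(is-true(ar{sel _}(sub _ g)))); F∈ G∈ f g(th i∈)-> s7 F∈ G∈ f g i∈}))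
  rt : ∀{F}a -> F ∈ 𝒢 -> cls a F ≡ tu -> bit(not(ok i a))+ # Ss(\ i -> not(ok i(st i F)))≤ m
  rt{F}a F∈ s = tr(re(co(\ b -> bit(not(ok i b))+ # Ss(\ i -> not(ok i(st i F))))(sym(is-true(ar{sel F}s)))))(few F∈(ad s))
  eh : ∀ a -> ok i a ≡ tu ⊎ ok i a ≡ fa -> # 𝒢(cls a)* t ^ suc L ≤(t * bit(ok i a)+ bit(not(ok i a)))*(X * t ^ m * P)
  eh a(i1 e)= begin
   # 𝒢(cls a)* t ^ suc L ≡⟨ ri(# 𝒢(cls a))t(t ^ L)⟩
   t *(# 𝒢(cls a)* t ^ L)≤⟨ mo t(rec a m(\ F∈ s -> tr(m5 _ _)(rt a F∈ s)))⟩
   t *(X * t ^ m * P)≡⟨ co(_*(X * t ^ m * P))(ta(sym(it t))(co(\ b -> t * bit b)(sym e)))⟩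
   t * bit(ok i a)*(X * t ^ m * P)≤⟨ mn(X * t ^ m * P)(mm(t * bit(ok i a))_)⟩
   (t * bit(ok i a)+ bit(not(ok i a)))*(X * t ^ m * P)∎
  eh a(i0 e)= tr(by m refl)(mn(X * t ^ m * P)(tr(re(co(bit ∘ not)(sym e)))(m5 _(t * bit(ok i a)))))
   where
   by : ∀ m₀ -> m ≡ m₀ -> # 𝒢(cls a)* t ^ suc L ≤ 1 *(X * t ^ m * P)
   by zero refl = tr(re(co(_* t ^ suc L)empty))zn
    where
    empty : # 𝒢(cls a)≡ 0
    empty = n≤0⇒n≡0(tr(sj 𝒢{g = \ _ -> 0}(\{F}F∈ -> tr(b0{b = fa}(\ s -> el(il refl
     (tr(re(co(bit ∘ not)(sym e)))(tr(mm _ _)(rt a F∈ s))))))zn))(re(sz 𝒢(\ _ -> refl))))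
   by(suc m′)refl = begin
    # 𝒢(cls a)* t ^ suc L ≡⟨ ri(# 𝒢(cls a))t(t ^ L)⟩
    t *(# 𝒢(cls a)* t ^ L)≤⟨ mo t(rec a m′(\ F∈ s -> ≤-pred(tr(re(co(_+ _)(co(bit ∘ not)(sym e))))(rt a F∈ s))))⟩
    t *(X * t ^ m′ * P)≡⟨ rn t X(t ^ m′)P ⟩
    1 *(X * t ^ suc m′ * P)∎
    where
    rn : ∀ t x a p -> t *(x * a * p)≡ 1 *(x *(t * a)* p)
    rn = so

bernoulli : ∀ T A s ->(T + A)^ suc s ≤ T ^ suc s + suc s * A *(T + A)^ s
bernoulli T A zero    = re(ri T A)
 where
 ri : ∀ T A ->(T + A)* 1 ≡ T * 1 + 1 * A * 1
 ri = so
bernoulli T A(suc s)= begin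
 (T + A)*(T + A)^ suc s ≡⟨ *-distribʳ-+((T + A)^ suc s)T A ⟩
 T *(T + A)^ suc s + A *(T + A)^ suc s ≤⟨ m4 _(mo T(bernoulli T A s))⟩
 T *(T ^ suc s + suc s * A *(T + A)^ s)+ A *(T + A)^ suc s ≤⟨ m4 _(tr(re(rg T(T ^ suc s)(suc s * A)((T + A)^ s)))(m2(T ^ suc(suc s))(mo(suc s * A)(mn((T + A)^ s)(mm T A)))))⟩
 T ^ suc(suc s)+ suc s * A *(T + A)^ suc s + A *(T + A)^ suc s ≡⟨ rn(T ^ suc(suc s))(suc s)A((T + A)^ suc s)⟩
 T ^ suc(suc s)+ suc(suc s)* A *(T + A)^ suc s ∎
 where
 open Re
 rg : ∀ T a b c -> T *(a + b * c)≡ T * a + b *(T * c)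
 rg = so
 rn : ∀ a s A c -> a + s * A * c + A * c ≡ a + suc s * A * c
 rn = so

pow-double : ∀ T A s -> 2 *(s * A)≤ T ->(T + A)^ s ≤ 2 * T ^ s
pow-double T A zero    h = ss zn
pow-double T A(suc s)h = c6((T + A)^ suc s)_ _(begin
 (T + A)^ suc s +(T + A)^ suc s ≡⟨ dbl((T + A)^ suc s)⟩
 2 *(T + A)^ suc s ≤⟨ mo 2(bernoulli T A s)⟩
 2 *(T ^ suc s + suc s * A *(T + A)^ s)≡⟨ ri(T ^ suc s)(suc s * A)((T + A)^ s)⟩
 2 * T ^ suc s + 2 *(suc s * A)*(T + A)^ s ≤⟨ m2(2 * T ^ suc s)(mn((T + A)^ s)(tr h(mm T A)))⟩
 2 * T ^ suc s +(T + A)^ suc s ∎)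
 where
 open Re
 dbl : ∀ a -> a + a ≡ 2 * a
 dbl = so
 ri : ∀ a b c -> 2 *(a + b * c)≡ 2 * a + 2 * b * c
 ri = so

-- With t = 2^τ, τ = 2sA, the unlikely states cost at most a factor 2^(1/s) each.
near-bound : ∀{I : Set}(Ss : List I)g X m s A(a b : I -> ℕ)->(∀ i -> b i ≤ A)->(∀ i -> 1 ≤ a i)->
 g *(2 ^(2 *(s * A)))^ length Ss ≤ X *(2 ^(2 *(s * A)))^ m * pd Ss(\ i -> 2 ^(2 *(s * A))* a i + b i)->
 g ^ s ≤ X ^ s * 2 ^(2 *(s * A)* m * s + length Ss)* pd Ss a ^ s
near-bound Ss g X m s A a b b≤A 1≤a h = cf _ _((t ^ s)^ L){{m^n≢0(t ^ s)L{{m^n≢0 t s{{m^n≢0 2 τ}}}}}}(begin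
 g ^ s *(t ^ s)^ L ≡⟨ co(g ^ s *_)(ta(ao t s L)(ta(co(t ^_)(c2 s L))(sym(ao t L s))))⟩
 g ^ s *(t ^ L)^ s ≡⟨ sym(db g(t ^ L)s)⟩
 (g * t ^ L)^ s ≤⟨ m3 s h ⟩
 (X * t ^ m * pd Ss(\ i -> t * a i + b i))^ s ≤⟨ m3 s(mo(X * t ^ m)(tr(pm Ss eh)(re(prod-* Ss(\ _ -> t + A)a))))⟩
 (X * t ^ m *(pd Ss(\ _ -> t + A)* pd Ss a))^ s ≡⟨ ta(db(X * t ^ m)_ s)(cn _*_(db X(t ^ m)s)(db(pd Ss(\ _ -> t + A))_ s))⟩
 X ^ s *(t ^ m)^ s *(pd Ss(\ _ -> t + A)^ s * pd Ss a ^ s)≤⟨ mo(X ^ s *(t ^ m)^ s)(mn(pd Ss a ^ s)shrink)⟩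
 X ^ s *(t ^ m)^ s *(2 ^ L *(t ^ s)^ L * pd Ss a ^ s)≡⟨ co(\ z -> X ^ s * z *(2 ^ L *(t ^ s)^ L * pd Ss a ^ s))(ta(ao t m s)(ta(ao 2 τ(m * s))(co(2 ^_)(sym(ac τ m s)))))⟩
 X ^ s * 2 ^(τ * m * s)*(2 ^ L *(t ^ s)^ L * pd Ss a ^ s)≡⟨ ri(X ^ s)(2 ^(τ * m * s))(2 ^ L)((t ^ s)^ L)(pd Ss a ^ s)⟩
 X ^ s *(2 ^(τ * m * s)* 2 ^ L)* pd Ss a ^ s *(t ^ s)^ L ≡⟨ co(\ z -> X ^ s * z * pd Ss a ^ s *(t ^ s)^ L)(sym(dr 2(τ * m * s)L))⟩
 X ^ s * 2 ^(τ * m * s + L)* pd Ss a ^ s *(t ^ s)^ L ∎)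
 where
 open Re
 τ = 2 *(s * A)
 t = 2 ^ τ
 L = length Ss
 ri : ∀ x y z u v -> x * y *(z * u * v)≡ x *(y * z)* v * u
 ri = so
 eh : ∀ i -> t * a i + b i ≤(t + A)* a i
 eh i = tr(m2(t * a i)(tr(b≤A i)(tr(re(sym(it A)))(mo A(1≤a i)))))(re(sym(*-distribʳ-+(a i)t A)))
 shrink : pd Ss(\ _ -> t + A)^ s ≤ 2 ^ L *(t ^ s)^ L
 shrink = begin
  pd Ss(\ _ -> t + A)^ s ≡⟨ co(_^ s)(pn Ss(t + A))⟩
  ((t + A)^ L)^ s ≡⟨ ta(ao(t + A)L s)(ta(co((t + A)^_)(c2 L s))(sym(ao(t + A)s L)))⟩
  ((t + A)^ s)^ L ≤⟨ m3 L(pow-double t A s(n4 τ))⟩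
  (2 * t ^ s)^ L ≡⟨ db 2(t ^ s)L ⟩
  2 ^ L *(t ^ s)^ L ∎

wo : ∀{P : Set}-> List P -> List(List Bool)
wo []       = [] ∷ []
wo(_ ∷ ps)= map(tu ∷_)(wo ps)++ map(fa ∷_)(wo ps)

l3 : ∀{P : Set}(ps : List P)-> length(wo ps)≡ 2 ^ length ps
l3 []       = refl
l3(p ∷ ps)= ta(length-++(map(tu ∷_)(wo ps)))(cn _+_(ta(length-map _(wo ps))(l3 ps))
 (ta(ta(length-map _(wo ps))(l3 ps))(sym(ie _))))

wd : ∀{P : Set}(ps : List P)(f : P -> Bool)-> map f ps ∈ wo ps
wd []       f = he refl
wd(p ∷ ps)f with f p
... | tu  = ax(mp(tu ∷_)(wd ps f))
... | fa = ah(map(tu ∷_)(wo ps))(mp(fa ∷_)(wd ps f))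

noTrue : List Bool -> Bool
noTrue w = a2 w not

-- Allowed words: no true entry, or a single one at an admissible place. There are at most 1 + q of
-- them (`cW`), which is the factor a set with q patterns contributes.
oW : ∀{P : Set}-> List P ->(P -> Bool)-> List Bool -> Bool
oW []       q w           = tu
oW(p ∷ ps)q []          = tu
oW(p ∷ ps)q(tu ∷ w)= q p ∧ noTrue w
oW(p ∷ ps)q(fa ∷ w)= oW ps q w

cW : ∀{P : Set}(ps : List P)q -> #(wo ps)(oW ps q)≤ 1 + # ps q
cW []       q = rf
cW(p ∷ ps)q = begin
 #(wo(p ∷ ps))(oW(p ∷ ps)q)≡⟨ ta(sum-++(map(tu ∷_)(wo ps))_ _)(cn _+_(sC(tu ∷_)(wo ps)_)(sC(fa ∷_)(wo ps)_))⟩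
 #(wo ps)(\ w -> q p ∧ noTrue w)+ #(wo ps)(oW ps q)≤⟨ m1(f5(q p))(cW ps q)⟩
 bit(q p)+(1 + # ps q)≡⟨ +-suc(bit(q p))(# ps q)⟩
 1 + #(p ∷ ps)q ∎
 where
 open Re
 oy : ∀{P : Set}(ps : List P)-> #(wo ps)noTrue ≤ 1
 oy []       = rf
 oy(p ∷ ps)= tr(re(ta(sum-++(map(tu ∷_)(wo ps))_ _)(cn _+_
  (ta(sC(tu ∷_)(wo ps)_)(sz(wo ps)(\ _ -> refl)))(sC(fa ∷_)(wo ps)_))))(oy ps)
 f5 : ∀ b -> #(wo ps)(\ w -> b ∧ noTrue w)≤ bit b
 f5 tu  = oy ps
 f5 fa = re(sz(wo ps)(\ _ -> refl))

nk : ∀{P : Set}(ps : List P)(q f : P -> Bool)-> oW ps q(map f ps)≡ fa ->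
 (∃ \ p -> p ∈ ps × f p ∧ not(q p)≡ tu)⊎ 2 ≤ # ps f
nk(p ∷ ps)q f h with f p in e
... | fa with nk ps q f h
... | i1(p1 , m , r)= i1(p1 , th m , r)
... | i0 r = i0 r
nk(p ∷ ps)q f h | tu with q p in e₂
... | fa = i1(p , he refl , ai e(co not e₂))
... | tu  = i0(ss(some ps h))
 where
 some : ∀ ps -> noTrue(map f ps)≡ fa -> 1 ≤ # ps f
 some(r ∷ ps)h with f r
 ... | tu  = ss zn
 ... | fa = some ps h

-- Patterns on one set and their weights

differs : ∀{k}(p q : Vec Bool k)-> eqP p q ≡ fa -> ∃ \ i -> eqB(lo p i)(lo q i)≡ fa
differs [] []()
differs(a ∷ p)(b ∷ q)h with eqB a b in e
... | fa = zero , e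
... | tu  = let i , r = differs p q h in suc i , r

flip-char : ∀{k}(p q : Vec Bool k)i -> lo q i ≡ not(lo p i)->(∀ j -> j ≢ i -> lo q j ≡ lo p j)-> q ≡ fp i p
flip-char p q i e h = lx(\ j -> ce j(j Fin.≟ i))
 where
 ce : ∀ j -> Dec(j ≡ i)-> lo q j ≡ lo(fp i p)j
 ce j(yes refl)= ta e(sym(Ve i p _))
 ce j(no ne)= ta(h j ne)(sym(Vu ne p _))

module Patterns{n k : ℕ}(Q : Fo n k)where
 open St Q

 pe : Vec(Fin n)k -> ℕ
 pe v = #(pa k)(Q v)

 module _{v : Vec(Fin n)k}(sS : mb v ≡ fa)where
  cV : ∀{p q}i -> Q v p ≡ tu -> Q v q ≡ tu -> eqB(lo p i)(lo q i)≡ fa -> q ≡ fp i p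
  cV{p}{q}i hp hq e = flip-char p q i(ef _ _ e)(\ j ne -> ce j ne(bo(eqB(lo p j)(lo q j))))
   where
   ce : ∀ j -> j ≢ i -> eqB(lo p j)(lo q j)≡ tu ⊎ eqB(lo p j)(lo q j)≡ fa -> lo q j ≡ lo p j
   ce j ne(i1 r)= sym(eB _ _ r)
   ce j ne(i0 r)= el(te(mr p q j i ne(ef _ _ r)(ef _ _ e)hp hq)sS)

  close-dir : ∀{p q}-> Q v p ≡ tu -> Q v q ≡ tu -> eqP p q ≡ fa -> ∃ \ i -> dA i v ≡ tu × q ≡ fp i p
  close-dir{p}{q}hp hq e = let i , r = differs p q e ; c = cV i hp hq r in
   i , an{p = \ p -> Q v p ∧ Q v(fp i p)}(pt p)(ai hp(ta(co(Q v)(sym c))hq)), c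

  patterns-≤ : ∀ p q ->(∀ r -> Q v r ≡ tu -> eqP r p ≡ tu ⊎ eqP r q ≡ tu)-> pe v ≤ 2
  patterns-≤ p q h = tr(sm(pa k)one)(re(ta(s3(pa k)_ _)(cn _+_(sP p(\ _ -> 1))(sP q(\ _ -> 1)))))
   where
   one : ∀ r -> bit(Q v r)≤ bit(eqP r p)* 1 + bit(eqP r q)* 1
   one r = go(Q v r)refl
    where
    go : ∀ b -> Q v r ≡ b -> bit b ≤ bit(eqP r p)* 1 + bit(eqP r q)* 1
    go fa e = zn
    go tu  e with h r e
    ... | i1 x = tr(re(sym(co(\ b -> bit b * 1)x)))(mm _ _)
    ... | i0 x = tr(re(sym(co(\ b -> bit b * 1)x)))(m5 _ _)

  -- All patterns differ from a given p in one place. Two that differ from p in the same place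
  -- coincide; in different places, they would differ from each other twice.
  patterns-≤-2 : pe v ≤ 2
  patterns-≤-2 = ce(pe v)refl
   where
   ce : ∀ x -> pe v ≡ x -> pe v ≤ 2
   ce zero    e = tr(re e)zn
   ce(suc _)e = use(wi(pa k)(Q v)(rp(sym e)(ss zn)))
    where
    use :(∃ \ p -> p ∈ pa k × Q v p ≡ tu)-> pe v ≤ 2
    use(p , _ , hp)= second(bo(ay(pa k)(\ r -> Q v r ∧ not(eqP p r))))
     where
     second : ay(pa k)(\ r -> Q v r ∧ not(eqP p r))≡ tu ⊎ ay(pa k)(\ r -> Q v r ∧ not(eqP p r))≡ fa -> pe v ≤ 2
     second(i0 n3)= patterns-≤ p p(\ r hr -> i1(sb(\ x -> eqP x p ≡ tu)(et p r(nj(ta(n1(\ t -> te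
      (an{p = \ r -> Q v r ∧ not(eqP p r)}(pt r)(ai hr t))n3))refl)))(eP p)))
     second(i1 some)= third(ae(pa k)some)
      where
      third :(∃ \ q -> q ∈ pa k × Q v q ∧ not(eqP p q)≡ tu)-> pe v ≤ 2
      third(q , _ , hq)= patterns-≤ p q \ r hr -> dd r hr(bo(eqP p r))
       where
       pq = close-dir hp(ad hq)(nt(ar{Q v q}hq))
       dd : ∀ r -> Q v r ≡ tu -> eqP p r ≡ tu ⊎ eqP p r ≡ fa -> eqP r p ≡ tu ⊎ eqP r q ≡ tu
       dd r hr(i1 e)= i1(sb(\ x -> eqP x p ≡ tu)(et p r e)(eP p))
       dd r hr(i0 e)= i0(s7(i′ Fin.≟ i))
        where
        i = po pq
        pr = close-dir hp hr e
        i′ = po pr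
        cq = p0(p0 pq)
        cr = p0(p0 pr)
        s7 : Dec(i′ ≡ i)-> eqP r q ≡ tu
        s7(yes z)= sb(\ x -> eqP r x ≡ tu)(ta cr(ta(co(\ t -> fp t p)z)(sym cq)))(eP r)
        s7(no ne)= el(te(mr q r i i′(\ z -> ne(sym z))
         (ta(co(\ x -> lo x i)cr)(ta(Vu(\ z -> ne(sym z))p _)(ta(sym(nl _))(co not(sym(ta(co(\ x -> lo x i)cq)(Ve i p _)))))))
         (ta(co(\ x -> lo x i′)cr)(ta(Ve i′ p _)(co not(sym(ta(co(\ x -> lo x i′)cq)(Vu ne p _))))))
         (ad hq)hr)sS)

  two-patterns : 2 ≤ pe v -> ∃ \ i -> dA i v ≡ tu
  two-patterns h = use(wi(pa k)(Q v)(tr(ss zn)h))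
   where
   use :(∃ \ p -> p ∈ pa k × Q v p ≡ tu)-> ∃ \ i -> dA i v ≡ tu
   use(p , _ , hp)= second(bo(ay(pa k)(\ r -> Q v r ∧ not(eqP p r))))
    where
    second : ay(pa k)(\ r -> Q v r ∧ not(eqP p r))≡ tu ⊎ ay(pa k)(\ r -> Q v r ∧ not(eqP p r))≡ fa -> ∃ \ i -> dA i v ≡ tu
    second(i1 some)= let q , _ , hq = ae(pa k)some ; i , d , _ = close-dir hp(ad hq)(nt(ar{Q v q}hq))in i , d
    second(i0 n3)= el(il refl(tr h(tr(sm(pa k)one)(re(sP p(\ _ -> 1))))))
     where
     one : ∀ r -> bit(Q v r)≤ bit(eqP r p)* 1
     one r = go(Q v r)refl
      where
      go : ∀ b -> Q v r ≡ b -> bit b ≤ bit(eqP r p)* 1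
      go fa e = zn
      go tu  e = re(co(\ b -> bit b * 1)(sym(sb(\ x -> eqP x p ≡ tu)(et p r(nj(n1(\ t -> te
       (an{p = \ r -> Q v r ∧ not(eqP p r)}(pt r)(ai e t))n3))))(eP p))))

 two-bound : ∀ v -> bit(le 2(pe v))≤ sum(al k)(\ j -> bit(dir j v))+ bit(mb v)
 two-bound v = go(mb v)refl(le 2(pe v))refl
  where
  go : ∀ b -> mb v ≡ b -> ∀ c -> le 2(pe v)≡ c -> bit c ≤ sum(al k)(\ j -> bit(dir j v))+ bit b
  go b e fa e₂ = zn
  go tu  e tu e₂ = m5 1 _
  go fa e tu e₂ = let i , d = two-patterns e(lr e₂)in tr(tr(re(sym(co bit(ai d(co not e)))))(s4(\ j -> bit(dir j v))(aF i)))(mm _ _)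

 three-bound : ∀ v -> bit(le 3(pe v))≤ bit(mb v)
 three-bound v = b0(\ h -> fix(bo(mb v))h)
  where
  fix : mb v ≡ tu ⊎ mb v ≡ fa -> le 3(pe v)≡ tu -> mb v ≡ tu
  fix(i1 e)h = e
  fix(i0 e)h = el(il refl(tr(lr h)(patterns-≤-2 e)))

m7 : ∀ a b -> a ≤ b -> 2 ^ a ≤ 2 ^ b
m7 a b = m8 2

-- Fifth powers turn log2 3 < 8/5 into 3^5 = 243 < 256 = 2^8: in units of a fifth of a bit an empty
-- set gains 5, a set with two patterns costs 3, and more patterns are charged trivially.
pp : ∀ k q -> q ≤ 2 ^ k ->(1 + q)^ 5 * 2 ^(5 * bit(le q 0))≤ 2 ^(5 +(3 * bit(le 2 q)+ 5 * suc k * bit(le 3 q)))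
pp k 0 h = tr(re(co(\ b -> 1 * 2 ^(5 * bit b))(l4{0}{0}zn)))(m7 5(5 +(3 * bit(le 2 0)+ 5 * suc k * bit(le 3 0)))(mm 5 _))
pp k 1 h = tr(mo 32(re(co(\ b -> 2 ^(5 * bit b))(n1(\ e -> el(il refl(lr{1}{0}e)))))))(m7 5(5 +(3 * bit(le 2 1)+ 5 * suc k * bit(le 3 1)))(mm 5 _))
pp k 2 h = tr(tr(mo 243(re(co(\ b -> 2 ^(5 * bit b)){le 2 0}{fa}(n1(\ e -> a9(lr e))))))(aa 243 256 tt))
 (m7 8(5 +(3 * bit(le 2 2)+ 5 * suc k * bit(le 3 2)))(m2 5(tr(re(co(\ b -> 3 * bit b)(sym(l4{2}{2}rf))))(mm(3 * bit(le 2 2))_))))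
 where
 a9 : 2 ≤ 0 -> ⊥
 a9()
pp k q@(suc(suc(suc q′)))h = begin
 (1 + q)^ 5 * 2 ^(5 * bit(le q 0))≤⟨ m0(m3 5(tr(m1(m9 2 k)h)(re(co(2 ^ k +_)(sym(ie _))))))(re(co(\ b -> 2 ^(5 * bit b)){le q 0}{fa}(n1(\ e -> a9(lr e)))))⟩
 (2 ^ suc k)^ 5 * 1 ≡⟨ ta(it _)(ao 2(suc k)5)⟩
 2 ^(suc k * 5)≤⟨ m7(suc k * 5)(5 +(3 * bit(le 2 q)+ 5 * suc k * bit(le 3 q)))(tr(re(ta(ri(suc k))(co(\ b -> 5 * suc k * bit b)(sym(l4{3}{q}(ss(ss(ss zn))))))))(tr(m5 _(3 * bit(le 2 q)))(m5 _ 5)))⟩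
 2 ^(5 +(3 * bit(le 2 q)+ 5 * suc k * bit(le 3 q)))∎
 where
 open Re
 a9 : q ≤ 0 -> ⊥
 a9()
 ri : ∀ x -> x * 5 ≡ 5 * x * 1
 ri = so

-- Counting the formulas close to a container

Di : ∀{n k}-> List(Fo n k)-> Set
Di = AllPairs.AllPairs(\ F G -> ¬(∀ v p -> F v p ≡ G v p))

cw : ∀{n k}(𝒢 : List(Fo n k))sel -> Di 𝒢 ->
 (∀{F G}-> F ∈ 𝒢 -> G ∈ 𝒢 -> sel F ≡ tu -> sel G ≡ tu -> ∀ v p -> F v p ≡ G v p)-> # 𝒢 sel ≤ 1
cw [] sel _ s7 = zn
cw(F ∷ 𝒢)sel(a AllPairs.∷ as)s7 with sel F in e
... | fa = cw 𝒢 sel as(\ f g -> s7(th f)(th g))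
... | tu  = ss(re(n3 𝒢 a(\ m s -> s7(he refl)(th m)e s)))
 where
 n3 : ∀ 𝒢 -> All.All(\ G -> ¬(∀ v p -> F v p ≡ G v p))𝒢 ->(∀{G}-> G ∈ 𝒢 -> sel G ≡ tu -> ∀ v p -> F v p ≡ G v p)-> # 𝒢 sel ≡ 0
 n3 [] _ h = refl
 n3(G ∷ 𝒢)(b All.∷ bs)h with sel G in e₂
 ... | tu  = el(b(h(he refl)e₂))
 ... | fa = n3 𝒢 bs(h ∘ th)

sQ : ∀{A : Set}{k}(g : Vec A k -> Bool)->(∀ v i j -> g v ≡ tu -> g(v ⊙ sw i j)≡ tu)-> ∀ v i j -> g(v ⊙ sw i j)≡ g v
sQ g h v i j = go(g v)(g(v ⊙ sw i j))refl refl
 where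
 go : ∀ a b -> g v ≡ a -> g(v ⊙ sw i j)≡ b -> b ≡ a
 go tu  b e e′ = ta(sym e′)(h v i j e)
 go fa tu e e′ = ta(ta(sym(h(v ⊙ sw i j)i j e′))(co g(sH v i j)))e
 go fa fa e e′ = refl

da : ∀{n k}(v : Vec(Fin n)k)i j -> di(v ⊙ sw i j)≡ di v
da = sQ di(\ v i j h -> dc(v ⊙ sw i j)(d1 v(sw i j)(dn v h)(sd i j)))

sA : ∀{n k}{Q : Fo n k}-> Sy Q -> ∀ v p i j -> Q(v ⊙ sw i j)(p ⊙ sw i j)≡ Q v p
sA{Q = Q}s v p i j = go(Q v p)(Q(v ⊙ sw i j)(p ⊙ sw i j))refl refl
 where
 d = sd i j
 go : ∀ a b -> Q v p ≡ a -> Q(v ⊙ sw i j)(p ⊙ sw i j)≡ b -> b ≡ a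
 go tu  b e e′ = ta(sym e′)(s v p(sw i j)d e)
 go fa tu e e′ = ta(ta(sym(s _ _(sw i j)d e′))(cn Q(sH v i j)(sH p i j)))e
 go fa fa e e′ = refl

bb : ∀{k}i j(f : Vec Bool k -> ℕ)-> sum(pa k)(\ p -> f(p ⊙ sw i j))≡ sum(pa k)f
bb i j f = sum-⊙(tu ∷ fa ∷ [])(sw i j)(sd i j)(ss zn)f

ml : ∀{n k}{F : Fo n k}-> Mi F -> Sy F
ml M v p π d h = Mi.perm M v p(v ⊙ π)(p ⊙ π)h(d1 v π(Mi.dist M v p h)d)(\ i -> lo π i , lu v π i , lu p π i)

Dt : ∀{n k}-> Fo n k -> Set
Dt Q = ∀ v p -> Q v p ≡ tu -> Ds v

sX : ∀{n k}{Q : Fo n k}-> Dt Q -> ∀ v -> di v ≡ fa -> ∀ p -> Q v p ≡ fa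
sX D v h p = n1(\ e -> te(dc v(D v p e))h)

-- The number of disagreements at a tuple depends only on its set and vanishes on repetitions, so
-- its sum over tuples is k! times its sum over increasing tuples.
sW : ∀{n k}{F G : Fo n k}-> Mi F -> Mi G ->
 (∀{S}-> S ∈ ks n k -> map(F S)(pa k)≡ map(G S)(pa k))-> ∀ v p -> F v p ≡ G v p
sW{n}{k}{F}{G}MF MG s7 v p = eB _ _(n1(\ e -> il refl(t5
 (rp(sym(co(bit ∘ not)e))(rf{1}))(tr(s4(\ p -> bit(not(eqB(F v p)(G v p))))(pt p))(tr(s4 g(t1 v))(re tl))))))
 where
 g : Vec(Fin n)k -> ℕ
 g v = sum(pa k)(\ p -> bit(not(eqB(F v p)(G v p))))
 setg : Se g
 setg = record
  {sB = \ v i j -> ta(sym(bb i j _))(sc(pa k)(\ p -> cn(\ a b -> bit(not(eqB a b)))(sA(ml MF)v p i j)(sA(ml MG)v p i j)))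
  ; vn = \ v h -> sz(pa k)(\ p -> cn(\ a b -> bit(not(eqB a b)))(sX(Mi.dist MF)v h p)(sX(Mi.dist MG)v h p))}
 at-zero : ∀(f g : Vec Bool k -> Bool)ps -> map f ps ≡ map g ps -> sum ps(\ p -> bit(not(eqB(f p)(g p))))≡ 0
 at-zero f g []       e = refl
 at-zero f g(p ∷ ps)e = cn _+_(ta(co(\ x -> bit(not(eqB x(g p))))(∷-injectiveˡ e))(co(bit ∘ not)(e6(g p))))(at-zero f g ps(∷-injectiveʳ e))
 zeros : ∀ Ss ->(∀{S}-> S ∈ Ss -> g S ≡ 0)-> sum Ss g ≡ 0
 zeros []       h = refl
 zeros(S ∷ Ss)h = cn _+_(h(he refl))(zeros Ss(h ∘ th))
 tl : sum(tup n k)g ≡ 0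
 tl = ta(tp n k g setg)(ta(co(ft k *_)(zeros(ks n k)(\{S}m -> at-zero(F S)(G S)(pa k)(s7 m))))(ze(ft k)))

module _{n k}{F : Fo n k}(M : Mi F)where
 -- With the other entries fixed, at most one value of the j-th entry carries both signs: the
 -- witness of the clause at one value would satisfy one of the two clauses at any other.
 flips-few : ∀ j p -> n * #(tup n k)(\ v -> F v p ∧ F v(fp j p))≤ n ^ k
 flips-few j p = begin
  n * #(tup n k)bh ≡⟨ co(_* #(tup n k)bh)(sym(lf n))⟩
  length(al n)* #(tup n k)bh ≡⟨ sym(sh(al n)j(\ v -> bit(bh v)))⟩
  sum(tup n k)(\ u -> #(al n)(\ z -> bh(u [ j ]≔ z)))≤⟨ s2(tup n k)1(\ u -> aD(al n)(Uniq.allFin⁺ n)(\ z -> bh(u [ j ]≔ z)){tu}(\{x}{y}-> unique u x y)(\ _ -> refl))⟩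
  length(tup n k)* 1 ≡⟨ ta(it _)(lg n k)⟩
  n ^ k ∎
  where
  open Re
  bh : Vec(Fin n)k -> Bool
  bh v = F v p ∧ F v(fp j p)
  unique : ∀ u x y -> bh(u [ j ]≔ x)≡ tu -> bh(u [ j ]≔ y)≡ tu -> x ≡ y
  unique u x y hx hy = use(Mi.wit M(u [ j ]≔ x)p(ad hx))
   where
   use :(∃ \(w : Fin n -> Bool)->(∀ i -> w(lo(u [ j ]≔ x)i)≡ lo p i)×
    (∀ v′ p1 -> F v′ p1 ≡ tu ->(∀ i -> w(lo v′ i)≡ lo p1 i)-> ∀ i -> ∃ \ t -> lo v′ i ≡ lo(u [ j ]≔ x)t))-> x ≡ y
   use(w , sat , oy)= p5(bo(eqB(lo p j)(w y)))
    where
    fo : ∀ q -> F(u [ j ]≔ y)q ≡ tu -> lo q j ≡ w y ->(∀ t -> t ≢ j -> lo q t ≡ lo p t)-> x ≡ y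
    fo q hq ej eo = hit(oy(u [ j ]≔ y)q hq(\ t -> satq t(t Fin.≟ j))j)
     where
     satq : ∀ t -> Dec(t ≡ j)-> w(lo(u [ j ]≔ y)t)≡ lo q t
     satq t(yes refl)= ta(co w(Ve t u y))(sym ej)
     satq t(no ne)= ta(co w(ta(Vu ne u y)(sym(Vu ne u x))))(ta(sat t)(sym(eo t ne)))
     hit :(∃ \ t -> lo(u [ j ]≔ y)j ≡ lo(u [ j ]≔ x)t)-> x ≡ y
     hit(t , e)= at-t(t Fin.≟ j)
      where
      at-t : Dec(t ≡ j)-> x ≡ y
      at-t(yes refl)= ta(sym(Ve t u x))(ta(sym e)(Ve t u y))
      at-t(no ne)= el(ne(sym(Mi.dist M(u [ j ]≔ y)q hq j t(ta e(ta(Vu ne u x)(sym(Vu ne u y)))))))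
    p5 : eqB(lo p j)(w y)≡ tu ⊎ eqB(lo p j)(w y)≡ fa -> x ≡ y
    p5(i1 e)= fo p(ad hy)(eB _ _ e)(\ _ _ -> refl)
    p5(i0 e)= fo(fp j p)(ar{F(u [ j ]≔ y)p}hy)(ta(Ve j p _)(sym(ef _ _ e)))(\ t ne -> Vu ne p _)

 f9 : Vec(Fin n)k -> ℕ
 f9 v = sum(al k)(\ j -> #(pa k)(\ p -> F v p ∧ F v(fp j p)))

 sum-flips : n * sum(tup n k)f9 ≤ k *(2 ^ k * n ^ k)
 sum-flips = begin
  n * sum(tup n k)f9 ≡⟨ co(n *_)(ta(s1(tup n k)(al k)_)(sc(al k)(\ j -> s1(tup n k)(pa k)_)))⟩
  n * sum(al k)(\ j -> sum(pa k)(\ p -> #(tup n k)(\ v -> F v p ∧ F v(fp j p))))≡⟨ ta(sym(s0(al k)n _))(sc(al k)(\ j -> sym(s0(pa k)n _)))⟩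
  sum(al k)(\ j -> sum(pa k)(\ p -> n * #(tup n k)(\ v -> F v p ∧ F v(fp j p))))≤⟨ s2(al k)(2 ^ k * n ^ k)(\ j -> tr(s2(pa k)(n ^ k)(flips-few j))(re(co(_* n ^ k)(lh(tu ∷ fa ∷ [])k))))⟩
  length(al k)*(2 ^ k * n ^ k)≡⟨ co(_*(2 ^ k * n ^ k))(lf k)⟩
  k *(2 ^ k * n ^ k)∎
  where open Re

 en : Fo n k -> Vec(Fin n)k -> Bool
 en Q v = not(oW(pa k)(Q v)(map(F v)(pa k)))

 -- An exceptional set has a clause outside Q or two clauses. Two clauses differing at least twice
 -- are outside Q or sit on a multiple tuple of Q; those differing once are counted by `f9`, whose
 -- sum is small by minimality.
 e7 : ∀ Q -> #(ks n k)(en Q)≤ exc Q F + St.mc Q + sum(tup n k)f9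
 e7 Q = tr(sk n k _)(tr(sm(tup n k)one)(re(ta(s3(tup n k)_ _)(co(_+ sum(tup n k)f9)(s3(tup n k)_ _)))))
  where
  module SQ = St Q
  module SF = St F
  out : Vec(Fin n)k -> ℕ
  out v = #(pa k)(\ p -> F v p ∧ not(Q v p))
  use-out : ∀ v p -> F v p ≡ tu -> Q v p ≡ fa -> 1 ≤ out v
  use-out v p f q = tr(re(sym(co bit(ai f(co not q)))))(s4(\ p -> bit(F v p ∧ not(Q v p)))(pt p))
  one : ∀ v -> bit(en Q v)≤ out v + bit(SQ.mb v)+ f9 v
  one v = go(oW(pa k)(Q v)(map(F v)(pa k)))refl
   where
   go : ∀ b -> oW(pa k)(Q v)(map(F v)(pa k))≡ b -> bit(not b)≤ out v + bit(SQ.mb v)+ f9 v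
   go tu  e = zn
   go fa e with nk(pa k)(Q v)(F v)e
   ... | i1(p , m , h)= tr(use-out v p(ad h)(nt(ar{F v p}h)))(tr(mm _ _)(mm _ _))
   ... | i0 two = ce(bo(SF.mb v))
    where
    ce : SF.mb v ≡ tu ⊎ SF.mb v ≡ fa -> 1 ≤ out v + bit(SQ.mb v)+ f9 v
    ce(i0 s)= let i , d = Patterns.two-patterns F s two ; p , m , h = ae(pa k)d in
     tr(tr(re(sym(co bit h)))(tr(s4(\ p -> bit(F v p ∧ F v(fp i p)))m)(s4(\ j -> #(pa k)(\ p -> F v p ∧ F v(fp j p)))(aF i))))(m5(f9 v)_)
    ce(i1 s)= let p , _ , h0 = ae(pa k)s ; q , _ , h1 = ae(pa k)h0 ; i , _ , h₃ = ae(al k)h1 ; j , _ , h₄ = ae(al k)h₃ in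
     tr(bh p q i j h₄(bo(Q v p))(bo(Q v q)))(mm _(f9 v))
     where
     bh : ∀ p q i j -> SF.df i j p q ∧(F v p ∧ F v q)≡ tu -> Q v p ≡ tu ⊎ Q v p ≡ fa -> Q v q ≡ tu ⊎ Q v q ≡ fa -> 1 ≤ out v + bit(SQ.mb v)
     bh p q i j h(i0 a)_ = tr(use-out v p(ad{F v p}(ar{SF.df i j p q}h))a)(mm _ _)
     bh p q i j h(i1 a)(i0 b)= tr(use-out v q(ar{F v p}(ar{SF.df i j p q}h))b)(mm _ _)
     bh p q i j h(i1 a)(i1 b)= tr(re(sym(co bit(SQ.mr p q i j(\{refl -> te(eF i)(nt(ad d))})
      (ef _ _(nt(ad(ar{not(eqF i j)}d))))(ef _ _(nt(ar{not(eqB(lo p i)(lo q i))}(ar{not(eqF i j)}d))))a b))))(m5 _(out v))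
      where d = ad{SF.df i j p q}h

lD :(a b : List Bool)-> Dec(a ≡ b)
lD []      []      = yes refl
lD [](_ ∷ _)= no \()
lD(_ ∷ _)[]      = no \()
lD(a ∷ as)(b ∷ bs)with a Bool.≟ b | lD as bs
... | yes refl | yes refl = yes refl
... | no ne    | _        = no(\{refl -> ne refl})
... | _        | no ne    = no(\{refl -> ne refl})

-- `near-bound` with the word of clauses on a set as its state. The allowed words have at most one
-- clause, taken from Q, and fixing all words leaves a single formula.
cO : ∀{n k}(𝒢 : List(Fo n k))->(∀{F}-> F ∈ 𝒢 -> Mi F)-> Di 𝒢 -> ∀ sel Q x s ->
 (∀{F}(m : F ∈ 𝒢)(M : Mi F)-> sel F ≡ tu -> #(ks n k)(en M Q)≤ x)->
 # 𝒢 sel ^ s ≤ 2 ^(2 *(s * 2 ^ 2 ^ k)* x * s + bi n k)* pd(ks n k)(\ v -> 1 + #(pa k)(Q v))^ s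
cO{n}{k}𝒢 minimal different sel Q x s few = tr
 (near-bound(ks n k)(# 𝒢 sel)1 x s(2 ^ 2 ^ k)(\ v -> 1 + #(pa k)(Q v))(\ S -> #(wo(pa k))(\ a -> not(oW(pa k)(Q S)a)))(\ S -> tr(#-≤(wo(pa k))_)(re(ta(l3(pa k))(co(2 ^_)(lh(tu ∷ fa ∷ [])k)))))(\ _ -> ss zn)
  (tr(near lD 𝒢(\ S F -> map(F S)(pa k))(\ _ -> wo(pa k))(\ S -> oW(pa k)(Q S))t 1(m9 2(2 *(s * 2 ^ 2 ^ k)))(ks n k)x sel
   (\{F}{S}_ _ _ -> wd(pa k)(F S))(\ F∈ s -> few F∈(minimal F∈)s)
   (\ se _ s7 -> cw 𝒢 se different(\ f g a b -> sW(minimal f)(minimal g)(\ m -> s7 f g a b m))))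
   (mo(1 * t ^ x)(pm(ks n k)(\ S -> m4 _(mo t(cW(pa k)(Q S))))))))
 (re(ta(co(\ z -> z * E(length(ks n k))* P)(^-zeroˡ s))(ta(co(_* P)(ii(E(length(ks n k)))))(co(\ l -> E l * P)(l1 n k)))))
 where
 E : ℕ -> ℕ
 E l = 2 ^(2 *(s * 2 ^ 2 ^ k)* x * s + l)
 t = 2 ^(2 *(s * 2 ^ 2 ^ k))
 P = pd(ks n k)(\ v -> 1 + #(pa k)(Q v))^ s

-- All but a tiny fraction of the formulas are nearly unate.

wr : ∀{n k}->(Fin n -> Bool)-> Vec(Fin n)k -> Vec Bool k -> Bool
wr{k = k}σ v p = ay(al k)(\ j -> not(eqB(lo p j)(σ(lo v j))))

mf : ∀{n k}->(Fin n -> Bool)-> Fo n k -> ℕ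
mf σ F = sx(\ v p -> F v p ∧ wr σ v p)

s6 : ∀{Z c U x}q -> 1 ≤ c -> c * q ≤ Z -> Z * x ≤ c * U -> q * x ≤ U
s6{Z}{c}{U}{x}q 1≤c h0 h1 = ca c{{nn 1≤c}}(tr(re(sym(ac c q x)))(tr(mn x h0)h1))

distinctForm : ∀{n k}-> Fo n k -> Fo n k
distinctForm Q v p = di v ∧ Q v p

module Clean{n k : ℕ}(Q₀ : Fo n k)where
 Q : Fo n k
 Q = distinctForm(sy Q₀)

 symQ : Sy Q
 symQ v p π d h = ai(dc(v ⊙ π)(d1 v π(dn v(ad h))d))(closure-sym Q₀ v p π d(ar{di v}h))

 support : Dt Q
 support v p h = dn v(ad h)

 sparseQ : ∀{Z}-> Sa Q₀ Z -> Sa Q Z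
 sparseQ{Z}sp = record
  {pf = \ p q i j a b c -> ≤-<-trans(mo Z(m6(tup n k)(\ v h -> ai(ar{di v}(ad{Q v p}h))(ar{di v}(ar{Q v p}h)))))
   (Sa.pf(aK Q₀ sp)p q i j a b c)
  ; tf = \ i j p q r a b -> ≤-<-trans(mo Z(m6(tup n(suc k))(\{(z ∷ v)h -> ai(ar{di(v [ j ]≔ z)}(ad{Q(v [ j ]≔ z)p}h))
   (ai(ar{di(v [ i ]≔ z)}(ad{Q(v [ i ]≔ z)q}(ar{Q(v [ j ]≔ z)p}h)))(ar{di v}(ar{Q(v [ i ]≔ z)q}(ar{Q(v [ j ]≔ z)p}h))))})))
   (Sa.tf(aK Q₀ sp)i j p q r a b)}

 excQ : 1 ≤ n -> ∀{F}-> Mi F -> exc Q F ≤ k ^ k * exc Q₀ F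
 excQ n0{F}M = tr(sm(tup n k)(\ v -> m6(pa k)(\ p h -> ai(ad h)(drop-distinct(dc v(Mi.dist M v p(ad h)))(ar{F v p}h)))))(exc-closure Q₀ n0 M)
  where
  drop-distinct : ∀{a b}-> a ≡ tu -> not(a ∧ b)≡ tu -> not b ≡ tu
  drop-distinct refl h = h

 q : Vec(Fin n)k -> ℕ
 q v = #(pa k)(Q v)

 q-swap : ∀ v i j -> q(v ⊙ sw i j)≡ q v
 q-swap v i j = ta(sym(bb i j(\ p -> bit(Q(v ⊙ sw i j)p))))(sc(pa k)(\ p -> co bit(sA symQ v p i j)))

 q-none : ∀ v -> di v ≡ fa -> q v ≡ 0
 q-none v h = sz(pa k)(\ p -> co bit(sX support v h p))

 K = ft k
 open St Q

 empties : ℕ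
 empties = sum(ks n k)(\ v -> bit(le(q v)0))

 aL : ℕ -> ℕ
 aL c = sum(ks n k)(\ v -> bit(le c(q v)))

 empties-bound : non ≤ K * empties + #(tup n k)(\ v -> not(di v))
 empties-bound = tr(sm(tup n k)(\ v -> one(ed v)(di v)(le(q v)0)(zero-q v)))(tr(re(s3(tup n k)_ _))(m4(#(tup n k)(\ v -> not(di v)))
  (tr(re(tp n k(\ v -> bit(di v ∧ le(q v)0))setg))(mo K(sm(ks n k)(\ v -> b0(\ h -> ar{di v}h)))))))
  where
  setg : Se(\ v -> bit(di v ∧ le(q v)0))
  setg = record{sB = \ v i j -> cn(\ a b -> bit(a ∧ le b 0))(da v i j)(q-swap v i j); vn = \ v h -> co(\ a -> bit(a ∧ le(q v)0))h}
  zero-q : ∀ v -> ed v ≡ fa -> le(q v)0 ≡ tu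
  zero-q v e = l4(re(sz(pa k)(\ p -> co bit(n1(\ h -> te(an{p = Q v}(pt p)h)e)))))
  one : ∀ a d c ->(a ≡ fa -> c ≡ tu)-> bit(not a)≤ bit(d ∧ c)+ bit(not d)
  one tu  d c h = zn
  one fa tu c h rewrite h refl = ss zn
  one fa fa c h = ss zn

 atLeast-bound : ∀ c -> 1 ≤ c -> K * aL c ≤ sum(tup n k)(\ v -> bit(le c(q v)))
 atLeast-bound c 1≤c = re(sym(tp n k(\ v -> bit(le c(q v)))(record{sB = \ v i j -> co(\ a -> bit(le c a))(q-swap v i j)
  ; vn = \ v h -> co bit(n1(\ t -> il refl(t5 1≤c(tr(lr t)(re(q-none v h))))))})))

 two-total : K * aL 2 ≤ de + mc
 two-total = tr(atLeast-bound 2(ss zn))(tr(sm(tup n k)(Patterns.two-bound Q))(re(ta(s3(tup n k)_ _)(co(_+ mc)(s1(tup n k)(al k)_)))))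

 three-total : aL 3 ≤ mc
 three-total = tr(sk n k _)(sm(tup n k)(Patterns.three-bound Q))

 product-bound : pd(ks n k)(\ v -> 1 + q v)^ 5 * 2 ^(5 * empties)≤ 2 ^(5 * bi n k +(3 * aL 2 + 5 * suc k * aL 3))
 product-bound = begin
  pd(ks n k)(\ v -> 1 + q v)^ 5 * 2 ^(5 * empties)≡⟨ cn _*_(prod-pow(ks n k)5 _)(ta(co(2 ^_)(sym(s0(ks n k)5 _)))(sym(prod-^(ks n k)2 _)))⟩
  pd(ks n k)(\ v ->(1 + q v)^ 5)* pd(ks n k)(\ v -> 2 ^(5 * bit(le(q v)0)))≡⟨ sym(prod-*(ks n k)_ _)⟩
  pd(ks n k)(\ v ->(1 + q v)^ 5 * 2 ^(5 * bit(le(q v)0)))≤⟨ pm(ks n k)(\ v -> pp k(q v)(tr(#-≤(pa k)(Q v))(re(lh(tu ∷ fa ∷ [])k))))⟩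
  pd(ks n k)(\ v -> 2 ^(5 +(3 * bit(le 2(q v))+ 5 * suc k * bit(le 3(q v)))))≡⟨ prod-^(ks n k)2 _ ⟩
  2 ^ sum(ks n k)(\ v -> 5 +(3 * bit(le 2(q v))+ 5 * suc k * bit(le 3(q v))))≡⟨ co(2 ^_)(ta(s3(ks n k)(\ _ -> 5)_)(cn _+_(ta(sn(ks n k)5)(ta(co(_* 5)(l1 n k))(c2(bi n k)5)))
   (ta(s3(ks n k)(\ v -> 3 * bit(le 2(q v)))(\ v -> 5 * suc k * bit(le 3(q v))))(cn _+_(s0(ks n k)3 _)(s0(ks n k)(5 * suc k)_)))))⟩
  2 ^(5 * bi n k +(3 * aL 2 + 5 * suc k * aL 3))∎
  where open Re

-- Raising the two bounds to the powers e = 305 K and 61 K s combines them.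
combine-powers : ∀ H G P K s E N \₀ a b c U -> H ≤ 2 ^ \₀ * G -> G ^ s ≤ 2 ^(E + N)* P ^ s -> P ^ 5 * 2 ^(5 * a)≤ 2 ^(5 * N +(3 * b + c))->
 \₀ *(305 * K * s)+(E + N)*(305 * K)+ 61 * K * s *(3 * b + c)+ U ≤ 305 * K * s * a ->
 H ^(305 * K * s)* 2 ^ U ≤ 2 ^(305 * K * s * N)
combine-powers H G P K s E N \₀ a b c U hH hG hP budget = cf _ _(2 ^ X){{m^n≢0 2 X}}(begin
 H ^ M * 2 ^ U * 2 ^ X ≤⟨ mn(2 ^ X)(mn(2 ^ U)(m3 M hH))⟩
 (2 ^ \₀ * G)^ M * 2 ^ U * 2 ^ X ≡⟨ co(\ z -> z * 2 ^ U * 2 ^ X)(ta(db(2 ^ \₀)G M)(cn _*_(ao 2 \₀ M)(ta(co(G ^_)(ta(c2(305 * K)s)refl))(sym(ao G s(305 * K))))))⟩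
 2 ^(\₀ * M)*(G ^ s)^(305 * K)* 2 ^ U * 2 ^ X ≤⟨ mn(2 ^ X)(mn(2 ^ U)(mo(2 ^(\₀ * M))(m3(305 * K)hG)))⟩
 2 ^(\₀ * M)*(2 ^(E + N)* P ^ s)^(305 * K)* 2 ^ U * 2 ^ X ≡⟨ co(\ z -> 2 ^(\₀ * M)* z * 2 ^ U * 2 ^ X)(ta(db(2 ^(E + N))(P ^ s)(305 * K))(cn _*_(ao 2(E + N)(305 * K))
  (ta(ao P s(305 * K))(ta(co(P ^_)(r1 s K))(sym(ao P 5(61 * K * s)))))))⟩
 2 ^(\₀ * M)*(2 ^((E + N)*(305 * K))*(P ^ 5)^(61 * K * s))* 2 ^ U * 2 ^ X ≤⟨ mo(2 ^(\₀ * M)*(2 ^((E + N)*(305 * K))*(P ^ 5)^(61 * K * s))* 2 ^ U)(m7 X(M * a)budget)⟩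
 2 ^(\₀ * M)*(2 ^((E + N)*(305 * K))*(P ^ 5)^(61 * K * s))* 2 ^ U * 2 ^(M * a)≡⟨ co(2 ^(\₀ * M)*(2 ^((E + N)*(305 * K))*(P ^ 5)^(61 * K * s))* 2 ^ U *_)(ta(co(2 ^_)(r0 K s a))(sym(ao 2(5 * a)(61 * K * s))))⟩
 2 ^(\₀ * M)*(2 ^((E + N)*(305 * K))*(P ^ 5)^(61 * K * s))* 2 ^ U *(2 ^(5 * a))^(61 * K * s)≡⟨ r3(2 ^(\₀ * M))(2 ^((E + N)*(305 * K)))((P ^ 5)^(61 * K * s))(2 ^ U)((2 ^(5 * a))^(61 * K * s))⟩
 2 ^(\₀ * M)* 2 ^((E + N)*(305 * K))* 2 ^ U *((P ^ 5)^(61 * K * s)*(2 ^(5 * a))^(61 * K * s))≤⟨ mo(2 ^(\₀ * M)* 2 ^((E + N)*(305 * K))* 2 ^ U)(tr(re(sym(db(P ^ 5)(2 ^(5 * a))(61 * K * s))))(tr(m3(61 * K * s)hP)(re(ao 2(5 * N +(3 * b + c))(61 * K * s)))))⟩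
 2 ^(\₀ * M)* 2 ^((E + N)*(305 * K))* 2 ^ U * 2 ^((5 * N +(3 * b + c))*(61 * K * s))≡⟨ ta(co(\ z -> z * 2 ^ U * 2 ^((5 * N +(3 * b + c))*(61 * K * s)))(sym(dr 2(\₀ * M)_)))(ta(co(_* 2 ^((5 * N +(3 * b + c))*(61 * K * s)))(sym(dr 2(\₀ * M +(E + N)*(305 * K))U)))
  (sym(dr 2(\₀ * M +(E + N)*(305 * K)+ U)_)))⟩
 2 ^(\₀ * M +(E + N)*(305 * K)+ U +(5 * N +(3 * b + c))*(61 * K * s))≡⟨ co(2 ^_)(r5(\₀ * M)((E + N)*(305 * K))U N(3 * b + c)K s)⟩
 2 ^(M * N + X)≡⟨ dr 2(M * N)X ⟩
 2 ^(M * N)* 2 ^ X ∎)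
 where
 open Re
 M = 305 * K * s
 X = \₀ * M +(E + N)*(305 * K)+ 61 * K * s *(3 * b + c)+ U
 r1 : ∀ s K -> s *(305 * K)≡ 5 *(61 * K * s)
 r1 = so
 r0 : ∀ K s a -> 305 * K * s * a ≡ 5 * a *(61 * K * s)
 r0 = so
 r3 : ∀ a b c d e -> a *(b * c)* d * e ≡ a * b * d *(c * e)
 r3 = so
 r5 : ∀ x y u N z K s -> x + y + u +(5 * N + z)*(61 * K * s)≡ 305 * K * s * N +(x + y + 61 * K * s * z + u)
 r5 = so

bm : ∀ n k -> bi n k ≤ n ^ k
bm n k = tr(re(ta(sym(l1 n k))(ln(ks n k))))(tr(sk n k _)(re(ta(sym(ln(tup n k)))(lg n k))))

d3 : ∀ q U x .{{_ : NonZero q}}-> q * x ≤ U -> x ≤ U / q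
d3 q U x h = tr(re(sym(m*n/n≡m x q)))(/-monoˡ-≤ q(tr(re(c2 x q))h))

-- Families with few negative clauses and a restriction on the positive ones

iN : ∀{k}-> Vec Bool k -> Bool
iN{k}p = not(eqP p(aT k))

nS : ∀{n k}-> Fo n k -> ℕ
nS F = sx(\ v p -> F v p ∧ iN p)

ns : ∀{k}(p : Vec Bool k)-> iN p ≡ tu -> ∃ \ i -> lo p i ≡ fa
ns{k}p h = let i , e = differs p(aT k)(nt h)in i , nj(ta(sym(ef _ _ e))(Vr i tu))

n5 : ∀{n k}(F : Fo n k)-> nS F ≤ mf(\ _ -> tu)F
n5{n}{k}F = sm(tup n k)(\ v -> m6(pa k)(\ p h -> ai(ad h)(wrong v p(ns p(ar{F v p}h)))))
 where
 wrong : ∀ v p ->(∃ \ i -> lo p i ≡ fa)-> wr{n}(\ _ -> tu)v p ≡ tu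
 wrong v p(i , e)= an{p = \ j -> not(eqB(lo p j)tu)}(aF i)(co(\ b -> not(eqB b tu))e)

Po : ∀{n k}-> Fo n k -> Set
Po{n}{k}Q = ∀ v p -> Q v p ≡ tu -> p ≡ aT k

module _{n k}{F Q : Fo n k}(M : Mi F)(posQ : Po Q)(inside : ∀ v -> F v(aT k)≡ tu -> Q v(aT k)≡ tu)where
 exceptional-neg : ∀ v -> bit(en M Q v)≤ #(pa k)(\ p -> F v p ∧ iN p)
 exceptional-neg v = go(oW(pa k)(Q v)(map(F v)(pa k)))refl
  where
  fo : ∀ p -> F v p ≡ tu -> iN p ≡ tu -> 1 ≤ #(pa k)(\ p -> F v p ∧ iN p)
  fo p f g = tr(re(sym(co bit(ai f g))))(s4(\ p -> bit(F v p ∧ iN p))(pt p))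
  go : ∀ b -> oW(pa k)(Q v)(map(F v)(pa k))≡ b -> bit(not b)≤ #(pa k)(\ p -> F v p ∧ iN p)
  go tu  e = zn
  go fa e with nk(pa k)(Q v)(F v)e
  ... | i1(p , _ , h)= fo p(ad h)(na(n1(\ q -> te(ta(co(Q v)(et p _ q))(inside v(ta(co(F v)(sym(et p _ q)))(ad h))))(nt(ar{F v p}h)))))
  ... | i0 two = ce(bo(ay(pa k)(\ p -> F v p ∧ iN p)))
   where
   ce : ay(pa k)(\ p -> F v p ∧ iN p)≡ tu ⊎ ay(pa k)(\ p -> F v p ∧ iN p)≡ fa -> 1 ≤ #(pa k)(\ p -> F v p ∧ iN p)
   ce(i1 q)= let p , _ , h = ae(pa k)q in fo p(ad h)(ar{F v p}h)
   ce(i0 q)= el(il refl(tr two(tr(sm(pa k)one)(re(sP(aT k)(\ _ -> 1))))))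
    where
    one : ∀ p -> bit(F v p)≤ bit(eqP p(aT k))* 1
    one p = tr(b0(\ f -> nj(n1(\ z -> te(an{p = \ p -> F v p ∧ iN p}(pt p)(ai f z))q))))(re(sym(it _)))

-- All positive clauses lie in Q, which has no other patterns. A set outside Q thus loses its free
-- bit, while negative clauses enter only as exceptions.
gain : ∀{n k}(𝒢 : List(Fo n k))->(∀{F}-> F ∈ 𝒢 -> Mi F)-> Di 𝒢 -> ∀ sel Q x s -> Po Q ->
 (∀{F}-> F ∈ 𝒢 -> sel F ≡ tu -> nS F ≤ x ×(∀ v -> F v(aT k)≡ tu -> Q v(aT k)≡ tu))->
 # 𝒢 sel ^ s * 2 ^(s * #(ks n k)(\ v -> not(Q v(aT k))))≤ 2 ^(2 *(s * 2 ^ 2 ^ k)* x * s + bi n k + s * bi n k)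
gain{n}{k}𝒢 minimal different sel Q x s posQ ok = begin
 # 𝒢 sel ^ s * 2 ^(s * miss)≤⟨ mn(2 ^(s * miss))(cO 𝒢 minimal different sel Q x s(\{F}m M h -> tr(sk n k _)(tr(sm(tup n k)(exceptional-neg M posQ(p0(ok m h))))(po(ok m h)))))⟩
 2 ^ E * P ^ s * 2 ^(s * miss)≤⟨ mn(2 ^(s * miss))(mo(2 ^ E)(m3 s(tr(pm(ks n k)eh)(re(prod-^(ks n k)2 _)))))⟩
 2 ^ E *(2 ^ hits)^ s * 2 ^(s * miss)≡⟨ co(\ z -> 2 ^ E * z * 2 ^(s * miss))(ta(ao 2 hits s)(co(2 ^_)(c2 hits s)))⟩
 2 ^ E * 2 ^(s * hits)* 2 ^(s * miss)≡⟨ ta(co(_* 2 ^(s * miss))(sym(dr 2 E(s * hits))))(sym(dr 2(E + s * hits)(s * miss)))⟩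
 2 ^(E + s * hits + s * miss)≡⟨ co(2 ^_)(ta(+-assoc E(s * hits)(s * miss))(co(E +_)(ta(sym(d0 s hits miss))(co(s *_)tl))))⟩
 2 ^(E + s * bi n k)∎
 where
 open Re
 miss = #(ks n k)(\ v -> not(Q v(aT k)))
 hits = #(ks n k)(\ v -> Q v(aT k))
 E = 2 *(s * 2 ^ 2 ^ k)* x * s + bi n k
 P = pd(ks n k)(\ v -> 1 + #(pa k)(Q v))
 tl : hits + miss ≡ bi n k
 tl = ta(sym(s3(ks n k)_ _))(ta(sc(ks n k)(\ v -> lem(Q v(aT k))))(ta(sym(ln(ks n k)))(l1 n k)))
  where
  lem : ∀ b -> bit b + bit(not b)≡ 1
  lem tu  = refl
  lem fa = refl
 eh : ∀ v -> 1 + #(pa k)(Q v)≤ 2 ^ bit(Q v(aT k))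
 eh v = tr(ss(tr(sm(pa k)(\ p -> one p(Q v p)refl))(re(sP(aT k)(\ p -> bit(Q v p))))))(pow(Q v(aT k)))
  where
  one : ∀ p b -> Q v p ≡ b -> bit b ≤ bit(eqP p(aT k))* bit(Q v p)
  one p fa e = zn
  one p tu  e = re(sym(cn(\ a b -> bit a * bit b)(ta(co(\ z -> eqP z(aT k))(posQ v p e))(eP(aT k)))e))
  pow : ∀ b -> 1 + bit b ≤ 2 ^ bit b
  pow tu  = rf
  pow fa = rf

-- The inequality x <= 2^(bi n k - n^k / s) with the denominator cleared.
Tiny : ℕ -> ℕ -> ℕ -> ℕ -> Set
Tiny n k s x = x ^ s * 2 ^(n ^ k)≤ 2 ^(s * bi n k)

-- A positive proportion of the sets is excluded by one of few guides.
guided : ∀{n k}{B : Set}(𝒢 : List(Fo n k))->(∀{F}-> F ∈ 𝒢 -> Mi F)-> Di 𝒢 -> ∀ sel(Gs : List B)(rel : Fo n k -> B -> Bool)g γ D ->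
 1 ≤ length Gs -> length Gs ≤ 2 ^ g -> 4 * γ * g ≤ n ^ k -> 1 ≤ γ -> 2 *(4 * γ * 2 ^ 2 ^ k)*(4 * γ)≤ D ->
 (∀{F}-> F ∈ 𝒢 -> sel F ≡ tu -> D * nS F ≤ n ^ k × ay Gs(rel F)≡ tu)->
 (Q : B -> Fo n k)->(∀ b -> Po(Q b))->
 (∀{F b}-> F ∈ 𝒢 -> sel F ≡ tu -> rel F b ≡ tu ->(∀ v -> F v(aT k)≡ tu -> Q b v(aT k)≡ tu)×
  n ^ k ≤ γ * #(ks n k)(\ v -> not(Q b v(aT k))))-> Tiny n k(4 * γ)(# 𝒢 sel)
guided{n}{k}𝒢 minimal different sel Gs rel g γ D ne len hg 1≤γ hD ok Q posQ miss = p5(popular 𝒢 Gs rel sel ne(\ m h -> p0(ok m h)))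
 where
 s = 4 * γ
 τ = 2 *(s * 2 ^ 2 ^ k)
 U = n ^ k
 open Re
 p5 :(∃ \ b -> # 𝒢 sel ≤ length Gs * # 𝒢(\ F -> sel F ∧ rel F b))-> Tiny n k s(# 𝒢 sel)
 p5(b , h)= ce(# 𝒢(\ F -> sel F ∧ rel F b))refl
  where
  se : Fo n k -> Bool
  se F = sel F ∧ rel F b
  bin = bi n k
  ce : ∀ y -> # 𝒢 se ≡ y -> Tiny n k s(# 𝒢 sel)
  ce zero e = tr(re(co(\ z -> z ^ s * 2 ^ U)(n≤0⇒n≡0(tr h(re(ta(co(length Gs *_)e)(ze(length Gs))))))))(zero^ s(m0(ss(zn{3}))1≤γ))
   where
   zero^ : ∀ s -> 1 ≤ s -> 0 ^ s * 2 ^ U ≤ 2 ^(s * bin)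
   zero^(suc s)_ = zn
  ce(suc y)e = use(wi 𝒢 se(rp(sym e)(ss zn)))
   where
   1≤D : 1 ≤ D
   1≤D = tr(m0(m0(ss(zn{1}))(m0(m0(ss(zn{3}))1≤γ)(m9 2(2 ^ k))))(m0(ss(zn{3}))1≤γ))hD
   x =(U / D){{nn 1≤D}}
   miss₀ = #(ks n k)(\ v -> not(Q b v(aT k)))
   use :(∃ \ F -> F ∈ 𝒢 × se F ≡ tu)-> Tiny n k s(# 𝒢 sel)
   use(F0 , F₀∈ , h₀)= cf _ _(2 ^(2 * U)){{m^n≢0 2(2 * U)}}(begin
    # 𝒢 sel ^ s * 2 ^ U * 2 ^(2 * U)≤⟨ mn(2 ^(2 * U))(mn(2 ^ U)(m3 s(tr h(mn(# 𝒢 se)len))))⟩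
    (2 ^ g * # 𝒢 se)^ s * 2 ^ U * 2 ^(2 * U)≡⟨ co(\ z -> z * 2 ^ U * 2 ^(2 * U))(ta(db(2 ^ g)_ s)(co(_* # 𝒢 se ^ s)(ta(ao 2 g s)(co(2 ^_)(c2 g s)))))⟩
    2 ^(s * g)* # 𝒢 se ^ s * 2 ^ U * 2 ^(2 * U)≤⟨ mn(2 ^(2 * U))(mn(2 ^ U)(mn(# 𝒢 se ^ s)(m8 2 hg)))⟩
    2 ^ U * # 𝒢 se ^ s * 2 ^ U * 2 ^(2 * U)≡⟨ ta(ri(2 ^ U)(# 𝒢 se ^ s)(2 ^(2 * U)))(co(# 𝒢 se ^ s *_)(ta(co(_* 2 ^(2 * U))(sym(dr 2 U U)))(ta(sym(dr 2(U + U)(2 * U)))(co(2 ^_)(four U)))))⟩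
    # 𝒢 se ^ s * 2 ^(4 * U)≤⟨ mo(# 𝒢 se ^ s)(m8 2(tr(mo 4(p0(miss F₀∈(ad h₀)(ar{sel F0}h₀))))(re(sym(ac 4 γ miss₀)))))⟩
    # 𝒢 se ^ s * 2 ^(s * miss₀)≤⟨ gain 𝒢 minimal different se(Q b)x s(posQ b)(\{F}m q -> d3 D U(nS F){{nn 1≤D}}(po(ok m(ad q))), po(miss m(ad q)(ar{sel F}q)))⟩
    2 ^(τ * x * s + bin + s * bin)≤⟨ m8 2(tr(m4(s * bin)(m1(tr(re(rn τ x s))(tr(mn x hD)(tr(re(c2 D x))(m/n*n≤m U D{{nn 1≤D}}))))(bm n k)))(re(two U(s * bin))))⟩
    2 ^(s * bin + 2 * U)≡⟨ dr 2(s * bin)(2 * U)⟩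
    2 ^(s * bin)* 2 ^(2 * U)∎)
    where
    ri : ∀ a b c -> a * b * a * c ≡ b *(a * a * c)
    ri = so
    four : ∀ u -> u + u + 2 * u ≡ 4 * u
    four = so
    rn : ∀ τ x s -> τ * x * s ≡ τ * s * x
    rn = so
    two : ∀ u y -> u + u + y ≡ y + 2 * u
    two = so

-- Large sets of variables without positive clauses

iS : ∀{n k}->(Fin n -> Bool)-> Vec(Fin n)k -> Bool
iS w []      = tu
iS w(x ∷ v)= w x ∧ iS w v

io : ∀{n k}(w : Fin n -> Bool)(v : Vec(Fin n)k)->(∀ i -> w(lo v i)≡ tu)-> iS w v ≡ tu
io w []      h = refl
io w(x ∷ v)h = ai(h zero)(io w v(h ∘ suc))

lS : ∀{n k}(w : Fin n -> Bool)(v : Vec(Fin n)k)-> iS w v ≡ tu -> ∀ i -> w(lo v i)≡ tu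
lS w(x ∷ v)h zero    = ad h
lS w(x ∷ v)h(suc i)= lS w v(ar{w x}h)i

#-inSet : ∀{n}(w : Fin n -> Bool)k -> #(tup n k)(iS w)≡ #(al n)w ^ k
#-inSet w zero    = refl
#-inSet{n}w(suc k)= ta(su(al n)k _)(ta(sc(al n)(\ x -> ta(sc(tup n k)(\ v -> bd(w x)(iS w v)))
 (ta(s0(tup n k)(bit(w x))(\ v -> bit(iS w v)))(co(bit(w x)*_)(#-inSet w k)))))(sD(al n)(#(al n)w ^ k)(\ x -> bit(w x))))

cQ : ∀{n k}(i : Fin k)(g : Fin n -> Bool)-> n * #(tup n k)(\ u -> g(lo u i))≡ n ^ k * #(al n)g
cQ{n}{k}i g = ta(co(_* #(tup n k)(\ u -> g(lo u i)))(sym(lf n)))(ta(sym(sh(al n)i(\ u -> bit(g(lo u i)))))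
 (ta(sc(tup n k)(\ u -> sc(al n)(\ z -> co(bit ∘ g)(Ve i u z))))(ta(sn(tup n k)_)(co(_* #(al n)g)(lg n k)))))

not-onto : ∀{k}(f : Fin k -> Fin k)->(∀ i j -> f i ≡ f j -> i ≡ j)-> ∀ j ->(∀ i -> f i ≢ j)-> ⊥
not-onto{suc k}f inj j miss = il refl(Fin.injective⇒≤{f = \ i -> punchOut(\ e -> miss i(sym e))}
 (\{x}{y}e -> inj x y(Fin.punchOut-injective(\ e -> miss x(sym e))(\ e -> miss y(sym e))e)))

-- w is a large set containing no positive clause.
emptySet : ∀{n k}-> ℕ -> Fo n k -> Vec Bool n -> Bool
emptySet{n}{k}c F w = le n(c * #(al n)(lo w))∧ not(ay(tup n k)(\ v -> F v(aT k)∧ iS(lo w)v))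

ha : ∀{n k}-> ℕ -> Fo n k -> Bool
ha{n}c F = ay(allAssignments n)(emptySet c F)

module _{n k}{F : Fo n k}(M : Mi F){c}(n3 : ha c F ≡ fa)(big : c * k ≤ n)(n0 : 1 ≤ n)where
 -- The true variables of the witness of a clause that is not positive contain
 -- no positive clause, so there are few of them.
 fw : ∀ p(ε : Vec Bool k)v ->(∀ i -> lo ε i ≡ fa -> lo p i ≡ fa)->(∃ \ i -> lo ε i ≡ fa)->
  c * #(tup n k)(\ u -> F(mix ε v u)p)≤ 2 * k * n ^ k
 fw p ε v dom(i₀ , εi₀)= ce(#(tup n k)(\ u -> F(mix ε v u)p))refl
  where
  open Re
  cnt = #(tup n k)(\ u -> F(mix ε v u)p)
  ce : ∀ x -> cnt ≡ x -> c * cnt ≤ 2 * k * n ^ k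
  ce zero    e = tr(re(ta(co(c *_)e)(ze c)))zn
  ce(suc _)e = let u₀ , _ , h = wi(tup n k)(\ u -> F(mix ε v u)p)(rp(sym e)(ss zn))in use u₀ h(Mi.wit M(mix ε v u₀)p h)
   where
   use : ∀ u₀ -> F(mix ε v u₀)p ≡ tu ->(∃ \(w : Fin n -> Bool)->(∀ i -> w(lo(mix ε v u₀)i)≡ lo p i)×
    (∀ v′ p1 -> F v′ p1 ≡ tu ->(∀ i -> w(lo v′ i)≡ lo p1 i)-> ∀ i -> ∃ \ j -> lo v′ i ≡ lo(mix ε v u₀)j))-> c * cnt ≤ 2 * k * n ^ k
   use u₀ h₀(w , sat , oy)= ca n{{nn n0}}(begin
    n *(c * cnt)≤⟨ mo n(mo c(tr(m6(tup n k)hit)(aq(tup n k)(al k)(\ u i -> w(lo u i)∨ ou(lo u i)v₀))))⟩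
    n *(c * sum(al k)(\ i -> #(tup n k)(\ u -> w(lo u i)∨ ou(lo u i)v₀)))≡⟨ ta(sJ n c _)(co(c *_)(ta(sym(s0(al k)n _))(ta(sc(al k)(\ i -> cQ i(\ x -> w x ∨ ou x v₀)))(ta(sn(al k)_)(co(_*(n ^ k * W))(lf k))))))⟩
    c *(k *(n ^ k * W))≤⟨ mo c(mo k(mo(n ^ k)(tr(#-or(al n){q = w}{r = \ x -> ou x v₀}(\ x -> sl(w x)))(m2(#(al n)w)(os v₀)))))⟩
    c *(k *(n ^ k *(#(al n)w + k)))≡⟨ ri c k(n ^ k)(#(al n)w)⟩
    k * n ^ k *(c * #(al n)w + c * k)≤⟨ mo(k * n ^ k)(m1 s9 big)⟩
    k * n ^ k *(n + n)≡⟨ rn k(n ^ k)n ⟩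
    n *(2 * k * n ^ k)∎)
    where
    v₀ = mix ε v u₀
    W = #(al n)(\ x -> w x ∨ ou x v₀)
    sJ : ∀ a b c -> a *(b * c)≡ b *(a * c)
    sJ = so
    ri : ∀ c k u x -> c *(k *(u *(x + k)))≡ k * u *(c * x + c * k)
    ri = so
    rn : ∀ k u n -> k * u *(n + n)≡ n *(2 * k * u)
    rn = so
    sl : ∀ a{b}-> a ∨ b ≡ tu -> a ≡ tu ⊎ b ≡ tu
    sl tu  _ = i1 refl
    sl fa h = i0 h
    wi₀ : w(lo v₀ i₀)≡ fa
    wi₀ = ta(sat i₀)(dom i₀ εi₀)
    tab : ∀ x -> lo(tb w)x ≡ w x
    tab = Vt w
    no-clause : ay(tup n k)(\ v -> F v(aT k)∧ iS(lo(tb w))v)≡ fa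
    no-clause = n1(\ t -> let v′ , _ , q = ae(tup n k)t in a9 v′(ad q)(\ i -> ta(sym(tab _))(lS(lo(tb w))v′(ar{F v′(aT k)}q)i)))
     where
     a9 : ∀ v′ -> F v′(aT k)≡ tu ->(∀ i -> w(lo v′ i)≡ tu)-> ⊥
     a9 v′ f q = not-onto(\ i -> po(sub i))(\ i j e -> Mi.dist M v′ _ f i j(ta(p0(sub i))(ta(co(lo v₀)e)(sym(p0(sub j))))))i₀
      (\ i e -> te(q i)(ta(co w(ta(p0(sub i))(co(lo v₀)e)))wi₀))
      where sub = oy v′(aT k)f(\ i -> ta(q i)(sym(Vr i tu)))
    s9 : c * #(al n)w ≤ n
    s9 = go(bo(le n(c * #(al n)(lo(tb w)))))
     where
     go : le n(c * #(al n)(lo(tb w)))≡ tu ⊎ le n(c * #(al n)(lo(tb w)))≡ fa -> c * #(al n)w ≤ n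
     go(i1 t)= el(te(an{p = emptySet c F}(ag(tb w))(ai t(na no-clause)))n3)
     go(i0 f)= tr(re(co(c *_)(sc(al n)(\ x -> co bit(sym(tab x))))))(bf(la f))
    hit : ∀ u -> F(mix ε v u)p ≡ tu -> ay(al k)(\ i -> w(lo u i)∨ ou(lo u i)v₀)≡ tu
    hit u h = n1(\ t -> ch t)
     where
     ch : ay(al k)(\ i -> w(lo u i)∨ ou(lo u i)v₀)≡ fa -> ⊥
     ch t = let j , e = oy(mix ε v u)p h(\ i -> satu i(lo ε i)refl)i₀ in te
      (ta(co(\ x -> ou x v₀)(ta(sym(ta(lm ε v u i₀)(co(\ b -> if b then lo v i₀ else lo u i₀)εi₀)))e))(ol v₀ j))(p0(off i₀))
      where
      off : ∀ i -> w(lo u i)≡ fa × ou(lo u i)v₀ ≡ fa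
      off i = oa(n1(\ z -> te(an{p = \ i -> w(lo u i)∨ ou(lo u i)v₀}(aF i)z)t))
       where
       oa : ∀{a b}-> a ∨ b ≡ fa -> a ≡ fa × b ≡ fa
       oa{fa}h = refl , h
      satu : ∀ i b -> lo ε i ≡ b -> w(lo(mix ε v u)i)≡ lo p i
      satu i tu  e = ta(co w(ta(lm ε v u i)(ta(co(\ b -> if b then lo v i else lo u i)e)(sym(ta(lm ε v u₀ i)(co(\ b -> if b then lo v i else lo u₀ i)e))))))(sat i)
      satu i fa e = ta(co w(ta(lm ε v u i)(co(\ b -> if b then lo v i else lo u i)e)))(ta(po(off i))(sym(dom i e)))

-- The guide is the empty set w: there are only 2^n of them, while a set of size n/c contains a
-- positive proportion of all k-sets, none of which is a positive clause.
empty-sets-tiny : ∀{n k}c D(𝒢 : List(Fo n k))->(∀{F}-> F ∈ 𝒢 -> Mi F)-> Di 𝒢 -> ∀ sel -> let γ = 2 * c ^ k * ft k in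
 1 ≤ c -> 4 * γ * n ≤ n ^ k -> 2 *(4 * γ * 2 ^ 2 ^ k)*(4 * γ)≤ D -> 2 * c ^ k * #(tup n k)(\ v -> not(di v))≤ n ^ k ->
 (∀{F}-> F ∈ 𝒢 -> sel F ≡ tu -> D * nS F ≤ n ^ k × ha c F ≡ tu)-> Tiny n k(4 * γ)(# 𝒢 sel)
empty-sets-tiny{n}{k}c D 𝒢 minimal different sel 1≤c hg hD nd-small ok = guided 𝒢 minimal different sel(allAssignments n)(emptySet c)n γ D
 (rp(sym(am n))(m9 2 n))(re(am n))hg(m0(m0(ss(zn{1}))(af k 1≤c))(f0 k))hD ok
 (\ w v p -> eqP p(aT k)∧ not(iS(lo w)v))(\ w v p h -> et p _(ad h))(\{F}{w}m s r ->(\ v f -> ai(eP(aT k))(na(n1(\ z -> te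
  (an{p = \ v -> F v(aT k)∧ iS(lo w)v}(t1 v)(ai f z))(nt(ar{le n(c * #(al n)(lo w))}r)))))), enough w(lr(ad r)))
 where
 γ = 2 * c ^ k * ft k
 open Re
 enough : ∀ w -> n ≤ c * #(al n)(lo w)-> n ^ k ≤ γ * #(ks n k)(\ v -> not(eqP(aT k)(aT k)∧ not(iS(lo w)v)))
 enough w h = c6(n ^ k)_ _(begin
  n ^ k + n ^ k ≡⟨ dbl(n ^ k)⟩
  2 * n ^ k ≤⟨ mo 2(tr(m3 k h)(re(db c(#(al n)(lo w))k)))⟩
  2 *(c ^ k * #(al n)(lo w)^ k)≡⟨ ta(sym(ac 2(c ^ k)_))(co(2 * c ^ k *_)(sym(#-inSet(lo w)k)))⟩
  2 * c ^ k * #(tup n k)(iS(lo w))≤⟨ mo(2 * c ^ k)(tr(sm(tup n k)(\ v -> lem(iS(lo w)v)(di v)))(re(s3(tup n k)_ _)))⟩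
  2 * c ^ k *(#(tup n k)(\ v -> di v ∧ iS(lo w)v)+ #(tup n k)(\ v -> not(di v)))≡⟨ d0(2 * c ^ k)_ _ ⟩
  2 * c ^ k * #(tup n k)(\ v -> di v ∧ iS(lo w)v)+ 2 * c ^ k * #(tup n k)(\ v -> not(di v))≤⟨ m1(re(ta(co(2 * c ^ k *_)(tp n k(\ v -> bit(di v ∧ iS(lo w)v))setg))(sym(ac(2 * c ^ k)(ft k)_))))nd-small ⟩
  γ * #(ks n k)(\ v -> di v ∧ iS(lo w)v)+ n ^ k ≤⟨ m4(n ^ k)(mo γ(m6(ks n k)(\ v q -> ta(co(\ a -> not(a ∧ not(iS(lo w)v)))(eP(aT k)))(ta(nl _)(ar{di v}q)))))⟩
  γ * #(ks n k)(\ v -> not(eqP(aT k)(aT k)∧ not(iS(lo w)v)))+ n ^ k ∎)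
  where
  dbl : ∀ a -> a + a ≡ 2 * a
  dbl = so
  lem : ∀ a d -> bit a ≤ bit(d ∧ a)+ bit(not d)
  lem a tu  = mm _ _
  lem tu  fa = rf
  lem fa fa = zn
  setg : Se(\ v -> bit(di v ∧ iS(lo w)v))
  setg = record{sB = \ v i j -> cn(\ a b -> bit(a ∧ b))(da v i j)(sQ(iS(lo w))(\ v i j h -> io(lo w)(v ⊙ sw i j)(\ t -> ta(co(lo w)(lu v(sw i j)t))(lS(lo w)v h(lo(sw i j)t))))v i j)
   ; vn = \ v h -> co(\ a -> bit(a ∧ iS(lo w)v))h}

-- A set whose projections are all small is small compared to them
-- (a qualitative Loomis–Whitney inequality).
shadow : ∀ m q -> ∃ \ Θ -> ∀{n}-> 1 ≤ n ->(D : Fin(suc m)-> Vec(Fin n)(suc m)-> Bool)->(∀ r w z -> D r(w [ r ]≔ z)≡ D r w)->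
 (∀ r -> Θ * #(tup n(suc m))(D r)≤ n ^ suc m)->
 suc q * #(tup n(suc m))(\ w -> a2(al(suc m))(\ r -> D r w))≤ sum(al(suc m))(\ r -> #(tup n(suc m))(D r))
shadow zero q = 2 , \{n}n0 D ind s9 -> tr(re(ta(co(suc q *_)(sz(tup n 1)(\ w -> co bit(n1(\ h -> a9 n n0 D ind(s9 zero)w(ad h))))))(ze(suc q))))zn
 where
 a9 : ∀ n -> 1 ≤ n ->(D : Fin 1 -> Vec(Fin n)1 -> Bool)->(∀ r w z -> D r(w [ r ]≔ z)≡ D r w)-> 2 * #(tup n 1)(D zero)≤ n ^ 1 -> ∀ w -> D zero w ≡ tu -> ⊥
 a9 n n0 D ind s9(x ∷ [])h = il refl(tr(tr(m1 n0(rf{n}))(re(co(n +_)(sym(ie n)))))(tr(mo 2(re(sym tl)))(tr s9(re(it n)))))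
  where
  tl : #(tup n 1)(D zero)≡ n
  tl = ta(sc(tup n 1)(\{(y ∷ [])-> co bit(ta(sym(ind zero(y ∷ [])x))h)}))(ta(sym(ln(tup n 1)))(ta(lg n 1)(it n)))
shadow(suc m)q = 2 * suc q * Θ′ , main
 where
 Q = suc q
 -- The bound of `shadow` carries the factor suc q, hence the subtraction of 1. Of the factor 4 Q^2
 -- one half-share 2Q is lost in `sizeH`; the other is kept in `h2`.
 Θ′ = po(shadow m(4 * Q * Q ∸ 1))
 main : ∀{n}-> 1 ≤ n ->(D : Fin(suc(suc m))-> Vec(Fin n)(suc(suc m))-> Bool)->(∀ r w z -> D r(w [ r ]≔ z)≡ D r w)->
  (∀ r -> 2 * Q * Θ′ * #(tup n(suc(suc m)))(D r)≤ n ^ suc(suc m))->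
  Q * #(tup n(suc(suc m)))(\ w -> a2(al(suc(suc m)))(\ r -> D r w))≤ sum(al(suc(suc m)))(\ r -> #(tup n(suc(suc m)))(D r))
 main{n}n0 D ind s9 = tr(mn _(mm Q(Q + 0)))(begin
  2 * Q * #(tup n(suc(suc m)))all ≡⟨ co(2 * Q *_)(by-fibres all)⟩
  2 * Q * sum ys(\ y -> # zs(\ a -> all(a ∷ y)))≡⟨ sym(s0 ys(2 * Q)_)⟩
  sum ys(\ y -> 2 * Q * # zs(\ a -> all(a ∷ y)))≤⟨ sm ys fibre ⟩
  sum ys(\ y -> # zs(\ a -> D zero(a ∷ y))+ 2 * Q * n * bit(allH y))≡⟨ ta(s3 ys _ _)(cn _+_(sym(by-fibres(D zero)))(s0 ys(2 * Q * n)_))⟩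
  #(tup n(suc(suc m)))(D zero)+ 2 * Q * n * # ys allH ≤⟨ m2(#(tup n(suc(suc m)))(D zero))h2 ⟩
  #(tup n(suc(suc m)))(D zero)+ sum(al(suc m))(\ r -> #(tup n(suc(suc m)))(D(suc r)))≡⟨ sym(sM(suc m)(\ r -> #(tup n(suc(suc m)))(D r)))⟩
  sum(al(suc(suc m)))(\ r -> #(tup n(suc(suc m)))(D r))∎)
  where
  open Re
  zs = al n
  ys = tup n(suc m)
  all : Vec(Fin n)(suc(suc m))-> Bool
  all w = a2(al(suc(suc m)))(\ r -> D r w)
  by-fibres : ∀(p : Vec(Fin n)(suc(suc m))-> Bool)-> #(tup n(suc(suc m)))p ≡ sum ys(\ y -> # zs(\ a -> p(a ∷ y)))
  by-fibres p = ta(su zs(suc m)_)(s1 zs ys _)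
  -- If y is not heavy in some direction, its fibre has at most n/(2Q) points. A nonempty fibre is
  -- contained in a full line of `D zero`, which ignores the first coordinate, so `D zero` pays for
  -- it.
  H : Fin(suc m)-> Vec(Fin n)(suc m)-> Bool
  H r y = le n(2 * Q * # zs(\ a -> D(suc r)(a ∷ y)))
  allH : Vec(Fin n)(suc m)-> Bool
  allH y = a2(al(suc m))(\ r -> H r y)
  indH : ∀ r y z -> H r(y [ r ]≔ z)≡ H r y
  indH r y z = co(\ x -> le n(2 * Q * x))(sc zs(\ a -> co bit(ind(suc r)(a ∷ y)z)))
  sizeH : ∀ r -> n * # ys(H r)≤ 2 * Q * #(tup n(suc(suc m)))(D(suc r))
  sizeH r = begin
   n * # ys(H r)≡⟨ sym(s0 ys n _)⟩
   sum ys(\ y -> n * bit(H r y))≤⟨ sm ys(\ y -> one y(H r y)refl)⟩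
   sum ys(\ y -> 2 * Q * # zs(\ a -> D(suc r)(a ∷ y)))≡⟨ ta(s0 ys(2 * Q)_)(co(2 * Q *_)(sym(by-fibres(D(suc r)))))⟩
   2 * Q * #(tup n(suc(suc m)))(D(suc r))∎
   where
   one : ∀ y b -> H r y ≡ b -> n * bit b ≤ 2 * Q * # zs(\ a -> D(suc r)(a ∷ y))
   one y tu  e = tr(re(it n))(lr e)
   one y fa e = tr(re(ze n))zn
  h2 : 2 * Q * n * # ys allH ≤ sum(al(suc m))(\ r -> #(tup n(suc(suc m)))(D(suc r)))
  h2 = ca(2 * Q)(begin
   2 * Q *(2 * Q * n * # ys allH)≡⟨ r1 Q n(# ys allH)⟩
   n *(4 * Q * Q * # ys allH)≤⟨ mo n(r2(co(_* # ys allH)(md{1}{4 * Q * Q}(ss zn)))(p0(shadow m(4 * Q * Q ∸ 1))n0 H indH(\ r -> ca n{{nn n0}}(begin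
    n *(Θ′ * # ys(H r))≡⟨ sJ n Θ′ _ ⟩
    Θ′ *(n * # ys(H r))≤⟨ mo Θ′(sizeH r)⟩
    Θ′ *(2 * Q * #(tup n(suc(suc m)))(D(suc r)))≡⟨ r0 Θ′(2 * Q)_ ⟩
    2 * Q * Θ′ * #(tup n(suc(suc m)))(D(suc r))≤⟨ s9(suc r)⟩
    n ^ suc(suc m)∎))))⟩
   n * sum(al(suc m))(\ r -> # ys(H r))≡⟨ sym(s0(al(suc m))n(\ r -> # ys(H r)))⟩
   sum(al(suc m))(\ r -> n * # ys(H r))≤⟨ sm(al(suc m))sizeH ⟩
   sum(al(suc m))(\ r -> 2 * Q * #(tup n(suc(suc m)))(D(suc r)))≡⟨ s0(al(suc m))(2 * Q)(\ r -> #(tup n(suc(suc m)))(D(suc r)))⟩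
   2 * Q * sum(al(suc m))(\ r -> #(tup n(suc(suc m)))(D(suc r)))∎)
   where
   r1 : ∀ q n x -> 2 * q *(2 * q * n * x)≡ n *(4 * q * q * x)
   r1 = so
   r0 : ∀ a b c -> a *(b * c)≡ b * a * c
   r0 = so
   sJ : ∀ a b c -> a *(b * c)≡ b *(a * c)
   sJ = so
  fibre : ∀ y -> 2 * Q * # zs(\ a -> all(a ∷ y))≤ # zs(\ a -> D zero(a ∷ y))+ 2 * Q * n * bit(allH y)
  fibre y = go(allH y)refl
   where
   go : ∀ b -> allH y ≡ b -> 2 * Q * # zs(\ a -> all(a ∷ y))≤ # zs(\ a -> D zero(a ∷ y))+ 2 * Q * n * bit b
   go tu e = tr(tr(mo(2 * Q)(tr(#-≤ zs _)(re(lf n))))(re(sym(it _))))(m5 _(# zs(\ a -> D zero(a ∷ y))))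
   go fa e = tr(ce(# zs(\ a -> all(a ∷ y)))refl)(mm _ _)
    where
    l8 : ∃ \ r -> H r y ≡ fa
    l8 = let r , q = differing(al(suc m))e in r , q
     where
     differing : ∀ rs -> a2 rs(\ r -> H r y)≡ fa -> ∃ \ r -> H r y ≡ fa
     differing(r ∷ rs)q with H r y in eq
     ... | fa = r , eq
     ... | tu  = differing rs q
    ce : ∀ x -> # zs(\ a -> all(a ∷ y))≡ x -> 2 * Q * # zs(\ a -> all(a ∷ y))≤ # zs(\ a -> D zero(a ∷ y))
    ce zero    e = tr(re(ta(co(2 * Q *_)e)(ze(2 * Q))))zn
    ce(suc _)e = let a₀ , _ , h = wi zs(\ a -> all(a ∷ y))(rp(sym e)(ss zn)); r , l = l8 in begin
     2 * Q * # zs(\ a -> all(a ∷ y))≤⟨ mo(2 * Q)(m6 zs(\ a h -> aB{xs = al(suc(suc m))}{p = \ r -> D r(a ∷ y)}h(aF(suc r))))⟩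
     2 * Q * # zs(\ a -> D(suc r)(a ∷ y))≤⟨ bf(la l)⟩
     n ≡⟨ sym(ta(sc zs(\ a -> co bit(ta(sym(ind zero(a ∷ y)a₀))(aB{xs = al(suc(suc m))}{p = \ r -> D r(a₀ ∷ y)}h(aF zero)))))(ta(sym(ln zs))(lf n)))⟩
     # zs(\ a -> D zero(a ∷ y))∎

-- Greedy packings of blocks and rich places

gr : ∀{X : Set}->(X -> Bool)->(X -> X -> Bool)-> List X -> List X
gr vd touch []       = []
gr vd touch(x ∷ xs)= if vd x ∧ not(ay(gr vd touch xs)(touch x))then x ∷ gr vd touch xs else gr vd touch xs

module _{X : Set}(vd : X -> Bool)(touch : X -> X -> Bool)where
 gv : ∀ xs{x}-> x ∈ gr vd touch xs -> vd x ≡ tu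
 gv(y ∷ xs)m with vd y ∧ not(ay(gr vd touch xs)(touch y))in e
 gv(y ∷ xs)(he refl)| tu = ad e
 gv(y ∷ xs)(th m)| tu = gv xs m
 ... | fa = gv xs m

 ga : ∀ xs -> AllPairs.AllPairs(\ x y -> touch x y ≡ fa)(gr vd touch xs)
 ga []       = AllPairs.[]
 ga(y ∷ xs)with vd y ∧ not(ay(gr vd touch xs)(touch y))in e
 ... | fa = ga xs
 ... | tu  = All.tabulate(\{x}m -> n1(\ t -> te(an{p = touch y}m t)(nt(ar{vd y}e))))AllPairs.∷ ga xs

 gm : ∀ xs{x}-> x ∈ xs -> vd x ≡ tu -> touch x x ≡ tu -> ay(gr vd touch xs)(touch x)≡ tu
 gm(y ∷ xs)m v t with vd y ∧ not(ay(gr vd touch xs)(touch y))in e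
 gm(y ∷ xs)(he refl)v t | tu rewrite t = refl
 gm(y ∷ xs){x}(th m)v t | tu rewrite gm xs m v t = ∨-zeroʳ(touch x y)
 gm(y ∷ xs)(he refl)v t | fa = nj(ta(sym(strip v))e)
  where
  strip : ∀{a b}-> a ≡ tu -> a ∧ b ≡ b
  strip refl = refl
 gm(y ∷ xs)(th m)v t | fa = gm xs m v t

gc : ∀{X : Set}{vd valid′ : X -> Bool}touch ->(∀ x -> vd x ≡ valid′ x)-> ∀ xs -> gr vd touch xs ≡ gr valid′ touch xs
gc touch h []       = refl
gc touch h(x ∷ xs)rewrite h x | gc touch h xs = refl

-- Equality of underlying sets, for tuples without repetition; one inclusion suffices as both have k
-- elements.
sim : ∀{n k}-> Vec(Fin n)k -> Vec(Fin n)k -> Bool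
sim{k = k}v t = di v ∧(di t ∧ iS(\ x -> ou x t)v)

module _{n k}{v t : Vec(Fin n)k}(h : sim v t ≡ tu)where
 si : Ds v
 si = dn v(ad h)

 aM : Ds t
 aM = dn t(ad{di t}(ar{di v}h))

 aX : ∀ i -> ∃ \ j -> lo v i ≡ lo t j
 aX i = oe t(lS(\ x -> ou x t)v(ar{di t}(ar{di v}h))i)

bq : ∀{n k}(v t : Vec(Fin n)k)-> Ds v -> Ds t ->(∀ i -> ∃ \ j -> lo v i ≡ lo t j)-> sim v t ≡ tu
bq v t dv dt h = ai(dc v dv)(ai(dc t dt)(io _ v(\ i -> let j , e = h i in ta(co(\ x -> ou x t)e)(ol t j))))

sim-refl : ∀{n k}(v : Vec(Fin n)k)-> Ds v -> sim v v ≡ tu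
sim-refl v d = bq v v d d(\ i -> i , refl)

sim-trans : ∀{n k}{u v t : Vec(Fin n)k}-> sim u v ≡ tu -> sim v t ≡ tu -> sim u t ≡ tu
sim-trans{u = u}{v}{t}a b = bq u t(si{v = u}{v}a)(aM{v = v}{t}b)(\ i -> let j , e = aX{v = u}{v}a i ; l , f = aX{v = v}{t}b j in l , ta e f)

sim-sym : ∀{n k}{v t : Vec(Fin n)k}-> sim v t ≡ tu -> sim t v ≡ tu
sim-sym{v = v}{t}h = bq t v(aM{v = v}{t}h)(si{v = v}{t}h)(\ i -> oe v(n1(\ e -> not-onto(\ j -> po(aX{v = v}{t}h j))
 (\ a b q -> si{v = v}{t}h a b(ta(p0(aX{v = v}{t}h a))(ta(co(lo t)q)(sym(p0(aX{v = v}{t}h b))))))i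
 (\ j q -> te(ta(co(\ x -> ou x v)(sym(ta(p0(aX{v = v}{t}h j))(co(lo t)q))))(ol v j))e))))

sim-swap : ∀{n k}(v : Vec(Fin n)k)i j -> Ds v -> sim(v ⊙ sw i j)v ≡ tu
sim-swap v i j d = bq(v ⊙ sw i j)v(d1 v(sw i j)d(sd i j))d(\ t -> lo(sw i j)t , lu v(sw i j)t)

minimal-sim : ∀{n k}{F : Fo n k}-> Mi F -> ∀{v t}-> F v(aT k)≡ tu -> sim t v ≡ tu -> F t(aT k)≡ tu
minimal-sim M{v}{t}f h = Mi.perm M v _ t _ f(si{v = t}{v}h)(\ i -> let j , e = aX{v = t}{v}h i in j , e , ta(Vr i tu)(sym(Vr j tu)))

#-sim : ∀{n k}(t : Vec(Fin n)k)-> #(tup n k)(\ v -> sim v t)≤ k ^ k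
#-sim{n}{k}t = tr(m6(tup n k)(\ v h -> ar{di t}(ar{di v}h)))(tr(re(#-inSet(\ x -> ou x t)k))(m3 k(os t)))

ke : ∀{n k}(t : Vec(Fin n)k)-> Ds t -> ∃ \ S -> S ∈ ks n k × sim S t ≡ tu
ke{n}{k}t d = wi(ks n k)(\ v -> sim v t)(f1(ft k)_(rf{1})(tr(tr(re(sym(co bit(sim-refl t d))))(s4(\ v -> bit(sim v t))(t1 t)))
 (re(tp n k(\ v -> bit(sim v t))(record{sB = \ v i j -> co bit(sQ(\ v -> sim v t)(\ v i j h -> sim-trans{u = v ⊙ sw i j}{v}{t}(sim-swap v i j(si{v = v}{t}h))h)v i j)
  ; vn = \ v h -> co(\ b -> bit(b ∧(di t ∧ iS(\ x -> ou x t)v)))h})))))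

-- Blocks: if all their sets were positive clauses, the first would be redundant.
Block : ℕ -> ℕ -> Set
Block n k =(Vec(Fin n)k × Vec Bool k)×(Vec(Fin n)k × Fin k)

module _{n k : ℕ}where
 -- A block starts from a clause (v , p) with a negative literal and fresh vertices u. The core
 -- replaces the negative vertices of v by those of u, and a side puts one negative vertex of v
 -- back, at position r.
 core : Block n k -> Vec(Fin n)k
 core((v , p),(u , r))= mix p v u

 side : Block n k -> Fin k -> Vec(Fin n)k
 side b@((v , p),(u , r))i = core b [ r ]≔ lo v i

 inB : Block n k -> Vec(Fin n)k -> Bool
 inB b@((v , p), _)t = sim t(core b)∨ ay(al k)(\ i -> not(lo p i)∧ sim t(side b i))

 fh : Vec(Fin n)k -> Vec(Fin n)k -> Bool
 fh v u = di u ∧ not(ay(al k)(\ j -> ou(lo u j)v))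

 vB : Fo n k -> Block n k -> Bool
 vB F((v , p),(u , r))=(F v p ∧ iN p)∧ fh v u

 tc : Block n k -> Block n k -> Bool
 tc b b′ = ay(ks n k)(\ S -> inB b S ∧ inB b′ S)

 blocks : List(Block n k)
 blocks = ct(ct(tup n k)(pa k))(ct(tup n k)(al k))

 abstract
  pc : Fo n k -> List(Block n k)
  pc F = gr(vB F)tc blocks

  packing-valid : ∀ F{b}-> b ∈ pc F -> vB F b ≡ tu
  packing-valid F = gv(vB F)tc blocks

  packing-apart : ∀ F -> AllPairs.AllPairs(\ b b′ -> tc b b′ ≡ fa)(pc F)
  packing-apart F = ga(vB F)tc blocks

  packing-maximal : ∀ F v p u r -> let b =((v , p),(u , r))in vB F b ≡ tu -> tc b b ≡ tu -> ay(pc F)(tc b)≡ tu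
  packing-maximal F v p u r = gm(vB F)tc blocks(ci(ci(t1 v)(pt p))(ci(t1 u)(aF r)))

  packing-cong : ∀ F G ->(∀ v p -> iN p ≡ tu -> F v p ≡ G v p)-> pc F ≡ pc G
  packing-cong F G h = gc tc(\{((v , p),(u , r))-> co(_∧ fh v u)(s7 v p(iN p)refl)})blocks
   where
   s7 : ∀ v p b -> iN p ≡ b -> F v p ∧ b ≡ G v p ∧ b
   s7 v p tu  e = co(_∧ tu)(h v p e)
   s7 v p fa e = ta(zr(F v p))(sym(zr(G v p)))

 c4 : Fo n k -> Vec(Fin n)k -> Bool
 c4 F t = ay(pc F)(\ b -> inB b t)

 θ : ℕ
 θ = 2 * suc k

 -- Rich: for a fraction 1/θ of all u, filling the false positions of ε from u gives a covered set.
 -- Only the entries of v at true positions matter. The value θ = 2(k + 1) is tuned to `rh`, where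
 -- half of all u are fresh and k + 1 alternatives compete.
 rc : Fo n k -> Vec Bool k -> Vec(Fin n)k -> Bool
 rc F ε v = le(n ^ k)(θ * #(tup n k)(\ u -> c4 F(mix ε v u)))

 oi : ∀ a{b}-> a ∨ b ≡ tu -> a ≡ tu ⊎ b ≡ tu
 oi tu  _ = i1 refl
 oi fa h = i0 h

 or-r : ∀{a b}-> b ≡ tu -> a ∨ b ≡ tu
 or-r{a}refl = ∨-zeroʳ a

 or-l : ∀{a b}-> a ≡ tu -> a ∨ b ≡ tu
 or-l refl = refl

 inB-sim : ∀ b{t t′}-> inB b t ≡ tu -> sim t′ t ≡ tu -> inB b t′ ≡ tu
 inB-sim b@((v , p), _){t}{t′}h s = ce(oi(sim t(core b))h)
  where
  ce : sim t(core b)≡ tu ⊎ ay(al k)(\ i -> not(lo p i)∧ sim t(side b i))≡ tu -> inB b t′ ≡ tu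
  ce(i1 e)= or-l(sim-trans{u = t′}{t}{core b}s e)
  ce(i0 e)= let i , m , q = ae(al k)e in or-r{sim t′(core b)}(an{p = \ i -> not(lo p i)∧ sim t′(side b i)}m
   (ai(ad{not(lo p i)}q)(sim-trans{u = t′}{t}{side b i}s(ar{not(lo p i)}q))))

 inB-distinct : ∀ b{t}-> inB b t ≡ tu -> Ds t
 inB-distinct b@((v , p), _){t}h = ce(oi(sim t(core b))h)
  where
  ce : sim t(core b)≡ tu ⊎ ay(al k)(\ i -> not(lo p i)∧ sim t(side b i))≡ tu -> Ds t
  ce(i1 e)= si{v = t}{core b}e
  ce(i0 e)= let i , m , q = ae(al k)e in si{v = t}{side b i}(ar{not(lo p i)}q)

 blockSize = suc k * k ^ k

 #-inB : ∀ b -> #(tup n k)(inB b)≤ blockSize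
 #-inB b@((v , p), _)= tr(#-or(tup n k){q = \ t -> sim t(core b)}{r = \ t -> ay(al k)(\ i -> not(lo p i)∧ sim t(side b i))}(\ t h -> oi(sim t(core b))h))(m1(#-sim(core b))
  (tr(aq(tup n k)(al k)(\ t i -> not(lo p i)∧ sim t(side b i)))(tr(s2(al k)(k ^ k)(\ i -> tr(m6(tup n k)(\ t h -> ar{not(lo p i)}h))(#-sim(side b i))))(re(co(_* k ^ k)(lf k))))))

 #-cover : ∀ F -> #(tup n k)(c4 F)≤ length(pc F)* blockSize
 #-cover F = tr(aq(tup n k)(pc F)(\ t b -> inB b t))(s2(pc F)blockSize #-inB)

 cover-swap : ∀ F t i j -> c4 F(t ⊙ sw i j)≡ c4 F t
 cover-swap F = sQ(c4 F)(\ t i j h -> let b , m , q = ae(pc F)h in an{p = \ b -> inB b(t ⊙ sw i j)}m(inB-sim b{t}{t ⊙ sw i j}q(sim-swap t i j(inB-distinct b{t}q))))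

 rich-cong : ∀ F ε{v v′}->(∀ t -> lo ε t ≡ tu -> lo v t ≡ lo v′ t)-> rc F ε v ≡ rc F ε v′
 rich-cong F ε{v}{v′}h = co(\ x -> le(n ^ k)(θ * x))(sc(tup n k)(\ u -> co(\ t -> bit(c4 F t))(me ε v v′ u h)))
  where
  me : ∀{k}(ε : Vec Bool k)(v v′ u : Vec(Fin n)k)->(∀ t -> lo ε t ≡ tu -> lo v t ≡ lo v′ t)-> mix ε v u ≡ mix ε v′ u
  me []          []      []        []      h = refl
  me(tu ∷ ε)(x ∷ v)(x′ ∷ v′)(y ∷ u)h = cn _∷_(h zero refl)(me ε v v′ u(h ∘ suc))
  me(fa ∷ ε)(x ∷ v)(x′ ∷ v′)(y ∷ u)h = co(y ∷_)(me ε v v′ u(h ∘ suc))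

 ru : ∀ F ε v i z -> lo ε i ≡ fa -> rc F ε(v [ i ]≔ z)≡ rc F ε v
 ru F ε v i z e = rich-cong F ε{v [ i ]≔ z}{v}(\ t q -> Vu(\{refl -> te q e})v z)

 rich-mix : ∀ F ε v u -> rc F ε(mix ε v u)≡ rc F ε v
 rich-mix F ε v u = rich-cong F ε{mix ε v u}{v}(\ t q -> ta(lm ε v u t)(co(\ b -> if b then lo v t else lo u t)q))

 #-rich : 1 ≤ n -> ∀ F ε -> #(tup n k)(rc F ε)≤ θ * #(tup n k)(c4 F)
 #-rich n0 F ε = ca(n ^ k){{nn(af k n0)}}(begin
  n ^ k * #(tup n k)(rc F ε)≡⟨ sym(s0(tup n k)(n ^ k)_)⟩
  sum(tup n k)(\ v -> n ^ k * bit(rc F ε v))≤⟨ sm(tup n k)(\ v -> one v(rc F ε v)refl)⟩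
  sum(tup n k)(\ v -> θ * #(tup n k)(\ u -> c4 F(mix ε v u)))≡⟨ ta(s0(tup n k)θ _)(co(θ *_)(ta(aV(al n)ε(\ t -> bit(c4 F t)))(co(\ l -> l ^ k * #(tup n k)(c4 F))(lf n))))⟩
  θ *(n ^ k * #(tup n k)(c4 F))≡⟨ sJ θ(n ^ k)_ ⟩
  n ^ k *(θ * #(tup n k)(c4 F))∎)
  where
  open Re
  sJ : ∀ a b c -> a *(b * c)≡ b *(a * c)
  sJ = so
  one : ∀ v b -> rc F ε v ≡ b -> n ^ k * bit b ≤ θ * #(tup n k)(\ u -> c4 F(mix ε v u))
  one v tu  e = tr(re(it(n ^ k)))(lr e)
  one v fa e = tr(re(ze(n ^ k)))zn

 -- The mask of a side: after exchanging positions r and i, the side at i is again a mixture of v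
 -- with fresh vertices (`mask-side`).
 mk : Vec Bool k -> Fin k -> Fin k -> Vec Bool k
 mk p r i = p [ r ]≔ fa [ i ]≔ tu

 mask-side : ∀(v u : Vec(Fin n)k)p r i -> lo p i ≡ fa ->(mix p v u [ r ]≔ lo v i)⊙ sw r i ≡ mix(mk p r i)v(u ⊙ sw r i)
 mask-side v u p r i pi = lx(\ t -> ta(lu(mix p v u [ r ]≔ lo v i)(sw r i)t)(ta(go t(lw r i t))(sym(lm(mk p r i)v(u ⊙ sw r i)t))))
  where
  X = mix p v u [ r ]≔ lo v i
  go : ∀ t -> _ -> lo X(lo(sw r i)t)≡(if lo(mk p r i)t then lo v t else lo(u ⊙ sw r i)t)
  go t(i1(refl , e))rewrite e | Ve t(p [ r ]≔ fa)tu = Ve r(mix p v u)(lo v t)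
  go t(i0(i1(refl , ne , e)))rewrite Vu ne(p [ t ]≔ fa)tu | Ve t p fa | lu u(sw t i)t | e =
   ta(Vu(\ q -> ne(sym q))(mix p v u)(lo v i))(ta(lm p v u i)(co(\ b -> if b then lo v i else lo u i)pi))
  go t(i0(i0(a , b , e)))rewrite Vu b(p [ r ]≔ fa)tu | Vu a p fa | lu u(sw r i)t | e =
   ta(Vu a(mix p v u)(lo v i))(lm p v u t)

 module _(v u : Vec(Fin n)k)(p : Vec Bool k)(dv : Ds v)(fr : fh v u ≡ tu)where
  off : ∀ i j -> lo v i ≢ lo u j
  off i j e = te(an{p = \ j -> ou(lo u j)v}(aF j)(ta(co(\ x -> ou x v)(sym e))(ol v i)))(nt(ar{di u}fr))

  cL : Ds(mix p v u)
  cL i j e = go(lo p i)(lo p j)(ta(sym(lm p v u i))(ta e(lm p v u j)))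
   where
   go : ∀ a b ->(if a then lo v i else lo u i)≡(if b then lo v j else lo u j)-> i ≡ j
   go tu  tu  q = dv i j q
   go tu  fa q = el(off i j q)
   go fa tu  q = el(off j i(sym q))
   go fa fa q = dn u(ad fr)i j q

  cN : ∀ i j -> lo p i ≡ fa -> lo v i ≢ lo(mix p v u)j
  cN i j pi e = go(lo p j)refl(ta e(lm p v u j))
   where
   go : ∀ b -> lo p j ≡ b -> lo v i ≡(if b then lo v j else lo u j)-> ⊥
   go tu  pj q = te(ta(co(lo p)(dv i j q))pj)pi
   go fa pj q = off i j q

  side-distinct : ∀ r i -> lo p i ≡ fa -> Ds(mix p v u [ r ]≔ lo v i)
  side-distinct r i pi a b e = go(a Fin.≟ r)(b Fin.≟ r)
   where
   miss = Vu
   go : Dec(a ≡ r)-> Dec(b ≡ r)-> a ≡ b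
   go(yes refl)(yes refl)= refl
   go(yes refl)(no z)= el(cN i b pi(ta(sym(Ve a(mix p v u)(lo v i)))(ta e(miss z(mix p v u)_))))
   go(no z)(yes refl)= el(cN i a pi(ta(sym(Ve b(mix p v u)(lo v i)))(ta(sym e)(miss z(mix p v u)_))))
   go(no y)(no z)= cL a b(ta(sym(miss y(mix p v u)_))(ta e(miss z(mix p v u)_)))

 module _{F : Fo n k}(M : Mi F)where
  valid-distinct : ∀{v p u r}-> vB F((v , p),(u , r))≡ tu -> Ds v
  valid-distinct{v}{p}h = Mi.dist M v p(ad(ad{F v p ∧ iN p}h))

  -- Suppose all sets of the block are positive clauses. The witness of the core cannot make a
  -- negative vertex v_i true, or it would satisfy the side at i; so these vertices are false and it
  -- satisfies (v , p). Both clauses reach outside the core.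
  block-avoid : ∀ b -> vB F b ≡ tu ->(∀{S}-> S ∈ ks n k -> inB b S ≡ tu -> F S(aT k)≡ tu)-> ⊥
  block-avoid b@((v , p),(u , r))h all = use(Mi.wit M Γ pos(pv Γ(cL v u p dv fr)(\ S e -> or-l e)))
   where
   pos = aT k
   fr = ar{F v p ∧ iN p}h
   dv = valid-distinct{v}{p}{u}{r}h
   Γ = mix p v u
   pv : ∀ t -> Ds t ->(∀ S -> sim S t ≡ tu -> inB b S ≡ tu)-> F t pos ≡ tu
   pv t d q = let S , m , e = ke t d in minimal-sim M{S}{t}(all m(q S e))(sim-sym{v = S}{t}e)
   use :(∃ \(w : Fin n -> Bool)->(∀ i -> w(lo Γ i)≡ lo pos i)×(∀ v′ p1 -> F v′ p1 ≡ tu ->(∀ i -> w(lo v′ i)≡ lo p1 i)-> ∀ i -> ∃ \ j -> lo v′ i ≡ lo Γ j))-> ⊥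
   use(w , sat , oy)= let i₀ , e₀ = ns p(ar{F v p}(ad{F v p ∧ iN p}h)); j , e = oy v p(ad(ad{F v p ∧ iN p}h))(\ i -> satv i(lo p i)refl)i₀ in
    cN v u p dv fr i₀ j e₀ e
    where
    one : ∀ i -> w(lo Γ i)≡ tu
    one i = ta(sat i)(Vr i tu)
    satv : ∀ i b -> lo p i ≡ b -> w(lo v i)≡ lo p i
    satv i tu  e = ta(co w(sym(ta(lm p v u i)(co(\ b -> if b then lo v i else lo u i)e))))(ta(one i)(sym e))
    satv i fa e = ta(n1(\ t -> hit t(oy(side b i)pos(pv(side b i)(side-distinct v u p dv fr r i e)(\ S s -> or-r{sim S Γ}(an{p = \ i -> not(lo p i)∧ sim S(side b i)}(aF i)(ai(co not e)s))))
     (\ l -> ta(true-at t l(l Fin.≟ r))(sym(Vr l tu)))r)))(sym e)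
     where
     hit : w(lo v i)≡ tu ->(∃ \ j -> lo(side b i)r ≡ lo Γ j)-> ⊥
     hit _(j , q)= cN v u p dv fr i j e(ta(sym(Ve r Γ(lo v i)))q)
     true-at : w(lo v i)≡ tu -> ∀ l -> Dec(l ≡ r)-> w(lo(side b i)l)≡ tu
     true-at t l(yes refl)= ta(co w(Ve l Γ(lo v i)))t
     true-at t l(no z)= ta(co w(Vu z Γ(lo v i)))(one l)

  cover-hit : ∀ v p u r -> F v p ≡ tu -> iN p ≡ tu -> fh v u ≡ tu ->
   c4 F(mix p v u)≡ tu ⊎ ∃ \ i -> lo p i ≡ fa × c4 F(mix p v u [ r ]≔ lo v i)≡ tu
  cover-hit v p u r f ng fr = let b′ , m , e = ae(pc F)touched ; S , _ , q = ae(ks n k)e in ce b′ m S(ar{inB b S}q)(oi(sim S(core b))(ad q))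
   where
   b =((v , p),(u , r))
   ok : vB F b ≡ tu
   ok = ai(ai f ng)fr
   dv = Mi.dist M v p f
   self : tc b b ≡ tu
   self = let S , m , e = ke(core b)(cL v u p dv fr)in an{p = \ S -> inB b S ∧ inB b S}m(ai(or-l e)(or-l e))
   touched : ay(pc F)(tc b)≡ tu
   touched = packing-maximal F v p u r ok self
   ce : ∀ b′ -> b′ ∈ pc F -> ∀ S -> inB b′ S ≡ tu -> sim S(core b)≡ tu ⊎ ay(al k)(\ i -> not(lo p i)∧ sim S(side b i))≡ tu ->
    c4 F(mix p v u)≡ tu ⊎ ∃ \ i -> lo p i ≡ fa × c4 F(mix p v u [ r ]≔ lo v i)≡ tu
   ce b′ m S q(i1 e)= i1(an{p = \ b′ -> inB b′(core b)}m(inB-sim b′{S}{core b}q(sim-sym{v = S}{core b}e)))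
   ce b′ m S q(i0 e)= let i , _ , z = ae(al k)e in i0(i , nt(ad z), an{p = \ b′ -> inB b′(side b i)}m(inB-sim b′{S}{side b i}q(sim-sym{v = S}{side b i}(ar{not(lo p i)}z))))

  -- By maximality the block of (v , p) with any fresh u meets the packing, so its core or one of
  -- its sides is covered. Averaging over u makes one of these at most k + 1 alternatives rich.
  rh : 4 *(k * k)≤ n -> 1 ≤ n -> ∀ v p r -> F v p ≡ tu -> iN p ≡ tu -> rc F p v ≡ tu ⊎ ∃ \ i -> lo p i ≡ fa × rc F(mk p r i)v ≡ tu
  rh big n0 v p r f ng = dd(bo(rc F p v))(bo(ay(al k)(\ i -> not(lo p i)∧ rc F(mk p r i)v)))
   where
   open Re
   U = n ^ k
   cB = #(tup n k)(\ u -> c4 F(mix p v u))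
   c0 : Fin k -> ℕ
   c0 i = bit(not(lo p i))* #(tup n k)(\ u -> c4 F(mix(mk p r i)v u))
   nf = #(tup n k)(\ u -> not(fh v u))
   tl : U ≤ nf +(cB + sum(al k)c0)
   tl = begin
    U ≡⟨ sym(ta(sym(ln(tup n k)))(lg n k))⟩
    sum(tup n k)(\ _ -> 1)≤⟨ sm(tup n k)(\ u -> go u(bo(fh v u)))⟩
    sum(tup n k)(\ u -> bit(not(fh v u))+(bit(c4 F(mix p v u))+ sum(al k)(\ i -> bit(not(lo p i))* bit(c4 F(mix p v u [ r ]≔ lo v i)))))≡⟨ ta(s3(tup n k)_ _)(co(nf +_)(ta(s3(tup n k)_ _)(co(cB +_)(ta(s1(tup n k)(al k)_)(sc(al k)(\ i -> ta(s0(tup n k)(bit(not(lo p i)))_)(moved i(lo p i)refl)))))))⟩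
    nf +(cB + sum(al k)c0)∎
    where
    moved : ∀ i b -> lo p i ≡ b -> bit(not b)* #(tup n k)(\ u -> c4 F(mix p v u [ r ]≔ lo v i))≡ bit(not b)* #(tup n k)(\ u -> c4 F(mix(mk p r i)v u))
    moved i tu  e = refl
    moved i fa e = co(1 *_)(ta(sc(tup n k)(\ u -> co bit(ta(sym(cover-swap F(mix p v u [ r ]≔ lo v i)r i))(co(c4 F)(mask-side v u p r i e)))))
     (sum-⊙(al n)(sw r i)(sd r i)(rp(sym(lf n))n0)(\ u -> bit(c4 F(mix(mk p r i)v u)))))
    go : ∀ u -> fh v u ≡ tu ⊎ fh v u ≡ fa -> 1 ≤ bit(not(fh v u))+(bit(c4 F(mix p v u))+ sum(al k)(\ i -> bit(not(lo p i))* bit(c4 F(mix p v u [ r ]≔ lo v i))))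
    go u(i0 e)= tr(re(sym(co(bit ∘ not)e)))(mm _ _)
    go u(i1 e)= by(cover-hit v p u r f ng e)
     where
     by : c4 F(mix p v u)≡ tu ⊎(∃ \ i -> lo p i ≡ fa × c4 F(mix p v u [ r ]≔ lo v i)≡ tu)-> _
     by(i1 q)= tr(re(sym(co bit q)))(tr(mm _ _)(m5 _(bit(not(fh v u)))))
     by(i0(i , z , q))= tr(tr(re(sym(cn(\ a b -> bit(not a)* bit b)z q)))(s4(\ i -> bit(not(lo p i))* bit(c4 F(mix p v u [ r ]≔ lo v i)))(aF i)))
      (tr(m5 _(bit(c4 F(mix p v u))))(m5 _(bit(not(fh v u)))))
   nf-small : 2 * nf ≤ U
   nf-small = ca n{{nn n0}}(begin
    n *(2 * nf)≤⟨ mo n(mo 2(tr(#-or(tup n k){q = \ u -> not(di u)}{r = \ u -> ay(al k)(\ j -> ou(lo u j)v)}(\ u -> lem(di u)))(m2(#(tup n k)(\ u -> not(di u)))(aq(tup n k)(al k)(\ u j -> ou(lo u j)v)))))⟩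
    n *(2 *(#(tup n k)(\ u -> not(di u))+ sum(al k)(\ j -> #(tup n k)(\ u -> ou(lo u j)v))))≡⟨ ri n(#(tup n k)(\ u -> not(di u)))_ ⟩
    2 *(n * #(tup n k)(\ u -> not(di u)))+ 2 *(n * sum(al k)(\ j -> #(tup n k)(\ u -> ou(lo u j)v)))≤⟨ m1(mo 2(ni n k))(mo 2(tr(re(ta(sym(s0(al k)n _))(sc(al k)(\ j -> cQ j(\ x -> ou x v)))))(tr(s2(al k)(U * k)(\ j -> mo U(os v)))(re(co(_*(U * k))(lf k))))))⟩
    2 *(k * k * U)+ 2 *(k *(U * k))≡⟨ rn k U ⟩
    4 *(k * k)* U ≤⟨ mn U big ⟩
    n * U ∎)
    where
    lem : ∀ a{b}-> not(a ∧ not b)≡ tu -> not a ≡ tu ⊎ b ≡ tu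
    lem tu{b}h = i0(ta(sym(nl b))h)
    lem fa h = i1 refl
    ri : ∀ n a b -> n *(2 *(a + b))≡ 2 *(n * a)+ 2 *(n * b)
    ri = so
    rn : ∀ k u -> 2 *(k * k * u)+ 2 *(k *(u * k))≡ 4 *(k * k)* u
    rn = so
   dd : rc F p v ≡ tu ⊎ rc F p v ≡ fa -> ay(al k)(\ i -> not(lo p i)∧ rc F(mk p r i)v)≡ tu ⊎ ay(al k)(\ i -> not(lo p i)∧ rc F(mk p r i)v)≡ fa ->
    rc F p v ≡ tu ⊎ ∃ \ i -> lo p i ≡ fa × rc F(mk p r i)v ≡ tu
   dd(i1 e)_ = i1 e
   dd(i0 e)(i1 q)= let i , _ , z = ae(al k)q in i0(i , nt(ad z), ar{not(lo p i)}z)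
   dd(i0 e)(i0 q)= el(il refl(begin-strict
    θ * U ≤⟨ mo θ tl ⟩
    θ *(nf +(cB + sum(al k)c0))≡⟨ ta(d0 θ nf _)(cn _+_(r1 k nf)(d0 θ cB _))⟩
    suc k *(2 * nf)+(θ * cB + θ * sum(al k)c0)<⟨ +-mono-≤-<(mo(suc k)nf-small)(+-mono-<-≤(la e)(tr(re(sym(s0(al k)θ c0)))(tr(s2(al k)U(\ i -> eh i(lo p i)refl))(re(co(_* U)(lf k))))))⟩
    suc k * U +(U + k * U)≡⟨ r0 k U ⟩
    θ * U ∎))
    where
    r1 : ∀ k x -> 2 * suc k * x ≡ suc k *(2 * x)
    r1 = so
    r0 : ∀ k u -> suc k * u +(u + k * u)≡ 2 * suc k * u
    r0 = so
    eh : ∀ i b -> lo p i ≡ b -> θ *(bit(not b)* #(tup n k)(\ u -> c4 F(mix(mk p r i)v u)))≤ U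
    eh i tu  z = tr(re(ze θ))zn
    eh i fa z = tr(re(co(θ *_)(ie _)))(bf(la(n1(\ t -> te(an{p = \ i -> not(lo p i)∧ rc F(mk p r i)v}(aF i)(ai(co not z)t))q))))

tw : ∀{k}-> Vec Bool k -> Bool
tw{k}p = ay(al k)(\ i -> ay(al k)(\ j -> not(eqF i j)∧(not(lo p i)∧ not(lo p j))))

tv : ∀{k}(p : Vec Bool k)-> tw p ≡ tu -> ∃ \ i -> ∃ \ j -> i ≢ j × lo p i ≡ fa × lo p j ≡ fa
tv{k}p h = let i , _ , h₀ = ae(al k)h ; j , _ , h0 = ae(al k)h₀ in
 i , j ,(\ e -> te(ta(co(eqF i)(sym e))(eF i))(nt(ad h0))), nt(ad(ar{not(eqF i j)}h0)), nt(ar{not(lo p i)}(ar{not(eqF i j)}h0))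

i5 : ∀{k}(ε : Vec Bool k)i -> lo ε i ≡ fa -> iN ε ≡ tu
i5 ε i e = na(n1(\ z -> te(ta(co(\ y -> lo y i)(et ε _ z))(Vr i tu))e))

module _{n k : ℕ}{F : Fo n k}(M : Mi F)(n0 : 1 ≤ n)(1≤k : 1 ≤ k){c Λ : ℕ}(n3 : ha c F ≡ fa)(big : c * k ≤ n)(cΛ : 2 * k * Λ ≤ c)(big₂ : 4 *(k * k)≤ n)where
 private
  ts = tup n k
  R : Vec Bool k -> ℕ
  R ε = # ts(rc F ε)

 -- Richness survives refilling the false positions, and by `fw` at most a fraction 2k/c of the
 -- refillings are clauses with pattern p.
 in-rich : ∀ p ε ->(∀ i -> lo ε i ≡ fa -> lo p i ≡ fa)->(∃ \ i -> lo ε i ≡ fa)-> Λ * # ts(\ v -> rc F ε v ∧ F v p)≤ # ts(rc F ε)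
 in-rich p ε dom ex = ca(2 * k * n ^ k){{nn pos}}(begin
  2 * k * n ^ k *(Λ * X)≡⟨ r1(2 * k)(n ^ k)Λ X ⟩
  2 * k * Λ *(n ^ k * X)≤⟨ mn(n ^ k * X)cΛ ⟩
  c *(n ^ k * X)≡⟨ co(c *_)(sym(ta(aV(al n)ε(\ v -> bit(rc F ε v ∧ F v p)))(co(\ l -> l ^ k * X)(lf n))))⟩
  c * sum ts(\ v -> # ts(\ u -> rc F ε(mix ε v u)∧ F(mix ε v u)p))≡⟨ sym(s0 ts c(\ v -> # ts(\ u -> rc F ε(mix ε v u)∧ F(mix ε v u)p)))⟩
  sum ts(\ v -> c * # ts(\ u -> rc F ε(mix ε v u)∧ F(mix ε v u)p))≤⟨ sm ts(\ v -> tr(re(co(c *_)(sc ts(\ u -> co(\ b -> bit(b ∧ F(mix ε v u)p))(rich-mix F ε v u)))))(eh v(rc F ε v)))⟩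
  sum ts(\ v -> 2 * k * n ^ k * bit(rc F ε v))≡⟨ s0 ts(2 * k * n ^ k)(\ v -> bit(rc F ε v))⟩
  2 * k * n ^ k * # ts(rc F ε)∎)
  where
  open Re
  pos : 1 ≤ 2 * k * n ^ k
  pos = m0(m0(ss(zn{1}))1≤k)(af k n0)
  X = # ts(\ v -> rc F ε v ∧ F v p)
  r1 : ∀ a u l x -> a * u *(l * x)≡ a * l *(u * x)
  r1 = so
  eh : ∀ v b -> c * # ts(\ u -> b ∧ F(mix ε v u)p)≤ 2 * k * n ^ k * bit b
  eh v tu  = tr(fw M{c}n3 big n0 p ε v dom ex)(re(sym(it _)))
  eh v fa = tr(re(ta(co(c *_)(sz ts(\ _ -> refl)))(ze c)))zn

 -- With two negative positions one of them stays false in every mask produced by `rh`, so `in-rich`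
 -- applies to each alternative.
 two-few : ∀ p -> tw p ≡ tu -> Λ * # ts(\ v -> F v p)≤ R p + sum(al k)(\ i -> R(p [ i ]≔ tu))
 two-few p h = let i₀ , j₀ , ne , e₀ , e₁ = tv p h in go i₀ j₀ ne e₀ e₁
  where
  open Re
  go : ∀ i₀ j₀ -> i₀ ≢ j₀ -> lo p i₀ ≡ fa -> lo p j₀ ≡ fa -> Λ * # ts(\ v -> F v p)≤ R p + sum(al k)(\ i -> R(p [ i ]≔ tu))
  go i₀ j₀ ne e₀ e₁ = begin
   Λ * # ts(\ v -> F v p)≤⟨ mo Λ(tr(#-or ts{q = \ v -> rc F p v ∧ F v p}{r = \ v -> ay(al k)(\ i -> not(lo p i)∧(rc F(p [ i ]≔ tu)v ∧ F v p))}sl)(m2(# ts(\ v -> rc F p v ∧ F v p))(aq ts(al k)(\ v i -> not(lo p i)∧(rc F(p [ i ]≔ tu)v ∧ F v p)))))⟩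
   Λ *(# ts(\ v -> rc F p v ∧ F v p)+ sum(al k)(\ i -> # ts(\ v -> not(lo p i)∧(rc F(p [ i ]≔ tu)v ∧ F v p))))≡⟨ ta(d0 Λ(# ts(\ v -> rc F p v ∧ F v p))_)(co(Λ * # ts(\ v -> rc F p v ∧ F v p)+_)(sym(s0(al k)Λ(\ i -> # ts(\ v -> not(lo p i)∧(rc F(p [ i ]≔ tu)v ∧ F v p))))))⟩
   Λ * # ts(\ v -> rc F p v ∧ F v p)+ sum(al k)(\ i -> Λ * # ts(\ v -> not(lo p i)∧(rc F(p [ i ]≔ tu)v ∧ F v p)))≤⟨ m1(in-rich p p(\ _ e -> e)(i₀ , e₀))(sm(al k)(\ i -> term i(lo p i)refl))⟩
   R p + sum(al k)(\ i -> R(p [ i ]≔ tu))∎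
   where
   sl : ∀ v -> F v p ≡ tu -> rc F p v ∧ F v p ≡ tu ⊎ ay(al k)(\ i -> not(lo p i)∧(rc F(p [ i ]≔ tu)v ∧ F v p))≡ tu
   sl v f = by(rh M big₂ n0 v p i₀ f(i5 p i₀ e₀))
    where
    by : rc F p v ≡ tu ⊎(∃ \ i -> lo p i ≡ fa × rc F(mk{n}p i₀ i)v ≡ tu)-> rc F p v ∧ F v p ≡ tu ⊎ ay(al k)(\ i -> not(lo p i)∧(rc F(p [ i ]≔ tu)v ∧ F v p))≡ tu
    by(i1 z)= i1(ai z f)
    by(i0(i , e , z))= i0(an{p = \ i -> not(lo p i)∧(rc F(p [ i ]≔ tu)v ∧ F v p)}(aF i)(ai(co not e)(ai(sb(\ x -> rc F(x [ i ]≔ tu)v ≡ tu)(ta(co(p [ i₀ ]≔_)(sym e₀))(Vec.[]≔-lookup p i₀))z)f)))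
   term : ∀ i b -> lo p i ≡ b -> Λ * # ts(\ v -> not b ∧(rc F(p [ i ]≔ tu)v ∧ F v p))≤ R(p [ i ]≔ tu)
   term i tu  e = tr(re(ta(co(Λ *_)(sz ts(\ _ -> refl)))(ze Λ)))zn
   term i fa e = in-rich p(p [ i ]≔ tu)(\ t z -> still t z(t Fin.≟ i))(ot(i₀ Fin.≟ i))
    where
    still : ∀ t -> lo(p [ i ]≔ tu)t ≡ fa -> Dec(t ≡ i)-> lo p t ≡ fa
    still t z(yes refl)= e
    still t z(no ne)= ta(sym(Vu ne p tu))z
    ot : Dec(i₀ ≡ i)-> ∃ \ t -> lo(p [ i ]≔ tu)t ≡ fa
    ot(no z)= i₀ , ta(Vu z p tu)e₀
    ot(yes refl)= j₀ , ta(Vu(\ z -> ne(sym z))p tu)e₁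

module _{n k : ℕ}{F : Fo n k}(M : Mi F)(n0 : 1 ≤ n)(big₂ : 4 *(k * k)≤ n)where
 cA : Vec(Fin n)k -> Bool
 cA v = ay(pa k)(\ ε -> iN ε ∧ rc F ε v)

 -- Every clause with a negative literal lies at a rich place.
 a8 : ∀{v p}-> F v p ≡ tu -> iN p ≡ tu -> ∀ r ->(∀ i -> lo p i ≡ fa -> iN(mk{n}p r i)≡ tu)-> cA v ≡ tu
 a8{v}{p}f ng r h = go(rh M big₂ n0 v p r f ng)
  where
  fo : ∀ ε -> iN ε ≡ tu -> rc F ε v ≡ tu -> cA v ≡ tu
  fo ε a b = an{p = \ ε -> iN ε ∧ rc F ε v}(pt ε)(ai a b)
  go : rc F p v ≡ tu ⊎(∃ \ i -> lo p i ≡ fa × rc F(mk{n}p r i)v ≡ tu)-> cA v ≡ tu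
  go(i1 z)= fo p ng z
  go(i0(i , e , z))= fo(mk{n}p r i)(h i e)z

 t4 : ∀{v p}-> F v p ≡ tu -> tw p ≡ tu -> cA v ≡ tu
 t4{v}{p}f h = let i₀ , j₀ , ne , e₀ , e₁ = tv p h in
  a8 f(i5 p i₀ e₀)i₀(\ i e -> p5 i₀ j₀ ne e₀ e₁ i(i₀ Fin.≟ i))
  where
  p5 : ∀ i₀ j₀ -> i₀ ≢ j₀ -> lo p i₀ ≡ fa -> lo p j₀ ≡ fa -> ∀ i -> Dec(i₀ ≡ i)-> iN(mk{n}p i₀ i)≡ tu
  p5 i₀ j₀ ne e₀ e₁ i(no z)= i5(mk{n}p i₀ i)i₀(ta(Vu z(p [ i₀ ]≔ fa)tu)(Ve i₀ p fa))
  p5 i₀ j₀ ne e₀ e₁ i(yes refl)= i5(mk{n}p i₀ i)j₀(ta(Vu(\ z -> ne(sym z))(p [ i₀ ]≔ fa)tu)(ta(Vu(\ z -> ne(sym z))p fa)e₁))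

module Sizes{n m : ℕ}{F : Fo n(suc m)}(M : Mi F)(n0 : 1 ≤ n)(big₂ : 4 *(suc m * suc m)≤ n)where
 private
  k = suc m
  ts = tup n k

 p2 : Vec Bool k
 p2 = fa ∷ aT m

 sR : Fin m -> ∀{v}-> F v p2 ≡ tu -> cA M n0 big₂ v ≡ tu
 sR r f = a8 M n0 big₂ f refl(suc r)(\{zero e -> i5(mk{n}p2(suc r)zero)(suc r)(Ve r(aT m)fa);(suc i)e -> el(te(Vr i tu)e)})

 module _{c Λ q Θ}(n3 : ha c F ≡ fa)(big : c * k ≤ n)(cΛ : 2 * k * Λ ≤ c)(Λq : Λ ≤ suc q)(η : ℕ)(Λη : Λ * Θ ≤ η)
  (shadowed :(D : Fin m -> Vec(Fin n)m -> Bool)->(∀ r w z -> D r(w [ r ]≔ z)≡ D r w)->(∀ r -> Θ * #(tup n m)(D r)≤ n ^ m)-> suc q * #(tup n m)(\ w -> a2(al m)(\ r -> D r w))≤ sum(al m)(\ r -> #(tup n m)(D r)))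
  (l8 : ∀ x -> η * #(tup n m)(\ w -> F(x ∷ w)p2)≤ n ^ m)where
  private
   R : Vec Bool k -> ℕ
   R ε = # ts(rc F ε)

  -- For a single negative literal the other masks of `rh` are false only at a positive position r,
  -- and `in-rich` fails. But r is arbitrary, so such a place is rich in all directions r at once.
  -- By `shadow` these places are few compared with the rich ones, unless one direction is so rich
  -- that the bound `l8` on the negative clauses at x suffices.
  single-few : Λ * # ts(\ v -> F v p2)≤ R p2 + sum(al m)(\ r -> R(tu ∷(aT m [ r ]≔ fa)))
  single-few = begin
   Λ * # ts(\ v -> F v p2)≤⟨ mo Λ(#-or ts{q = \ v -> rc F p2 v ∧ F v p2}{r = bad}sl)⟩
   Λ *(# ts(\ v -> rc F p2 v ∧ F v p2)+ # ts bad)≡⟨ d0 Λ(# ts(\ v -> rc F p2 v ∧ F v p2))(# ts bad)⟩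
   Λ * # ts(\ v -> rc F p2 v ∧ F v p2)+ Λ * # ts bad ≤⟨ m1(in-rich M n0(ss zn){c}{Λ}n3 big cΛ big₂ p2 p2(\ _ e -> e)(zero , refl))tail ⟩
   R p2 + sum(al m)(\ r -> R(tu ∷(aT m [ r ]≔ fa)))∎
   where
   open Re
   D : Fin n -> Fin m -> Vec(Fin n)m -> Bool
   D x r w = rc F(tu ∷(aT m [ r ]≔ fa))(x ∷ w)
   bad : Vec(Fin n)k -> Bool
   bad(x ∷ w)= F(x ∷ w)p2 ∧ a2(al m)(\ r -> D x r w)
   ind : ∀ x r w z -> D x r(w [ r ]≔ z)≡ D x r w
   ind x r w z = ru F(tu ∷(aT m [ r ]≔ fa))(x ∷ w)(suc r)z(Ve r(aT m)fa)
   sl : ∀ v -> F v p2 ≡ tu -> rc F p2 v ∧ F v p2 ≡ tu ⊎ bad v ≡ tu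
   sl(x ∷ w)f = go(bo(rc F p2(x ∷ w)))
    where
    go : rc F p2(x ∷ w)≡ tu ⊎ rc F p2(x ∷ w)≡ fa -> rc F p2(x ∷ w)∧ F(x ∷ w)p2 ≡ tu ⊎ bad(x ∷ w)≡ tu
    go(i1 z)= i1(ai z f)
    go(i0 z)= i0(ai f(a0(al m)(\{r}_ -> by r(rh M big₂ n0(x ∷ w)p2(suc r)f refl))))
     where
     by : ∀ r -> rc F p2(x ∷ w)≡ tu ⊎(∃ \ i -> lo p2 i ≡ fa × rc F(mk{n}p2(suc r)i)(x ∷ w)≡ tu)-> D x r w ≡ tu
     by r(i1 y)= el(te y z)
     by r(i0(zero , _ , y))= y
     by r(i0(suc i , e , y))= el(te(Vr i tu)e)
   tail : Λ * # ts bad ≤ sum(al m)(\ r -> R(tu ∷(aT m [ r ]≔ fa)))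
   tail = begin
    Λ * # ts bad ≡⟨ ta(co(Λ *_)(su(al n)m(\ v -> bit(bad v))))(sym(s0(al n)Λ(\ x -> #(tup n m)(\ w -> bad(x ∷ w)))))⟩
    sum(al n)(\ x -> Λ * #(tup n m)(\ w -> bad(x ∷ w)))≤⟨ sm(al n)at-x ⟩
    sum(al n)(\ x -> sum(al m)(\ r -> #(tup n m)(D x r)))≡⟨ ta(s1(al n)(al m)(\ x r -> #(tup n m)(D x r)))(sc(al m)(\ r -> sym(su(al n)m(\ v -> bit(rc F(tu ∷(aT m [ r ]≔ fa))v)))))⟩
    sum(al m)(\ r -> R(tu ∷(aT m [ r ]≔ fa)))∎
    where
    at-x : ∀ x -> Λ * #(tup n m)(\ w -> bad(x ∷ w))≤ sum(al m)(\ r -> #(tup n m)(D x r))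
    at-x x = go(bo(ay(al m)(\ r -> le(n ^ m)(Θ * #(tup n m)(D x r)))))
     where
     go : ay(al m)(\ r -> le(n ^ m)(Θ * #(tup n m)(D x r)))≡ tu ⊎ ay(al m)(\ r -> le(n ^ m)(Θ * #(tup n m)(D x r)))≡ fa -> Λ * #(tup n m)(\ w -> bad(x ∷ w))≤ sum(al m)(\ r -> #(tup n m)(D x r))
     go(i1 h)= let r , r∈ , z = ae(al m)h in tr(h2 r(f1(#(tup n m)(D x r))Θ(af m n0)(tr(lr z)(re(c2 Θ _))))(lr z))(s4(\ r -> #(tup n m)(D x r))r∈)
      where
      h2 : ∀ r -> 1 ≤ Θ -> n ^ m ≤ Θ * #(tup n m)(D x r)-> Λ * #(tup n m)(\ w -> bad(x ∷ w))≤ #(tup n m)(D x r)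
      h2 r 1≤Θ z = ca Θ{{nn 1≤Θ}}(begin
       Θ *(Λ * #(tup n m)(\ w -> bad(x ∷ w)))≡⟨ ta(sym(ac Θ Λ _))(co(_* #(tup n m)(\ w -> bad(x ∷ w)))(c2 Θ Λ))⟩
       Λ * Θ * #(tup n m)(\ w -> bad(x ∷ w))≤⟨ m0 Λη(m6(tup n m)(\ w h -> ad h))⟩
       η * #(tup n m)(\ w -> F(x ∷ w)p2)≤⟨ l8 x ⟩
       n ^ m ≤⟨ z ⟩
       Θ * #(tup n m)(D x r)∎)
     go(i0 h)= tr(m0 Λq(m6(tup n m)(\ w z -> ar{F(x ∷ w)p2}z)))(shadowed(D x)(ind x)(\ r -> bf(la(n1(\ t -> te(an{p = \ r -> le(n ^ m)(Θ * #(tup n m)(D x r))}(aF r)t)h)))))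

  canon-few : ∀ p ->(tw p ≡ tu ⊎ p ≡ p2)-> Λ * # ts(\ v -> F v p)≤ suc k *(θ{n}{k}* # ts(c4 F))
  canon-few p(i1 h)= tr(two-few M n0(ss zn){c}{Λ}n3 big cΛ big₂ p h)(m1(#-rich n0 F p)(tr(s2(al k)(θ{n}{k}* # ts(c4 F))(\ i -> #-rich n0 F(p [ i ]≔ tu)))(re(co(_*(θ{n}{k}* # ts(c4 F)))(lf k)))))
  canon-few p(i0 refl)= tr single-few(m1(#-rich n0 F p2)(tr(s2(al m)(θ{n}{k}* # ts(c4 F))(\ r -> #-rich n0 F(tu ∷(aT m [ r ]≔ fa))))(tr(re(co(_*(θ{n}{k}* # ts(c4 F)))(lf m)))(mn(θ{n}{k}* # ts(c4 F))(n2 m)))))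

-- Sparse tables and the saving from a packing

^-swap : ∀ a b c ->(a ^ b)^ c ≡(a ^ c)^ b
^-swap a b c = ta(ao a b c)(ta(co(a ^_)(c2 b c))(sym(ao a c b)))

c9 : ∀{a b}s -> 1 ≤ s -> a ^ s ≤ b ^ s -> a ≤ b
c9{a}{b}s aO h = ≮⇒≥(\ lt -> <⇒≱(^-monoˡ-< s{{nn aO}}lt)h)

-- A uniform bound for the classes of a partition that all satisfy P.
largest : ∀{P : ℕ -> Set}->(∀ y -> Dec(P y))-> P 0 -> ∀ B -> ∃ \ X -> P X × ∀{y}-> y ≤ B -> P y -> y ≤ X
largest dec p2 zero = 0 , p2 , \ h _ -> h
largest{P}dec p2(suc B)= p5(dec(suc B))
 where
 p5 : Dec(P(suc B))-> ∃ \ X -> P X × ∀{y}-> y ≤ suc B -> P y -> y ≤ X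
 p5(yes p)= suc B , p , \ h _ -> h
 p5(no np)= let X , pX , up = largest dec p2 B in X , pX , \ h p -> up(≤-pred(≤∧≢⇒< h(\{refl -> np p})))p

e5 : ∀{A : Set}(xs : List A)p -> # xs p ≡ 0 ⊎ ∃ \ x -> x ∈ xs × p x ≡ tu
e5 [] p = i1 refl
e5(x ∷ xs)p with p x in e
... | tu  = i0(x , he refl , e)
... | fa with e5 xs p
...   | i1 h = i1 h
...   | i0(y , m , h)= i0(y , th m , h)

ll : ∀{A : Set}(xs : List A)p -> length(fi p xs)≡ # xs p
ll [] p = refl
ll(x ∷ xs)p with p x
... | tu  = co suc(ll xs p)
... | fa = ll xs p

fe : ∀{A : Set}{xs : List A}{p x}-> x ∈ xs -> p x ≡ tu -> x ∈ fi p xs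
fe{xs = x ∷ xs}(he refl)h rewrite h = he refl
fe{xs = x ∷ xs}{p}(th m)h with p x
... | tu  = th(fe m h)
... | fa = fe m h

sf : ∀{A : Set}(xs : List A)p f -> sum(fi p xs)f ≤ sum xs f
sf [] p f = zn
sf(x ∷ xs)p f with p x
... | tu  = m2(f x)(sf xs p f)
... | fa = tr(sf xs p f)(m5 _(f x))

mh : ∀{A B : Set}{f g : A -> B}{xs x}-> map f xs ≡ map g xs -> x ∈ xs -> f x ≡ g x
mh{xs = x ∷ xs}e(he refl)= ∷-injectiveˡ e
mh{xs = x ∷ xs}e(th m)= mh(∷-injectiveʳ e)m

-- `near` with true as the disallowed entry: each true costs log2 t bits, and each place of the
-- table only 1/s bit.
sparse-bits : ∀{O I : Set}(𝒢 : List O)(st : I -> O -> Bool)(Ss : List I)m sel t s X -> 1 ≤ t -> 2 * s ≤ t ->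
 (∀{F}-> F ∈ 𝒢 -> sel F ≡ tu -> # Ss(\ i -> st i F)≤ m)->
 (∀ se ->(∀ F -> se F ≡ tu -> sel F ≡ tu)->
  (∀{F G i}-> F ∈ 𝒢 -> G ∈ 𝒢 -> se F ≡ tu -> se G ≡ tu -> i ∈ Ss -> st i F ≡ st i G)-> # 𝒢 se ≤ X)->
 # 𝒢 sel ^ s ≤ X ^ s *((t ^ m)^ s * 2 ^ length Ss)
sparse-bits 𝒢 st Ss m sel t s X 1≤t 2s≤t few leaf = cf _ _((t ^ s)^ L){{nn(af L(af s 1≤t))}}(begin
 g ^ s *(t ^ s)^ L ≡⟨ ta(co(g ^ s *_)(^-swap t s L))(sym(db g(t ^ L)s))⟩
 (g * t ^ L)^ s ≤⟨ m3 s(near Bool._≟_ 𝒢 st(\ _ -> tu ∷ fa ∷ [])(\ _ -> not)t X 1≤t Ss m sel(\{F}{i}_ _ _ -> b1(st i F))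
  (\{F}f h -> r2(sc Ss(\ i -> co bit(sym(nl(st i F)))))(few f h))leaf)⟩
 (X * t ^ m * pd Ss(\ _ -> t * 1 + 1))^ s ≡⟨ co(_^ s)(co(X * t ^ m *_)(ta(pn Ss(t * 1 + 1))(co(\ z ->(z + 1)^ L)(it t))))⟩
 (X * t ^ m *(t + 1)^ L)^ s ≡⟨ ta(db(X * t ^ m)((t + 1)^ L)s)(cn _*_(db X(t ^ m)s)(^-swap(t + 1)L s))⟩
 X ^ s *(t ^ m)^ s *((t + 1)^ s)^ L ≤⟨ mo(X ^ s *(t ^ m)^ s)(m3 L(pow-double t 1 s(r2(co(2 *_)(sym(it s)))2s≤t)))⟩
 X ^ s *(t ^ m)^ s *(2 * t ^ s)^ L ≡⟨ co(X ^ s *(t ^ m)^ s *_)(db 2(t ^ s)L)⟩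
 X ^ s *(t ^ m)^ s *(2 ^ L *(t ^ s)^ L)≡⟨ ri(X ^ s)((t ^ m)^ s)(2 ^ L)((t ^ s)^ L)⟩
 X ^ s *((t ^ m)^ s * 2 ^ L)*(t ^ s)^ L ∎)
 where
 open Re
 L = length Ss
 g = # 𝒢 sel
 ri : ∀ x y z u -> x * y *(z * u)≡ x *(y * z)* u
 ri = so

-- (1 + 1/a)^s >= 1 + s/a >= 2. With a = 2^h - 1: excluding one of the 2^h states of a block saves
-- at least 1/s bit.
half-power : ∀ a s -> a ≤ s -> 1 ≤ s -> 2 * a ^ s ≤ suc a ^ s
half-power zero(suc s)_ _ = zn
half-power a@(suc a′)s a≤s _ = ca a(begin
 a *(2 * a ^ s)≡⟨ r1 a(a ^ s)⟩
 a ^ s *(a + a)≤⟨ mo(a ^ s)(m2 a a≤s)⟩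
 a ^ s *(a + s)≤⟨ sI s ⟩
 a * suc a ^ s ∎)
 where
 open Re
 r1 : ∀ a x -> a *(2 * x)≡ x *(a + a)
 r1 = so
 r0 : ∀ a s x -> a * x *(a + suc s)+ x * s ≡ x *(a + s)* suc a
 r0 = so
 r3 : ∀ a x -> a * x * suc a ≡ a *(suc a * x)
 r3 = so
 sI : ∀ s -> a ^ s *(a + s)≤ a * suc a ^ s
 sI zero    = re(ta(ii(a + 0))(ta(ie a)(sym(it a))))
 sI(suc s)= tr(mm _(a ^ s * s))(tr(re(r0 a s(a ^ s)))(tr(mn(suc a)(sI s))(re(r3 a(suc a ^ s)))))

#-apart : ∀{A : Set}{xs : List A}(p : A -> Bool)-> AllPairs.AllPairs(\ x y -> p x ∧ p y ≡ fa)xs -> # xs p ≤ 1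
#-apart p AllPairs.[] = zn
#-apart{xs = x ∷ xs}p(a AllPairs.∷ as)with p x
... | fa = #-apart p as
... | tu  = ss(re(n3 a))
 where
 n3 : ∀{ys}-> All.All(\ y -> p y ≡ fa)ys -> # ys p ≡ 0
 n3 All.[] = refl
 n3(h All.∷ hs)= cn _+_(co bit h)(n3 hs)

i3 : ∀{k}(p : Vec Bool k)-> iN p ≡ fa -> p ≡ aT k
i3{k}p h = et p(aT k)(nj h)

module _{n k : ℕ}(𝒢 : List(Fo n k))(minimal : ∀{F}-> F ∈ 𝒢 -> Mi F)(different : Di 𝒢)(T : ℕ)(T≥ : 2 ^ blockSize{n}{k}≤ T)
 (sel : Fo n k -> Bool)(𝒩 : List(Block n k))(packed : ∀{F}-> F ∈ 𝒢 -> sel F ≡ tu -> pc F ≡ 𝒩)(apart : AllPairs.AllPairs(\ b b′ -> tc b b′ ≡ fa)𝒩)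
 (s7 : ∀{F G}-> F ∈ 𝒢 -> G ∈ 𝒢 -> sel F ≡ tu -> sel G ≡ tu -> ∀ v p -> iN p ≡ tu -> F v p ≡ G v p)where
 private
  K = ks n k
  pos = aT k
  Group = Bool × List(Vec(Fin n)k)
  cov : Vec(Fin n)k -> Bool
  cov S = ay 𝒩(\ b -> inB b S)
  gp : Block n k -> Group
  gp b = tu , fi(inB b)K
  sS : Vec(Fin n)k -> Group
  sS S = fa , S ∷ []
  -- One group for each block and a singleton for each uncovered set. Blocks of the packing share no
  -- set, so no set is counted twice; the Boolean tag marks the groups that save.
  Ss = map gp 𝒩 ++ map sS(fi(not ∘ cov)K)
  st : Group -> Fo n k -> List Bool
  st(_ , g)F = map(\ S -> F S pos)g
  allT : List Bool -> Bool
  allT w = a2 w id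
  s5 : Group -> List(List Bool)
  s5(tu , g)= fi(not ∘ allT)(wo g)
  s5(fa , g)= wo g

  sum-Ss : ∀ f -> sum Ss f ≡ sum 𝒩(f ∘ gp)+ sum(fi(not ∘ cov)K)(f ∘ sS)
  sum-Ss f = ta(sum-++(map gp 𝒩)_ f)(cn _+_(sC gp 𝒩 f)(sC sS(fi(not ∘ cov)K)f))

  tags : sum Ss(\ i -> bit(po i))≡ length 𝒩
  tags = ta(sum-Ss(\ i -> bit(po i)))(ta(cn _+_(sym(ln 𝒩))(sz(fi(not ∘ cov)K)(\ _ -> refl)))(ie _))

  sizes : sum Ss(\ i -> length(p0 i))≤ bi n k
  sizes = begin
   sum Ss(\ i -> length(p0 i))≡⟨ sum-Ss(\ i -> length(p0 i))⟩
   sum 𝒩(\ b -> length(fi(inB b)K))+ sum(fi(not ∘ cov)K)(\ _ -> 1)≡⟨ cn _+_(ta(sc 𝒩(\ b -> ll K(inB b)))(s1 𝒩 K(\ b S -> bit(inB b S))))(ta(sym(ln(fi(not ∘ cov)K)))(ll K(not ∘ cov)))⟩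
   sum K(\ S -> # 𝒩(\ b -> inB b S))+ # K(not ∘ cov)≡⟨ sym(s3 K(\ S -> # 𝒩(\ b -> inB b S))(\ S -> bit(not(cov S))))⟩
   sum K(\ S -> # 𝒩(\ b -> inB b S)+ bit(not(cov S)))≤⟨ sj K{g = \ _ -> 1}(\{S}m -> one S m(bo(cov S)))⟩
   sum K(\ _ -> 1)≡⟨ ta(sym(ln K))(l1 n k)⟩
   bi n k ∎
   where
   open Re
   one : ∀ S -> S ∈ K -> cov S ≡ tu ⊎ cov S ≡ fa -> # 𝒩(\ b -> inB b S)+ bit(not(cov S))≤ 1
   one S m(i1 e)= tr(re(ta(co(\ z -> # 𝒩(\ b -> inB b S)+ bit(not z))e)(ie _)))
    (#-apart(\ b -> inB b S)(AllPairs.map(\{b}{b′}h -> n1(\ t -> te(an{p = \ S -> inB b S ∧ inB b′ S}m t)h))apart))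
   one S m(i0 e)= re(cn _+_(n3(e5 𝒩(\ b -> inB b S)))(co(bit ∘ not)e))
    where
    n3 : # 𝒩(\ b -> inB b S)≡ 0 ⊎(∃ \ b -> b ∈ 𝒩 × inB b S ≡ tu)-> # 𝒩(\ b -> inB b S)≡ 0
    n3(i1 z)= z
    n3(i0(b , b∈ , z))= el(te(an{p = \ b -> inB b S}b∈ z)e)

  f : Group -> ℕ
  f i = 1 * #(s5 i)(\ _ -> tu)+ #(s5 i)(\ _ -> fa)

  f-length : ∀ i -> f i ≡ length(s5 i)
  f-length i = ta(cn _+_(ta(ii _)(sym(ln(s5 i))))(sz(s5 i)(\ _ -> refl)))(ie _)

  1≤T : 1 ≤ T
  1≤T = tr(m9 2(blockSize{n}{k}))T≥

  full-word : ∀(g : List(Vec(Fin n)k))-> 1 ≤ #(wo g)allT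
  full-word g = tr(re(sym(co bit(a0(map(\ _ -> tu)g){p = id}(\ m -> all g m)))))(s4(bit ∘ allT)(wd g(\ _ -> tu)))
   where
   all : ∀ g{b}-> b ∈ map(\(_ : Vec(Fin n)k)-> tu)g -> b ≡ tu
   all g m = p0(p0(ma(\ _ -> tu)m))

  one-group : ∀{i}-> i ∈ Ss -> f i ^ T * 2 ^ bit(po i)≤(2 ^ T)^ length(p0 i)
  one-group{i}i∈ = sl(∈-++⁻(map gp 𝒩)i∈)
   where
   open Re
   sl : i ∈ map gp 𝒩 ⊎ i ∈ map sS(fi(not ∘ cov)K)-> f i ^ T * 2 ^ bit(po i)≤(2 ^ T)^ length(p0 i)
   sl(i0 m)with ma sS m
   ... | S , _ , refl = re(ta(it _)(ta(co(_^ T)(f-length(sS S)))(sym(it(2 ^ T)))))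
   sl(i1 m)with ma gp m
   ... | b , _ , refl = begin
    f(gp b)^ T * 2 ≤⟨ mn 2(m3 T(tr(re(ta(f-length(gp b))(ll(wo g)(not ∘ allT))))missing))⟩
    a ^ T * 2 ≡⟨ c2(a ^ T)2 ⟩
    2 * a ^ T ≤⟨ half-power a T(tr(tr(n2 a)(re sa))(tr(m7 h(blockSize{n}{k})(tr(re(ll K(inB b)))(tr(sk n k(\ S -> bit(inB b S)))(#-inB b))))T≥))1≤T ⟩
    suc a ^ T ≡⟨ ta(co(_^ T)sa)(^-swap 2 h T)⟩
    (2 ^ T)^ h ∎
    where
    g = fi(inB b)K
    h = length g
    a = 2 ^ h ∸ 1
    sa : suc a ≡ 2 ^ h
    sa = md{1}(m9 2 h)
    tl : ∀ ws -> # ws(not ∘ allT)+ # ws allT ≡ length ws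
    tl ws = ta(sym(s3 ws(bit ∘ not ∘ allT)(bit ∘ allT)))(ta(sc ws(\ w -> by(allT w)))(sym(ln ws)))
     where
     by : ∀ b -> bit(not b)+ bit b ≡ 1
     by tu = refl
     by fa = refl
    missing : #(wo g)(not ∘ allT)≤ a
    missing = ≤-pred(tr(tr(re(+-comm 1 _))(m2(#(wo g)(not ∘ allT))(full-word g)))(re(ta(tl(wo g))(ta(l3 g)(sym sa)))))

  in-states : ∀{F i}-> F ∈ 𝒢 -> sel F ≡ tu -> i ∈ Ss -> st i F ∈ s5 i
  in-states{F}{i}F∈ h i∈ = sl(∈-++⁻(map gp 𝒩)i∈)
   where
   sl : i ∈ map gp 𝒩 ⊎ i ∈ map sS(fi(not ∘ cov)K)-> st i F ∈ s5 i
   sl(i0 m)with ma sS m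
   ... | S , _ , refl = wd(S ∷ [])(\ S -> F S pos)
   sl(i1 m)with ma gp m
   ... | b , b∈ , refl = fe(wd(fi(inB b)K)(\ S -> F S pos))(na(n1(\ z -> block-avoid(minimal F∈)b(packing-valid F(sb(b ∈_)(sym(packed F∈ h))b∈))
    (\{S}S∈ q -> aB{p = id}z(mp(\ S -> F S pos)(fe S∈ q))))))

  leaf : ∀ se ->(∀ F -> se F ≡ tu -> sel F ≡ tu)->
   (∀{F G i}-> F ∈ 𝒢 -> G ∈ 𝒢 -> se F ≡ tu -> se G ≡ tu -> i ∈ Ss -> st i F ≡ st i G)-> # 𝒢 se ≤ 1
  leaf se sub eqs = cw 𝒢 se different(\{F}{G}F∈ G∈ hF hG -> sW(minimal F∈)(minimal G∈)(\{S}S∈ -> map-cong(\ p -> aj F∈ G∈ hF hG S∈ p(bo(iN p)))(pa k)))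
   where
   aj : ∀{F G}-> F ∈ 𝒢 -> G ∈ 𝒢 -> se F ≡ tu -> se G ≡ tu -> ∀{S}-> S ∈ K -> ∀ p -> iN p ≡ tu ⊎ iN p ≡ fa -> F S p ≡ G S p
   aj{F}{G}F∈ G∈ hF hG{S}S∈ p(i1 e)= s7 F∈ G∈(sub F hF)(sub G hG)S p e
   aj{F}{G}F∈ G∈ hF hG{S}S∈ p(i0 e)= sb(\ q -> F S q ≡ G S q)(sym(i3 p e))(by(bo(cov S)))
    where
    by : cov S ≡ tu ⊎ cov S ≡ fa -> F S pos ≡ G S pos
    by(i1 c)= let b , b∈ , q = ae 𝒩 c in mh(eqs F∈ G∈ hF hG(ax(mp gp b∈)))(fe S∈ q)
    by(i0 c)= ∷-injectiveˡ(eqs F∈ G∈ hF hG(ah(map gp 𝒩)(mp sS(fe S∈(na c)))))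

 -- Each block of the packing excludes one of the 2 ^ h states of its h sets.
 packed-class : # 𝒢 sel ^ T * 2 ^ length 𝒩 ≤ 2 ^(T * bi n k)
 packed-class = begin
  # 𝒢 sel ^ T * 2 ^ length 𝒩 ≤⟨ mn(2 ^ length 𝒩)(m3 T(tr(re(sym(ta(co(# 𝒢 sel *_)(^-zeroˡ(length Ss)))(it _))))
   (tr(near lD 𝒢 st s5(\ _ _ -> tu)1 1 rf Ss 0 sel in-states(\ _ _ -> re(sz Ss(\ _ -> refl)))leaf)(re(ii(pd Ss f))))))⟩
  pd Ss f ^ T * 2 ^ length 𝒩 ≡⟨ cn _*_(prod-pow Ss T f)(ta(co(2 ^_)(sym tags))(sym(prod-^ Ss 2(\ i -> bit(po i)))))⟩
  pd Ss(\ i -> f i ^ T)* pd Ss(\ i -> 2 ^ bit(po i))≡⟨ sym(prod-* Ss(\ i -> f i ^ T)(\ i -> 2 ^ bit(po i)))⟩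
  pd Ss(\ i -> f i ^ T * 2 ^ bit(po i))≤⟨ p6 Ss one-group ⟩
  pd Ss(\ i ->(2 ^ T)^ length(p0 i))≡⟨ prod-^ Ss(2 ^ T)(\ i -> length(p0 i))⟩
  (2 ^ T)^ sum Ss(\ i -> length(p0 i))≤⟨ m8(2 ^ T){{nn(m9 2 T)}}sizes ⟩
  (2 ^ T)^ bi n k ≡⟨ ao 2 T(bi n k)⟩
  2 ^(T * bi n k)∎
  where
  open Re
  p6 : ∀{A : Set}(xs : List A){f g}->(∀{x}-> x ∈ xs -> f x ≤ g x)-> pd xs f ≤ pd xs g
  p6 []       h = rf
  p6(x ∷ xs)h = m0(h(he refl))(p6 xs(\ m -> h(th m)))

-- Canonical patterns and formulas without heavy variables

twoNeg-intro : ∀{k}(p : Vec Bool k)i j -> i ≢ j -> lo p i ≡ fa -> lo p j ≡ fa -> tw p ≡ tu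
twoNeg-intro{k}p i j ne e₁ e₂ = an{p = \ i -> ay(al k)(\ j -> not(eqF i j)∧(not(lo p i)∧ not(lo p j)))}(aF i)
 (an{p = \ j -> not(eqF i j)∧(not(lo p i)∧ not(lo p j))}(aF j)(ai(na(n1(\ z -> ne(ee z))))(ai(co not e₁)(co not e₂))))

on : ∀ m -> Vec Bool(suc m)
on m = fa ∷ aT m

cl : ∀{m}-> Vec Bool(suc m)-> Bool
cl{m}p = tw p ∨ eqP p(on m)

cI : ∀{m}(p : Vec Bool(suc m))-> cl p ≡ tu -> tw p ≡ tu ⊎ p ≡ on m
cI{m}p h = by(oi{0}{0}(tw p)h)
 where
 by : tw p ≡ tu ⊎ eqP p(on m)≡ tu -> tw p ≡ tu ⊎ p ≡ on m
 by(i1 z)= i1 z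
 by(i0 z)= i0(et p(on m)z)

-- By symmetry the canonical patterns determine all patterns with a negative literal.
cS : ∀{m}(p : Vec Bool(suc m))-> iN p ≡ tu -> ∃ \ i -> cl(p ⊙ sw zero i)≡ tu
cS{m}p ng = let i , e = ns p ng in i , go i e(bo(tw(p ⊙ sw zero i)))
 where
 go : ∀ i -> lo p i ≡ fa -> tw(p ⊙ sw zero i)≡ tu ⊎ tw(p ⊙ sw zero i)≡ fa -> cl(p ⊙ sw zero i)≡ tu
 go i e(i1 h)= or-l{0}{0}h
 go i e(i0 h)= or-r{0}{0}{tw(p ⊙ sw zero i)}(sb(\ z -> eqP z(on m)≡ tu)(sym(lx{u = p ⊙ sw zero i}{on m}at-t))(eP(on m)))
  where
  f5 : lo(p ⊙ sw zero i)zero ≡ fa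
  f5 = ta(lu p(sw zero i)zero)(ta(co(lo p)(by(lw zero i zero)))e)
   where
   by :(zero ≡ i × lo(sw zero i)zero ≡ zero)⊎(zero ≡ zero × zero ≢ i × lo(sw zero i)zero ≡ i)⊎(zero ≢ zero × zero ≢ i × lo(sw zero i)zero ≡ zero)-> lo(sw zero i)zero ≡ i
   by(i1(a , b))= ta b a
   by(i0(i1(_ , _ , b)))= b
   by(i0(i0(a , _)))= el(a refl)
  at-t : ∀ t -> lo(p ⊙ sw zero i)t ≡ lo(on m)t
  at-t zero = f5
  at-t(suc t)= ta(n1(\ z -> te(twoNeg-intro(p ⊙ sw zero i)zero(suc t)(\())f5 z)h))(sym(Vr t tu))

module _{n k : ℕ}where
 #-slice : ∀(F : Fo n k)ε i c -> lo ε i ≡ fa -> n * #(tup n k)(\ v -> eqF(lo v i)c ∧ rc F ε v)≤ #(tup n k)(rc F ε)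
 #-slice F ε i c e = begin
  n * #(tup n k)(\ v -> eqF(lo v i)c ∧ rc F ε v)≡⟨ co(_* #(tup n k)(\ v -> eqF(lo v i)c ∧ rc F ε v))(sym(lf n))⟩
  length(al n)* #(tup n k)(\ v -> eqF(lo v i)c ∧ rc F ε v)≡⟨ sym(sh(al n)i(\ v -> bit(eqF(lo v i)c ∧ rc F ε v)))⟩
  sum(tup n k)(\ v -> #(al n)(\ x -> eqF(lo(v [ i ]≔ x)i)c ∧ rc F ε(v [ i ]≔ x)))≤⟨ sm(tup n k)(\ v -> tr(re(sc(al n)(\ x -> cn(\ a b -> bit(eqF a c ∧ b))(Ve i v x)(ru F ε v i x e))))(one(rc F ε v)))⟩
  #(tup n k)(rc F ε)∎
  where
  open Re
  one : ∀ b -> #(al n)(\ x -> eqF x c ∧ b)≤ bit b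
  one tu  = tr(m6(al n){q = \ x -> eqF x c}(\ x h -> ad h))(#-eqF c)
  one fa = re(sz(al n)(\ x -> co bit(zr(eqF x c))))

 -- Richness ignores the entry at a false position of ε, so one rich place yields n of them, and
 -- rich places are bounded by a constant times the number of blocks.
 packing-large : ∀{F : Fo n k}-> 1 ≤ n -> ∀ ε v -> iN ε ≡ tu -> rc F ε v ≡ tu -> n ≤ θ{n}{k}*(length(pc F)* blockSize{n}{k})
 packing-large{F}n0 ε v ng h = let i , e = ns ε ng in begin
  n ≡⟨ sym(it n)⟩
  n * 1 ≤⟨ mo n(tr(re(sym(co bit(ai(eF(lo v i))h))))(s4(\ u -> bit(eqF(lo u i)(lo v i)∧ rc F ε u))(t1 v)))⟩
  n * #(tup n k)(\ u -> eqF(lo u i)(lo v i)∧ rc F ε u)≤⟨ #-slice F ε i(lo v i)e ⟩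
  #(tup n k)(rc F ε)≤⟨ tr(#-rich n0 F ε)(mo(θ{n}{k})(#-cover F))⟩
  θ{n}{k}*(length(pc F)* blockSize{n}{k})∎
  where open Re

module LightClass{n m : ℕ}(r₀ : Fin m)(n0 : 1 ≤ n)(big₂ : 4 *(suc m * suc m)≤ n)(𝒢 : List(Fo n(suc m)))(minimal : ∀{F}-> F ∈ 𝒢 -> Mi F)(different : Di 𝒢)
 (T : ℕ)(T≥ : 2 ^ blockSize{n}{suc m}≤ T)(μ : ℕ)where
 private
  k = suc m
  ts = tup n k
  b = bi n k
  pk = 2 ^ k
  bs = blockSize{n}{k}
  lp : length(pa k)≡ pk
  lp = lh(tu ∷ fa ∷ [])k

 Packed :(Fo n k -> Bool)-> Set
 Packed sel = ∀{F}-> F ∈ 𝒢 -> sel F ≡ tu -> length(pc F)≡ μ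

 SameRich :(Fo n k -> Bool)-> Set
 SameRich sel = ∀{F G}-> F ∈ 𝒢 -> G ∈ 𝒢 -> sel F ≡ tu -> sel G ≡ tu -> ∀ ε v -> iN ε ≡ tu -> rc F ε v ≡ rc G ε v

 SameCanonical :(Fo n k -> Bool)-> Set
 SameCanonical sel = ∀{F G}-> F ∈ 𝒢 -> G ∈ 𝒢 -> sel F ≡ tu -> sel G ≡ tu -> ∀ v p -> cl p ≡ tu -> F v p ≡ G v p

 -- The canonical clauses determine all negative clauses and hence the packing; only the positive
 -- clauses remain free, and `packed-class` counts these.
 same-canonical : ∀ sel -> Packed sel -> SameCanonical sel -> # 𝒢 sel ^ T * 2 ^ μ ≤ 2 ^(T * b)
 same-canonical sel packed s7 = by(e5 𝒢 sel)
  where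
  1≤T = tr(m9 2 bs)T≥
  neg : ∀{F G}-> F ∈ 𝒢 -> G ∈ 𝒢 -> sel F ≡ tu -> sel G ≡ tu -> ∀ v p -> iN p ≡ tu -> F v p ≡ G v p
  neg{F}{G}f g hf hg v p ng = let i , c = cS p ng in
   ta(sym(sA(ml(minimal f))v p zero i))(ta(s7 f g hf hg(v ⊙ sw zero i)(p ⊙ sw zero i)c)(sA(ml(minimal g))v p zero i))
  by : # 𝒢 sel ≡ 0 ⊎(∃ \ F -> F ∈ 𝒢 × sel F ≡ tu)-> # 𝒢 sel ^ T * 2 ^ μ ≤ 2 ^(T * b)
  by(i1 z)= tr(re(co(\ x -> x ^ T * 2 ^ μ)z))(tr(re(co(_* 2 ^ μ)(zp T 1≤T)))zn)
   where
   zp : ∀ T -> 1 ≤ T -> 0 ^ T ≡ 0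
   zp(suc T)_ = refl
  by(i0(F0 , f , h))= sb(\ l -> # 𝒢 sel ^ T * 2 ^ l ≤ 2 ^(T * b))(packed f h)(packed-class 𝒢 minimal different T T≥ sel(pc F0)
   (\{F}f′ h3 -> packing-cong F F0(neg f′ f h3 h))(packing-apart F0)neg)

 module _(s σ Λ : ℕ)(2s≤ : 2 * s ≤ 2 ^ σ)(az : 1 ≤ Λ)where
  few₂ = pk *(suc k *(θ{n}{k}*(μ * bs)))
  m₂ = _/_ few₂ Λ{{nn az}}
  L₂ = pk *(θ{n}{k}*(μ * bs))* pk

  Few :(Fo n k -> Bool)-> Set
  Few sel = ∀{F}-> F ∈ 𝒢 -> sel F ≡ tu -> ∀ p -> cl p ≡ tu -> Λ * # ts(\ v -> F v p)≤ suc k *(θ{n}{k}* # ts(c4 F))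

  -- The rich table confines the canonical clauses to `L₂` = O(μ) positions, of which at most `m₂` =
  -- O(μ/Λ) are occupied. Choosing them costs a small fraction of the μ/T bits saved.
  same-rich : ∀ sel X -> Packed sel -> Few sel -> SameRich sel ->(∀{y}-> y ≤ length 𝒢 -> y ^ T * 2 ^ μ ≤ 2 ^(T * b)-> y ≤ X)->
   # 𝒢 sel ^ s ≤ X ^ s *(((2 ^ σ)^ m₂)^ s * 2 ^ L₂)
  same-rich sel X packed few s7 up = by(e5 𝒢 sel)
   where
   open Re
   cT : ∀{F}-> F ∈ 𝒢 -> sel F ≡ tu -> θ{n}{k}* # ts(c4 F)≤ θ{n}{k}*(μ * bs)
   cT{F}f h = mo(θ{n}{k})(tr(#-cover F)(re(co(_* bs)(packed f h))))
   by : # 𝒢 sel ≡ 0 ⊎(∃ \ F -> F ∈ 𝒢 × sel F ≡ tu)-> # 𝒢 sel ^ s ≤ X ^ s *(((2 ^ σ)^ m₂)^ s * 2 ^ L₂)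
   by(i1 z)= tr(re(co(_^ s)z))(tr(m3 s(zn{X}))(tr(re(sym(it(X ^ s))))(mo(X ^ s)(m0(af s(af m₂(m9 2 σ)))(m9 2 L₂)))))
   by(i0(F0 , f₀ , h₀))= tr(sparse-bits 𝒢(\ i F -> cl(p0 i)∧ F(po i)(p0 i))Ss m₂ sel(2 ^ σ)s X(m9 2 σ)2s≤ ep leaf)
    (mo(X ^ s)(mo(((2 ^ σ)^ m₂)^ s)(m7(length Ss)L₂ aW)))
    where
    cand : Vec(Fin n)k -> Bool
    cand = cA(minimal f₀)n0 big₂
    Ss = ct(fi cand ts)(pa k)
    sum-Ss : ∀ f -> sum Ss f ≡ sum(fi cand ts)(\ v -> sum(pa k)(\ p -> f(v , p)))
    sum-Ss f = sr _,_(fi cand ts)(pa k)f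
    aW : length Ss ≤ L₂
    aW = begin
     length Ss ≡⟨ ta(ln Ss)(sum-Ss(\ _ -> 1))⟩
     sum(fi cand ts)(\ _ -> sum(pa k)(\ _ -> 1))≡⟨ ta(sn(fi cand ts)_)(cn _*_(ll ts cand)(ta(sym(ln(pa k)))lp))⟩
     # ts cand * pk ≤⟨ mn pk(tr(aq ts(pa k)(\ v ε -> iN ε ∧ rc F0 ε v))(tr(s2(pa k)(θ{n}{k}*(μ * bs))(\ ε -> tr(m6 ts{q = rc F0 ε}(\ v h -> ar{iN ε}h))(tr(#-rich n0 F0 ε)(cT f₀ h₀))))(re(co(_*(θ{n}{k}*(μ * bs)))lp))))⟩
     L₂ ∎
    ep : ∀{F}-> F ∈ 𝒢 -> sel F ≡ tu -> # Ss(\ i -> cl(p0 i)∧ F(po i)(p0 i))≤ m₂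
    ep{F}f h = d3 Λ few₂(# Ss(\ i -> cl(p0 i)∧ F(po i)(p0 i))){{nn az}}(begin
     Λ * # Ss(\ i -> cl(p0 i)∧ F(po i)(p0 i))≤⟨ mo Λ(tr(re(sum-Ss(\ i -> bit(cl(p0 i)∧ F(po i)(p0 i)))))(tr(sf ts cand(\ v -> #(pa k)(\ p -> cl p ∧ F v p)))(re(s1 ts(pa k)(\ v p -> bit(cl p ∧ F v p))))))⟩
     Λ * sum(pa k)(\ p -> # ts(\ v -> cl p ∧ F v p))≡⟨ sym(s0(pa k)Λ(\ p -> # ts(\ v -> cl p ∧ F v p)))⟩
     sum(pa k)(\ p -> Λ * # ts(\ v -> cl p ∧ F v p))≤⟨ s2(pa k)(suc k *(θ{n}{k}*(μ * bs)))(\ p -> eh p(cl p)refl)⟩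
     length(pa k)*(suc k *(θ{n}{k}*(μ * bs)))≡⟨ co(_*(suc k *(θ{n}{k}*(μ * bs))))lp ⟩
     few₂ ∎)
     where
     eh : ∀ p c -> cl p ≡ c -> Λ * # ts(\ v -> c ∧ F v p)≤ suc k *(θ{n}{k}*(μ * bs))
     eh p tu  e = tr(few f h p e)(mo(suc k)(cT f h))
     eh p fa e = tr(re(ta(co(Λ *_)(sz ts(\ _ -> refl)))(ze Λ)))zn
    outside : ∀{F}-> F ∈ 𝒢 -> sel F ≡ tu -> ∀ v p -> cl p ≡ tu -> cand v ≡ fa -> F v p ≡ fa
    outside{F}f h v p c e = n1(\ z -> te(ta(same-cand(pa k))(fo z(cI p c)))e)
     where
     same-cand : ∀ ps -> ay ps(\ ε -> iN ε ∧ rc F0 ε v)≡ ay ps(\ ε -> iN ε ∧ rc F ε v)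
     same-cand [] = refl
     same-cand(ε ∷ ps)= cn _∨_(at-ε(iN ε)refl)(same-cand ps)
      where
      at-ε : ∀ c -> iN ε ≡ c -> c ∧ rc F0 ε v ≡ c ∧ rc F ε v
      at-ε tu  q = s7 f₀ f h₀ h ε v q
      at-ε fa q = refl
     fo : F v p ≡ tu -> tw p ≡ tu ⊎ p ≡ on m -> cA(minimal f)n0 big₂ v ≡ tu
     fo z(i1 t)= t4(minimal f)n0 big₂{v}{p}z t
     fo z(i0 refl)= Sizes.sR(minimal f)n0 big₂ r₀{v}z
    leaf : ∀ se ->(∀ F -> se F ≡ tu -> sel F ≡ tu)->
     (∀{F G i}-> F ∈ 𝒢 -> G ∈ 𝒢 -> se F ≡ tu -> se G ≡ tu -> i ∈ Ss -> cl(p0 i)∧ F(po i)(p0 i)≡ cl(p0 i)∧ G(po i)(p0 i))-> # 𝒢 se ≤ X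
    leaf se sub eqs = up(#-≤ 𝒢 se)(same-canonical se(\{F}f h -> packed f(sub F h))(\{F}{G}f g hf hg v p c -> aj F G f g hf hg v p c(bo(cand v))))
     where
     aj : ∀ F G -> F ∈ 𝒢 -> G ∈ 𝒢 -> se F ≡ tu -> se G ≡ tu -> ∀ v p -> cl p ≡ tu -> cand v ≡ tu ⊎ cand v ≡ fa -> F v p ≡ G v p
     aj F G f g hf hg v p c(i0 e)= ta(outside f(sub F hf)v p c e)(sym(outside g(sub G hg)v p c e))
     aj F G f g hf hg v p c(i1 e)= ta(sym(co(_∧ F v p)c))(ta(eqs f g hf hg(ci(fe(t1 v)e)(pt p)))(co(_∧ G v p)c))

  L₁ = pk * n ^ k
  few₁ = pk *(θ{n}{k}*(μ * bs))
  m₁ = _/_ few₁ n{{nn n0}}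

  ff :(ε : Vec Bool k)-> ∃ \ i -> iN ε ≡ tu -> lo ε i ≡ fa
  ff ε = by(bo(iN ε))
   where
   by : iN ε ≡ tu ⊎ iN ε ≡ fa -> ∃ \ i -> iN ε ≡ tu -> lo ε i ≡ fa
   by(i1 h)= let i , e = ns ε h in i , \ _ -> e
   by(i0 h)= zero , \ h3 -> el(te h3 h)

  -- A rich table does not depend on its false coordinates, so one slice of it determines it.
  by-rich : ∀ sel X τ -> 2 * L₁ ≤ 2 ^ τ -> Packed sel ->(∀ se ->(∀ F -> se F ≡ tu -> sel F ≡ tu)-> SameRich se -> # 𝒢 se ≤ X)->
   # 𝒢 sel ≤ X *(2 ^ τ)^ m₁ * 2
  by-rich sel X τ 2L≤ packed leaf = c9 L₁(m0(m9 2 k)(af k n0))(begin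
   # 𝒢 sel ^ L₁ ≤⟨ sparse-bits 𝒢 st Ss m₁ sel(2 ^ τ)L₁ X(m9 2 τ)2L≤ ep leaf′ ⟩
   X ^ L₁ *(((2 ^ τ)^ m₁)^ L₁ * 2 ^ length Ss)≡⟨ co(\ l -> X ^ L₁ *(((2 ^ τ)^ m₁)^ L₁ * 2 ^ l))aW ⟩
   X ^ L₁ *(((2 ^ τ)^ m₁)^ L₁ * 2 ^ L₁)≡⟨ ta(sym(ac(X ^ L₁)_ _))(ta(co(_* 2 ^ L₁)(sym(db X((2 ^ τ)^ m₁)L₁)))(sym(db(X *(2 ^ τ)^ m₁)2 L₁)))⟩
   (X *(2 ^ τ)^ m₁ * 2)^ L₁ ∎)
   where
   open Re
   cB : Fin n
   cB = Data.Fin.fromℕ< n0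
   st : Vec Bool k × Vec(Fin n)k -> Fo n k -> Bool
   st(ε , v)F = iN ε ∧(eqF(lo v(po(ff ε)))cB ∧ rc F ε v)
   Ss = ct(pa k)ts
   aW : length Ss ≡ L₁
   aW = ta(ln Ss)(ta(sr _,_(pa k)ts(\ _ -> 1))(ta(sn(pa k)_)(cn _*_ lp(ta(sym(ln ts))(lg n k)))))
   ep : ∀{F}-> F ∈ 𝒢 -> sel F ≡ tu -> # Ss(\ i -> st i F)≤ m₁
   ep{F}f h = d3 n few₁(# Ss(\ i -> st i F)){{nn n0}}(begin
    n * # Ss(\ i -> st i F)≡⟨ ta(co(n *_)(sr _,_(pa k)ts(\ i -> bit(st i F))))(sym(s0(pa k)n(\ ε -> # ts(\ v -> st(ε , v)F))))⟩
    sum(pa k)(\ ε -> n * # ts(\ v -> st(ε , v)F))≤⟨ s2(pa k)(θ{n}{k}*(μ * bs))(\ ε -> eh ε(iN ε)refl)⟩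
    length(pa k)*(θ{n}{k}*(μ * bs))≡⟨ co(_*(θ{n}{k}*(μ * bs)))lp ⟩
    few₁ ∎)
    where
    eh : ∀ ε c -> iN ε ≡ c -> n * # ts(\ v -> c ∧(eqF(lo v(po(ff ε)))cB ∧ rc F ε v))≤ θ{n}{k}*(μ * bs)
    eh ε tu  e = tr(#-slice F ε(po(ff ε))cB(p0(ff ε)e))(tr(#-rich n0 F ε)(mo(θ{n}{k})(tr(#-cover F)(re(co(_* bs)(packed f h))))))
    eh ε fa e = tr(re(ta(co(n *_)(sz ts(\ _ -> refl)))(ze n)))zn
   leaf′ : ∀ se ->(∀ F -> se F ≡ tu -> sel F ≡ tu)->
    (∀{F G i}-> F ∈ 𝒢 -> G ∈ 𝒢 -> se F ≡ tu -> se G ≡ tu -> i ∈ Ss -> st i F ≡ st i G)-> # 𝒢 se ≤ X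
   leaf′ se sub eqs = leaf se sub(\{F}{G}f g hf hg ε v ng -> ta(sliced F ε v ng)(ta(eqs f g hf hg(ci(pt ε)(t1(v [ po(ff ε)]≔ cB))))(sym(sliced G ε v ng))))
    where
    sliced : ∀ F ε v -> iN ε ≡ tu -> rc F ε v ≡ st(ε , v [ po(ff ε)]≔ cB)F
    sliced F ε v ng = sym(ta(cn _∧_ ng(cn _∧_(ta(co(\ x -> eqF x cB)(Ve(po(ff ε))v cB))(eF cB))refl))(ru F ε v(po(ff ε))cB(p0(ff ε)ng)))

logarithm : ∀ a k c -> ∃ \ N -> ∀ n -> N ≤ n -> ∃ \ τ -> a * n ^ k ≤ 2 ^ τ × c * τ ≤ n
logarithm a k c = N , \ n N≤n -> a + k *(n / Γ), aW n(tr(mm _ _)N≤n), half n(tr(m5(2 *(c * a))(Γ *(a7 + suc a7)))N≤n)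
 where
 open Re
 Γ = suc(2 *(c * k))
 a7 = 2 * Γ
 N = Γ *(a7 + suc a7)+ 2 *(c * a)
 less : ∀ n -> Γ *(a7 + suc a7)≤ n -> n ≤ 2 ^(n / Γ)
 less n h = begin
  n ≤⟨ bf below ⟩
  Γ * suc x ≤⟨ mo Γ(m1 1≤x(re(sym(ie x))))⟩
  Γ *(2 * x)≡⟨ ri Γ x ⟩
  a7 * x ≡⟨ co(a7 *_)x≡ ⟩
  a7 *(a7 + suc y)≤⟨ linear≤2^ a7 y(tr(n2 a7)(mm(suc a7)(x ∸(a7 + suc a7))))⟩
  2 ^(a7 + suc y)≡⟨ co(2 ^_)(sym x≡)⟩
  2 ^ x ∎
  where
  x = n / Γ
  x≥ : a7 + suc a7 ≤ x
  x≥ = r2(ta(co(_/ Γ)(c2 Γ(a7 + suc a7)))(m*n/n≡m(a7 + suc a7)Γ))(/-monoˡ-≤ Γ h)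
  y = a7 +(x ∸(a7 + suc a7))
  x≡ : x ≡ a7 + suc y
  x≡ = ta(sym(md x≥))(+-assoc a7(suc a7)_)
  1≤x : 1 ≤ x
  1≤x = tr(ss zn)(tr(m5(suc a7)a7)x≥)
  below : n < Γ * suc x
  below = tr(ss(re(m≡m%n+[m/n]*n n Γ)))(tr(m4(x * Γ)(m%n<n n Γ))(re(c2(suc x)Γ)))
  ri : ∀ g x -> g *(2 * x)≡ 2 * g * x
  ri = so
 aW : ∀ n -> Γ *(a7 + suc a7)≤ n -> a * n ^ k ≤ 2 ^(a + k *(n / Γ))
 aW n h = tr(m0(n4 a)(tr(m3 k(less n h))(re(ta(ao 2(n / Γ)k)(co(2 ^_)(c2(n / Γ)k))))))(re(sym(dr 2 a(k *(n / Γ)))))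
 half : ∀ n -> 2 *(c * a)≤ n -> c *(a + k *(n / Γ))≤ n
 half n h = ca 2(begin
  2 *(c *(a + k *(n / Γ)))≡⟨ ri c a k(n / Γ)⟩
  2 *(c * a)+ 2 *(c * k)*(n / Γ)≤⟨ m1 h(tr(mn(n / Γ)(n2(2 *(c * k))))(tr(re(c2 Γ(n / Γ)))(m/n*n≤m n Γ)))⟩
  n + n ≡⟨ co(n +_)(sym(ie n))⟩
  2 * n ∎)
  where
  ri : ∀ c a k x -> 2 *(c *(a + k * x))≡ 2 *(c * a)+ 2 *(c * k)* x
  ri = so

square-cancel : ∀{a b}-> a * a ≤ b * b -> a ≤ b
square-cancel h = ≮⇒≥(\ lt -> <⇒≱(*-mono-< lt lt)h)

-- `X₃` bounds a class with fixed negative clauses, `X₂` one with a fixed rich table, and y is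
-- everything. Half of the saving is spent on the bits e₁ and e₂ of the two tables; the conclusion
-- is squared so that μ need not be halved.
combine-stages : ∀ y X₂ X₃ e₁ e₂ s T μ B -> 1 ≤ s -> y ≤ X₂ * 2 ^ e₁ -> X₂ ^ s ≤ X₃ ^ s * 2 ^ e₂ -> X₃ ^ T * 2 ^ μ ≤ B -> 2 *(e₁ * s * T + e₂ * T)≤ μ * s ->
 y ^ T * y ^ T * 2 ^ μ ≤ B * B
combine-stages y X₂ X₃ e₁ e₂ s T μ B aO h0 h1 h₃ s9 = cf _ _(2 ^ μ){{nn(m9 2 μ)}}(tr(re(r1(y ^ T)(2 ^ μ)))(c9 s aO(begin
 (A * A)^ s ≡⟨ db A A s ⟩
 A ^ s * A ^ s ≤⟨ m0 once once ⟩
 2 ^ E * B ^ s *(2 ^ E * B ^ s)≡⟨ r0(2 ^ E)(B ^ s)⟩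
 2 ^ E * 2 ^ E *(B ^ s * B ^ s)≤⟨ mn(B ^ s * B ^ s)(tr(re(sym(dr 2 E E)))(tr(m7(E + E)(μ * s)(r2(co(E +_)(ie E))s9))(re(sym(ao 2 μ s)))))⟩
 (2 ^ μ)^ s *(B ^ s * B ^ s)≡⟨ ta(co((2 ^ μ)^ s *_)(sym(db B B s)))(ta(sym(db(2 ^ μ)(B * B)s))(co(_^ s)(c2(2 ^ μ)(B * B))))⟩
 (B * B * 2 ^ μ)^ s ∎)))
 where
 open Re
 A = y ^ T * 2 ^ μ
 E = e₁ * s * T + e₂ * T
 r1 : ∀ y u -> y * y * u * u ≡ y * u *(y * u)
 r1 = so
 r0 : ∀ e b -> e * b *(e * b)≡ e * e *(b * b)
 r0 = so
 r3 : ∀ x e f u -> x * e * f * u ≡ f * e *(x * u)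
 r3 = so
 once : A ^ s ≤ 2 ^ E * B ^ s
 once = begin
  A ^ s ≡⟨ ta(db(y ^ T)(2 ^ μ)s)(co(_*(2 ^ μ)^ s)(^-swap y T s))⟩
  (y ^ s)^ T *(2 ^ μ)^ s ≤⟨ mn((2 ^ μ)^ s)(m3 T(tr(m3 s h0)(tr(re(db X₂(2 ^ e₁)s))(mn((2 ^ e₁)^ s)h1))))⟩
  (X₃ ^ s * 2 ^ e₂ *(2 ^ e₁)^ s)^ T *(2 ^ μ)^ s ≡⟨ co(_*(2 ^ μ)^ s)(ta(db(X₃ ^ s * 2 ^ e₂)((2 ^ e₁)^ s)T)(cn _*_(ta(db(X₃ ^ s)(2 ^ e₂)T)(cn _*_(^-swap X₃ s T)(ao 2 e₂ T)))(ta(ao(2 ^ e₁)s T)(ta(ao 2 e₁(s * T))(co(2 ^_)(sym(ac e₁ s T)))))))⟩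
  (X₃ ^ T)^ s * 2 ^(e₂ * T)* 2 ^(e₁ * s * T)*(2 ^ μ)^ s ≡⟨ r3((X₃ ^ T)^ s)(2 ^(e₂ * T))(2 ^(e₁ * s * T))((2 ^ μ)^ s)⟩
  2 ^(e₁ * s * T)* 2 ^(e₂ * T)*((X₃ ^ T)^ s *(2 ^ μ)^ s)≡⟨ cn _*_(sym(dr 2(e₁ * s * T)(e₂ * T)))(sym(db(X₃ ^ T)(2 ^ μ)s))⟩
  2 ^ E *(X₃ ^ T * 2 ^ μ)^ s ≤⟨ mo(2 ^ E)(m3 s h₃)⟩
  2 ^ E * B ^ s ∎

-- The costs of the two sparse stages stay below a quarter of the saving each.
stage-budget : ∀{n τ m₁ σ m₂ s L₂ T μ c0 c5 c₃ cF Λ}-> 1 ≤ n -> 1 ≤ Λ -> m₁ * n ≤ c0 * μ -> m₂ * Λ ≤ c5 * μ -> L₂ ≤ c₃ * μ -> n ≤ cF * μ ->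
 8 * T * c0 * τ ≤ n -> 8 * σ * T * c5 ≤ Λ -> 8 * T * c₃ ≤ s -> 8 * T * cF ≤ n -> 2 *((τ * m₁ + 1)* s * T +(σ * m₂ * s + L₂)* T)≤ μ * s
stage-budget{n}{τ}{m₁}{σ}{m₂}{s}{L₂}{T}{μ}{c0}{c5}{c₃}{cF}{Λ}n0 az h0 h1 h₃ h₄ g₁ g₂ g₃ g₄ = ca 4(begin
 4 *(2 *((τ * m₁ + 1)* s * T +(σ * m₂ * s + L₂)* T))≡⟨ r₀ τ m₁ s T σ m₂ L₂ ⟩
 8 * T * τ * m₁ * s + 8 * T * s + 8 * σ * T * m₂ * s + 8 * T * L₂ ≤⟨ m1(m1(m1(mn s a₁)(mn s a₄))(mn s a7))a₃ ⟩
 μ * s + μ * s + μ * s + μ * s ≡⟨ r₅(μ * s)⟩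
 4 *(μ * s)∎)
 where
 open Re
 r₀ : ∀ τ m₁ s T σ m₂ L₂ -> 4 *(2 *((τ * m₁ + 1)* s * T +(σ * m₂ * s + L₂)* T))≡ 8 * T * τ * m₁ * s + 8 * T * s + 8 * σ * T * m₂ * s + 8 * T * L₂
 r₀ = so
 r₅ : ∀ a -> a + a + a + a ≡ 4 * a
 r₅ = so
 r1 : ∀ x c u -> x *(c * u)≡ u *(x * c)
 r1 = so
 scaled : ∀ d x c a -> 1 ≤ d -> a * d ≤ c * μ -> x * c ≤ d -> x * a ≤ μ
 scaled d x c a 1≤d p q = cf _ _ d{{nn 1≤d}}(tr(re(ac x a d))(tr(mo x p)(tr(re(r1 x c μ))(mo μ q))))
 a₁ : 8 * T * τ * m₁ ≤ μ
 a₁ = scaled n(8 * T * τ)c0 m₁ n0 h0(tr(re(r0 T τ c0))g₁)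
  where
  r0 : ∀ T τ c -> 8 * T * τ * c ≡ 8 * T * c * τ
  r0 = so
 a7 : 8 * σ * T * m₂ ≤ μ
 a7 = scaled Λ(8 * σ * T)c5 m₂ az h1 g₂
 a₃ : 8 * T * L₂ ≤ μ * s
 a₃ = tr(mo(8 * T)h₃)(tr(re(r1(8 * T)c₃ μ))(mo μ g₃))
 a₄ : 8 * T ≤ μ
 a₄ = r2(it(8 * T))(scaled n(8 * T)cF 1 n0(r2(sym(ii n))h₄)g₄)

2^-cancel : ∀{a b}-> 2 ^ a ≤ 2 ^ b -> a ≤ b
2^-cancel{a}{b}h = ≮⇒≥(\ lt -> <⇒≱(^-monoʳ-< 2(ss(ss zn))lt)h)

module Light(k₂ : ℕ)where
 private
  m k : ℕ
  m = suc k₂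
  k = suc m

 Light : ∀{n}-> ℕ -> Fo n k -> Set
 Light{n}η F = ∀ x -> η * #(tup n m)(\ w -> F(x ∷ w)(on m))≤ n ^ m

 Negative : ∀{n}-> Fo n k -> Set
 Negative{n}F = ∃ \ v -> ∃ \ p -> F v p ≡ tu × iN p ≡ tu

 abstract
  T cF pk : ℕ
  pk = 2 ^ k
  T = 2 ^(suc k * k ^ k)
  cF = 2 * suc k *(suc k * k ^ k)
  s σ c0 c5 c₃ Λ c η : ℕ
  -- The order of choice is `T` and `cF`, then `s`, `σ` and `Λ`, and last `c` and `η`. The
  -- exceptional classes defined through `c` and `η` are treated elsewhere, so these two may be as
  -- large as required here.
  c0 = pk * cF
  c5 = pk *(suc k * cF)
  c₃ = pk * cF * pk
  s = suc(8 * T * c₃)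
  σ = 2 * s
  Λ = suc(8 * σ * T * c5)
  c = 2 * k * Λ
  η = Λ * po(shadow k₂ Λ)
  pk≡ : 2 ^ k ≡ pk
  pk≡ = refl
  T≥ : ∀ n -> 2 ^ blockSize{n}{k}≤ T
  T≥ n = rf{2 ^(suc k * k ^ k)}
  1≤T : 1 ≤ T
  1≤T = m9 2(suc k * k ^ k)
  c₄≡ : ∀ n μ -> θ{n}{k}*(μ * blockSize{n}{k})≡ cF * μ
  c₄≡ n μ = ri(2 * suc k)μ(suc k * k ^ k)
   where
   ri : ∀ t u b -> t *(u * b)≡ t * b * u
   ri = so
  aO : 1 ≤ s
  aO = ss zn
  s≥ : 8 * T * c₃ ≤ s
  s≥ = n2 _
  σ≥ : 2 * s ≤ 2 ^ σ
  σ≥ = n4 σ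
  az : 1 ≤ Λ
  az = ss zn
  Λ≥ : 8 * σ * T * c5 ≤ Λ
  Λ≥ = n2 _
  c₁≡ : c0 ≡ pk * cF
  c₁≡ = refl
  c₂≡ : c5 ≡ pk *(suc k * cF)
  c₂≡ = refl
  c₃≡ : c₃ ≡ pk * cF * pk
  c₃≡ = refl
  few-canonical : ∀{n}-> 1 ≤ n -> c * k ≤ n -> 4 *(k * k)≤ n -> ∀{F : Fo n k}-> Mi F -> ha c F ≡ fa -> Light η F -> ∀ p -> cl p ≡ tu -> Λ * #(tup n k)(\ v -> F v p)≤ suc k *(θ{n}{k}* #(tup n k)(c4 F))
  few-canonical n0 big big₂ M n3 l8 p h = Sizes.canon-few{_}{m}M n0 big₂{c}{Λ}{Λ}{po(shadow k₂ Λ)}n3 big rf(n2 Λ)η rf(p0(shadow k₂ Λ)n0)l8 p(cI p h)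

 -- A single negative clause already forces a packing linear in n, which is why its saving outweighs
 -- every factor polynomial in n.
 nc : ∀{n}-> 1 ≤ n -> 4 *(k * k)≤ n -> ∀{F : Fo n k}-> Mi F -> Negative F -> n ≤ cF * length(pc F)
 nc{n}n0 big₂{F}M(v , p , f , ng)= let i , c = cS p ng in
  p4(ae(pa k)(fo(v ⊙ sw zero i)(p ⊙ sw zero i)(ta(sA(ml M)v p zero i)f)(cI(p ⊙ sw zero i)c)))
  where
  fo : ∀ v p -> F v p ≡ tu -> tw p ≡ tu ⊎ p ≡ on m -> cA{n}{k}{F}M n0 big₂ v ≡ tu
  fo v p z(i1 t)= t4{n}{k}{F}M n0 big₂{v}{p}z t
  fo v p z(i0 refl)= Sizes.sR{n}{m}{F}M n0 big₂ zero{v}z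
  p4 : ∀{v}->(∃ \ ε -> ε ∈ pa k × iN ε ∧ rc F ε v ≡ tu)-> n ≤ cF * length(pc F)
  p4{v}(ε , _ , h)= rp(c₄≡ n(length(pc F)))(packing-large{F = F}n0 ε v(ad h)(ar{iN ε}h))

 module _{n : ℕ}(n0 : 1 ≤ n)(big : c * k ≤ n)(big₂ : 4 *(k * k)≤ n)(τ : ℕ)(2L≤ : 2 * pk * n ^ k ≤ 2 ^ τ)(τ≤ : 8 * T * c0 * τ ≤ n)(c₄≤ : 8 * T * cF ≤ n)
  (𝒢 : List(Fo n k))(minimal : ∀{F}-> F ∈ 𝒢 -> Mi F)(different : Di 𝒢)(sel : Fo n k -> Bool)
  (l8 : ∀{F}-> F ∈ 𝒢 -> sel F ≡ tu ->(ha c F ≡ fa × Light η F)× Negative F)where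
  private b = bi n k

  Bound : ℕ -> ℕ -> Set
  Bound μ y = y ^ T * y ^ T * 2 ^ μ ≤ 2 ^(T * b)* 2 ^(T * b)

  light-class : ∀ μ se ->(∀ F -> se F ≡ tu -> sel F ≡ tu)->(∀{F}-> F ∈ 𝒢 -> se F ≡ tu -> length(pc F)≡ μ)-> n ≤ cF * μ -> Bound μ(# 𝒢 se)
  light-class μ se sub packed n≤ = go
   (largest{\ y -> y ^ T * 2 ^ μ ≤ 2 ^(T * b)}(\ y -> _ ≤? _)(tr(re(co(_* 2 ^ μ)(zp T 1≤T)))zn)(length 𝒢))
   where
   open LightClass{n}{m}zero n0 big₂ 𝒢 minimal different T(T≥ n)μ
   zp : ∀ T -> 1 ≤ T -> 0 ^ T ≡ 0
   zp(suc T)_ = refl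
   mm₁ = m₁ s σ Λ σ≥ az
   mm₂ = m₂ s σ Λ σ≥ az
   LL₂ = L₂ s σ Λ σ≥ az
   W =((2 ^ σ)^ mm₂)^ s * 2 ^ LL₂
   few : Few s σ Λ σ≥ az se
   few{F}f h = let(n3 , li), _ = l8 f(sub F h)in few-canonical n0 big big₂(minimal f)n3 li
   go :(∃ \ X -> X ^ T * 2 ^ μ ≤ 2 ^(T * b)× ∀{y}-> y ≤ length 𝒢 -> y ^ T * 2 ^ μ ≤ 2 ^(T * b)-> y ≤ X)-> Bound μ(# 𝒢 se)
   go(X₃ , h₃ , up₃)= go₂(largest{\ y -> y ^ s ≤ X₃ ^ s * W}(\ y -> _ ≤? _)(tr(re(zp s aO))zn)(length 𝒢))
    where
    go₂ :(∃ \ X -> X ^ s ≤ X₃ ^ s * W × ∀{y}-> y ≤ length 𝒢 -> y ^ s ≤ X₃ ^ s * W -> y ≤ X)-> Bound μ(# 𝒢 se)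
    go₂(X₂ , h1 , up₂)= combine-stages(# 𝒢 se)X₂ X₃(τ * mm₁ + 1)(σ * mm₂ * s + LL₂)s T μ(2 ^(T * b))aO
     (tr(by-rich s σ Λ σ≥ az se X₂ τ(tr(re(ta(sym(ac 2(2 ^ k)(n ^ k)))(co(\ z -> 2 * z * n ^ k)pk≡)))2L≤)packed
      (\ sel″ sub′ rich′ -> up₂(#-≤ 𝒢 sel″)(same-rich s σ Λ σ≥ az sel″ X₃(\{F}f h -> packed f(sub′ F h))(\{F}f h -> few f(sub′ F h))rich′ up₃)))
      (re(ta(ac X₂ _ 2)(co(X₂ *_)(ta(co(_* 2)(ao 2 τ mm₁))(sym(dr 2(τ * mm₁)1)))))))
     (tr h1(re(co(X₃ ^ s *_)(ta(co(_* 2 ^ LL₂)(ta(co(_^ s)(ao 2 σ mm₂))(ao 2(σ * mm₂)s)))(sym(dr 2(σ * mm₂ * s)LL₂))))))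
     h₃(stage-budget{n}{τ}{mm₁}{σ}{mm₂}{s}{LL₂}{T}{μ}{c0}{c5}{c₃}{cF}{Λ}n0 az
      (tr(m/n*n≤m _ n{{nn n0}})(re(ta(cn _*_ pk≡(c₄≡ n μ))(ta(sym(ac pk cF μ))(co(_* μ)(sym c₁≡))))))
      (tr(m/n*n≤m _ Λ{{nn az}})(re(ta(cn(\ a z -> a *(suc k * z))pk≡(c₄≡ n μ))(ta(r0 pk(suc k)cF μ)(co(_* μ)(sym c₂≡))))))
      (re(ta(cn(\ a z -> a * z * a)pk≡(c₄≡ n μ))(ta(r3 pk cF μ)(co(_* μ)(sym c₃≡)))))
      n≤ τ≤ Λ≥ s≥ c₄≤)
     where
     r0 : ∀ p k c u -> p *(k *(c * u))≡ p *(k * c)* u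
     r0 = so
     r3 : ∀ p c u -> p *(c * u)* p ≡ p * c * p * u
     r3 = so

  -- Union over the packing size μ. A nonempty class cannot save more than its whole bound, so only
  -- O(bi n k) sizes occur, and `nc` makes the saving in each exceed the cost ρ.
  light-union : ∀ M₀ ρ -> M₀ *(suc(2 * T)* n ^ k)≤ 2 ^ ρ -> 2 * T * cF * ρ ≤ n -> M₀ * # 𝒢 sel ≤ 2 ^ b
  light-union M₀ ρ Z≤ ρ≤ = finish(popular 𝒢(al V)rel sel(rp(sym(lf V))(ss zn))covered)
   where
   open Re
   V = suc(T * b + T * b)
   rel : Fo n k -> Fin V -> Bool
   rel F i = le(length(pc F))(Fin′.toℕ i)∧ le(Fin′.toℕ i)(length(pc F))
   class : ∀{F0}-> F0 ∈ 𝒢 -> sel F0 ≡ tu -> ∀ se ->(∀ F -> se F ≡ tu -> sel F ≡ tu)->(∀{F}-> F ∈ 𝒢 -> se F ≡ tu -> length(pc F)≡ length(pc F0))-> Bound(length(pc F0))(# 𝒢 se)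
   class{F0}f h se sub packed = light-class(length(pc F0))se sub packed(nc n0 big₂(minimal f)(p0(l8 f h)))
   covered : ∀{F}-> F ∈ 𝒢 -> sel F ≡ tu -> ay(al V)(rel F)≡ tu
   covered{F}f h = an{p = rel F}(aF(Fin′.fromℕ<(ss μ≤)))(ai(l4(re(sym(Fin.toℕ-fromℕ<(ss μ≤)))))(l4(re(Fin.toℕ-fromℕ<(ss μ≤)))))
    where
    μ = length(pc F)
    se : Fo n k -> Bool
    se G = sel G ∧(le(length(pc G))μ ∧ le μ(length(pc G)))
    1≤y : 1 ≤ # 𝒢 se
    1≤y = tr(re(sym(co bit(ai h(ai(l4(rf{μ}))(l4(rf{μ})))))))(s4(bit ∘ se)f)
    μ≤ : μ ≤ T * b + T * b
    μ≤ = 2^-cancel(begin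
     2 ^ μ ≡⟨ sym(ii(2 ^ μ))⟩
     1 * 2 ^ μ ≤⟨ mn(2 ^ μ)(m0(af T 1≤y)(af T 1≤y))⟩
     # 𝒢 se ^ T * # 𝒢 se ^ T * 2 ^ μ ≤⟨ class f h se(\ G h -> ad h)(\{G}_ h -> ≤-antisym(lr(ad(ar{sel G}h)))(lr(ar{le(length(pc G))μ}(ar{sel G}h))))⟩
     2 ^(T * b)* 2 ^(T * b)≡⟨ sym(dr 2(T * b)(T * b))⟩
     2 ^(T * b + T * b)∎)
   finish :(∃ \ i -> # 𝒢 sel ≤ length(al V)* # 𝒢(\ F -> sel F ∧ rel F i))-> M₀ * # 𝒢 sel ≤ 2 ^ b
   finish(i , h)= by(e5 𝒢 se)
    where
    se = \ F -> sel F ∧ rel F i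
    y = # 𝒢 se
    h3 : M₀ * # 𝒢 sel ≤ 2 ^ ρ * y
    h3 = begin
     M₀ * # 𝒢 sel ≤⟨ mo M₀ h ⟩
     M₀ *(length(al V)* y)≡⟨ ta(co(\ l -> M₀ *(l * y))(lf V))(sym(ac M₀ V y))⟩
     M₀ * V * y ≤⟨ mn y(tr(mo M₀(tr(m1(af k n0)(m1(mo T(bm n k))(mo T(bm n k))))(re(ri T(n ^ k)))))Z≤)⟩
     2 ^ ρ * y ∎
     where
     ri : ∀ t u -> u +(t * u + t * u)≡ suc(2 * t)* u
     ri = so
    by : y ≡ 0 ⊎(∃ \ F -> F ∈ 𝒢 × se F ≡ tu)-> M₀ * # 𝒢 sel ≤ 2 ^ b
    by(i1 z)= tr h3(tr(re(ta(co(2 ^ ρ *_)z)(ze(2 ^ ρ))))zn)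
    by(i0(F , f , hF))= tr h3(square-cancel(c9 T 1≤T(begin
     (2 ^ ρ * y *(2 ^ ρ * y))^ T ≡⟨ ta(co(_^ T)(r1(2 ^ ρ)y))(ta(db(2 ^ ρ * 2 ^ ρ)(y * y)T)(cn _*_(ta(co(_^ T)(sym(dr 2 ρ ρ)))(ao 2(ρ + ρ)T))(db y y T)))⟩
     2 ^((ρ + ρ)* T)*(y ^ T * y ^ T)≤⟨ mn(y ^ T * y ^ T)(m7((ρ + ρ)* T)μ ρ-small)⟩
     2 ^ μ *(y ^ T * y ^ T)≡⟨ c2(2 ^ μ)(y ^ T * y ^ T)⟩
     y ^ T * y ^ T * 2 ^ μ ≤⟨ class f(ad hF)se(\ G h -> ad h)(\{G}g hG -> ta(size″ hG)(sym(size″ hF)))⟩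
     2 ^(T * b)* 2 ^(T * b)≡⟨ ta(co(\ z -> 2 ^ z * 2 ^ z)(c2 T b))(ta(co(\ z -> z * z)(sym(ao 2 b T)))(sym(db(2 ^ b)(2 ^ b)T)))⟩
     (2 ^ b * 2 ^ b)^ T ∎)))
     where
     μ = length(pc F)
     size″ : ∀{G}-> se G ≡ tu -> length(pc G)≡ Fin′.toℕ i
     size″{G}h = ≤-antisym(lr(ad(ar{sel G}h)))(lr(ar{le(length(pc G))(Fin′.toℕ i)}(ar{sel G}h)))
     r1 : ∀ a y -> a * y *(a * y)≡ a * a *(y * y)
     r1 = so
     r0 : ∀ ρ T c u ->(ρ + ρ)* T *(c * u)≡ 2 * T * c * ρ * u
     r0 = so
     ρ-small :(ρ + ρ)* T ≤ μ
     ρ-small = ca n{{nn n0}}(tr(tr(re(c2 n((ρ + ρ)* T)))(mo((ρ + ρ)* T)(nc n0 big₂(minimal f)(p0(l8 f(ad hF))))))(tr(re(r0 ρ T cF μ))(mn μ ρ≤)))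

 light-few : ∀ M₀ -> ∃ \ N -> ∀{n}-> N ≤ n ->(𝒢 : List(Fo n k))->(∀{F}-> F ∈ 𝒢 -> Mi F)-> Di 𝒢 -> ∀ sel ->
  (∀{F}-> F ∈ 𝒢 -> sel F ≡ tu ->(ha c F ≡ fa × Light η F)× Negative F)-> M₀ * # 𝒢 sel ≤ 2 ^ bi n k
 light-few M₀ = N , use
  where
  A = logarithm(2 * pk)k(8 * T * c0)
  B = logarithm(M₀ * suc(2 * T))k(2 * T * cF)
  N = suc(c * k + 4 *(k * k)+ 8 * T * cF + po A + po B)
  use : ∀{n}-> N ≤ n ->(𝒢 : List(Fo n k))->(∀{F}-> F ∈ 𝒢 -> Mi F)-> Di 𝒢 -> ∀ sel ->
   (∀{F}-> F ∈ 𝒢 -> sel F ≡ tu ->(ha c F ≡ fa × Light η F)× Negative F)-> M₀ * # 𝒢 sel ≤ 2 ^ bi n k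
  use{n}N≤n 𝒢 minimal different sel h = let τ , a₁ , a7 = p0 A n gA ; ρ , b₁ , b₂ = p0 B n gB in
   light-union(tr(ss zn)N≤n)(tr(tr(mm _ _)(tr(mm _ _)(tr(mm _(po A))(mm _(po B)))))N′)(tr(tr(m5 _(c * k))(tr(mm _(8 * T * cF))(tr(mm _(po A))(mm _(po B)))))N′)τ a₁ a7
    (tr(tr(m5 _(c * k + 4 *(k * k)))(tr(mm _(po A))(mm _(po B))))N′)𝒢 minimal different sel h M₀ ρ(r2(ac M₀(suc(2 * T))(n ^ k))b₁)b₂
   where
   N′ : c * k + 4 *(k * k)+ 8 * T * cF + po A + po B ≤ n
   N′ = tr(n2 _)N≤n
   gA = tr(tr(m5(po A)(c * k + 4 *(k * k)+ 8 * T * cF))(mm _(po B)))N′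
   gB = tr(m5(po B)(c * k + 4 *(k * k)+ 8 * T * cF + po A))N′

-- Colouring the faces of two families that rarely meet

allB-false : ∀{A : Set}(xs : List A){p}-> a2 xs p ≡ fa -> ∃ \ x -> x ∈ xs × p x ≡ fa
allB-false(x ∷ xs){p}h with p x in e
... | fa = x , he refl , e
... | tu  = let y , m , q = allB-false xs h in y , th m , q

-- Two families of sets, few of whose members differ in exactly one element: up to few
-- exceptions each lives on its own side of a colouring, and many sets are on neither side.
module Bichromatic{N m : ℕ}(1≤N : 1 ≤ N)(α β : Vec(Fin N)m -> Bool)where
 private
  ts = tup N m
  zs = al N

 dg :(Vec(Fin N)m -> Bool)-> Fin m -> Vec(Fin N)m -> ℕ
 dg γ i w = # zs(\ z -> γ(w [ i ]≔ z))

 dg-update : ∀ γ i w z -> dg γ i(w [ i ]≔ z)≡ dg γ i w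
 dg-update γ i w z = sc zs(\ y -> co(bit ∘ γ)(Vec.[]≔-idempotent w i))

 -- Colours the face of w omitting coordinate i by the family with more extensions of it, ties going
 -- to α. `up` and `dw` are the sets with all faces of one colour.
 col : Fin m -> Vec(Fin N)m -> Bool
 col i w = le(dg β i w)(dg α i w)

 cK : ∀ i w z -> col i(w [ i ]≔ z)≡ col i w
 cK i w z = cn le(dg-update β i w z)(dg-update α i w z)

 up dw mi : Vec(Fin N)m -> Bool
 up w = a2(al m)(\ i -> col i w)
 dw w = a2(al m)(\ i -> not(col i w))
 mi w = not(up w)∧ not(dw w)

 pairSum : Fin m -> ℕ
 pairSum i = sum ts(\ w -> dg α i w * dg β i w)

 bad : Fin m -> Vec(Fin N)(suc m)-> Bool
 bad i(z ∷ w)= α w ∧ β(w [ i ]≔ z)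

 pairSum-bad : ∀ i -> pairSum i ≡ N * #(tup N(suc m))(bad i)
 pairSum-bad i = begin
  sum ts(\ w -> dg α i w * dg β i w)≡⟨ sc ts(\ w -> ta(sym(sD zs(dg β i w)(\ z -> bit(α(w [ i ]≔ z)))))(sc zs(\ z -> co(bit(α(w [ i ]≔ z))*_)(sym(dg-update β i w z)))))⟩
  sum ts(\ w -> sum zs(\ z -> f(w [ i ]≔ z)))≡⟨ ta(sh zs i f)(co(_* sum ts f)(lf N))⟩
  N * sum ts f ≡⟨ co(N *_)(sc ts(\ w -> ta(sym(s0 zs(bit(α w))(\ z -> bit(β(w [ i ]≔ z)))))(sc zs(\ z -> sym(bd(α w)(β(w [ i ]≔ z)))))))⟩
  N * sum ts(\ w -> sum zs(\ z -> bit(bad i(z ∷ w))))≡⟨ co(N *_)(ta(s1 ts zs(\ w z -> bit(bad i(z ∷ w))))(sym(su zs m(\ v -> bit(bad i v)))))⟩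
  N * #(tup N(suc m))(bad i)∎
  where
  open Ra
  f : Vec(Fin N)m -> ℕ
  f w = bit(α w)* dg β i w

 -- On a face where γ is the minority, the square of its degree is at most the product of the α- and
 -- β-degrees. The sum of these products is small, and AM-GM against N converts this into few γ-sets
 -- with such a face.
 few : ∀ d ->(∀ i -> d * d * pairSum i ≤ N * N * N ^ m)-> ∀ γ(c : Fin m -> Vec(Fin N)m -> Bool)->(∀ i w z -> c i(w [ i ]≔ z)≡ c i w)->
  (∀ i w -> c i w ≡ tu -> dg γ i w * dg γ i w ≤ dg α i w * dg β i w)-> d * # ts(\ w -> γ w ∧ ay(al m)(\ i -> c i w))≤ m *(2 * N ^ m)
 few d hd γ c upd s9 = begin
  d * # ts(\ w -> γ w ∧ ay(al m)(\ i -> c i w))≤⟨ mo d(tr(m6 ts(\ w h -> let i , i∈ , q = ae(al m)(ar{γ w}h)in an{p = \ i -> γ w ∧ c i w}i∈(ai(ad h)q)))(aq ts(al m)(\ w i -> γ w ∧ c i w)))⟩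
  d * sum(al m)(\ i -> # ts(\ w -> γ w ∧ c i w))≡⟨ sym(s0(al m)d(\ i -> # ts(\ w -> γ w ∧ c i w)))⟩
  sum(al m)(\ i -> d * # ts(\ w -> γ w ∧ c i w))≤⟨ s2(al m)(2 * N ^ m)eh ⟩
  length(al m)*(2 * N ^ m)≡⟨ co(_*(2 * N ^ m))(lf m)⟩
  m *(2 * N ^ m)∎
  where
  open Re
  amgm : ∀ x y -> x * y ≤ x * x + y * y
  amgm x y with ≤-total x y
  ... | i1 h = tr(mn y h)(m5(y * y)(x * x))
  ... | i0 h = tr(mo x h)(mm(x * x)(y * y))
  r1 : ∀ d x -> d * x *(d * x)≡ d * d *(x * x)
  r1 = so
  r0 : ∀ n d x -> n * n *(d * x)≡ n * d *(n * x)
  r0 = so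
  r3 : ∀ n u -> u *(n * n)+ n * n * u ≡ n * n *(2 * u)
  r3 = so
  point : ∀ i w b -> c i w ≡ b -> N * d *(dg γ i w * bit b)≤ N * N + d * d *(dg α i w * dg β i w)
  point i w tu  h = tr(re(ta(co(N * d *_)(it _))(ac N d _)))(tr(amgm N(d * dg γ i w))(m2(N * N)(tr(re(r1 d(dg γ i w)))(mo(d * d)(s9 i w h)))))
  point i w fa h = tr(re(ta(co(N * d *_)(ze(dg γ i w)))(ze(N * d))))zn
  eh : ∀ i -> d * # ts(\ w -> γ w ∧ c i w)≤ 2 * N ^ m
  eh i = ca(N * N){{nn(m0 1≤N 1≤N)}}(begin
   N * N *(d * # ts(\ w -> γ w ∧ c i w))≡⟨ r0 N d(# ts(\ w -> γ w ∧ c i w))⟩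
   N * d *(N * # ts(\ w -> γ w ∧ c i w))≡⟨ co(N * d *_)(ta(co(_* # ts(\ w -> γ w ∧ c i w))(sym(lf N)))(ta(sym(sh zs i(\ w -> bit(γ w ∧ c i w))))(sc ts(\ w -> ta(sc zs(\ z -> ta(bd(γ(w [ i ]≔ z))(c i(w [ i ]≔ z)))(co(\ b -> bit(γ(w [ i ]≔ z))* bit b)(upd i w z))))(sD zs(bit(c i w))(\ z -> bit(γ(w [ i ]≔ z))))))))⟩
   N * d * sum ts(\ w -> dg γ i w * bit(c i w))≡⟨ sym(s0 ts(N * d)(\ w -> dg γ i w * bit(c i w)))⟩
   sum ts(\ w -> N * d *(dg γ i w * bit(c i w)))≤⟨ sm ts(\ w -> point i w(c i w)refl)⟩
   sum ts(\ w -> N * N + d * d *(dg α i w * dg β i w))≡⟨ ta(s3 ts(\ _ -> N * N)(\ w -> d * d *(dg α i w * dg β i w)))(cn _+_(ta(sn ts(N * N))(co(_*(N * N))(lg N m)))(s0 ts(d * d)(\ w -> dg α i w * dg β i w)))⟩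
   N ^ m *(N * N)+ d * d * pairSum i ≤⟨ m2(N ^ m *(N * N))(hd i)⟩
   N ^ m *(N * N)+ N * N * N ^ m ≡⟨ r3 N(N ^ m)⟩
   N * N *(2 * N ^ m)∎)

 module _(d : ℕ)(hd : ∀ i -> d * d * pairSum i ≤ N * N * N ^ m)where
  α-few : d * # ts(\ w -> α w ∧ not(up w))≤ m *(2 * N ^ m)
  α-few = tr(mo d(m6 ts(\ w h -> let i , i∈ , q = allB-false(al m)(nt(ar{α w}h))in ai(ad h)(an{p = \ i -> not(col i w)}i∈(co not q)))))
   (few d hd α(\ i w -> not(col i w))(\ i w z -> co not(cK i w z))(\ i w h -> mo(dg α i w)(bf(la(nt h)))))

  β-few : d * # ts(\ w -> β w ∧ not(dw w))≤ m *(2 * N ^ m)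
  β-few = tr(mo d(m6 ts(\ w h -> let i , i∈ , q = allB-false(al m)(nt(ar{β w}h))in ai(ad h)(an{p = \ i -> col i w}i∈(nj q)))))
   (few d hd β col cK(\ i w h -> mn(dg β i w)(lr h)))

 -- Walking from w to w′ one coordinate at a time, some point is on neither side.
 path : Fin m -> ∀ w w′ -> up w ≡ tu -> dw w′ ≡ tu -> ay(pa m)(\ ε -> mi(mix ε w w′))≡ tu
 path i₀ w w′ hu hd = by(walk(al m)(aT m)(sb(\ x -> up x ≡ tu)(sym(mix-all w w′))hu))
  where
  clear : List(Fin m)-> Vec Bool m -> Vec Bool m
  clear [] ε = ε
  clear(i ∷ is)ε = clear is(ε [ i ]≔ fa)
  stays : ∀ is ε i -> lo ε i ≡ fa -> lo(clear is ε)i ≡ fa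
  stays [] ε i h = h
  stays(j ∷ is)ε i h = stays is(ε [ j ]≔ fa)i(go(i Fin.≟ j))
   where
   go : Dec(i ≡ j)-> lo(ε [ j ]≔ fa)i ≡ fa
   go(yes refl)= Ve i ε fa
   go(no ne)= ta(Vu ne ε fa)h
  cleared : ∀ is ε i -> i ∈ is -> lo(clear is ε)i ≡ fa
  cleared(i ∷ is)ε .i(he refl)= stays is(ε [ i ]≔ fa)i(Ve i ε fa)
  cleared(j ∷ is)ε i(th m)= cleared is(ε [ j ]≔ fa)i m
  sI : ∀ ε i -> mix(ε [ i ]≔ fa)w w′ ≡ mix ε w w′ [ i ]≔ lo w′ i
  sI ε i = lx(\ t -> ta(lm(ε [ i ]≔ fa)w w′ t)(go t(t Fin.≟ i)))
   where
   go : ∀ t -> Dec(t ≡ i)->(if lo(ε [ i ]≔ fa)t then lo w t else lo w′ t)≡ lo(mix ε w w′ [ i ]≔ lo w′ i)t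
   go t(yes refl)= ta(co(\ b -> if b then lo w t else lo w′ t)(Ve t ε fa))(sym(Ve t(mix ε w w′)(lo w′ t)))
   go t(no ne)= ta(co(\ b -> if b then lo w t else lo w′ t)(Vu ne ε fa))(ta(sym(lm ε w w′ t))(sym(Vu ne(mix ε w w′)(lo w′ i))))
  fo : ∀ ε -> mi(mix ε w w′)≡ tu -> ay(pa m)(\ ε -> mi(mix ε w w′))≡ tu
  fo ε = an{p = \ ε -> mi(mix ε w w′)}(pt ε)
  walk : ∀ is ε -> up(mix ε w w′)≡ tu -> ay(pa m)(\ ε -> mi(mix ε w w′))≡ tu ⊎ up(mix(clear is ε)w w′)≡ tu
  walk [] ε h = i0 h
  walk(i ∷ is)ε h = go(bo(up(mix(ε [ i ]≔ fa)w w′)))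
   where
   coli : col i(mix(ε [ i ]≔ fa)w w′)≡ tu
   coli = ta(co(col i)(sI ε i))(ta(cK i(mix ε w w′)(lo w′ i))(aB{p = \ i -> col i(mix ε w w′)}h(aF i)))
   go : up(mix(ε [ i ]≔ fa)w w′)≡ tu ⊎ up(mix(ε [ i ]≔ fa)w w′)≡ fa -> ay(pa m)(\ ε -> mi(mix ε w w′))≡ tu ⊎ up(mix(clear is(ε [ i ]≔ fa))w w′)≡ tu
   go(i1 q)= walk is(ε [ i ]≔ fa)q
   go(i0 q)= i1(fo(ε [ i ]≔ fa)(ai(na q)(na(n1(\ z -> te coli(nt(aB{p = \ j -> not(col j(mix(ε [ i ]≔ fa)w w′))}z(aF i))))))))
  by : ay(pa m)(\ ε -> mi(mix ε w w′))≡ tu ⊎ up(mix(clear(al m)(aT m))w w′)≡ tu -> ay(pa m)(\ ε -> mi(mix ε w w′))≡ tu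
  by(i1 h)= h
  by(i0 h)= el(te(aB{p = \ i -> col i w′}(sb(\ x -> up x ≡ tu)end h)(aF i₀))(nt(aB{p = \ i -> not(col i w′)}hd(aF i₀))))
   where
   end : mix(clear(al m)(aT m))w w′ ≡ w′
   end = lx(\ t -> ta(lm(clear(al m)(aT m))w w′ t)(co(\ b -> if b then lo w t else lo w′ t)(cleared(al m)(aT m)t(aF t))))

 -- Each pair of an up-set and a down-set has a mixed set among its mixtures, and every mixture is
 -- uniform (`aV`).
 mixed-many : Fin m -> # ts up * # ts dw ≤ 2 ^ m *(N ^ m * # ts mi)
 mixed-many i₀ = begin
  # ts up * # ts dw ≡⟨ ta(sym(sD ts(# ts dw)(bit ∘ up)))(sc ts(\ w -> sym(s0 ts(bit(up w))(bit ∘ dw))))⟩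
  sum ts(\ w -> sum ts(\ w′ -> bit(up w)* bit(dw w′)))≤⟨ sm ts(\ w -> sm ts(\ w′ -> one w w′(bo(up w))(bo(dw w′))))⟩
  sum ts(\ w -> sum ts(\ w′ -> #(pa m)(\ ε -> mi(mix ε w w′))))≡⟨ ta(sc ts(\ w -> s1 ts(pa m)(\ w′ ε -> bit(mi(mix ε w w′)))))(s1 ts(pa m)(\ w ε -> # ts(\ w′ -> mi(mix ε w w′))))⟩
  sum(pa m)(\ ε -> sum ts(\ w -> # ts(\ w′ -> mi(mix ε w w′))))≡⟨ ta(sc(pa m)(\ ε -> ta(aV zs ε(bit ∘ mi))(co(\ l -> l ^ m * # ts mi)(lf N))))(ta(sn(pa m)(N ^ m * # ts mi))(co(_*(N ^ m * # ts mi))(lh(tu ∷ fa ∷ [])m)))⟩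
  2 ^ m *(N ^ m * # ts mi)∎
  where
  open Re
  one : ∀ w w′ -> up w ≡ tu ⊎ up w ≡ fa -> dw w′ ≡ tu ⊎ dw w′ ≡ fa -> bit(up w)* bit(dw w′)≤ #(pa m)(\ ε -> mi(mix ε w w′))
  one w w′(i1 a)(i1 b)= let ε , ε∈ , q = ae(pa m)(path i₀ w w′ a b)in tr(re(ta(cn(\ x y -> bit x * bit y)a b)(sym(co bit q))))(s4(\ ε -> bit(mi(mix ε w w′)))ε∈)
  one w w′(i0 a)_ = tr(re(co(\ x -> bit x * bit(dw w′))a))zn
  one w w′(i1 a)(i0 b)= tr(re(ta(co(\ x -> bit(up w)* bit x)b)(ze(bit(up w)))))zn

 module _(αs : ∀ w i j -> α(w ⊙ sw i j)≡ α w)(βs : ∀ w i j -> β(w ⊙ sw i j)≡ β w)where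
  update-swap : ∀(w : Vec(Fin N)m)i j r z ->(w ⊙ sw i j)[ r ]≔ z ≡(w [ lo(sw i j)r ]≔ z)⊙ sw i j
  update-swap w i j r z = lx(\ t -> go t(t Fin.≟ r))
   where
   go : ∀ t -> Dec(t ≡ r)-> lo((w ⊙ sw i j)[ r ]≔ z)t ≡ lo((w [ lo(sw i j)r ]≔ z)⊙ sw i j)t
   go t(yes refl)= ta(Ve t(w ⊙ sw i j)z)(sym(ta(lu(w [ lo(sw i j)t ]≔ z)(sw i j)t)(Ve(lo(sw i j)t)w z)))
   go t(no ne)= ta(Vu ne(w ⊙ sw i j)z)(ta(lu w(sw i j)t)(sym(ta(lu(w [ lo(sw i j)r ]≔ z)(sw i j)t)(Vu(\ e -> ne(sd i j t r e))w z))))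

  col-swap : ∀ w i j r -> col r(w ⊙ sw i j)≡ col(lo(sw i j)r)w
  col-swap w i j r = cn le(part β βs)(part α αs)
   where
   part : ∀ γ ->(∀ w i j -> γ(w ⊙ sw i j)≡ γ w)-> dg γ r(w ⊙ sw i j)≡ dg γ(lo(sw i j)r)w
   part γ γs = sc zs(\ z -> co bit(ta(co γ(update-swap w i j r z))(γs(w [ lo(sw i j)r ]≔ z)i j)))

  up-swap : ∀ w i j -> up(w ⊙ sw i j)≡ up w
  up-swap = sQ up(\ w i j h -> a0(al m)(\{r}_ -> ta(col-swap w i j r)(aB{p = \ i -> col i w}h(aF(lo(sw i j)r)))))

  down-swap : ∀ w i j -> dw(w ⊙ sw i j)≡ dw w
  down-swap = sQ dw(\ w i j h -> a0(al m)(\{r}_ -> ta(co not(col-swap w i j r))(aB{p = \ i -> not(col i w)}h(aF(lo(sw i j)r)))))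

  mixed-sets : # ts mi ≤ ft m * #(ks N m)mi + # ts(\ w -> not(di w))
  mixed-sets = tr(#-or ts{q = \ w -> di w ∧ mi w}{r = \ w -> not(di w)}(\ w h -> go w h(bo(di w))))(m4 _
   (tr(re(tp N m(\ w -> bit(di w ∧ mi w))record{sB = \ w i j -> co bit(cn _∧_(da w i j)(cn(\ a b -> not a ∧ not b)(up-swap w i j)(down-swap w i j))); vn = \ w h -> co(\ b -> bit(b ∧ mi w))h}))
    (mo(ft m)(m6(ks N m)(\ w h -> ar{di w}h)))))
   where
   go : ∀ w -> mi w ≡ tu -> di w ≡ tu ⊎ di w ≡ fa -> di w ∧ mi w ≡ tu ⊎ not(di w)≡ tu
   go w h(i1 e)= i1(ai e h)
   go w h(i0 e)= i0(na e)

-- Deleting a variable: rest and links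

sY : ∀{n}(x : Fin(suc n))f -> sum(al(suc n))f ≡ f x + sum(al n)(f ∘ pu x)
sY{n}zero f = sM n f
sY{suc n}(suc x)f = begin
 sum(al(suc(suc n)))f ≡⟨ ta(sM(suc n)f)(co(f zero +_)(sY x(f ∘ suc)))⟩
 f zero +(f(suc x)+ sum(al n)(f ∘ suc ∘ pu x))≡⟨ ri(f zero)(f(suc x))_ ⟩
 f(suc x)+(f zero + sum(al n)(f ∘ suc ∘ pu x))≡⟨ co(f(suc x)+_)(sym(sM n(f ∘ pu(suc x))))⟩
 f(suc x)+ sum(al(suc n))(f ∘ pu(suc x))∎
 where
 open Ra
 ri : ∀ a b c -> a +(b + c)≡ b +(a + c)
 ri = so

bj : ∀{n}m(x : Fin(suc n))(h : Vec(Fin(suc n))m -> ℕ)->(∀ v -> ou x v ≡ tu -> h v ≡ 0)->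
 sum(tup(suc n)m)h ≡ sum(tup n m)(h ∘ Vc(pu x))
bj zero x h z = refl
bj{n}(suc m)x h z = begin
 sum(tup(suc n)(suc m))h ≡⟨ ta(su(al(suc n))m h)(sY x(\ y -> sum(tup(suc n)m)(\ v -> h(y ∷ v))))⟩
 sum(tup(suc n)m)(\ v -> h(x ∷ v))+ sum(al n)(\ y -> sum(tup(suc n)m)(\ v -> h(pu x y ∷ v)))≡⟨ cn _+_(sz(tup(suc n)m)(\ v -> z(x ∷ v)(or-l{0}{0}(eF x))))
  (sc(al n)(\ y -> bj m x(\ v -> h(pu x y ∷ v))(\ v q -> z(pu x y ∷ v)(or-r{0}{0}{eqF x(pu x y)}q))))⟩
 sum(al n)(\ y -> sum(tup n m)(\ v -> h(Vc(pu x)(y ∷ v))))≡⟨ sym(su(al n)m(h ∘ Vc(pu x)))⟩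
 sum(tup n(suc m))(h ∘ Vc(pu x))∎
 where open Ra

aZ : ∀{n}m(x : Fin(suc n))(p : Vec(Fin(suc n))m -> Bool)-> #(tup n m)(p ∘ Vc(pu x))≤ #(tup(suc n)m)p
aZ{n}m x p = tr(tr(m6(tup n m){q = p1 ∘ Vc(pu x)}(\ v h -> ai(na(avoid v))h))(re(sym(bj m x(bit ∘ p1)(\ v h -> co(\ b -> bit(not b ∧ p v))h)))))(m6(tup(suc n)m)(\ v h -> ar{not(ou x v)}h))
 where
 p1 : Vec(Fin(suc n))m -> Bool
 p1 v = not(ou x v)∧ p v
 avoid : ∀{m}(v : Vec(Fin n)m)-> ou x(Vc(pu x)v)≡ fa
 avoid v = n1(\ h -> let i , e = oe(Vc(pu x)v)h in Fin.punchInᵢ≢i x(lo v i)(sym(ta e(Vm i(pu x)v))))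

module _{n : ℕ}(x : Fin(suc n))where
 ι : ∀{k}-> Vec(Fin n)k -> Vec(Fin(suc n))k
 ι = Vc(pu x)

 l0 : ∀{k}(v : Vec(Fin n)k)i -> lo(ι v)i ≡ pu x(lo v i)
 l0 v i = Vm i(pu x)v

 x∉ι : ∀{k}(v : Vec(Fin n)k)i -> x ≢ lo(ι v)i
 x∉ι v i e = Fin.punchInᵢ≢i x(lo v i)(sym(ta e(l0 v i)))

 ι-match : ∀{k l}(u : Vec(Fin n)k)(v : Vec(Fin n)l){i j}-> lo(ι u)i ≡ lo(ι v)j -> lo u i ≡ lo v j
 ι-match u v{i}{j}e = Fin.punchIn-injective x(lo u i)(lo v j)(ta(sym(l0 u i))(ta e(l0 v j)))

 d4 : ∀{k}(v : Vec(Fin n)k)-> Ds v -> Ds(ι v)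
 d4 v d i j e = d i j(ι-match v v e)

 cC : ∀{k}(v : Vec(Fin n)k)-> Ds v -> Ds(x ∷ ι v)
 cC v d zero zero e = refl
 cC v d zero(suc j)e = el(x∉ι v j e)
 cC v d(suc i)zero e = el(x∉ι v i(sym e))
 cC v d(suc i)(suc j)e = co suc(d4 v d i j e)

 module _{m : ℕ}(F : Fo(suc n)(suc m))where
  -- `rt` keeps the clauses avoiding x; `l6 b` below is the link of x, its clauses with sign b at x
  -- and x removed. Both inherit minimality from restricted witnesses.
  rt : Fo n(suc m)
  rt v p = F(ι v)p

  l6 : Bool -> Fo n m
  l6 b w p = F(x ∷ ι w)(b ∷ p)

  module _(M : Mi F)where
   rest-minimal : Mi rt
   rest-minimal = record
    {dist = \ v p f i j e -> Mi.dist M(ι v)p f i j(ta(l0 v i)(ta(co(pu x)e)(sym(l0 v j))))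
    ; perm = \ v p v′ p1 f d h -> Mi.perm M(ι v)p(ι v′)p1 f(d4 v′ d)(\ i -> let j , a , b = h i in j , ta(l0 v′ i)(ta(co(pu x)a)(sym(l0 v j))), b)
    ; wit = \ v p f -> let w , sat , oy = Mi.wit M(ι v)p f in w ∘ pu x ,(\ i -> ta(co w(sym(l0 v i)))(sat i)),
     \ v′ p1 f′ s i -> let j , e = oy(ι v′)p1 f′(\ i -> ta(co w(l0 v′ i))(s i))i in j , ι-match v′ v e}

   l7 : ∀ b -> Mi(l6 b)
   l7 b = record
    {dist = \ v p f i j e -> Fin.suc-injective(Mi.dist M(x ∷ ι v)(b ∷ p)f(suc i)(suc j)(ta(l0 v i)(ta(co(pu x)e)(sym(l0 v j)))))
    ; perm = \ v p v′ p1 f d h -> Mi.perm M(x ∷ ι v)(b ∷ p)(x ∷ ι v′)(b ∷ p1)f(cC v′ d)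
     (\{zero -> zero , refl , refl ;(suc i)-> let j , a , c = h i in suc j , ta(l0 v′ i)(ta(co(pu x)a)(sym(l0 v j))), c})
    ; wit = \ v p f -> let w , sat , oy = Mi.wit M(x ∷ ι v)(b ∷ p)f in w ∘ pu x ,(\ i -> ta(co w(sym(l0 v i)))(sat(suc i))),
     \ v′ p1 f′ s i -> back v v′ i(oy(x ∷ ι v′)(b ∷ p1)f′(\{zero -> sat zero ;(suc i)-> ta(co w(l0 v′ i))(s i)})(suc i))}
    where
    back : ∀(v v′ : Vec(Fin n)m)i ->(∃ \ j -> lo(ι v′)i ≡ lo(x ∷ ι v)j)-> ∃ \ j -> lo v′ i ≡ lo v j
    back v v′ i(zero , e)= el(x∉ι v′ i(sym e))
    back v v′ i(suc j , e)= j , ι-match v′ v e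

   -- x is true in the witness or false, and one of the two clauses at x is satisfied.
   bad-empty : ∀ i z w -> l6 tu w(aT m)≡ tu -> l6 fa(w [ i ]≔ z)(aT m)≡ tu -> F(ι(z ∷ w))(aT(suc m))≡ tu -> ⊥
   bad-empty i z w a b f = let W , sat , oy = Mi.wit M(ι(z ∷ w))(aT(suc m))f in go W(\ j -> ta(sat j)(Vr j tu))oy(bo(W x))
    where
    go :(W : Fin(suc n)-> Bool)->(∀ j -> W(lo(ι(z ∷ w))j)≡ tu)->(∀ v′ p1 -> F v′ p1 ≡ tu ->(∀ i -> W(lo v′ i)≡ lo p1 i)-> ∀ i -> ∃ \ j -> lo v′ i ≡ lo(ι(z ∷ w))j)-> W x ≡ tu ⊎ W x ≡ fa -> ⊥
    go W sat oy(i1 e)= let j , q = oy(x ∷ ι w)(tu ∷ aT m)a(\{zero -> e ;(suc t)-> ta(sat(suc t))(sym(Vr t tu))})zero in x∉ι(z ∷ w)j q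
    go W sat oy(i0 e)= let j , q = oy(x ∷ ι(w [ i ]≔ z))(fa ∷ aT m)b(\{zero -> e ;(suc t)-> ta(one t(t Fin.≟ i))(sym(Vr t tu))})zero in x∉ι(z ∷ w)j q
     where
     one : ∀ t -> Dec(t ≡ i)-> W(lo(ι(w [ i ]≔ z))t)≡ tu
     one t(yes refl)= ta(co W(ta(l0(w [ t ]≔ z)t)(co(pu x)(Ve t w z))))(sat zero)
     one t(no ne)= ta(co W(ta(l0(w [ i ]≔ z)t)(ta(co(pu x)(Vu ne w z))(sym(l0 w t)))))(sat(suc t))

f6 : ∀{A : Set}->((a b : A)-> Dec(a ≡ b))-> List A -> List Bool -> A -> Bool
f6 _≟_(a ∷ as)(b ∷ bs)x = if does(x ≟ a)then b else f6 _≟_ as bs x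
f6 _ _ _ _ = fa

fW : ∀{A : Set}(_≟_ :(a b : A)-> Dec(a ≡ b))as f{x}-> x ∈ as -> f6 _≟_ as(map f as)x ≡ f x
fW _≟_(a ∷ as)f{x}m with x ≟ a
... | yes refl = refl
fW _≟_(a ∷ as)f(he refl)| no ne = el(ne refl)
fW _≟_(a ∷ as)f(th m)| no ne = fW _≟_ as f m

does-true : ∀{P : Set}(d : Dec P)-> does d ≡ tu -> P
does-true(yes p)_ = p

module ManyBad{n m : ℕ}(x : Fin(suc n))(i : Fin m)where
 private
  k = suc m
  ts = tup n m
  vec≟ :(a b : Vec(Fin n)m)-> Dec(a ≡ b)
  vec≟ = Vec.≡-dec Fin._≟_

 badAt :(α β : Vec(Fin n)m -> Bool)-> Vec(Fin n)k -> Bool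
 badAt α β(z ∷ w)= α w ∧ β(w [ i ]≔ z)

 lB : Fo(suc n)k -> Vec(Fin n)k -> Bool
 lB F = badAt(\ w -> l6 x F tu w(aT m))(\ w -> l6 x F fa w(aT m))

 ba :(Vec(Fin n)k -> Bool)-> Vec(Fin(suc n))k -> Bool
 ba bad S = ay(tup n k)(\ t -> sim(ι x t)S ∧ bad t)

 #-badSet : ∀ bad -> #(tup n k)(\ t -> bad t ∧ di t)≤ k ^ k * #(ks(suc n)k)(ba bad)
 #-badSet bad = begin
  #(tup n k)(\ t -> bad t ∧ di t)≤⟨ sm(tup n k)(\ t -> one t(bo(bad t ∧ di t)))⟩
  sum(tup n k)(\ t -> sum K(\ S -> bit(ba bad S)* bit(sim(ι x t)S)))≡⟨ ta(s1(tup n k)K(\ t S -> bit(ba bad S)* bit(sim(ι x t)S)))(sc K(\ S -> s0(tup n k)(bit(ba bad S))(\ t -> bit(sim(ι x t)S))))⟩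
  sum K(\ S -> bit(ba bad S)* #(tup n k)(\ t -> sim(ι x t)S))≤⟨ sm K(\ S -> mo(bit(ba bad S))(tr(aZ k x(\ v -> sim v S))(#-sim S)))⟩
  sum K(\ S -> bit(ba bad S)* k ^ k)≡⟨ ta(sD K(k ^ k)(\ S -> bit(ba bad S)))(c2 _(k ^ k))⟩
  k ^ k * # K(ba bad)∎
  where
  open Re
  K = ks(suc n)k
  one : ∀ t -> bad t ∧ di t ≡ tu ⊎ bad t ∧ di t ≡ fa -> bit(bad t ∧ di t)≤ sum K(\ S -> bit(ba bad S)* bit(sim(ι x t)S))
  one t(i0 e)= tr(re(co bit e))zn
  one t(i1 e)= let S , S∈ , q = ke(ι x t)(d4 x t(dn t(ar{bad t}e))); q′ = sim-sym{v = S}{ι x t}q in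
   tr(re(ta(co bit e)(sym(cn(\ a b -> bit a * bit b)(an{p = \ t -> sim(ι x t)S ∧ bad t}(t1 t)(ai q′(ad e)))q′))))(s4(\ S -> bit(ba bad S)* bit(sim(ι x t)S))S∈)

 -- The guides are the two positive-pattern links of x, encoded by 2 n^m bits. Each bad
 -- configuration forbids the positive clause on its set by `bad-empty`, so a positive proportion of
 -- the k-sets is excluded.
 many-bad-tiny : ∀ Γ D(𝒢 : List(Fo(suc n)k))->(∀{F}-> F ∈ 𝒢 -> Mi F)-> Di 𝒢 -> ∀ sel -> let γ = 2 * Γ *(2 ^ k * k ^ k)in
  1 ≤ Γ -> 8 * γ ≤ n -> 2 * Γ *(k * k)≤ n -> 2 *(4 * γ * 2 ^ 2 ^ k)*(4 * γ)≤ D -> 1 ≤ n ->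
  (∀{F}-> F ∈ 𝒢 -> sel F ≡ tu -> D * nS F ≤ suc n ^ k × n ^ k ≤ Γ * #(tup n k)(lB F))-> Tiny(suc n)k(4 * γ)(# 𝒢 sel)
 many-bad-tiny Γ D 𝒢 minimal different sel 1≤Γ 8γ≤n nd hD n0 ok =
  guided 𝒢 minimal different sel Gs rel g γ D(rp(sym lenG)(m9 2 g))(re lenG)
   (begin
    4 * γ * g ≡⟨ r1 γ(n ^ m)⟩
    8 * γ * n ^ m ≤⟨ m0(tr 8γ≤n(n2 n))(m3 m(n2 n))⟩
    suc n ^ k ∎)
   (m0(m0(ss(zn{1}))1≤Γ)(m0(m9 2 k)(af k(ss zn))))hD
   (\{F}f h -> po(ok f h), an{p = rel F}(ci(wd ts(\ w -> l6 x F tu w(aT m)))(wd ts(\ w -> l6 x F fa w(aT m))))(ai(s7(map(\ w -> l6 x F tu w(aT m))ts))(s7(map(\ w -> l6 x F fa w(aT m))ts))))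
   Q(\ B v p h -> et p(aT k)(ad h))
   (\{F}{B}f h r -> inside F B f(agrees F B r), my F B f h(agrees F B r))
  where
  open Re
  γ = 2 * Γ *(2 ^ k * k ^ k)
  g = 2 * n ^ m
  Gs = ct(wo ts)(wo ts)
  r1 : ∀ γ u -> 4 * γ *(2 * u)≡ 8 * γ * u
  r1 = so
  lenG : length Gs ≡ 2 ^ g
  lenG = ta(ta(ln Gs)(ta(sr _,_(wo ts)(wo ts)(\ _ -> 1))(ta(sn(wo ts)_)(co(length(wo ts)*_)(sym(ln(wo ts)))))))
   (ta(co(\ l -> l * l)(ta(l3 ts)(co(2 ^_)(lg n m))))(ta(sym(dr 2(n ^ m)(n ^ m)))(co(\ z -> 2 ^(n ^ m + z))(sym(ie(n ^ m))))))
  s7 : ∀ a -> does(lD a a)≡ tu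
  s7 a with lD a a
  ... | yes _ = refl
  ... | no ne = el(ne refl)
  rel : Fo(suc n)k -> List Bool × List Bool -> Bool
  rel F(a , b)= does(lD(map(\ w -> l6 x F tu w(aT m))ts)a)∧ does(lD(map(\ w -> l6 x F fa w(aT m))ts)b)
  guess : List Bool × List Bool -> Vec(Fin n)k -> Bool
  guess(a , b)= badAt(f6 vec≟ ts a)(f6 vec≟ ts b)
  Q : List Bool × List Bool -> Fo(suc n)k
  Q B v p = eqP p(aT k)∧ not(ba(guess B)v)
  agrees : ∀ F B -> rel F B ≡ tu -> ∀ t -> guess B t ≡ lB F t
  agrees F(a , b)r(z ∷ w)= cn _∧_(part a _(does-true(lD _ a)(ad r))w)(part b _(does-true(lD _ b)(ar{does(lD(map(\ w -> l6 x F tu w(aT m))ts)a)}r))(w [ i ]≔ z))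
   where
   part : ∀ a(f : Vec(Fin n)m -> Bool)-> map f ts ≡ a -> ∀ w -> f6 vec≟ ts a w ≡ f w
   part a f refl w = fW vec≟ ts f(t1 w)
  inside : ∀ F B -> F ∈ 𝒢 ->(∀ t -> guess B t ≡ lB F t)-> ∀ v -> F v(aT k)≡ tu -> Q B v(aT k)≡ tu
  inside F B f eq v h = ai(eP(aT k))(na(n1(\ q -> let t , _ , r = ae(tup n k)q in ch t(ad r)(ta(sym(eq t))(ar{sim(ι x t)v}r)))))
   where
   ch : ∀ t -> sim(ι x t)v ≡ tu -> lB F t ≡ tu -> ⊥
   ch t@(z ∷ w)s r = bad-empty x F(minimal f)i z w(ad r)(ar{l6 x F tu w(aT m)}r)(minimal-sim(minimal f){v}{ι x t}h s)
  my : ∀ F B -> F ∈ 𝒢 -> sel F ≡ tu ->(∀ t -> guess B t ≡ lB F t)-> suc n ^ k ≤ γ * #(ks(suc n)k)(\ v -> not(Q B v(aT k)))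
  my F B f h eq = ca n{{nn n0}}(begin
   n * suc n ^ k ≤⟨ mo n(tr(m3 k(m1 n0(re(sym(ie n)))))(re(db 2 n k)))⟩
   n *(2 ^ k * n ^ k)≡⟨ r0 n(2 ^ k)(n ^ k)⟩
   2 ^ k *(n * n ^ k)≤⟨ mo(2 ^ k)main ⟩
   2 ^ k *(n *(2 *(Γ * X)))≤⟨ mo(2 ^ k)(mo n(mo 2(mo Γ(tr(#-badSet(lB F))(mo(k ^ k)sets)))))⟩
   2 ^ k *(n *(2 *(Γ *(k ^ k * #(ks(suc n)k)(\ v -> not(Q B v(aT k)))))))≡⟨ r3(2 ^ k)n Γ(k ^ k)_ ⟩
   n *(γ * #(ks(suc n)k)(\ v -> not(Q B v(aT k))))∎)
   where
   X = #(tup n k)(\ t -> lB F t ∧ di t)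
   Z = #(tup n k)(\ t -> not(di t))
   r0 : ∀ n a b -> n *(a * b)≡ a *(n * b)
   r0 = so
   r3 : ∀ p n g q y -> p *(n *(2 *(g *(q * y))))≡ n *(2 * g *(p * q)* y)
   r3 = so
   r5 : ∀ g n a b -> 2 *(n *(g *(a + b)))≡ n *(2 *(g * a))+ 2 * g *(n * b)
   r5 = so
   dbl : ∀ a -> 2 * a ≡ a + a
   dbl = so
   sets : #(ks(suc n)k)(ba(lB F))≤ #(ks(suc n)k)(\ v -> not(Q B v(aT k)))
   sets = m6(ks(suc n)k)(\ S q -> let t , t∈ , r = ae(tup n k)q in co not(ta(co(_∧ not(ba(guess B)S))(eP(aT k)))(co not(an{p = \ t -> sim(ι x t)S ∧ guess B t}t∈(ai(ad r)(ta(eq t)(ar{sim(ι x t)S}r)))))))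
   sl : #(tup n k)(lB F)≤ X + Z
   sl = #-or(tup n k){q = \ t -> lB F t ∧ di t}{r = \ t -> not(di t)}(\ t q -> go t q(bo(di t)))
    where
    go : ∀ t -> lB F t ≡ tu -> di t ≡ tu ⊎ di t ≡ fa -> lB F t ∧ di t ≡ tu ⊎ not(di t)≡ tu
    go t q(i1 e)= i1(ai q e)
    go t q(i0 e)= i0(na e)
   main : n * n ^ k ≤ n *(2 *(Γ * X))
   main = c6(n * n ^ k)_ _(begin
    n * n ^ k + n * n ^ k ≡⟨ sym(dbl(n * n ^ k))⟩
    2 *(n * n ^ k)≤⟨ mo 2(mo n(tr(p0(ok f h))(mo Γ sl)))⟩
    2 *(n *(Γ *(X + Z)))≡⟨ r5 Γ n X Z ⟩
    n *(2 *(Γ * X))+ 2 * Γ *(n * Z)≤⟨ m2(n *(2 *(Γ * X)))(tr(mo(2 * Γ)(ni n k))(tr(re(sym(ac(2 * Γ)(k * k)(n ^ k))))(mn(n ^ k)nd)))⟩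
    n *(2 *(Γ * X))+ n * n ^ k ∎)

-- `fw` with x held in place and the vertices of the remaining negative literals refilled at random.
few-at : ∀{n m}{F : Fo n(suc m)}-> Mi F -> ∀{c}-> ha c F ≡ fa -> c * suc m ≤ n -> 1 ≤ n -> ∀ x b p -> iN p ≡ tu ->
 c * #(tup n m)(\ w -> F(x ∷ w)(b ∷ p))≤ 2 * suc m * n ^ m
few-at{n}{m}{F}M{c}n3 big n0 x b p ng = ca(n * n ^ m){{nn(af(suc m)n0)}}(begin
 n * n ^ m *(c * #(tup n m)f)≡⟨ r1 n(n ^ m)c(#(tup n m)f)⟩
 c *(n *(n ^ m * #(tup n m)f))≡⟨ co(\ z -> c *(n * z))(sym(ta(aV(al n)p(bit ∘ f))(co(\ l -> l ^ m * #(tup n m)f)(lf n))))⟩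
 c *(n * sum(tup n m)(\ w -> #(tup n m)(\ u -> f(mix p w u))))≡⟨ co(c *_)(ta(sym(s0(tup n m)n _))(sc(tup n m)(\ w -> sym(ta(su(al n)m(\ u -> bit(F(mix(tu ∷ p)(x ∷ w)u)(b ∷ p))))(ta(sn(al n)_)(co(_* #(tup n m)(\ u -> f(mix p w u)))(lf n)))))))⟩
 c * sum(tup n m)(\ w -> #(tup n(suc m))(\ u -> F(mix(tu ∷ p)(x ∷ w)u)(b ∷ p)))≡⟨ sym(s0(tup n m)c(\ w -> #(tup n(suc m))(\ u -> F(mix(tu ∷ p)(x ∷ w)u)(b ∷ p))))⟩
 sum(tup n m)(\ w -> c * #(tup n(suc m))(\ u -> F(mix(tu ∷ p)(x ∷ w)u)(b ∷ p)))≤⟨ s2(tup n m)(2 * suc m * n ^ suc m)(\ w -> fw M{c}n3 big n0(b ∷ p)(tu ∷ p)(x ∷ w)(\{(suc i)e -> e})(let i , e = ns p ng in suc i , e))⟩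
 length(tup n m)*(2 * suc m * n ^ suc m)≡⟨ ta(co(_*(2 * suc m * n ^ suc m))(lg n m))(r0(n ^ m)(2 * suc m)n)⟩
 n * n ^ m *(2 * suc m * n ^ m)∎)
 where
 open Re
 f : Vec(Fin n)m -> Bool
 f w = F(x ∷ w)(b ∷ p)
 r1 : ∀ n u c y -> n * u *(c * y)≡ c *(n *(u * y))
 r1 = so
 r0 : ∀ u k n -> u *(k *(n * u))≡ n * u *(k * u)
 r0 = so

-- Variables negative in many clauses

hh : ∀ y Y s E₁ b h μ γ U -> 1 ≤ s -> y ^ s ≤ Y ^ s * 2 ^(E₁ + b)*(2 ^ h)^ s -> h + μ ≡ b -> U ≤ γ * μ -> b ≤ U -> 4 * γ ≤ s -> 4 * γ * E₁ ≤ s * U ->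
 y ^(2 * γ)* 2 ^ U ≤(Y * 2 ^ b)^(2 * γ)
hh y Y s E₁ b h μ γ U aO hy hμ hU b≤U sγ sE = c9 s aO(cf _ _((2 ^ U)^ s){{nn(af s(m9 2 U))}}(begin
 (y ^ g * 2 ^ U)^ s *(2 ^ U)^ s ≡⟨ ta(co(_*(2 ^ U)^ s)(db(y ^ g)(2 ^ U)s))(ta(ac((y ^ g)^ s)_ _)(cn _*_(^-swap y g s)(ta(sym(db(2 ^ U)(2 ^ U)s))(co(_^ s)(sym(dr 2 U U))))))⟩
 (y ^ s)^ g *(2 ^(U + U))^ s ≤⟨ mo((y ^ s)^ g)(m3 s(m7(U + U)(μ * g)(tr(m1 hU hU)(re(r1 γ μ)))))⟩
 (y ^ s)^ g *(2 ^(μ * g))^ s ≡⟨ co((y ^ s)^ g *_)(ta(co(_^ s)(sym(ao 2 μ g)))(^-swap(2 ^ μ)g s))⟩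
 (y ^ s)^ g *((2 ^ μ)^ s)^ g ≡⟨ sym(db(y ^ s)((2 ^ μ)^ s)g)⟩
 (y ^ s *(2 ^ μ)^ s)^ g ≤⟨ m3 g(mn((2 ^ μ)^ s)hy)⟩
 (Y ^ s * 2 ^(E₁ + b)*(2 ^ h)^ s *(2 ^ μ)^ s)^ g ≡⟨ co(_^ g)(ta(ac(Y ^ s * 2 ^(E₁ + b))_ _)(ta(co(Y ^ s * 2 ^(E₁ + b)*_)(ta(sym(db(2 ^ h)(2 ^ μ)s))(co(_^ s)(ta(sym(dr 2 h μ))(co(2 ^_)hμ)))))(ta(r0(Y ^ s)(2 ^(E₁ + b))((2 ^ b)^ s))(co(_* 2 ^(E₁ + b))(sym(db Y(2 ^ b)s))))))⟩
 ((Y * 2 ^ b)^ s * 2 ^(E₁ + b))^ g ≡⟨ ta(db((Y * 2 ^ b)^ s)(2 ^(E₁ + b))g)(cn _*_(^-swap(Y * 2 ^ b)s g)(ao 2(E₁ + b)g))⟩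
 ((Y * 2 ^ b)^ g)^ s * 2 ^((E₁ + b)* g)≤⟨ mo(((Y * 2 ^ b)^ g)^ s)(tr(m7((E₁ + b)* g)(U * s)s9)(re(sym(ao 2 U s))))⟩
 ((Y * 2 ^ b)^ g)^ s *(2 ^ U)^ s ∎))
 where
 open Re
 g = 2 * γ
 r1 : ∀ γ μ -> γ * μ + γ * μ ≡ μ *(2 * γ)
 r1 = so
 r0 : ∀ a b c -> a * b * c ≡ a * c * b
 r0 = so
 r3 : ∀ e b γ -> 2 *((e + b)*(2 * γ))≡ 4 * γ * e + 4 * γ * b
 r3 = so
 r5 : ∀ s u -> s * u + s * u ≡ 2 *(u * s)
 r5 = so
 s9 :(E₁ + b)* g ≤ U * s
 s9 = ca 2(tr(re(r3 E₁ b γ))(tr(m1 sE(m0 sγ b≤U))(re(r5 s U))))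

Af : ∀{A B : Set}{R : A -> A -> Set}{S : B -> B -> Set}(f : A -> B)(p : A -> Bool)xs -> AllPairs.AllPairs R xs ->
 (∀{x y}-> x ∈ xs -> y ∈ xs -> p x ≡ tu -> p y ≡ tu -> R x y -> S(f x)(f y))-> AllPairs.AllPairs S(map f(fi p xs))
Af f p [] _ h = AllPairs.[]
Af{S = S}f p(x ∷ xs)(a AllPairs.∷ as)h with p x in e
... | fa = Af f p xs as(\ m m′ -> h(th m)(th m′))
... | tu  = All.tabulate eh AllPairs.∷ Af f p xs as(\ m m′ -> h(th m)(th m′))
 where
 eh : ∀{z}-> z ∈ map f(fi p xs)-> S(f x)z
 eh m with ma f m
 ... | y , y∈ , refl = let y∈′ , q = fl p xs y∈ in h(he refl)(th y∈′)e q(All.lookup a y∈′)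

swapIx-first : ∀{m}(i : Fin(suc m))-> lo(sw zero i)zero ≡ i
swapIx-first i = by(lw zero i zero)
 where
 by :(zero ≡ i × lo(sw zero i)zero ≡ zero)⊎(zero ≡ zero × zero ≢ i × lo(sw zero i)zero ≡ i)⊎(zero ≢ zero × zero ≢ i × lo(sw zero i)zero ≡ zero)-> lo(sw zero i)zero ≡ i
 by(i1(a , b))= ta b a
 by(i0(i1(_ , _ , b)))= b
 by(i0(i0(a , _)))= el(a refl)

module HeavyClass{n m : ℕ}(x : Fin(suc n))(i₀ : Fin m)(n0 : 1 ≤ n)(𝒢 : List(Fo(suc n)(suc m)))(minimal : ∀{F}-> F ∈ 𝒢 -> Mi F)(different : Di 𝒢)
 (Y : ℕ)(smaller : ∀(ℋ : List(Fo n(suc m)))->(∀{F}-> F ∈ ℋ -> Mi F)-> Di ℋ -> length ℋ ≤ Y)where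
 private
  k = suc m
  ts = tup n m
  K = ks n m
  U = n ^ m
  b = bi n m
  A = 2 ^ 2 ^ k

 α β : Fo(suc n)k -> Vec(Fin n)m -> Bool
 α F w = l6 x F tu w(aT m)
 β F w = l6 x F fa w(aT m)

 module BC(F : Fo(suc n)k)= Bichromatic n0(α F)(β F)

 -- Once both links of x are fixed, deleting x is injective on the class and leads to fewer
 -- variables, where Y is the bound.
 same-links : ∀ sel ->(∀{F G}-> F ∈ 𝒢 -> G ∈ 𝒢 -> sel F ≡ tu -> sel G ≡ tu -> ∀ c w p -> l6 x F c w p ≡ l6 x G c w p)-> # 𝒢 sel ≤ Y
 same-links sel s7 = tr(re(sym(ta(length-map(rt x)(fi sel 𝒢))(ll 𝒢 sel))))(smaller(map(rt x)(fi sel 𝒢))mins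
  (Af(rt x)sel 𝒢 different(\{F}{G}f g hf hg ne eq -> ne(determined f g(s7 f g hf hg)eq))))
  where
  mins : ∀{H}-> H ∈ map(rt x)(fi sel 𝒢)-> Mi H
  mins h with ma(rt x)h
  ... | F , F∈ , refl = rest-minimal x F(minimal(po(fl sel 𝒢 F∈)))
  preimage : ∀{l}(v : Vec(Fin(suc n))l)->(∀ i -> x ≢ lo v i)-> ∃ \ v′ -> ι x v′ ≡ v
  preimage v ne = tb(\ i -> punchOut(ne i)), lx(\ i -> ta(l0 x(tb(\ i -> punchOut(ne i)))i)(ta(co(pu x)(Vt(\ i -> punchOut(ne i))i))(Fin.punchIn-punchOut(ne i))))
  determined : ∀{F G}-> F ∈ 𝒢 -> G ∈ 𝒢 ->(∀ c w p -> l6 x F c w p ≡ l6 x G c w p)->(∀ v p -> rt x F v p ≡ rt x G v p)-> ∀ v p -> F v p ≡ G v p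
  determined{F}{G}f g lk rs v p = go(bo(di v))(bo(ou x v))
   where
   front : ∀ u q -> lo u zero ≡ x -> Ds u -> F u q ≡ G u q
   front(.x ∷ w)(c ∷ q)refl d = let w′ , e = preimage w(\ j e -> s8(d zero(suc j)e))in sb(\ z -> F(x ∷ z)(c ∷ q)≡ G(x ∷ z)(c ∷ q))e(lk c w′ q)
    where
    s8 : ∀{m}{j : Fin m}-> zero ≡ suc j -> ⊥
    s8()
   go : di v ≡ tu ⊎ di v ≡ fa -> ou x v ≡ tu ⊎ ou x v ≡ fa -> F v p ≡ G v p
   go(i0 nd)_ = ta(absent f)(sym(absent g))
    where
    absent : ∀{H}-> H ∈ 𝒢 -> H v p ≡ fa
    absent h = n1(\ t -> te(dc v(Mi.dist(minimal h)v p t))nd)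
   go(i1 d)(i0 oc)= let v′ , e = preimage v(\ i e -> te(ta(co(\ z -> ou z v)e)(ol v i))oc)in sb(\ z -> F z p ≡ G z p)e(rs v′ p)
   go(i1 d)(i1 oc)= let i , e = oe v oc in ta(sym(sA(ml(minimal f))v p zero i))(ta
    (front(v ⊙ sw zero i)(p ⊙ sw zero i)(ta(lu v(sw zero i)zero)(ta(co(lo v)(swapIx-first i))(sym e)))(d1 v(sw zero i)(dn v d)(sd zero i)))
    (sA(ml(minimal g))v p zero i))

 -- Up-sets are expected to carry only the positive clause with x, down-sets only the one negative
 -- just at x, and mixed sets nothing (`aw`). `stray` counts the departures.
 target : Fo(suc n)k -> Vec(Fin n)m -> Vec Bool k
 target F w = if BC.up F w then aT k else on m

 aw : Fo(suc n)k -> Vec(Fin n)m -> Vec Bool k -> Bool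
 aw F w p = eqP p(target F w)∧ not(BC.mi F w)

 Sm :(Fo(suc n)k -> Bool)-> Fo(suc n)k -> Set
 Sm sel F0 = ∀{F}-> F ∈ 𝒢 -> sel F ≡ tu -> ∀ i w -> BC.col F i w ≡ BC.col F0 i w

 allB-cong : ∀{I : Set}(xs : List I){p q : I -> Bool}->(∀ i -> p i ≡ q i)-> a2 xs p ≡ a2 xs q
 allB-cong [] h = refl
 allB-cong(i ∷ xs)h = cn _∧_(h i)(allB-cong xs h)

 stray : Fo(suc n)k -> ℕ
 stray F = sum ts(\ w -> #(pa k)(\ p -> F(x ∷ ι x w)p ∧ not(aw F w p)))

 up-not-mixed : ∀ F w -> BC.up F w ≡ tu -> BC.mi F w ≡ fa
 up-not-mixed F w h = co(\ z -> not z ∧ not(BC.dw F w))h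

 down-not-up : ∀ F w -> BC.dw F w ≡ tu -> BC.up F w ≡ fa
 down-not-up F w h = n1(\ z -> te(aB{p = \ i -> BC.col F i w}z(aF i₀))(nt(aB{p = \ i -> not(BC.col F i w)}h(aF i₀))))

 coloured : ∀ sel F0 s e -> Sm sel F0 ->(∀{F}-> F ∈ 𝒢 -> sel F ≡ tu -> stray F ≤ e)->
  # 𝒢 sel ^ s ≤ Y ^ s * 2 ^(2 *(s * A)* e * s + b)*(2 ^ # K(\ S -> not(BC.mi F0 S)))^ s
 coloured sel F0 s e s7 few = tr
  (near-bound K(# 𝒢 sel)Y e s A(\ S -> 1 + #(pa k)(aw F0 S))(\ S -> #(wo(pa k))(\ a -> not(oW(pa k)(aw F0 S)a)))(\ S -> tr(#-≤(wo(pa k))_)(re(ta(l3(pa k))(co(2 ^_)(lh(tu ∷ fa ∷ [])k)))))(\ _ -> ss zn)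
   (tr(near lD 𝒢(\ S F -> map(F(x ∷ ι x S))(pa k))(\ _ -> wo(pa k))(\ S -> oW(pa k)(aw F0 S))t Y(m9 2(2 *(s * A)))K e sel
    (\{F}{S}_ _ _ -> wd(pa k)(F(x ∷ ι x S)))(\{F}f h -> tr(tr(sm K(\ S -> exception f h S))(sk n m _))(few f h))
    (\ se _ eqs -> same-links se(\{F}{G}f g hf hg c w p -> sW(l7 x F(minimal f)c)(l7 x G(minimal g)c)(\{S}S∈ -> map-cong(\ p -> mh(eqs f g hf hg S∈)(pt(c ∷ p)))(pa m))w p)))
    (mo(Y * t ^ e)(pm K(\ S -> m4 _(mo t(cW(pa k)(aw F0 S))))))))
  (tr(re(co(\ l -> Y ^ s * 2 ^(2 *(s * A)* e * s + l)* pd K(\ S -> 1 + #(pa k)(aw F0 S))^ s)(l1 n m)))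
   (mo(Y ^ s * 2 ^(2 *(s * A)* e * s + b))(m3 s(tr(pm K(\ S -> tr(ss(one-allowed S))(pow(not(BC.mi F0 S)))))(re(prod-^ K 2(\ S -> bit(not(BC.mi F0 S)))))))))
  where
  t = 2 ^(2 *(s * A))
  pow : ∀ c -> 1 + bit c ≤ 2 ^ bit c
  pow tu  = rf
  pow fa = rf
  one-allowed : ∀ S -> #(pa k)(aw F0 S)≤ bit(not(BC.mi F0 S))
  one-allowed S = re(ta(sc(pa k)(\ p -> bd(eqP p(target F0 S))_))(sP(target F0 S)(\ _ -> bit(not(BC.mi F0 S)))))
  same-allowed : ∀{F}-> F ∈ 𝒢 -> sel F ≡ tu -> ∀ S p -> aw F S p ≡ aw F0 S p
  same-allowed{F}f h S p = cn(\ u d -> eqP p(if u then aT k else on m)∧ not(not u ∧ not d))(allB-cong(al m)(\ i -> s7 f h i S))(allB-cong(al m)(\ i -> co not(s7 f h i S)))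
  exception : ∀{F}-> F ∈ 𝒢 -> sel F ≡ tu -> ∀ S -> bit(not(oW(pa k)(aw F0 S)(map(F(x ∷ ι x S))(pa k))))≤ #(pa k)(\ p -> F(x ∷ ι x S)p ∧ not(aw F S p))
  exception{F}f h S = tr(go(oW(pa k)(aw F0 S)(map(F(x ∷ ι x S))(pa k)))refl)(re(sc(pa k)(\ p -> co(\ z -> bit(F(x ∷ ι x S)p ∧ not z))(sym(same-allowed f h S p)))))
   where
   f₀ = F(x ∷ ι x S)
   q = aw F0 S
   lem : ∀ a c -> bit a ≤ bit c + bit(a ∧ not c)
   lem a tu = bt(ss zn)
   lem a fa = re(co bit(sym(∧-identityʳ a)))
   by :(∃ \ p -> p ∈ pa k × f₀ p ∧ not(q p)≡ tu)⊎ 2 ≤ #(pa k)f₀ -> 1 ≤ #(pa k)(\ p -> f₀ p ∧ not(q p))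
   by(i1(p , p∈ , z))= tr(re(sym(co bit z)))(s4(\ p -> bit(f₀ p ∧ not(q p)))p∈)
   by(i0 two)= +-cancelˡ-≤ 1 _ _(tr two(tr(tr(sm(pa k)(\ p -> lem(f₀ p)(q p)))(re(s3(pa k)(bit ∘ q)(\ p -> bit(f₀ p ∧ not(q p))))))(m4 _(tr(one-allowed S)(bt rf)))))
   go : ∀ c -> oW(pa k)q(map f₀(pa k))≡ c -> bit(not c)≤ #(pa k)(\ p -> f₀ p ∧ not(q p))
   go tu  _ = zn
   go fa e = by(nk(pa k)q f₀ e)

 slices : List(Fin m × Vec(Fin n)m)
 slices = fi(\(i , w)-> eqF(lo w i)(Fin′.fromℕ< n0))(ct(al m)ts)

 #-slices : n * length slices ≤ m * U
 #-slices = begin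
  n * length slices ≡⟨ co(n *_)(ta(ll(ct(al m)ts)(\(i , w)-> eqF(lo w i)cB))(sr _,_(al m)ts(\(i , w)-> bit(eqF(lo w i)cB))))⟩
  n * sum(al m)(\ i -> # ts(\ w -> eqF(lo w i)cB))≡⟨ sym(s0(al m)n(\ i -> # ts(\ w -> eqF(lo w i)cB)))⟩
  sum(al m)(\ i -> n * # ts(\ w -> eqF(lo w i)cB))≤⟨ s2(al m)U(\ i -> tr(re(cQ i(\ y -> eqF y cB)))(tr(mo U(#-eqF cB))(re(it U))))⟩
  length(al m)* U ≡⟨ co(_* U)(lf m)⟩
  m * U ∎
  where
  open Re
  cB = Fin′.fromℕ< n0

 -- The colour of w in direction i does not depend on its i-th coordinate.
 by-colours : ∀ sel X ->(∀ se ->(∀ F -> se F ≡ tu -> sel F ≡ tu)->(∀{F0}-> F0 ∈ 𝒢 -> se F0 ≡ tu -> Sm se F0)-> # 𝒢 se ≤ X)-> # 𝒢 sel ≤ X * 2 ^ length slices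
 by-colours sel X leaf = tr(re(sym(ta(co(# 𝒢 sel *_)(^-zeroˡ(length slices)))(it _))))
  (tr(near Bool._≟_ 𝒢(\(i , w)F -> BC.col F i w)(\ _ -> tu ∷ fa ∷ [])(\ _ _ -> tu)1 X rf slices 0 sel(\{F}{i}_ _ _ -> b1 _)(\ _ _ -> re(sz slices(\ _ -> refl)))
   (\ se sub eqs -> leaf se sub(\{F0}f₀ h₀{F}f h i w -> ta(sym(BC.cK F i w cB))(ta(eqs f f₀ h h₀(fe{p = \(i , w)-> eqF(lo w i)cB}(ci(aF i)(t1(w [ i ]≔ cB)))(ta(co(\ y -> eqF y cB)(Ve i w cB))(eF cB))))(BC.cK F0 i w cB)))))
   (re(cn _*_(it X)(pn slices 2))))
  where
  cB = Fin′.fromℕ< n0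

scaled-sum : ∀{q η U X Z A}-> U ≤ η * A -> A ≤ X + Z -> 2 * η * Z ≤ U -> q ≡ 2 * η -> U ≤ q * X
scaled-sum{q}{η}{U}{X}{Z}{A}h0 h1 h₃ refl = c6 U _ _(begin
 U + U ≤⟨ m1 h0 h0 ⟩
 η * A + η * A ≤⟨ m1(mo η h1)(mo η h1)⟩
 η *(X + Z)+ η *(X + Z)≡⟨ ri η X Z ⟩
 2 * η * X + 2 * η * Z ≤⟨ m2(2 * η * X)h₃ ⟩
 2 * η * X + U ∎)
 where
 open Re
 ri : ∀ η X Z -> η *(X + Z)+ η *(X + Z)≡ 2 * η * X + 2 * η * Z
 ri = so

#-split : ∀{A : Set}(xs : List A)(p q : A -> Bool)-> # xs p ≤ # xs q + # xs(\ x -> p x ∧ not(q x))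
#-split xs p q = #-or xs{q = q}{r = \ x -> p x ∧ not(q x)}(\ x h -> go(p x)(q x)h)
 where
 go : ∀ a b -> a ≡ tu -> b ≡ tu ⊎ a ∧ not b ≡ tu
 go a tu  h = i1 refl
 go a fa h = i0(ai h refl)

module Heavy(k₂ η : ℕ)where
 private
  m k : ℕ
  m = suc k₂
  k = suc m

 abstract
  ab G γ s Λ₁ aA d Γ c : ℕ
  ab = suc(η * k)
  G = 2 * ab *(2 * ab)* 2 ^ m
  γ = 2 * G * ft m
  s = 4 * γ
  Λ₁ = 2 *(s * 2 ^ 2 ^ k)*(4 * γ)
  aA = 2 ^ k * suc Λ₁
  d = 2 * m *(2 * ab)+ 2 * m * aA
  Γ = suc(d * d)
  c = 2 * k * 2 ^ m * aA
  η′≥ : η * k ≤ ab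
  η′≥ = n2 _
  1≤γ : 1 ≤ γ
  1≤γ = m0(m0(ss(zn{1}))(m0(m0(m0(ss(zn{1}))(ss(zn{η * k})))(m0(ss(zn{1}))(ss(zn{η * k}))))(m9 2 m)))(f0 m)
  G≡ : G ≡ 2 * ab *(2 * ab)* 2 ^ m
  G≡ = refl
  γ≡ : γ ≡ 2 * G * ft m
  γ≡ = refl
  s≡ : s ≡ 4 * γ
  s≡ = refl
  Λ₁≡ : Λ₁ ≡ 2 *(s * 2 ^ 2 ^ k)*(4 * γ)
  Λ₁≡ = refl
  Λ₂≡ : aA ≡ 2 ^ k * suc Λ₁
  Λ₂≡ = refl
  d≥₁ : 2 * m *(2 * ab)≤ d
  d≥₁ = mm _ _
  d≥₂ : 2 * m * aA ≤ d
  d≥₂ = m5 _(2 * m *(2 * ab))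
  Γ≥ : d * d ≤ Γ
  Γ≥ = n2 _
  1≤Γ : 1 ≤ Γ
  1≤Γ = ss zn
  c≡ : 2 * k * 2 ^ m * aA ≡ c
  c≡ = refl

 HeavyAt : ∀{n}-> Fin(suc n)-> Fo(suc n)k -> Set
 HeavyAt{n}x F = suc n ^ m ≤ η * #(tup(suc n)m)(\ w -> F(x ∷ w)(on m))× #(tup(suc n)m)(\ w -> F(x ∷ w)(on m))≤ k * #(tup(suc n)m)(\ w -> F(x ∷ w)(aT k))

 FewBad : ∀{n}-> Fin(suc n)-> Fo(suc n)k -> Set
 FewBad{n}x F = ∀ i -> Γ * #(tup n k)(ManyBad.lB x i F)≤ n ^ k

 module _{n : ℕ}(n0 : 1 ≤ n)(big : c * k ≤ suc n)(big₂ : 2 * G *(m * m)≤ n)(big₃ : 4 * γ * m ≤ n)(x : Fin(suc n))(𝒢 : List(Fo(suc n)k))(minimal : ∀{F}-> F ∈ 𝒢 -> Mi F)(different : Di 𝒢)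
  (Y : ℕ)(smaller : ∀(ℋ : List(Fo n k))->(∀{F}-> F ∈ ℋ -> Mi F)-> Di ℋ -> length ℋ ≤ Y)
  (sel : Fo(suc n)k -> Bool)(h2 : ∀{F}-> F ∈ 𝒢 -> sel F ≡ tu ->(ha c F ≡ fa × HeavyAt x F)× FewBad x F)where
  open HeavyClass{n}{m}x zero n0 𝒢 minimal different Y smaller
  private
   ts = tup n m
   U = n ^ m
   b = bi n m

  module _{F : Fo(suc n)k}(f : F ∈ 𝒢)(h : sel F ≡ tu)where
   private
    M = minimal f
    link-count : ∀ c -> #(tup(suc n)m)(\ w -> F(x ∷ w)(c ∷ aT m))≡ # ts(\ w -> l6 x F c w(aT m))
    link-count c = bj m x(\ w -> bit(F(x ∷ w)(c ∷ aT m)))(\ w oc -> co bit(n1(\ t -> let i , e = oe w oc in s8(Mi.dist M(x ∷ w)(c ∷ aT m)t zero(suc i)e))))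
     where
     s8 : ∀{m}{j : Fin m}-> zero ≡ suc j -> ⊥
     s8()
    U≤ : U ≤ suc n ^ m
    U≤ = m3 m(n2 n)
    hβ : U ≤ ab * # ts(β F)
    hβ = tr(tr U≤(tr(po(p0(po(h2 f h))))(re(co(η *_)(link-count fa)))))(mn(# ts(β F))(tr(tr(re(sym(it η)))(mo η(ss(zn{m}))))η′≥))
    hα : U ≤ ab * # ts(α F)
    hα = tr(tr U≤(tr(po(p0(po(h2 f h))))(tr(mo η(tr(p0(p0(po(h2 f h))))(re(co(k *_)(link-count tu)))))(re(sym(ac η k _))))))(mn(# ts(α F))η′≥)
    hd : ∀ i -> d * d * BC.pairSum F i ≤ n * n * n ^ m
    hd i = begin
     d * d * BC.pairSum F i ≡⟨ co(d * d *_)(BC.pairSum-bad F i)⟩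
     d * d *(n * #(tup n k)(BC.bad F i))≡⟨ r(d * d)n(#(tup n k)(BC.bad F i))⟩
     n *(d * d * #(tup n k)(BC.bad F i))≤⟨ mo n(tr(m0 Γ≥(re(sc(tup n k)(\{(z ∷ w)-> refl}))))(p0(h2 f h)i))⟩
     n * n ^ k ≡⟨ sym(ac n n(n ^ m))⟩
     n * n * n ^ m ∎
     where
     open Re
     r : ∀ a n y -> a *(n * y)≡ n *(a * y)
     r = so
    shape : ∀{y}-> d * y ≤ m *(2 * U)-> d * y ≤ 2 * m * U
    shape q = tr q(re(r m U))
     where
     r : ∀ m u -> m *(2 * u)≡ 2 * m * u
     r = so
    αf = shape(BC.α-few F d hd)
    βf = shape(BC.β-few F d hd)
    up-many : U ≤ 2 * ab * # ts(BC.up F)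
    up-many = scaled-sum{2 * ab}{ab}{U}{# ts(BC.up F)}{_}{# ts(α F)}hα(#-split ts(α F)(BC.up F))(s6{d}{2 * m}(2 * ab)(ss zn)d≥₁ αf)refl
    down-many : U ≤ 2 * ab * # ts(BC.dw F)
    down-many = scaled-sum{2 * ab}{ab}{U}{# ts(BC.dw F)}{_}{# ts(β F)}hβ(#-split ts(β F)(BC.dw F))(s6{d}{2 * m}(2 * ab)(ss zn)d≥₁ βf)refl

   -- The negative link is dense by heaviness and the positive one because all-positive is the best
   -- fit. With few bad configurations each fills its own colour, so up- and down-sets are both
   -- dense and `mixed-many` applies.
   many-mixed : U ≤ γ * #(ks n m)(BC.mi F)
   many-mixed = tr(scaled-sum{2 * G}{G}{U}{ft m * #(ks n m)(BC.mi F)}{_}{# ts(BC.mi F)}tuples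
    (BC.mixed-sets F(\ w i j -> link-swap tu w i j)(\ w i j -> link-swap fa w i j))(s6{n}{m * m}(2 * G)(ss zn)(tr(re(c2(m * m)(2 * G)))big₂)(ni n m))refl)
    (re(ta(sym(ac(2 * G)(ft m)_))(co(_* #(ks n m)(BC.mi F))(sym γ≡))))
    where
    open Re
    link-swap : ∀ c w i j -> l6 x F c(w ⊙ sw i j)(aT m)≡ l6 x F c w(aT m)
    link-swap c w i j = ta(co(l6 x F c(w ⊙ sw i j))(sym(lx(\ t -> ta(lu(aT m)(sw i j)t)(ta(Vr(lo(sw i j)t)tu)(sym(Vr t tu)))))))
     (sA(ml(l7 x F M c))w(aT m)i j)
    r : ∀ e u v p n y -> u * v ≡ p *(n * y)-> e * u *(e * v)≡ n *(e * e * p * y)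
    r e u v p n y q = ta(r₀ e u v)(ta(co(e * e *_)q)(r1 e p n y))
     where
     r₀ : ∀ e u v -> e * u *(e * v)≡ e * e *(u * v)
     r₀ = so
     r1 : ∀ e p n y -> e * e *(p *(n * y))≡ n *(e * e * p * y)
     r1 = so
    tuples : U ≤ G * # ts(BC.mi F)
    tuples = ca U{{nn(af m n0)}}(begin
     U * U ≤⟨ m0 up-many down-many ⟩
     2 * ab * # ts(BC.up F)*(2 * ab * # ts(BC.dw F))≡⟨ r(2 * ab)(# ts(BC.up F))(# ts(BC.dw F))1 1 _(ta(sym(ii _))(co(1 *_)(sym(ii _))))⟩
     1 *(2 * ab *(2 * ab)* 1 *(# ts(BC.up F)* # ts(BC.dw F)))≡⟨ ta(ii _)(co(_*(# ts(BC.up F)* # ts(BC.dw F)))(it(2 * ab *(2 * ab))))⟩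
     2 * ab *(2 * ab)*(# ts(BC.up F)* # ts(BC.dw F))≤⟨ mo(2 * ab *(2 * ab))(BC.mixed-many F zero)⟩
     2 * ab *(2 * ab)*(2 ^ m *(U * # ts(BC.mi F)))≡⟨ r3(2 * ab *(2 * ab))(2 ^ m)U(# ts(BC.mi F))⟩
     U *(2 * ab *(2 * ab)* 2 ^ m * # ts(BC.mi F))≡⟨ co(\ z -> U *(z * # ts(BC.mi F)))(sym G≡)⟩
     U *(G * # ts(BC.mi F))∎)
     where
     r3 : ∀ e p u y -> e *(p *(u * y))≡ u *(e * p * y)
     r3 = so

   -- A stray clause at x either has no other negative literal and lies on the wrong side, or has
   -- another one, and `few-at` bounds those since no large set is free of positive clauses.
   few-stray : suc Λ₁ * stray F ≤ U
   few-stray = ca(2 ^ k){{m^n≢0 2 k}}(begin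
    2 ^ k *(suc Λ₁ * stray F)≡⟨ ta(sym(ac(2 ^ k)(suc Λ₁)_))(cn _*_(sym Λ₂≡)(s1 ts(pa k)(\ w p -> bit(F(x ∷ ι x w)p ∧ not(aw F w p)))))⟩
    aA * sum(pa k)g ≡⟨ sym(s0(pa k)aA g)⟩
    sum(pa k)(\ p -> aA * g p)≤⟨ s2(pa k)U eh ⟩
    length(pa k)* U ≡⟨ co(_* U)(lh(tu ∷ fa ∷ [])k)⟩
    2 ^ k * U ∎)
    where
    open Re
    g : Vec Bool k -> ℕ
    g p = # ts(\ w -> F(x ∷ ι x w)p ∧ not(aw F w p))
    from : ∀{y}-> d * y ≤ 2 * m * U -> aA * y ≤ U
    from = s6{d}{2 * m}aA(ss zn)d≥₂
    eh : ∀ p -> aA * g p ≤ U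
    eh(e ∷ p)= go(bo(iN p))
     where
     pv : ∀ e -> aA * g(e ∷ aT m)≤ U
     pv tu = tr(mo aA(m6 ts(\ w q -> ai(ad q)(na(n1(\ u -> te
      (ai(ta(co(\ z -> eqP(aT k)(if z then aT k else on m))u)(eP(aT k)))(na(up-not-mixed F w u)))(nt(ar{F(x ∷ ι x w)(tu ∷ aT m)}q))))))))(from αf)
     pv fa = tr(mo aA(m6 ts(\ w q -> ai(ad q)(na(n1(\ u -> te
      (ai(ta(co(\ z -> eqP(on m)(if z then aT k else on m))(down-not-up F w u))(eP(on m)))(na(ta(co(\ z -> not(BC.up F w)∧ not z)u)(zr _))))(nt(ar{F(x ∷ ι x w)(fa ∷ aT m)}q))))))))(from βf)
     go : iN p ≡ tu ⊎ iN p ≡ fa -> aA * g(e ∷ p)≤ U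
     go(i0 q)= sb(\ z -> aA * g(e ∷ z)≤ U)(sym(i3 p q))(pv e)
     go(i1 q)= s6{c}{2 * k * 2 ^ m}{U}aA(m0(ss(zn{suc(k₂ + suc(suc(k₂ + 0)))}))(m9 2 m))(re c≡)(begin
      c * g(e ∷ p)≤⟨ mo c(tr(m6 ts(\ w z -> ad z))(aZ m x(\ w -> F(x ∷ w)(e ∷ p))))⟩
      c * #(tup(suc n)m)(\ w -> F(x ∷ w)(e ∷ p))≤⟨ few-at M{c}(po(po(h2 f h)))big(ss zn)x e p q ⟩
      2 * k * suc n ^ m ≤⟨ mo(2 * k)(tr(m3 m(m1 n0(re(sym(ie n)))))(re(db 2 n m)))⟩
      2 * k *(2 ^ m * U)≡⟨ sym(ac(2 * k)(2 ^ m)U)⟩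
      2 * k * 2 ^ m * U ∎)

  P : ℕ -> Set
  P y = y ^(2 * γ)* 2 ^ U ≤(Y * 2 ^ b)^(2 * γ)

  coloured-bound : ∀ se ->(∀ F -> se F ≡ tu -> sel F ≡ tu)->(∀{F0}-> F0 ∈ 𝒢 -> se F0 ≡ tu -> Sm se F0)-> P(# 𝒢 se)
  coloured-bound se sub s7 = by(e5 𝒢 se)
   where
   by : # 𝒢 se ≡ 0 ⊎(∃ \ F -> F ∈ 𝒢 × se F ≡ tu)-> P(# 𝒢 se)
   by(i1 z)= sb P(sym z)(tr(re(co(_* 2 ^ U)(zp(2 * γ)(tr 1≤γ(mm γ _)))))zn)
    where
    zp : ∀ T -> 1 ≤ T -> 0 ^ T ≡ 0
    zp(suc T)_ = refl
   by(i0(F0 , f₀ , h₀))= hh(# 𝒢 se)Y s(2 *(s * 2 ^ 2 ^ k)* e * s)b(#(ks n m)(\ S -> not(BC.mi F0 S)))(#(ks n m)(BC.mi F0))γ U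
    (tr 1≤γ(tr(mm γ _)(re(sym s≡))))(coloured se F0 s e(s7 f₀ h₀)(\{F}f h -> d3(suc Λ₁)U(stray F)(few-stray f(sub F h))))
    (ta(sym(s3(ks n m)_ _))(ta(sc(ks n m)(\ S -> lem(BC.mi F0 S)))(ta(sym(ln(ks n m)))(l1 n m))))
    (many-mixed f₀(sub F0 h₀))(bm n m)(re(sym s≡))ep
    where
    e = U / suc Λ₁
    lem : ∀ b -> bit(not b)+ bit b ≡ 1
    lem tu  = refl
    lem fa = refl
    r : ∀ g a e s -> 4 * g *(a * e * s)≡ s *(a *(4 * g)* e)
    r = so
    ep : 4 * γ *(2 *(s * 2 ^ 2 ^ k)* e * s)≤ s * U
    ep = tr(re(ta(r γ(2 *(s * 2 ^ 2 ^ k))e s)(co(\ z -> s *(z * e))(sym Λ₁≡))))(mo s(tr(mn e(n2 Λ₁))(tr(re(c2(suc Λ₁)e))(m/n*n≤m U(suc Λ₁)))))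

  -- The right side allows Y for the rest and one bit for each set in the link of x. Mixed sets lose
  -- their bit, a saving of order n^m, against O(n^(m-1)) bits for the colouring and ρ for M₀.
  heavy-class : ∀ M₀ ρ -> M₀ ≤ 2 ^ ρ -> 4 * γ * ρ ≤ U -> M₀ * # 𝒢 sel ≤ Y * 2 ^ b
  heavy-class M₀ ρ M₀≤ ρ≤ = go(largest{P}(\ y -> _ ≤? _)(tr(re(co(_* 2 ^ U)(zp(2 * γ)1≤g)))zn)(length 𝒢))
   where
   open Re
   l = length slices
   1≤g : 1 ≤ 2 * γ
   1≤g = tr 1≤γ(mm γ _)
   zp : ∀ T -> 1 ≤ T -> 0 ^ T ≡ 0
   zp(suc T)_ = refl
   r1 : ∀ a b -> 2 *((a + b)*(2 * γ))≡ 4 * γ * a + 4 * γ * b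
   r1 a b = r γ a b
    where
    r : ∀ g a b -> 2 *((a + b)*(2 * g))≡ 4 * g * a + 4 * g * b
    r = so
   slices-small : 4 * γ * l ≤ U
   slices-small = s6{n}{m}(4 * γ)(ss zn)(tr(re(c2 m(4 * γ)))big₃)#-slices
   s9 :(ρ + l)*(2 * γ)≤ U
   s9 = ca 2(tr(re(r1 ρ l))(tr(m1 ρ≤ slices-small)(re(co(U +_)(sym(ie U))))))
   go :(∃ \ X -> P X × ∀{y}-> y ≤ length 𝒢 -> P y -> y ≤ X)-> M₀ * # 𝒢 sel ≤ Y * 2 ^ b
   go(X , hX , upX)= c9(2 * γ)1≤g(begin
    (M₀ * # 𝒢 sel)^(2 * γ)≤⟨ m3(2 * γ)(m0 M₀≤(by-colours sel X(\ se sub s7 -> upX(#-≤ 𝒢 se)(coloured-bound se sub s7))))⟩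
    (2 ^ ρ *(X * 2 ^ l))^(2 * γ)≡⟨ ta(co(_^(2 * γ))(ta(r(2 ^ ρ)X(2 ^ l))(co(X *_)(sym(dr 2 ρ l)))))(ta(db X(2 ^(ρ + l))(2 * γ))(co(X ^(2 * γ)*_)(ao 2(ρ + l)(2 * γ))))⟩
    X ^(2 * γ)* 2 ^((ρ + l)*(2 * γ))≤⟨ mo(X ^(2 * γ))(m7((ρ + l)*(2 * γ))U s9)⟩
    X ^(2 * γ)* 2 ^ U ≤⟨ hX ⟩
    (Y * 2 ^ b)^(2 * γ)∎)
    where
    r : ∀ a x c -> a *(x * c)≡ x *(a * c)
    r = so

budget : ∀{n ν s e K τ x N U L non d mu viol nd a b b₃ k₁ T}-> 1 ≤ n -> 1 ≤ ν -> e ≡ 305 * K -> s ≡(e + 1)* ν -> N ≤ U ->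
 ν *(L *(e * s))≤ U -> ν * τ * e * x ≤ U -> K * b ≤ d + mu -> b₃ ≤ mu -> ν *(183 + 305 * k₁ * K)* mu ≤ U -> 3 * T * ν * viol ≤ n * U ->
 61 *(n * d)≤ 100 *(n * non)+ T * viol -> non ≤ K * a + nd -> 305 * ν * nd ≤ U -> 2 * U ≤ ν * non ->
 L *(305 * K * s)+(τ * x * s + N)*(305 * K)+ 61 * K * s *(3 * b + 5 * k₁ * b₃)+ U ≤ 305 * K * s * a
budget{n}{ν}{s}{e}{K}{τ}{x}{N}{U}{L}{non}{d}{mu}{viol}{nd}{a}{b}{b₃}{k₁}{T}n0 1≤ν refl refl N≤U hL hx hb hb₃ hmu hv ht hn hnd big =
 ca(ν * n){{nn(m0 1≤ν n0)}}(c6(s * n * U)_ _(begin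
  ν * n *(L *(305 * K * s)+(τ * x * s + N)*(305 * K)+ 61 * K * s *(3 * b + 5 * k₁ * b₃)+ U)+ s * n * U
   ≡⟨ r1 ν n L K s τ x N b k₁ b₃ U ⟩
  n *(ν *(L *(305 * K * s)))+ n * s *(ν * τ *(305 * K)* x)+ n *(ν *(305 * K * N + U))+ 183 * s * ν * n *(K * b)+ s * n *(ν *(305 * k₁ * K)* b₃)+ s * n * U
   ≤⟨ m4(s * n * U)(m1(m1(m1(m1(mo n hL)(mo(n * s)hx))(mo n(mo ν(m4 U(mo(305 * K)N≤U)))))(mo(183 * s * ν * n)hb))(mo(s * n)(mo(ν *(305 * k₁ * K))hb₃)))⟩
  n * U + n * s * U + n *(ν *(305 * K * U + U))+ 183 * s * ν * n *(d + mu)+ s * n *(ν *(305 * k₁ * K)* mu)+ s * n * U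
   ≡⟨ r0 n U K ν d mu k₁ ⟩
  n * U + 3 *(s * n * U)+(3 * s * ν *(61 *(n * d))+ s * n *(ν *(183 + 305 * k₁ * K)* mu))
   ≤⟨ m2(n * U + 3 *(s * n * U))(m1(mo(3 * s * ν)ht)(mo(s * n)hmu))⟩
  n * U + 3 *(s * n * U)+(3 * s * ν *(100 *(n * non)+ T * viol)+ s * n * U)
   ≡⟨ r3 n U s ν non T viol ⟩
  n * U + 4 *(s * n * U)+(300 * s * ν * n * non + s *(3 * T * ν * viol))
   ≤⟨ m1(m4(4 *(s * n * U))(tr(mm(n * U)(n * U *(305 * K * ν +(ν ∸ 1))))(re one)))(m2(300 * s * ν * n * non)(mo s hv))⟩
  s * n * U + 4 *(s * n * U)+(300 * s * ν * n * non + s *(n * U))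
   ≤⟨ tr(mm _(4 *(s * n * U)))(re(r5 s n U(300 * s * ν * n * non)))⟩
  300 * s * ν * n * non + 5 * s * n *(2 * U)≤⟨ m2(300 * s * ν * n * non)(mo(5 * s * n)big)⟩
  300 * s * ν * n * non + 5 * s * n *(ν * non)≡⟨ r₅ s ν n non ⟩
  305 * s * ν * n * non ≤⟨ mo(305 * s * ν * n)hn ⟩
  305 * s * ν * n *(K * a + nd)≡⟨ r₆ s ν n K a nd ⟩
  ν * n *(305 * K * s * a)+ s * n *(305 * ν * nd)≤⟨ m2(ν * n *(305 * K * s * a))(mo(s * n)hnd)⟩
  ν * n *(305 * K * s * a)+ s * n * U ∎))
 where
 open Re
 r1 : ∀ ν n L K s τ x N b k₁ b₃ U -> ν * n *(L *(305 * K * s)+(τ * x * s + N)*(305 * K)+ 61 * K * s *(3 * b + 5 * k₁ * b₃)+ U)+ s * n * U ≡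
  n *(ν *(L *(305 * K * s)))+ n * s *(ν * τ *(305 * K)* x)+ n *(ν *(305 * K * N + U))+ 183 * s * ν * n *(K * b)+ s * n *(ν *(305 * k₁ * K)* b₃)+ s * n * U
 r1 = so
 r0 : ∀ n U K ν d mu k₁ -> n * U + n *((305 * K + 1)* ν)* U + n *(ν *(305 * K * U + U))+ 183 *((305 * K + 1)* ν)* ν * n *(d + mu)+((305 * K + 1)* ν)* n *(ν *(305 * k₁ * K)* mu)+((305 * K + 1)* ν)* n * U ≡
  n * U + 3 *(((305 * K + 1)* ν)* n * U)+(3 *((305 * K + 1)* ν)* ν *(61 *(n * d))+((305 * K + 1)* ν)* n *(ν *(183 + 305 * k₁ * K)* mu))
 r0 = so
 r3 : ∀ n U s ν non T viol -> n * U + 3 *(s * n * U)+(3 * s * ν *(100 *(n * non)+ T * viol)+ s * n * U)≡ n * U + 4 *(s * n * U)+(300 * s * ν * n * non + s *(3 * T * ν * viol))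
 r3 = so
 one : n * U + n * U *(305 * K * ν +(ν ∸ 1))≡ s * n * U
 one = ta(ri(n * U)(305 * K * ν)(ν ∸ 1))(ta(co(\ z -> n * U *(305 * K * ν + z))(md 1≤ν))(rn n U K ν))
  where
  ri : ∀ a b c -> a + a *(b + c)≡ a *(b +(1 + c))
  ri = so
  rn : ∀ n U K ν -> n * U *(305 * K * ν + ν)≡(305 * K + 1)* ν * n * U
  rn = so
 r5 : ∀ s n U y -> s * n * U + 4 *(s * n * U)+(y + s *(n * U))+ 4 *(s * n * U)≡ y + 5 * s * n *(2 * U)
 r5 = so
 r₅ : ∀ s ν n non -> 300 * s * ν * n * non + 5 * s * n *(ν * non)≡ 305 * s * ν * n * non
 r₅ = so
 r₆ : ∀ s ν n K a nd -> 305 * s * ν * n *(K * a + nd)≡ ν * n *(305 * K * s * a)+ s * n *(305 * ν * nd)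
 r₆ = so

-- Formulas far from every sign vector

module FarFew(k₂ D : ℕ)where
 k m : ℕ
 k = suc(suc k₂)
 m = suc k₂
 K = ft k
 D₁ = D *(2 ^ k * k)
 T = tn k
 cm = 2 ^ k *(2 ^ k *(k * k))
 cv = k *(k *(2 ^ k *(2 ^ k * 2 ^ k)))
 cc = 2 ^ k *(2 ^ k * 2 ^ k)
 abstract
  ν e s τ q0 qm Y Z L N₀ N : ℕ
  -- Separates few from many non-edges: with at most 2U/ν of them, the part of the stability bound
  -- due to non-edges stays below a quarter of what `Far` requires.
  ν = suc(16 *(m * D₁))
  e = 305 * K
  s =(e + 1)* ν
  τ = 2 *(s * 2 ^ 2 ^ k)
  q0 = ν * τ * e
  qm = 3 * q0 + ν *(183 + 305 * suc k * K)
  Y = 2 ^ k *(k ^ k *(3 * q0 + 4 * D))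
  Z = cm * qm +(cv *(3 * T * ν)+ m * cc *(4 * D₁))
  L = po(sF k₂ Y Z)
  N₀ = po(p0(sF k₂ Y Z))
  N = suc(N₀ +(k * 2 ^ k *(3 * q0)+(k * k *(305 * ν)+ ν *(L *(e * s)))))

  1≤ν : 1 ≤ ν
  1≤ν = ss zn
  ν≥ : 16 *(m * D₁)≤ ν
  ν≥ = n2 _
  e≡ : e ≡ 305 * K
  e≡ = refl
  s≡ : s ≡(e + 1)* ν
  s≡ = refl
  τ≡ : τ ≡ 2 *(s * 2 ^ 2 ^ k)
  τ≡ = refl
  q₁≡ : q0 ≡ ν * τ * e
  q₁≡ = refl
  qm≥₁ : 3 * q0 ≤ qm
  qm≥₁ = mm(3 * q0)_
  qm≥₂ : ν *(183 + 305 * suc k * K)≤ qm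
  qm≥₂ = m5 _(3 * q0)
  Y≡ : 2 ^ k *(k ^ k *(3 * q0 + 4 * D))≡ Y
  Y≡ = refl
  Z≥₁ : cm * qm ≤ Z
  Z≥₁ = mm(cm * qm)_
  Z≥₂ : cv *(3 * T * ν)≤ Z
  Z≥₂ = tr(mm(cv *(3 * T * ν))_)(m5 _(cm * qm))
  Z≥₃ : m * cc *(4 * D₁)≤ Z
  Z≥₃ = tr(m5 _(cv *(3 * T * ν)))(m5 _(cm * qm))
  N≥₀ : suc N₀ ≤ N
  N≥₀ = ss(mm N₀ _)
  N≥₁ : k * 2 ^ k *(3 * q0)≤ N
  N≥₁ = tr(tr(mm(k * 2 ^ k *(3 * q0))_)(m5 _ N₀))(n2 _)
  N≥₂ : k * k *(305 * ν)≤ N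
  N≥₂ = tr(tr(mm(k * k *(305 * ν))_)(tr(m5 _(k * 2 ^ k *(3 * q0)))(m5 _ N₀)))(n2 _)
  N≥₃ : ν *(L *(e * s))≤ N
  N≥₃ = tr(tr(tr(m5 _(k * k *(305 * ν)))(m5 _(k * 2 ^ k *(3 * q0))))(m5 _ N₀))(n2 _)
  containers : ∀ n -> N₀ ≤ n ->(𝒢 : List(Fo n k))->(∀{F}-> F ∈ 𝒢 -> Mi F)-> ∀ sel -> 1 ≤ # 𝒢 sel -> Sp 𝒢 sel Y Z(L * n ^ suc k₂)
  containers = p0(p0(sF k₂ Y Z))

 M = 305 * K * s

 Far : ∀{n}-> Fo n k -> Set
 Far{n}F = ∀ σ -> n ^ k < D * mf σ F

 pos2 : ∀ j -> 1 ≤ 2 ^ j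
 pos2 j = m9 2 j

 1≤e : 1 ≤ e
 1≤e = rp(sym e≡)(m0(ss(zn{304}))(f0 k))

 aO : 1 ≤ s
 aO = rp(sym s≡)(m0(m5 1 e)1≤ν)

 1≤M : 1 ≤ M
 1≤M = m0(rp e≡ 1≤e)aO

 1≤q₁ : 1 ≤ q0
 1≤q₁ = rp(sym q₁≡)(m0(m0 1≤ν(rp(sym τ≡)(m0(ss(zn{1}))(m0 aO(pos2(2 ^ k))))))1≤e)

 module _{n : ℕ}(N≤n : N ≤ n)(𝒢 : List(Fo n k))(minimal : ∀{F}-> F ∈ 𝒢 -> Mi F)(different : Di 𝒢)
  (sel : Fo n k -> Bool)(far : ∀{F}-> F ∈ 𝒢 -> sel F ≡ tu -> Far F)where
  U = n ^ k
  n0 : 1 ≤ n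
  n0 = tr(tr(ss zn)N≥₀)N≤n

  -- If the container has many non-edges, counting with the Turán inequality gives the bound.
  -- Otherwise stability supplies a sign vector fitting every selected member, contradicting `Far`.
  far-count : 1 ≤ # 𝒢 sel -> # 𝒢 sel ^ M * 2 ^ U ≤ 2 ^(M * bi n k)
  far-count ne = use(containers n(tr(tr(n2 _)N≥₀)N≤n)𝒢 minimal sel ne)
   where
   use : Sp 𝒢 sel Y Z(L * n ^ suc k₂)-> # 𝒢 sel ^ M * 2 ^ U ≤ 2 ^(M * bi n k)
   use c = dd(≤-total(2 * U)(ν * non))
    where
    module C = Sp c
    open Clean C.Q hiding(K)
    open St Q
    sp = sparseQ C.bc
    exc-small : ∀{F}-> F ∈ 𝒢 -> C.se F ≡ tu ->(3 * q0 + 4 * D)* exc Q F ≤ U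
    exc-small{F}F∈ h = tr(mo(3 * q0 + 4 * D)(excQ n0(minimal F∈)))(tr(re(ri(3 * q0 + 4 * D)(k ^ k)(exc C.Q F)))
     (s6(k ^ k *(3 * q0 + 4 * D))(pos2 k)(re Y≡)(C.few F∈ h)))
     where
     ri : ∀ a b c -> a *(b * c)≡ b * a * c
     ri = so
    multis-small : qm * mc ≤ U
    multis-small = s6 qm(m0(pos2 k)(m0(pos2 k)(ss(zn{suc k₂ + suc k₂ * k}))))
     Z≥₁(tr(multis-few sp)(re(ri(2 ^ k)k U)))
     where
     ri : ∀ a k u -> a *(a *(k *(k * u)))≡ a *(a *(k * k))* u
     ri = so
    viol-small : 3 * T * ν * vo ≤ n * U
    viol-small = s6(3 * T * ν)(m0(ss(zn{suc k₂}))(m0(ss(zn{suc k₂}))(m0(pos2 k)(m0(pos2 k)(pos2 k)))))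
     Z≥₂(tr(violations-few sp)(re(ri k(2 ^ k)(n * U))))
     where
     ri : ∀ k a u -> k *(k *(a *(a *(a * u))))≡ k *(k *(a *(a * a)))* u
     ri = so
    open Stability{n}{m}n0 Q symQ using(cG; mt; stability)
    clash-small : 4 * D₁ * cG ≤ n * U
    clash-small = s6(4 * D₁)(m0(ss(zn{k₂}))(m0(pos2 k)(m0(pos2 k)(pos2 k))))
     Z≥₃
     (tr(re(sym(s0(al m)Z(\ i -> #(tup n(suc k))(ch(suc i)zero)))))
     (tr(s2(al m)(2 ^ k *(2 ^ k *(2 ^ k *(n * U))))(\ i -> clash-few sp(suc i)zero))(re(ta(co(_*(2 ^ k *(2 ^ k *(2 ^ k *(n * U)))))(lf m))(ri m(2 ^ k)(n * U))))))
     where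
     ri : ∀ m a u -> m *(a *(a *(a * u)))≡ m *(a *(a * a))* u
     ri = so
    dd : 2 * U ≤ ν * non ⊎ ν * non ≤ 2 * U -> # 𝒢 sel ^ M * 2 ^ U ≤ 2 ^(M * bi n k)
    dd(i1 my)= combine-powers(# 𝒢 sel)(# 𝒢 C.se)(pd(ks n k)(\ v -> 1 + q v))K s(τ * x * s)(bi n k)(L * n ^ suc k₂)empties(aL 2)(5 * suc k * aL 3)U
     C.my(sb(\ t -> # 𝒢 C.se ^ s ≤ 2 ^(t * x * s + bi n k)* pd(ks n k)(\ v -> 1 + q v)^ s)(sym τ≡)(cO 𝒢 minimal different C.se Q x s few))product-bound
     (budget{n}{ν}{s}{e}{K}{τ}{x}{bi n k}{U}{L * n ^ suc k₂}{non}{de}{mc}{vo}{nd}{empties}{aL 2}{aL 3}{suc k}{T}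
      n0 1≤ν e≡ s≡(bm n k)loss-small(tr(re(ta(co(_* x)(sym q₁≡))(c2 q0 x)))(m/n*n≤m U q0{{nz}}))two-total three-total
      (tr(mn mc qm≥₂)multis-small)viol-small(turan n0(ss zn)Q symQ)empties-bound nd-small my)
     where
     nz = nn 1≤q₁
     x =(U / q0){{nz}}
     nd = #(tup n k)(\ v -> not(di v))
     nd-small : 305 * ν * nd ≤ U
     nd-small = s6(305 * ν)(ss(zn{suc k₂ + suc k₂ * k}))(tr N≥₂ N≤n)(ni n k)
     loss-small : ν *(L * n ^ suc k₂ *(e * s))≤ U
     loss-small = tr(re(ri ν L(n ^ suc k₂)(e * s)))(mn(n ^ suc k₂)(tr N≥₃ N≤n))
      where
      ri : ∀ a b c d -> a *(b * c * d)≡ a *(b * d)* c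
      ri = so
     few : ∀{F}(F∈ : F ∈ 𝒢)(MF : Mi F)-> C.se F ≡ tu -> #(ks n k)(en MF Q)≤ x
     few{F}F∈ MF h = d3 q0 U _{{nz}}(ca 3(begin
      3 *(q0 * #(ks n k)(en MF Q))≤⟨ mo 3(mo q0(e7 MF Q))⟩
      3 *(q0 *(exc Q F + mc + sum(tup n k)(f9 MF)))≡⟨ ri q0(exc Q F)mc(sum(tup n k)(f9 MF))⟩
      3 * q0 * exc Q F +(3 * q0 * mc + 3 * q0 * sum(tup n k)(f9 MF))≤⟨ m1(tr(mn(exc Q F)(mm(3 * q0)(4 * D)))(exc-small F∈ h))
       (m1(tr(mn mc qm≥₁)multis-small)
        (s6(3 * q0)(m0(ss(zn{suc k₂}))(pos2 k))(tr N≥₁ N≤n)(tr(sum-flips MF)(re(sym(ac k(2 ^ k)U))))))⟩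
      U +(U + U)≡⟨ co(\ z -> U +(U + z))(sym(ie U))⟩
      3 * U ∎))
      where
      open Re
      ri : ∀ q a b c -> 3 *(q *(a + b + c))≡ 3 * q * a +(3 * q * b + 3 * q * c)
      ri = so
    dd(i0 few)= refute(wi 𝒢 C.se(f1(2 ^(L * n ^ suc k₂))(# 𝒢 C.se)ne C.my))(stability(ss zn))
     where
     refute :(∃ \ F -> F ∈ 𝒢 × C.se F ≡ tu)->(∃ \ σ -> n * #(tup n k)(mt σ)≤ k *(m *(2 *(n * non))+ cG))-> # 𝒢 sel ^ M * 2 ^ U ≤ 2 ^(M * bi n k)
     refute(F , F∈ , h)(σ , mis)= el(il refl(begin-strict
      4 *(n * U)<⟨ *-monoʳ-< 4(*-monoʳ-< n{{nn n0}}(far F∈(C.sub F h)σ))⟩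
      4 *(n *(D * mf σ F))≤⟨ mo 4(mo n(mo D bound))⟩
      4 *(n *(D *(exc Q F + #(tup n k)(mt σ)* 2 ^ k)))≡⟨ rg n D(exc Q F)(#(tup n k)(mt σ))(2 ^ k)⟩
      n *(4 * D * exc Q F)+ 4 *(D * 2 ^ k)*(n * #(tup n k)(mt σ))≤⟨ m1(mo n(tr(mn(exc Q F)(m5(4 * D)(3 * q0)))(exc-small F∈ h)))(mo(4 *(D * 2 ^ k))mis)⟩
      n * U + 4 *(D * 2 ^ k)*(k *(m *(2 *(n * non))+ cG))≡⟨ co(n * U +_)(rn D(2 ^ k)k m n non cG)⟩
      n * U +(8 *(m * D₁)*(n * non)+ 4 * D₁ * cG)≤⟨ m2(n * U)(m1(ca 2(tr(re(r4(m * D₁)n non))(tr(mo n(tr(mn non ν≥)few))(re(ring₄ n U)))))clash-small)⟩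
      n * U +(n * U + n * U)≤⟨ tr(mm _(n * U))(re(ring₅(n * U)))⟩
      4 *(n * U)∎))
      where
      open Re
      rg : ∀ n D a b c -> 4 *(n *(D *(a + b * c)))≡ n *(4 * D * a)+ 4 *(D * c)*(n * b)
      rg = so
      rn : ∀ D t k m n x y -> 4 *(D * t)*(k *(m *(2 *(n * x))+ y))≡ 8 *(m *(D *(t * k)))*(n * x)+ 4 *(D *(t * k))* y
      rn = so
      r4 : ∀ a n x -> 2 *(8 * a *(n * x))≡ n *(16 * a * x)
      r4 = so
      ring₄ : ∀ n u -> n *(2 * u)≡ 2 *(n * u)
      ring₄ = so
      ring₅ : ∀ x -> x +(x + x)+ x ≡ 4 * x
      ring₅ = so
      bound : mf σ F ≤ exc Q F + #(tup n k)(mt σ)* 2 ^ k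
      bound = tr(sm(tup n k)eh)(re(ta(s3(tup n k)_ _)(co(exc Q F +_)(sD(tup n k)(2 ^ k)_))))
       where
       eh : ∀ v -> #(pa k)(\ p -> F v p ∧ wr σ v p)≤ #(pa k)(\ p -> F v p ∧ not(Q v p))+ bit(mt σ v)* 2 ^ k
       eh v = tr(#-or(pa k){q = \ p -> F v p ∧ not(Q v p)}{r = \ p -> mt σ v}(\ p hp -> ce p hp(bo(Q v p))))(m2(#(pa k)(\ p -> F v p ∧ not(Q v p)))
        (re(ta(sn(pa k)(bit(mt σ v)))(ta(c2(length(pa k))_)(co(bit(mt σ v)*_)(lh(tu ∷ fa ∷ [])k))))))
        where
        ce : ∀ p -> F v p ∧ wr σ v p ≡ tu -> Q v p ≡ tu ⊎ Q v p ≡ fa -> F v p ∧ not(Q v p)≡ tu ⊎ mt σ v ≡ tu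
        ce p hp(i0 z)= i1(ai(ad hp)(co not z))
        ce p hp(i1 z)= i0(an{p = \ p -> Q v p ∧ wr σ v p}(pt p)(ai z(ar{F v p}hp)))

  far-few : # 𝒢 sel ^ M * 2 ^ U ≤ 2 ^(M * bi n k)
  far-few = go(# 𝒢 sel)refl
   where
   go : ∀ x -> # 𝒢 sel ≡ x -> # 𝒢 sel ^ M * 2 ^ U ≤ 2 ^(M * bi n k)
   go(suc _)h = far-count(rp(sym h)(ss zn))
   go zero    h = tr(re(co(_* 2 ^ U)(ta(co(_^ M)h)(zero^ M 1≤M))))zn
    where
    zero^ : ∀ M -> 1 ≤ M -> 0 ^ M ≡ 0
    zero^(suc M)_ = refl

-- Minimal formulas of a k-SAT function
module _{k n : ℕ}where
 var : Clause k n -> Fin k -> Fin n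
 var c j = po(lo(lits c)j)

 sign : Clause k n -> Fin k -> Bool
 sign c j = p0(lo(lits c)j)

 var-distinct : ∀ c i j -> var c i ≡ var c j -> i ≡ j
 var-distinct c i j e = VU.lookup-injective(distinct c)i j(ta(Vm i po(lits c))(ta e(sym(Vm j po(lits c)))))

 evalLit-eq : ∀(a : Vec Bool n)(l : Literal n)-> evalLit a l ≡ eqB(lo a(po l))(p0 l)
 evalLit-eq a(i , tu)with lo a i
 ... | tu  = refl
 ... | fa = refl
 evalLit-eq a(i , fa)with lo a i
 ... | tu  = refl
 ... | fa = refl

 eL : ∀{l}(a : Vec Bool n)(ls : Vec(Literal n)l)-> evalLits a ls ≡ tu -> ∀ j -> lo a(po(lo ls j))≡ p0(lo ls j)
 eL a(l ∷ ls)h zero    = eB _ _(ta(sym(evalLit-eq a l))(ad h))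
 eL a(l ∷ ls)h(suc j)= eL a ls(ar{evalLit a l}h)j

 e3 : ∀{l}(a : Vec Bool n)(ls : Vec(Literal n)l)->(∀ j -> lo a(po(lo ls j))≡ p0(lo ls j))-> evalLits a ls ≡ tu
 e3 a [] h = refl
 e3 a(l ∷ ls)h = ai(ta(evalLit-eq a l)(ta(co(\ z -> eqB z(p0 l))(h zero))(e6(p0 l))))(e3 a ls(\ j -> h(suc j)))

 e1 : Formula k n -> Vec Bool n -> Bool
 e1 Φ a = ay Φ(\ c -> evalClause c a)

 e0 : ∀ Φ a -> evalFormula Φ a ≡ e1 Φ a
 e0 [] a = refl
 e0(c ∷ Φ)a = co(evalClause c a ∨_)(e0 Φ a)

 Ir : Clause k n -> Formula k n -> Set
 Ir c Φ = ∃ \ a -> evalClause c a ≡ tu ×(∀{c′}-> c′ ∈ Φ -> evalClause c′ a ≡ tu -> c′ ≡ c)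

 -- A clause satisfied by some assignment that falsifies all others kept or still to come is kept,
 -- with that assignment as private witness; any other clause is redundant and dropped. Later
 -- deletions do not harm witnesses.
 minimise : ∀ d2 todo ->(∀{c}-> c ∈ d2 -> Ir c(d2 ++ todo))->
  ∃ \ Φ ->(∀ a -> e1 Φ a ≡ e1(d2 ++ todo)a)×(∀{c}-> c ∈ Φ -> Ir c Φ)
 minimise d2 [] irr = d2 ++ [] ,(\ _ -> refl), \{c}m -> irr(sb(c ∈_)(++-identityʳ d2)m)
 minimise d2(c ∷ todo)irr = dd(bo(ay(allAssignments n)(\ a -> evalClause c a ∧ not(e1(d2 ++ todo)a))))
  where
  weaken : ∀{c′}-> c′ ∈ d2 ++ todo -> c′ ∈ d2 ++ c ∷ todo
  weaken m with ∈-++⁻ d2 m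
  ... | i1 d = ax d
  ... | i0 t = ah d2(th t)
  sl : ∀{c′}-> c′ ∈ d2 ++ c ∷ todo -> c′ ≡ c ⊎ c′ ∈ d2 ++ todo
  sl m with ∈-++⁻ d2 m
  ... | i1 d = i0(ax d)
  ... | i0(he e)= i1 e
  ... | i0(th t)= i0(ah d2 t)
  s7 : ∀{Φ Ψ}a ->(∀{c}-> c ∈ Φ -> evalClause c a ≡ tu -> e1 Ψ a ≡ tu)->(∀{c}-> c ∈ Ψ -> evalClause c a ≡ tu -> e1 Φ a ≡ tu)-> e1 Φ a ≡ e1 Ψ a
  s7{Φ}{Ψ}a f g = go(bo(e1 Φ a))(bo(e1 Ψ a))
   where
   go : e1 Φ a ≡ tu ⊎ e1 Φ a ≡ fa -> e1 Ψ a ≡ tu ⊎ e1 Ψ a ≡ fa -> e1 Φ a ≡ e1 Ψ a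
   go(i1 p)_ = let c , m , e = ae Φ p in ta p(sym(f m e))
   go(i0 p)(i1 q)= let c , m , e = ae Ψ q in ta(g m e)(sym q)
   go(i0 p)(i0 q)= ta p(sym q)
  holds : ∀{Φ}a{c}-> c ∈ Φ -> evalClause c a ≡ tu -> e1 Φ a ≡ tu
  holds a m e = an{p = \ c -> evalClause c a}m e
  move : ∀{c′}-> c′ ∈(c ∷ d2)++ todo -> c′ ∈ d2 ++ c ∷ todo
  move(he refl)= ah d2(he refl)
  move(th m)= weaken m
  dd : ay(allAssignments n)(\ a -> evalClause c a ∧ not(e1(d2 ++ todo)a))≡ tu ⊎ ay(allAssignments n)(\ a -> evalClause c a ∧ not(e1(d2 ++ todo)a))≡ fa ->
   ∃ \ Φ ->(∀ a -> e1 Φ a ≡ e1(d2 ++ c ∷ todo)a)×(∀{c}-> c ∈ Φ -> Ir c Φ)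
  dd(i1 h)= let a , _ , e = ae(allAssignments n)h ; Φ , eq , ir = minimise(c ∷ d2)todo(keep a e)in
   Φ ,(\ a -> ta(eq a)(s7 a(\ m -> holds a(move m))(\ m -> holds a(back(sl m))))), ir
   where
   back : ∀{c′}-> c′ ≡ c ⊎ c′ ∈ d2 ++ todo -> c′ ∈(c ∷ d2)++ todo
   back(i1 e)= he e
   back(i0 m)= th m
   keep : ∀ a -> evalClause c a ∧ not(e1(d2 ++ todo)a)≡ tu -> ∀{c′}-> c′ ∈ c ∷ d2 -> Ir c′((c ∷ d2)++ todo)
   keep a e(th m)= let a′ , s , u = irr m in a′ , s , \ m -> u(move m)
   keep a e(he refl)= a , ad e , \{(he refl)_ -> refl ;(th m)z -> el(te(holds a m z)(nt(ar{evalClause c a}e)))}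
  dd(i0 h)= let Φ , eq , ir = minimise d2 todo(\ m -> let a , s , u = irr m in a , s , \ m -> u(weaken m))in
   Φ ,(\ a -> ta(eq a)(s7 a(\ m -> holds a(weaken m))(\ m e -> ot a(sl m)e))), ir
   where
   ot : ∀ a{c′}-> c′ ≡ c ⊎ c′ ∈ d2 ++ todo -> evalClause c′ a ≡ tu -> e1(d2 ++ todo)a ≡ tu
   ot a(i0 m)e = holds a m e
   ot a(i1 refl)e = n1(\ z -> te(an{p = \ a -> evalClause c a ∧ not(e1(d2 ++ todo)a)}(ag a)(ai e(na z)))h)

 literalIn : Clause k n -> Fin n -> Bool -> Bool
 literalIn c y b = ay(al k)(\ j -> eqF y(var c j)∧ eqB b(sign c j))

 ia : Clause k n -> Vec(Fin n)k -> Vec Bool k -> Bool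
 ia c v p = a2(al k)(\ i -> literalIn c(lo v i)(lo p i))

 iC : ∀ c v p -> ia c v p ≡ tu -> ∀ i -> ∃ \ j -> lo v i ≡ var c j × lo p i ≡ sign c j
 iC c v p h i = let j , _ , e = ae(al k)(aB{p = \ i -> literalIn c(lo v i)(lo p i)}h(aF i))in j , ee(ad e), eB _ _(ar{eqF(lo v i)(var c j)}e)

 iu : ∀ c v p ->(∀ i -> ∃ \ j -> lo v i ≡ var c j × lo p i ≡ sign c j)-> ia c v p ≡ tu
 iu c v p h = a0(al k)(\{i}_ -> let j , a , b = h i in an{p = \ j -> eqF(lo v i)(var c j)∧ eqB(lo p i)(sign c j)}(aF j)(ai(ta(co(eqF(lo v i))(sym a))(eF(lo v i)))(ta(co(eqB(lo p i))(sym b))(e6(lo p i)))))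

 i4 : ∀ c v p -> Ds v -> ia c v p ≡ tu -> ∀ j -> ∃ \ i -> lo v i ≡ var c j × lo p i ≡ sign c j
 i4 c v p d h j = by(Fin.any?(\ i -> f i Fin.≟ j))
  where
  f : Fin k -> Fin k
  f i = po(iC c v p h i)
  fv : ∀ i -> lo v i ≡ var c(f i)× lo p i ≡ sign c(f i)
  fv i = p0(iC c v p h i)
  by : Dec(∃ \ i -> f i ≡ j)-> ∃ \ i -> lo v i ≡ var c j × lo p i ≡ sign c j
  by(yes(i , e))= i , sb(\ j -> lo v i ≡ var c j × lo p i ≡ sign c j)e(fv i)
  by(no ne)= el(not-onto f(\ i i′ e -> d i i′(ta(po(fv i))(ta(co(var c)e)(sym(po(fv i′))))))j(\ i e -> ne(i , e)))

 form : Formula k n -> Fo n k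
 form Φ v p = di v ∧ ay Φ(\ c -> ia c v p)

 satisfied : ∀ c v p a -> Ds v -> ia c v p ≡ tu ->(∀ i -> lo a(lo v i)≡ lo p i)-> evalClause c a ≡ tu
 satisfied c v p a d h s = e3 a(lits c)(\ j -> let i , x , y = i4 c v p d h j in ta(co(lo a)(sym x))(ta(s i)y))

 form-minimal : ∀ Φ ->(∀{c}-> c ∈ Φ -> Ir c Φ)-> Mi(form Φ)
 form-minimal Φ irr = record
  {dist = \ v p h -> dn v(ad h)
  ; perm = \ v p v′ p1 h d sub -> let c , m , e = ae Φ(ar{di v}h)in
   ai(dc v′ d)(an{p = \ c -> ia c v′ p1}m(iu c v′ p1(\ i -> let j , a , b = sub i ; l , a′ , b′ = iC c v p e j in l , ta a a′ , ta b b′)))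
  ; wit = \ v p h -> witness v p(dn v(ad h))(ae Φ(ar{di v}h))}
  where
  witness : ∀ v p -> Ds v ->(∃ \ c -> c ∈ Φ × ia c v p ≡ tu)-> ∃ \(w : Fin n -> Bool)->(∀ i -> w(lo v i)≡ lo p i)×
   (∀ v′ p1 -> form Φ v′ p1 ≡ tu ->(∀ i -> w(lo v′ i)≡ lo p1 i)-> ∀ i -> ∃ \ j -> lo v′ i ≡ lo v j)
  witness v p d(c , m , e)= let a , s , u = irr m in lo a ,(\ i -> let j , x , y = iC c v p e i in ta(co(lo a)x)(ta(eL a(lits c)s j)(sym y))),
   \ v′ p1 h s′ i -> let c′ , m′ , e′ = ae Φ(ar{di v′}h); j , x , _ = iC c′ v′ p1 e′ i in
    fo c′(u m′(satisfied c′ v′ p1 a(dn v′(ad h))e′ s′))v′ i j x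
   where
   fo : ∀ c′ -> c′ ≡ c -> ∀ v′ i j -> lo v′ i ≡ var c′ j -> ∃ \ j -> lo v′ i ≡ lo v j
   fo c′ refl v′ i j x = let l , y , _ = i4 c v p d e j in l , ta x(sym y)

 -- The passage to signed tuples loses nothing about the function, so distinct functions receive
 -- distinct minimal forms (`fd`).
 form-eval : ∀ Φ Ψ ->(∀ v p -> form Φ v p ≡ form Ψ v p)-> ∀ a -> e1 Φ a ≡ tu -> e1 Ψ a ≡ tu
 form-eval Φ Ψ eq a h = let c , m , e = ae Φ h in go c m e
  where
  go : ∀ c -> c ∈ Φ -> evalClause c a ≡ tu -> e1 Ψ a ≡ tu
  go c m e = let c′ , m′ , e′ = ae Ψ(ar{di v}(ta(sym(eq v p))inΦ))in an{p = \ c -> evalClause c a}m′(satisfied c′ v p a dv e′(\ i -> ta(co(lo a)(vl i))(ta(eL a(lits c)e i)(sym(pl i)))))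
   where
   v = tb(var c)
   p = tb(sign c)
   vl : ∀ i -> lo v i ≡ var c i
   vl = Vt(var c)
   pl : ∀ i -> lo p i ≡ sign c i
   pl = Vt(sign c)
   dv : Ds v
   dv i j q = var-distinct c i j(ta(sym(vl i))(ta q(vl j)))
   inΦ : form Φ v p ≡ tu
   inΦ = ai(dc v dv)(an{p = \ c -> ia c v p}m(iu c v p(\ i -> i , vl i , pl i)))

 mF : ∀{T}-> IsKSATFunction k n T -> ∃ \ Φ -> Mi(form Φ)× T ≡ truthTable n(e1 Φ)
 mF(Ψ , e)= let Φ , eq , irr = minimise [] Ψ(\())in Φ , form-minimal Φ irr , ta e(map-cong(\ a -> ta(e0 Ψ a)(sym(eq a)))(allAssignments n))

 forms : ∀{L}-> All.All(IsKSATFunction k n)L -> List(Fo n k)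
 forms All.[] = []
 forms(t All.∷ ts)= form(po(mF t))∷ forms ts

 fg : ∀{L}(ts : All.All(IsKSATFunction k n)L)-> length(forms ts)≡ length L
 fg All.[] = refl
 fg(t All.∷ ts)= co suc(fg ts)

 f4 : ∀{L}(ts : All.All(IsKSATFunction k n)L)-> ∀{F}-> F ∈ forms ts -> Mi F
 f4(t All.∷ ts)(he refl)= po(p0(mF t))
 f4(t All.∷ ts)(th m)= f4 ts m

 fd : ∀{L}(ts : All.All(IsKSATFunction k n)L)-> Unique L -> Di(forms ts)
 fd All.[] _ = AllPairs.[]
 fd(t All.∷ ts)(ne AllPairs.∷ u)= apart ts ne AllPairs.∷ fd ts u
  where
  Φ = po(mF t)
  apart : ∀{L}(ts : All.All(IsKSATFunction k n)L)-> All.All(_ ≢_)L -> All.All(\ G -> ¬(∀ v p -> form Φ v p ≡ G v p))(forms ts)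
  apart All.[] All.[] = All.[]
  apart(t′ All.∷ ts)(ne All.∷ nes)=(\ eq -> ne(ta(p0(p0(mF t)))(ta(map-cong(\ a -> bh a{po(mF t′)}(form-eval Φ(po(mF t′))eq a)(form-eval(po(mF t′))Φ(\ v p -> sym(eq v p))a))(allAssignments n))(sym(p0(p0(mF t′)))))))All.∷ apart ts nes
   where
   bh : ∀ a{Ψ}->(e1 Φ a ≡ tu -> e1 Ψ a ≡ tu)->(e1 Ψ a ≡ tu -> e1 Φ a ≡ tu)-> e1 Φ a ≡ e1 Ψ a
   bh a{Ψ}f g = iff(e1 Φ a)(e1 Ψ a)f g
    where
    iff : ∀ x y ->(x ≡ tu -> y ≡ tu)->(y ≡ tu -> x ≡ tu)-> x ≡ y
    iff tu  y f g = sym(f refl)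
    iff fa fa f g = refl
    iff fa tu f g = g refl

-- Best fitting signs
e2 : ∀ a s -> eqB(eqB a s)s ≡ a
e2 tu  tu  = refl
e2 tu  fa = refl
e2 fa tu  = refl
e2 fa fa = refl

e8 : ∀ a t s -> eqB(eqB a s)(eqB t s)≡ eqB a t
e8 a t tu  = cn eqB(right a)(right t)
 where
 right : ∀ a -> eqB a tu ≡ a
 right tu  = refl
 right fa = refl
e8 tu  tu  fa = refl
e8 tu  fa fa = refl
e8 fa tu  fa = refl
e8 fa fa fa = refl

t6 : ∀{n k}->(Fin n -> Bool)-> Vec(Fin n)k -> Vec Bool k -> Vec Bool k
t6 σ v p = zW eqB p(Vc σ v)

l2 : ∀{n k}(σ : Fin n -> Bool)(v : Vec(Fin n)k)p i -> lo(t6 σ v p)i ≡ eqB(lo p i)(σ(lo v i))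
l2 σ v p i = ta(Vec.lookup-zipWith eqB i p(Vc σ v))(co(eqB(lo p i))(Vm i σ v))

twist-twist : ∀{n k}(σ : Fin n -> Bool)(v : Vec(Fin n)k)p -> t6 σ v(t6 σ v p)≡ p
twist-twist σ v p = lx(\ i -> ta(l2 σ v(t6 σ v p)i)(ta(co(\ z -> eqB z(σ(lo v i)))(l2 σ v p i))(e2(lo p i)(σ(lo v i)))))

f7 : ∀{n k}->(Fin n -> Bool)-> Fo n k -> Fo n k
f7 σ F v p = F v(t6 σ v p)

flip-minimal : ∀{n k}(σ : Fin n -> Bool){F : Fo n k}-> Mi F -> Mi(f7 σ F)
flip-minimal σ{F}M = record
 {dist = \ v p h -> Mi.dist M v(t6 σ v p)h
 ; perm = \ v p v′ p1 h d sub -> Mi.perm M v(t6 σ v p)v′(t6 σ v′ p1)h d(\ i -> let j , a , b = sub i in j , a , ta(l2 σ v′ p1 i)(ta(cn(\ x y -> eqB x(σ y))b a)(sym(l2 σ v p j))))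
 ; wit = \ v p h -> let w , sat , oy = Mi.wit M v(t6 σ v p)h in(\ y -> eqB(w y)(σ y)),
  (\ i -> ta(co(\ z -> eqB z(σ(lo v i)))(ta(sat i)(l2 σ v p i)))(e2(lo p i)(σ(lo v i)))),
  \ v′ p1 h3 s -> oy v′(t6 σ v′ p1)h3(\ i -> ta(ta(sym(e2(w(lo v′ i))(σ(lo v′ i))))(co(\ z -> eqB z(σ(lo v′ i)))(s i)))(sym(l2 σ v′ p1 i)))}

bg : ∀{k}(q : Vec Bool k)f -> sum(pa k)(\ p -> f(zW eqB p q))≡ sum(pa k)f
bg [] f = refl
bg{suc k}(s ∷ q)f = begin
 sum(pa(suc k))(\ p -> f(zW eqB p(s ∷ q)))≡⟨ su(tu ∷ fa ∷ [])k(\ p -> f(zW eqB p(s ∷ q)))⟩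
 g(eqB tu s)+(g(eqB fa s)+ 0)≡⟨ order s ⟩
 g tu +(g fa + 0)≡⟨ cn(\ a b -> a +(b + 0))(bg q(\ p -> f(tu ∷ p)))(bg q(\ p -> f(fa ∷ p)))⟩
 sum(pa k)(\ p -> f(tu ∷ p))+(sum(pa k)(\ p -> f(fa ∷ p))+ 0)≡⟨ sym(su(tu ∷ fa ∷ [])k f)⟩
 sum(pa(suc k))f ∎
 where
 open Ra
 g : Bool -> ℕ
 g c = sum(pa k)(\ p -> f(c ∷ zW eqB p q))
 ri : ∀ a b -> a +(b + 0)≡ b +(a + 0)
 ri = so
 order : ∀ s -> g(eqB tu s)+(g(eqB fa s)+ 0)≡ g tu +(g fa + 0)
 order tu  = refl
 order fa = ri(g fa)(g tu)

br : ∀{A : Set}(xs : List A){p q : A -> Bool}->(∀ x -> p x ≡ q x)-> ay xs p ≡ ay xs q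
br [] h = refl
br(x ∷ xs)h = cn _∨_(h x)(br xs h)

mg : ∀{n k}{σ τ : Fin n -> Bool}(F : Fo n k)->(∀ y -> σ y ≡ τ y)-> mf σ F ≡ mf τ F
mg{n}{k}F h = sc(tup n k)(\ v -> sc(pa k)(\ p -> co(\ z -> bit(F v p ∧ z))(br(al k)(\ j -> co(\ z -> not(eqB(lo p j)z))(h(lo v j))))))

misfits-flip : ∀{n k}(σ τ : Fin n -> Bool)(F : Fo n k)-> mf τ(f7 σ F)≡ mf(\ y -> eqB(τ y)(σ y))F
misfits-flip{n}{k}σ τ F = sc(tup n k)(\ v -> ta(sc(pa k)(\ p -> co(\ z -> bit(F v(t6 σ v p)∧ z))(br(al k)(\ j -> co not(ta(sym(e8(lo p j)(τ(lo v j))(σ(lo v j))))(co(\ z -> eqB z(eqB(τ(lo v j))(σ(lo v j))))(sym(l2 σ v p j))))))))(bg(Vc σ v)(\ p -> bit(F v p ∧ wr(\ y -> eqB(τ y)(σ y))v p))))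

argmin : ∀{A : Set}(xs : List A)(f : A -> ℕ){x}-> x ∈ xs -> ∃ \ y -> y ∈ xs ×(∀{z}-> z ∈ xs -> f y ≤ f z)
argmin(x ∷ [])f _ = x , he refl , \{(he refl)-> rf}
argmin(x ∷ x′ ∷ xs)f _ = let y , m , h = argmin(x′ ∷ xs)f(he refl)in p5 y m h(≤-total(f x)(f y))
 where
 p5 : ∀ y -> y ∈ x′ ∷ xs ->(∀{z}-> z ∈ x′ ∷ xs -> f y ≤ f z)-> f x ≤ f y ⊎ f y ≤ f x -> ∃ \ y -> y ∈ x ∷ x′ ∷ xs ×(∀{z}-> z ∈ x ∷ x′ ∷ xs -> f y ≤ f z)
 p5 y m h(i1 q)= x , he refl , \{(he refl)-> rf ;(th z)-> tr q(h z)}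
 p5 y m h(i0 q)= y , th m , \{(he refl)-> q ;(th z)-> h z}

be : ∀{n k}-> Fo n k -> Bool
be{n}F = a2(allAssignments n)(\ s -> le(mf(\ _ -> tu)F)(mf(lo s)F))

bestTrue-≤ : ∀{n k}{F : Fo n k}-> be F ≡ tu -> ∀ σ -> mf(\ _ -> tu)F ≤ mf σ F
bestTrue-≤{n}{F = F}h σ = tr(lr(aB{p = \ s -> le(mf(\ _ -> tu)F)(mf(lo s)F)}h(ag(tb σ))))(re(mg F(Vt σ)))

best-sign : ∀{n k}(F : Fo n k)-> ∃ \ s -> be(f7(lo s)F)≡ tu
best-sign{n}F = let s , _ , h = argmin(allAssignments n)(\ s -> mf(lo s)F)(ag(replicate n tu))in
 s , a0(allAssignments n)(\{t}_ -> l4(begin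
  mf(\ _ -> tu)(f7(lo s)F)≡⟨ ta(misfits-flip(lo s)(\ _ -> tu)F)(mg F(\ y -> eqB-trueˡ(lo s y)))⟩
  mf(lo s)F ≤⟨ h(ag(tb(\ y -> eqB(lo t y)(lo s y))))⟩
  mf(lo(tb(\ y -> eqB(lo t y)(lo s y))))F ≡⟨ ta(mg F(Vt(\ y -> eqB(lo t y)(lo s y))))(sym(misfits-flip(lo s)(lo t)F))⟩
  mf(lo t)(f7(lo s)F)∎))
 where
 open Re
 eqB-trueˡ : ∀ s -> eqB tu s ≡ s
 eqB-trueˡ tu  = refl
 eqB-trueˡ fa = refl

-- Flipping a formula by its best fitting sign vector makes all-positive the best fit; summing over
-- the sign vectors gives the factor 2^n of the theorem.
sign-classes : ∀{n k}(𝒢 : List(Fo n k))Z W ->(∀ σ -> Z * #(map(f7 σ)𝒢)be ≤ W)-> Z * length 𝒢 ≤ 2 ^ n * W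
sign-classes{n}𝒢 Z W h = begin
 Z * length 𝒢 ≤⟨ mo Z(tr(re(ln 𝒢))(tr(sm 𝒢 one)(re(s1 𝒢 as(\ F s -> bit(be(f7(lo s)F)))))))⟩
 Z * sum as(\ s -> # 𝒢(\ F -> be(f7(lo s)F)))≡⟨ sym(s0 as Z(\ s -> # 𝒢(\ F -> be(f7(lo s)F))))⟩
 sum as(\ s -> Z * # 𝒢(\ F -> be(f7(lo s)F)))≤⟨ s2 as W(\ s -> tr(re(co(Z *_)(sym(sC(f7(lo s))𝒢(bit ∘ be)))))(h(lo s)))⟩
 length as * W ≡⟨ co(_* W)(am n)⟩
 2 ^ n * W ∎
 where
 open Re
 as = allAssignments n
 one : ∀ F -> 1 ≤ sum as(\ s -> bit(be(f7(lo s)F)))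
 one F = let s , e = best-sign F in tr(re(sym(co bit e)))(s4(\ s -> bit(be(f7(lo s)F)))(ag s))

f3 : ∀{n k}(σ : Fin n -> Bool){𝒢 : List(Fo n k)}-> Di 𝒢 -> Di(map(f7 σ)𝒢)
f3 σ AllPairs.[] = AllPairs.[]
f3 σ{F ∷ 𝒢}(a AllPairs.∷ as)= All.tabulate eh AllPairs.∷ f3 σ as
 where
 eh : ∀{H}-> H ∈ map(f7 σ)𝒢 -> ¬(∀ v p -> f7 σ F v p ≡ H v p)
 eh m eq with ma(f7 σ)m
 ... | G , m′ , refl = All.lookup a m′(\ v p -> ta(co(F v)(sym(twist-twist σ v p)))(ta(eq v(t6 σ v p))(co(G v)(twist-twist σ v p))))

-- Changing the sign of x trades the positive clauses at x for those where only x is negative.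
best-link : ∀{n m}{F : Fo n(suc m)}-> Mi F -> be F ≡ tu -> 1 ≤ n -> ∀ x -> #(tup n m)(\ w -> F(x ∷ w)(on m))≤ suc m * #(tup n m)(\ w -> F(x ∷ w)(aT(suc m)))
best-link{n}{m}{F}M best n0 x = tr left(tr(+-cancelˡ-≤(mf(\ _ -> tu)F)_ _(tr(m4 _(bestTrue-≤{F = F}best σ))tl))right)
 where
 open Re
 k = suc m
 ts = tup n k
 pos = aT k
 σ : Fin n -> Bool
 σ y = not(eqF y x)
 T P : Fo n k
 T v p =(eqF(lo v zero)x ∧ eqP p(on m))∧ F v p
 P v p = eqP p pos ∧(ou x v ∧ F v p)
 gd : ∀ v p τ ->(∀ j -> lo p j ≡ τ(lo v j))-> wr{n}{k}τ v p ≡ fa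
 gd v p τ h = n1(\ q -> let j , _ , e = ae(al k)q in te(ta(co(eqB(lo p j))(sym(h j)))(e6(lo p j)))(nt e))
 point : ∀ v p f -> F v p ≡ f -> bit(f ∧ wr σ v p)+ bit((eqF(lo v zero)x ∧ eqP p(on m))∧ f)≤ bit(f ∧ wr(\ _ -> tu)v p)+ bit(eqP p pos ∧(ou x v ∧ f))
 point v p fa f = tr(re(co bit(zr(eqF(lo v zero)x ∧ eqP p(on m)))))zn
 point v p tu f = go(bo(eqF(lo v zero)x ∧ eqP p(on m)))(bo(wr(\ _ -> tu)v p))
  where
  d = Mi.dist M v p f
  W = wr{n}{k}σ v p
  go : eqF(lo v zero)x ∧ eqP p(on m)≡ tu ⊎ eqF(lo v zero)x ∧ eqP p(on m)≡ fa -> wr(\ _ -> tu)v p ≡ tu ⊎ wr(\ _ -> tu)v p ≡ fa ->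
   bit W + bit((eqF(lo v zero)x ∧ eqP p(on m))∧ tu)≤ bit(wr(\ _ -> tu)v p)+ bit(eqP p pos ∧(ou x v ∧ tu))
  go(i1 t)w = tr(m1(re(co bit(gd v p σ fits)))(bt{m = 1}rf))(tr(re(sym(co bit wrong)))(mm _ _))
   where
   p≡ : p ≡ on m
   p≡ = et p(on m)(ar{eqF(lo v zero)x}t)
   wrong : wr(\ _ -> tu)v p ≡ tu
   wrong = an{p = \ j -> not(eqB(lo p j)tu)}(aF zero)(co(\ z -> not(eqB(lo z zero)tu))p≡)
   fits : ∀ j -> lo p j ≡ σ(lo v j)
   fits zero = ta(co(\ z -> lo z zero)p≡)(sym(co not(ad t)))
   fits(suc j)= ta(co(\ z -> lo z(suc j))p≡)(ta(Vr j tu)(sym(na(n1(\ e -> s8(d zero(suc j)(ta(ee(ad t))(sym(ee e)))))))))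
    where
    s8 : ∀{m}{j : Fin m}-> zero ≡ suc j -> ⊥
    s8()
  go(i0 t)(i1 w)= tr(m1(bt{W}{1}rf)(re(co(\ z -> bit(z ∧ tu))t)))(tr(re(sym(co bit w)))(mm _ _))
  go(i0 t)(i0 w)= tr(re(ta(co(bit W +_)(co(\ z -> bit(z ∧ tu))t))(ie _)))(tr(by(bo(ou x v)))(m5 _(bit(wr(\ _ -> tu)v p))))
   where
   all-true : ∀ j -> lo p j ≡ tu
   all-true j = eB _ _(n1(\ e -> te(an{p = \ j -> not(eqB(lo p j)tu)}(aF j)(na e))w))
   p≡ : eqP p pos ≡ tu
   p≡ = sb(\ z -> eqP p z ≡ tu)(lx{u = p}{pos}(\ j -> ta(all-true j)(sym(Vr j tu))))(eP p)
   by : ou x v ≡ tu ⊎ ou x v ≡ fa -> bit W ≤ bit(eqP p pos ∧(ou x v ∧ tu))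
   by(i1 o)= bt(re(sym(co bit(ai p≡(ai o refl)))))
   by(i0 o)= tr(re(co bit(gd v p σ(\ j -> ta(all-true j)(sym(na(n1(\ e -> te(ta(co(\ z -> ou z v)(sym(ee e)))(ol v j))o))))))))zn
 tl : mf σ F + sx T ≤ mf(\ _ -> tu)F + sx P
 tl = begin
  mf σ F + sx T ≡⟨ sym(ta(sc ts(\ v -> s3(pa k)_ _))(s3 ts _ _))⟩
  sum ts(\ v -> sum(pa k)(\ p -> bit(F v p ∧ wr σ v p)+ bit(T v p)))≤⟨ sm ts(\ v -> sm(pa k)(\ p -> point v p(F v p)refl))⟩
  sum ts(\ v -> sum(pa k)(\ p -> bit(F v p ∧ wr(\ _ -> tu)v p)+ bit(P v p)))≡⟨ ta(sc ts(\ v -> s3(pa k)_ _))(s3 ts _ _)⟩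
  mf(\ _ -> tu)F + sx P ∎
 left : #(tup n m)(\ w -> F(x ∷ w)(on m))≤ sx T
 left = tr(sm(tup n m)(\ w -> tr(re(co bit(sym(cn(\ a b ->(a ∧ b)∧ F(x ∷ w)(on m))(eF x)(eP(on m))))))(s4(\ p -> bit(T(x ∷ w)p))(pt(on m)))))
  (tr(s4(\ y -> sum(tup n m)(\ w -> sum(pa k)(\ p -> bit(T(y ∷ w)p))))(aF x))(re(sym(su(al n)m(\ v -> sum(pa k)(\ p -> bit(T v p)))))))
 Px = #(tup n m)(\ w -> F(x ∷ w)pos)
 pos-swap : ∀ i j -> pos ⊙ sw i j ≡ pos
 pos-swap i j = lx(\ t -> ta(lu pos(sw i j)t)(ta(Vr(lo(sw i j)t)tu)(sym(Vr t tu))))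
 f5 : # ts(\ v -> eqF x(lo v zero)∧ F v pos)≤ Px
 f5 = begin
  # ts(\ v -> eqF x(lo v zero)∧ F v pos)≡⟨ su(al n)m(\ v -> bit(eqF x(lo v zero)∧ F v pos))⟩
  sum(al n)(\ y -> #(tup n m)(\ w -> eqF x y ∧ F(y ∷ w)pos))≤⟨ sm(al n)(\ y -> at-y y(eqF x y)refl)⟩
  sum(al n)(\ y -> bit(eqF y x)* Px)≡⟨ sD(al n)Px(\ y -> bit(eqF y x))⟩
  #(al n)(\ y -> eqF y x)* Px ≤⟨ mn Px(#-eqF x)⟩
  1 * Px ≡⟨ ii Px ⟩
  Px ∎
  where
  at-y : ∀ y c -> eqF x y ≡ c -> #(tup n m)(\ w -> c ∧ F(y ∷ w)pos)≤ bit(eqF y x)* Px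
  at-y y fa e = tr(re(sz(tup n m)(\ _ -> refl)))zn
  at-y y tu  e with ee{i = x}{y}e
  ... | refl = re(sym(ta(co(\ z -> bit z * Px)e)(ii Px)))
 right : sx P ≤ k * Px
 right = begin
  sx P ≡⟨ sc ts(\ v -> ta(sc(pa k)(\ p -> bd(eqP p pos)_))(sP pos(\ p -> bit(ou x v ∧ F v p))))⟩
  # ts(\ v -> ou x v ∧ F v pos)≤⟨ tr(m6 ts(\ v h -> let i , e = oe v(ad h)in an{p = \ i -> eqF x(lo v i)∧ F v pos}(aF i)(ai(ta(co(eqF x)(sym e))(eF x))(ar{ou x v}h))))(aq ts(al k)(\ v i -> eqF x(lo v i)∧ F v pos))⟩
  sum(al k)(\ i -> # ts(\ v -> eqF x(lo v i)∧ F v pos))≤⟨ s2(al k)Px(\ i -> tr(re(moved i))f5)⟩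
  length(al k)* Px ≡⟨ co(_* Px)(lf k)⟩
  k * Px ∎
  where
  moved : ∀ i -> # ts(\ v -> eqF x(lo v i)∧ F v pos)≡ # ts(\ v -> eqF x(lo v zero)∧ F v pos)
  moved i = ta(sc ts(\ v -> sym(cn(\ a b -> bit(eqF x a ∧ b))(ta(lu v(sw zero i)zero)(co(lo v)(swapIx-first i)))(ta(co(F(v ⊙ sw zero i))(sym(pos-swap zero i)))(sA(ml M)v pos zero i)))))
   (sum-⊙(al n)(sw zero i)(sd zero i)(rp(sym(lf n))n0)(\ v -> bit(eqF x(lo v zero)∧ F v pos)))

-- Assembling the upper bound

t2 : ∀ xs{n}-> sum xs id ≤ n -> All.All(_≤ n)xs
t2 [] h = All.[]
t2(x ∷ xs)h = tr(mm x(sum xs id))h All.∷ t2 xs(tr(m5(sum xs id)x)h)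

-- In dimension one a set has a single face, which has one of the two colours.
single-mixed : ∀{N}(1≤N : 1 ≤ N)α β w -> Bichromatic.mi{N}{1}1≤N α β w ≡ fa
single-mixed 1≤N α β w = go(Bichromatic.col 1≤N α β zero w)
 where
 go : ∀ c -> not(c ∧ tu)∧ not(not c ∧ tu)≡ fa
 go tu  = refl
 go fa = refl

-- The factor suc n pays for the choice of x, and 2 ^ suc n for the sign vectors already counted in
-- Y. For k >= 3 the saving of order n^m with m >= 2 affords this. For k = 2 it would not, but then
-- no mixed sets exist, contradicting `many-mixed`, so the class is empty.
heavy-few : ∀ k₂ η M₁ -> ∃ \ N -> ∀{n}-> N ≤ n -> ∀ x(𝒢 : List(Fo(suc n)(suc(suc k₂))))->(∀{F}-> F ∈ 𝒢 -> Mi F)-> Di 𝒢 ->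
 ∀ Y ->(∀(ℋ : List(Fo n(suc(suc k₂))))->(∀{F}-> F ∈ ℋ -> Mi F)-> Di ℋ -> length ℋ ≤ Y)-> ∀ sel ->
 (∀{F}-> F ∈ 𝒢 -> sel F ≡ tu ->(ha(Heavy.c k₂ η)F ≡ fa × Heavy.HeavyAt k₂ η x F)× Heavy.FewBad k₂ η x F)->
 suc n *(2 ^ suc n * M₁)* # 𝒢 sel ≤ Y * 2 ^ bi n(suc k₂)
heavy-few zero η M₁ = sum xs id , use
 where
 open Heavy zero η
 xs = 1 ∷ c * 2 ∷ 2 * G *(1 * 1)∷ 4 * γ * 1 ∷ []
 use : ∀{n}-> sum xs id ≤ n -> ∀ x(𝒢 : List(Fo(suc n)2))->(∀{F}-> F ∈ 𝒢 -> Mi F)-> Di 𝒢 ->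
  ∀ Y ->(∀(ℋ : List(Fo n 2))->(∀{F}-> F ∈ ℋ -> Mi F)-> Di ℋ -> length ℋ ≤ Y)-> ∀ sel ->
  (∀{F}-> F ∈ 𝒢 -> sel F ≡ tu ->(ha c F ≡ fa × HeavyAt x F)× FewBad x F)-> suc n *(2 ^ suc n * M₁)* # 𝒢 sel ≤ Y * 2 ^ bi n 1
 use{n}h x 𝒢 minimal different Y smaller sel h2 with t2 xs h
 ... | h0 All.∷ h1 All.∷ h₃ All.∷ h₄ All.∷ All.[] = by(e5 𝒢 sel)
  where
  by : # 𝒢 sel ≡ 0 ⊎(∃ \ F -> F ∈ 𝒢 × sel F ≡ tu)-> suc n *(2 ^ suc n * M₁)* # 𝒢 sel ≤ Y * 2 ^ bi n 1
  by(i1 z)= tr(re(ta(co(suc n *(2 ^ suc n * M₁)*_)z)(ze(suc n *(2 ^ suc n * M₁)))))zn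
  by(i0(F , f , q))= el(il refl(tr(af 1 h0)(tr(many-mixed h0(tr h1(n2 n))h₃ h₄ x 𝒢 minimal different Y smaller sel h2 f q)
   (re(ta(co(γ *_)(sz(ks n 1)(\ S -> co bit(single-mixed h0(\ w -> l6 x F tu w(aT 1))(\ w -> l6 x F fa w(aT 1))S))))(ze γ))))))
heavy-few(suc k₃)η M₁ = sum xs id , use
 where
 open Heavy(suc k₃)η
 m k : ℕ
 m = suc(suc k₃)
 k = suc m
 xs = 1 ∷ c * k ∷ 2 * G *(m * m)∷ 4 * γ * m ∷ M₁ ∷ 20 * γ ∷ []
 use : ∀{n}-> sum xs id ≤ n -> ∀ x(𝒢 : List(Fo(suc n)k))->(∀{F}-> F ∈ 𝒢 -> Mi F)-> Di 𝒢 ->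
  ∀ Y ->(∀(ℋ : List(Fo n k))->(∀{F}-> F ∈ ℋ -> Mi F)-> Di ℋ -> length ℋ ≤ Y)-> ∀ sel ->
  (∀{F}-> F ∈ 𝒢 -> sel F ≡ tu ->(ha c F ≡ fa × HeavyAt x F)× FewBad x F)-> suc n *(2 ^ suc n * M₁)* # 𝒢 sel ≤ Y * 2 ^ bi n m
 use{n}h x 𝒢 minimal different Y smaller sel h2 with t2 xs h
 ... | h0 All.∷ h1 All.∷ h₃ All.∷ h₄ All.∷ h₅ All.∷ h₆ All.∷ All.[] = heavy-class h0(tr h1(n2 n))h₃ h₄ x 𝒢 minimal different Y smaller sel h2(suc n *(2 ^ suc n * M₁))ρ
  (tr(m0(n4(suc n))(mo(2 ^ suc n)(n4 M₁)))(re(sym(ta(dr 2(suc n)(suc n + M₁))(co(2 ^ suc n *_)(dr 2(suc n)M₁))))))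
  (begin
   4 * γ * ρ ≤⟨ mo(4 * γ)(tr(m1(m4 n h0)(m1(m4 n h0)h₅))(re(r1 n)))⟩
   4 * γ *(5 * n)≡⟨ r0 γ n ⟩
   n *(20 * γ)≤⟨ mo n(tr h₆(tr(re(sym(it n)))(mo n(af k₃ h0))))⟩
   n ^ m ∎)
  where
  open Re
  ρ = suc n +(suc n + M₁)
  r1 : ∀ n -> n + n +(n + n + n)≡ 5 * n
  r1 = so
  r0 : ∀ g n -> 4 * g *(5 * n)≡ n *(20 * g)
  r0 = so

tiny-few : ∀{n k s x}Z ρ -> Tiny n k s x -> 1 ≤ s -> Z ≤ 2 ^ ρ -> ρ * s ≤ n ^ k -> Z * x ≤ 2 ^ bi n k
tiny-few{n}{k}{s}{x}Z ρ tiny aO Z≤ ρ≤ = c9 s aO(begin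
 (Z * x)^ s ≡⟨ db Z x s ⟩
 Z ^ s * x ^ s ≤⟨ mn(x ^ s)(tr(m3 s Z≤)(tr(re(ao 2 ρ s))(m7(ρ * s)(n ^ k)ρ≤)))⟩
 2 ^(n ^ k)* x ^ s ≡⟨ c2(2 ^(n ^ k))(x ^ s)⟩
 x ^ s * 2 ^(n ^ k)≤⟨ tiny ⟩
 2 ^(s * bi n k)≡⟨ ta(co(2 ^_)(c2 s(bi n k)))(sym(ao 2(bi n k)s))⟩
 (2 ^ bi n k)^ s ∎)
 where open Re

sum-share : ∀{A : Set}(xs : List A)f B ->(∀ x -> length xs * f x ≤ B)-> sum xs f ≤ B
sum-share [] f B h = zn
sum-share xs@(_ ∷ _)f B h = ca(length xs)(tr(re(sym(s0 xs(length xs)f)))(s2 xs B h))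

hS : ∀{n k c c′}(F : Fo n k)-> c ≤ c′ -> ha c′ F ≡ fa -> ha c F ≡ fa
hS{n}{c = c}{c′}F h n3 = n1(\ q -> let w , m , e = ae(allAssignments n)q in
 te(an{p = emptySet c′ F}m(ai(l4(tr(lr(ad e))(mn(#(al n)(lo w))h)))(ar{le n(c * #(al n)(lo w))}e)))n3)

bit-classes : ∀{O I : Set}(𝒢 : List O)(st : I -> O -> Bool)(Ss : List I)sel X ->
 (∀ se ->(∀ F -> se F ≡ tu -> sel F ≡ tu)->(∀{F G i}-> F ∈ 𝒢 -> G ∈ 𝒢 -> se F ≡ tu -> se G ≡ tu -> i ∈ Ss -> st i F ≡ st i G)-> # 𝒢 se ≤ X)->
 # 𝒢 sel ≤ X * 2 ^ length Ss
bit-classes 𝒢 st Ss sel X leaf = tr(re(sym(ta(co(# 𝒢 sel *_)(^-zeroˡ(length Ss)))(it _))))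
 (tr(near Bool._≟_ 𝒢 st(\ _ -> tu ∷ fa ∷ [])(\ _ _ -> tu)1 X rf Ss 0 sel(\{F}{i}_ _ _ -> b1(st i F))(\ _ _ -> re(sz Ss(\ _ -> refl)))leaf)
  (re(cn _*_(it X)(pn Ss 2))))

ig : ∀{n k}-> Fo n k -> Bool
ig{n}{k}F = ay(tup n k)(\ v -> ay(pa k)(\ p -> F v p ∧ iN p))

positive-class : ∀{n k}(𝒢 : List(Fo n k))->(∀{F}-> F ∈ 𝒢 -> Mi F)-> Di 𝒢 -> # 𝒢(not ∘ ig)≤ 2 ^ bi n k
positive-class{n}{k}𝒢 minimal different = tr(bit-classes 𝒢(\ S F -> F S(aT k))(ks n k)(not ∘ ig)1(\ se sub eqs -> cw 𝒢 se different(\{F}{G}f g hf hg -> sW(minimal f)(minimal g)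
 (\{S}S∈ -> map-cong(\ p -> bh F G(sub F hf)(sub G hg)S p(eqs f g hf hg S∈)(bo(iN p)))(pa k)))))
 (re(ta(ii _)(co(2 ^_)(l1 n k))))
 where
 n3 : ∀ F -> not(ig F)≡ tu -> ∀ v p -> iN p ≡ tu -> F v p ≡ fa
 n3 F h v p ng = n1(\ q -> te(an{p = \ v -> ay(pa k)(\ p -> F v p ∧ iN p)}(t1 v)(an{p = \ p -> F v p ∧ iN p}(pt p)(ai q ng)))(nt h))
 bh : ∀ F G -> not(ig F)≡ tu -> not(ig G)≡ tu -> ∀ S p -> F S(aT k)≡ G S(aT k)-> iN p ≡ tu ⊎ iN p ≡ fa -> F S p ≡ G S p
 bh F G hF hG S p e(i1 q)= ta(n3 F hF S p q)(sym(n3 G hG S p q))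
 bh F G hF hG S p e(i0 q)= sb(\ z -> F S z ≡ G S z)(sym(i3 p q))e

trivial-count : ∀{n k}(𝒢 : List(Fo n k))-> Di 𝒢 -> length 𝒢 ≤ 2 ^(n ^ k * 2 ^ k)
trivial-count{n}{k}𝒢 different = tr(re(ln 𝒢))(tr(bit-classes 𝒢(\ i F -> F(po i)(p0 i))Ss(\ _ -> tu)1
 (\ se _ eqs -> cw 𝒢 se different(\ f g hf hg v p -> eqs f g hf hg(ci(t1 v)(pt p)))))
 (re(ta(ii _)(co(2 ^_)(ta(ln Ss)(ta(sr _,_(tup n k)(pa k)(\ _ -> 1))(ta(sn(tup n k)_)(cn _*_(lg n k)(ta(sym(ln(pa k)))(lh(tu ∷ fa ∷ [])k))))))))))
 where Ss = ct(tup n k)(pa k)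

module Count(k₂ : ℕ)where
 private
  m k : ℕ
  m = suc k₂
  k = suc m
 module Li = Light k₂
 module He = Heavy k₂ Li.η
 abstract
  cE γE γB D : ℕ
  cE = suc(Li.c + He.c)
  γE = 2 * cE ^ k * ft k
  γB = 2 * He.Γ *(2 ^ k * k ^ k)
  D = 2 *(4 * γE * 2 ^ 2 ^ k)*(4 * γE)+ 2 *(4 * γB * 2 ^ 2 ^ k)*(4 * γB)
  cE≥₁ : Li.c ≤ cE
  cE≥₁ = tr(mm Li.c He.c)(n2 _)
  cE≥₂ : He.c ≤ cE
  cE≥₂ = tr(m5 He.c Li.c)(n2 _)
  1≤γE : 1 ≤ γE
  1≤γE = m0(m0(ss(zn{1}))(af k(ss(zn{Li.c + He.c}))))(f0 k)
  1≤γB : 1 ≤ γB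
  1≤γB = m0(m0(ss(zn{1}))He.1≤Γ)(m0(m9 2 k)(af k(ss(zn{m}))))
  empty-tiny : ∀{n}(𝒢 : List(Fo n k))->(∀{F}-> F ∈ 𝒢 -> Mi F)-> Di 𝒢 -> ∀ sel -> 4 * γE ≤ n -> 2 * cE ^ k *(k * k)≤ n -> 1 ≤ n ->
   (∀{F}-> F ∈ 𝒢 -> sel F ≡ tu -> D * nS F ≤ n ^ k × ha cE F ≡ tu)-> Tiny n k(4 * γE)(# 𝒢 sel)
  empty-tiny{n}𝒢 minimal different sel h0 h1 n0 ok = empty-sets-tiny cE D 𝒢 minimal different sel(ss zn)
   (tr(mn n h0)(mo n(tr(re(sym(it n)))(mo n(af k₂ n0)))))(mm _ _)
   (s6{n}{k * k}(2 * cE ^ k)(ss zn)(tr(re(c2(k * k)(2 * cE ^ k)))h1)(ni n k))ok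
  bad-tiny : ∀{n}x i(𝒢 : List(Fo(suc n)k))->(∀{F}-> F ∈ 𝒢 -> Mi F)-> Di 𝒢 -> ∀ sel -> 8 * γB ≤ n -> 2 * He.Γ *(k * k)≤ n -> 1 ≤ n ->
   (∀{F}-> F ∈ 𝒢 -> sel F ≡ tu -> D * nS F ≤ suc n ^ k × n ^ k ≤ He.Γ * #(tup n k)(ManyBad.lB x i F))-> Tiny(suc n)k(4 * γB)(# 𝒢 sel)
  bad-tiny x i 𝒢 minimal different sel h0 h1 n0 ok = ManyBad.many-bad-tiny x i He.Γ D 𝒢 minimal different sel He.1≤Γ h0 h1(m5 _(2 *(4 * γE * 2 ^ 2 ^ k)*(4 * γE)))n0 ok
 module FF = FarFew k₂ D

 module _{n : ℕ}where
  cV : Fo(suc n)k -> Bool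
  cV F = le(D * mf(\ _ -> tu)F)(suc n ^ k)
  hA : Fin(suc n)-> Fo(suc n)k -> Bool
  hA x F = not(le(Li.η * #(tup(suc n)m)(\ w -> F(x ∷ w)(on m)))(suc n ^ m))
  badAt : Fin(suc n)× Fin m -> Fo(suc n)k -> Bool
  badAt(x , i)F = le(n ^ k)(He.Γ * #(tup n k)(ManyBad.lB x i F))
  -- The classes: `s₁` far from unate, `s₂` with a large set free of positive clauses, `s₃` with
  -- many bad configurations at a variable, `s₄` with a heavy variable, `s₅` without one but with a
  -- negative clause, and `s₆` all-positive, the main term.
  s₁ s₂ s₅ s₆ : Fo(suc n)k -> Bool
  s₁ F = be F ∧ not(cV F)
  s₂ F = cV F ∧ ha cE F
  s₅ F =(not(ha cE F)∧ a2(al(suc n))(\ x -> not(hA x F)))∧ ig F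
  s₆ F = not(ig F)
  s₃ : Fin(suc n)× Fin m -> Fo(suc n)k -> Bool
  s₃ xi F = cV F ∧ badAt xi F
  s₄ : Fin(suc n)-> Fo(suc n)k -> Bool
  s₄ x F =(be F ∧ not(ha cE F))∧(hA x F ∧ a2(al m)(\ i -> not(badAt(x , i)F)))
  xis : List(Fin(suc n)× Fin m)
  xis = ct(al(suc n))(al m)

  cases : ∀(𝒢 : List(Fo(suc n)k))-> # 𝒢 be ≤ # 𝒢 s₁ +(# 𝒢 s₂ +(sum xis(\ xi -> # 𝒢(s₃ xi))+(sum(al(suc n))(\ x -> # 𝒢(s₄ x))+(# 𝒢 s₅ + # 𝒢 s₆))))
  cases 𝒢 = or{be}{s₁}{r0}sl(rf)(or{r0}{s₂}{r3}(\ F -> oi{0}{0}(s₂ F))rf(or{r3}{\ F -> ay xis(\ xi -> s₃ xi F)}{r5}(\ F -> oi{0}{0}(ay xis(\ xi -> s₃ xi F)))(aq 𝒢 xis(\ F xi -> s₃ xi F))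
   (or{r5}{\ F -> ay(al(suc n))(\ x -> s₄ x F)}{\ F -> s₅ F ∨ s₆ F}(\ F -> oi{0}{0}(ay(al(suc n))(\ x -> s₄ x F)))(aq 𝒢(al(suc n))(\ F x -> s₄ x F))(or{\ F -> s₅ F ∨ s₆ F}{s₅}{s₆}(\ F -> oi{0}{0}(s₅ F))rf rf))))
   where
   or : ∀{p q r a b}->(∀ F -> p F ≡ tu -> q F ≡ tu ⊎ r F ≡ tu)-> # 𝒢 q ≤ a -> # 𝒢 r ≤ b -> # 𝒢 p ≤ a + b
   or{p}{q}{r}h x y = tr(#-or 𝒢{p}{q}{r}h)(m1 x y)
   r0 r3 r5 : Fo(suc n)k -> Bool
   r5 F = ay(al(suc n))(\ x -> s₄ x F)∨(s₅ F ∨ s₆ F)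
   r3 F = ay xis(\ xi -> s₃ xi F)∨ r5 F
   r0 F = s₂ F ∨ r3 F
   sl : ∀ F -> be F ≡ tu -> s₁ F ≡ tu ⊎ r0 F ≡ tu
   sl F b = by(bo(cV F))(bo(ha cE F))(bo(ig F))(bo(ay(al(suc n))(\ x -> hA x F)))
    where
    to₃ : r3 F ≡ tu -> r0 F ≡ tu
    to₃ = or-r{0}{0}{s₂ F}
    to₄ : r5 F ≡ tu -> r0 F ≡ tu
    to₄ h = to₃(or-r{0}{0}{ay xis(\ xi -> s₃ xi F)}h)
    to₅ : s₅ F ∨ s₆ F ≡ tu -> r0 F ≡ tu
    to₅ h = to₄(or-r{0}{0}{ay(al(suc n))(\ x -> s₄ x F)}h)
    by : cV F ≡ tu ⊎ cV F ≡ fa -> ha cE F ≡ tu ⊎ ha cE F ≡ fa -> ig F ≡ tu ⊎ ig F ≡ fa ->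
     ay(al(suc n))(\ x -> hA x F)≡ tu ⊎ ay(al(suc n))(\ x -> hA x F)≡ fa -> s₁ F ≡ tu ⊎ r0 F ≡ tu
    by(i0 c)_ _ _ = i1(ai b(na c))
    by(i1 c)(i1 e)_ _ = i0(or-l{0}{0}(ai c e))
    by(i1 c)(i0 e)(i0 g)_ = i0(to₅(or-r{0}{0}{s₅ F}(na g)))
    by(i1 c)(i0 e)(i1 g)(i0 h)= i0(to₅(or-l{0}{0}(ai(ai(na e)(a0(al(suc n))(\{x}x∈ -> na(n1(\ q -> te(an{p = \ x -> hA x F}x∈ q)h)))))g)))
    by(i1 c)(i0 e)(i1 g)(i1 h)= let x , x∈ , q = ae(al(suc n))h in i0(at-x x x∈ q(bo(ay(al m)(\ i -> badAt(x , i)F))))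
     where
     at-x : ∀ x -> x ∈ al(suc n)-> hA x F ≡ tu -> ay(al m)(\ i -> badAt(x , i)F)≡ tu ⊎ ay(al m)(\ i -> badAt(x , i)F)≡ fa -> r0 F ≡ tu
     at-x x x∈ q(i1 z)= let i , i∈ , y = ae(al m)z in to₃(or-l{0}{0}(an{p = \ xi -> s₃ xi F}(ci x∈ i∈)(ai c y)))
     at-x x x∈ q(i0 z)= to₄(or-l{0}{0}(an{p = \ x -> s₄ x F}x∈(ai(ai b(na e))(ai q(a0(al m)(\{i}i∈ -> na(n1(\ y -> te(an{p = \ i -> badAt(x , i)F}i∈ y)z))))))))

module Bound(k₂ : ℕ)where
 open Count k₂
 private
  m k : ℕ
  m = suc k₂
  k = suc m

 -- `s₆` contributes the weight M₁, each of `s₁`, `s₂`, `s₃`, `s₅` at most 1 after multiplication by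
 -- M₁, and `s₄` the term with Y.
 classes : ∀ M₁ -> ∃ \ N -> ∀{n}-> N ≤ n -> ∀(𝒢 : List(Fo(suc n)k))->(∀{F}-> F ∈ 𝒢 -> Mi F)-> Di 𝒢 ->
  ∀ Y ->(∀(ℋ : List(Fo n k))->(∀{F}-> F ∈ ℋ -> Mi F)-> Di ℋ -> length ℋ ≤ Y)->
  2 ^ suc n * M₁ * # 𝒢 be ≤ 2 ^ suc n *((M₁ + 4)* 2 ^ bi(suc n)k)+ Y * 2 ^ bi n m
 classes M₁ = sum xs id , use
  where
  l8 = Li.light-few M₁
  h2 = heavy-few k₂ Li.η M₁
  xs = 1 ∷ M₁ ∷ m ∷ FF.N ∷ 3 * FF.M ∷ 3 *(4 * γE)∷ 4 * γE ∷ 2 * cE ^ k *(k * k)∷ 3 *(4 * γB)∷ 8 * γB ∷ 2 * He.Γ *(k * k)∷ po l8 ∷ po h2 ∷ []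
  use : ∀{n}-> sum xs id ≤ n -> ∀(𝒢 : List(Fo(suc n)k))->(∀{F}-> F ∈ 𝒢 -> Mi F)-> Di 𝒢 ->
   ∀ Y ->(∀(ℋ : List(Fo n k))->(∀{F}-> F ∈ ℋ -> Mi F)-> Di ℋ -> length ℋ ≤ Y)->
   2 ^ suc n * M₁ * # 𝒢 be ≤ 2 ^ suc n *((M₁ + 4)* 2 ^ bi(suc n)k)+ Y * 2 ^ bi n m
  use{n}h 𝒢 minimal different Y smaller = go(t2 xs h)
   where
   go : All.All(_≤ n)xs -> 2 ^ suc n * M₁ * # 𝒢 be ≤ 2 ^ suc n *((M₁ + 4)* 2 ^ bi(suc n)k)+ Y * 2 ^ bi n m
   go(h0 All.∷ hM All.∷ hm All.∷ hF All.∷ hF′ All.∷ hE′ All.∷ hE All.∷ hE″ All.∷ hB′ All.∷ hB All.∷ hB″ All.∷ hL All.∷ hH All.∷ All.[])= begin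
    A * M₁ * # 𝒢 be ≤⟨ mo(A * M₁)(cases 𝒢)⟩
    A * M₁ *(# 𝒢 s₁ +(# 𝒢 s₂ +(S₃ +(S₄ +(# 𝒢 s₅ + # 𝒢 s₆)))))≡⟨ ri A M₁(# 𝒢 s₁)(# 𝒢 s₂)S₃ S₄(# 𝒢 s₅)(# 𝒢 s₆)⟩
    A *(M₁ * # 𝒢 s₁ + M₁ * # 𝒢 s₂ + M₁ * S₃ + M₁ * # 𝒢 s₅ + M₁ * # 𝒢 s₆)+ A * M₁ * S₄ ≤⟨ m1(mo A(m1(m1(m1(m1 p₁ p₂)p₃)p₅)(mo M₁(positive-class 𝒢 minimal different))))p₄ ⟩
    A *(B + B + B + B + M₁ * B)+ Y * 2 ^ bi n m ≡⟨ co(\ z -> A * z + Y * 2 ^ bi n m)(rn M₁ B)⟩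
    A *((M₁ + 4)* B)+ Y * 2 ^ bi n m ∎
    where
    open Re
    A = 2 ^ suc n
    B = 2 ^ bi(suc n)k
    S₃ = sum xis(\ xi -> # 𝒢(s₃ xi))
    S₄ = sum(al(suc n))(\ x -> # 𝒢(s₄ x))
    ri : ∀ a m x y z w u v -> a * m *(x +(y +(z +(w +(u + v)))))≡ a *(m * x + m * y + m * z + m * u + m * v)+ a * m * w
    ri = so
    rn : ∀ m b -> b + b + b + b + m * b ≡(m + 4)* b
    rn = so
    up : ∀{x}-> x ≤ n -> x ≤ suc n
    up q = tr q(n2 n)
    -- M₁ and m are at most suc n, so M₁ * (suc n * m) is at most the cube of suc n, hence at most 2
    -- ^ ρ.
    ρ = suc n * 3
    room : ∀ s -> 3 * s ≤ n -> ρ * s ≤ suc n ^ k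
    room s q = tr(re(ac(suc n)3 s))(mo(suc n)(tr(up q)(tr(re(sym(it(suc n))))(mo(suc n)(af k₂(ss(zn{n})))))))
    Z≤ : M₁ *(suc n * m)≤ 2 ^ ρ
    Z≤ = tr(m0(up hM)(mo(suc n)(up hm)))(tr(re(r(suc n)))(tr(m3 3(n4(suc n)))(re(ao 2(suc n)3))))
     where
     r : ∀ x -> x *(x * x)≡ x *(x *(x * 1))
     r = so
    M₁≤ : M₁ ≤ 2 ^ ρ
    M₁≤ = tr(tr(re(sym(it M₁)))(mo M₁(m0(ss(zn{n}))(ss(zn{k₂})))))Z≤
    near-size : ∀ F -> cV F ≡ tu -> D * nS F ≤ suc n ^ k
    near-size F q = tr(mo D(n5 F))(lr q)
    p₁ : M₁ * # 𝒢 s₁ ≤ B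
    p₁ = tiny-few{suc n}{k}{FF.M}M₁ ρ(FF.far-few(up hF)𝒢 minimal different s₁(\{F}f q σ -> tr(la(nt(ar{be F}q)))(mo D(bestTrue-≤{F = F}(ad q)σ))))FF.1≤M M₁≤(room FF.M hF′)
    p₂ : M₁ * # 𝒢 s₂ ≤ B
    p₂ = tiny-few{suc n}{k}{4 * γE}M₁ ρ(empty-tiny 𝒢 minimal different s₂(up hE)(up hE″)(ss zn)(\{F}f q -> near-size F(ad q), ar{cV F}q))(m0(ss(zn{3}))1≤γE)M₁≤(room(4 * γE)hE′)
    p₃ : M₁ * S₃ ≤ B
    p₃ = tr(re(sym(s0 xis M₁(\ xi -> # 𝒢(s₃ xi)))))(sum-share xis(\ xi -> M₁ * # 𝒢(s₃ xi))B(\{(x , i)-> tr(re(r(length xis)M₁(# 𝒢(s₃(x , i)))len))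
     (tiny-few{suc n}{k}{4 * γB}(M₁ *(suc n * m))ρ(bad-tiny x i 𝒢 minimal different(s₃(x , i))hB hB″ h0(\{F}f q -> near-size F(ad q), lr(ar{cV F}q)))(m0(ss(zn{3}))1≤γB)Z≤(room(4 * γB)hB′))}))
     where
     len : length xis ≡ suc n * m
     len = ta(ln xis)(ta(sr _,_(al(suc n))(al m)(\ _ -> 1))(ta(sn(al(suc n))_)(cn _*_(lf(suc n))(ta(sym(ln(al m)))(lf m)))))
     r : ∀ l a y -> l ≡ suc n * m -> l *(a * y)≡ a *(suc n * m)* y
     r l a y refl = r₀(suc n * m)a y
      where
      r₀ : ∀ l a y -> l *(a * y)≡ a * l * y
      r₀ = so
    p₄ : A * M₁ * S₄ ≤ Y * 2 ^ bi n m
    p₄ = tr(re(sym(s0(al(suc n))(A * M₁)(\ x -> # 𝒢(s₄ x)))))(sum-share(al(suc n))(\ x -> A * M₁ * # 𝒢(s₄ x))(Y * 2 ^ bi n m)(\ x -> tr(re(ta(co(_*(A * M₁ * # 𝒢(s₄ x)))(lf(suc n)))(sym(ac(suc n)(A * M₁)(# 𝒢(s₄ x))))))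
     (p0 h2 hH x 𝒢 minimal different Y smaller(s₄ x)(hyp x))))
     where
     hyp : ∀ x{F}-> F ∈ 𝒢 -> s₄ x F ≡ tu ->(ha He.c F ≡ fa × He.HeavyAt x F)× He.FewBad x F
     hyp x{F}f q =(hS F cE≥₂(nt(ar{be F}(ad q))), bf(la(nt(ad(ar{be F ∧ not(ha cE F)}q)))), best-link(minimal f)(ad(ad q))(ss zn)x),
      \ i -> bf(la(nt(aB{p = \ i -> not(badAt(x , i)F)}(ar{hA x F}(ar{be F ∧ not(ha cE F)}q))(aF i))))
    p₅ : M₁ * # 𝒢 s₅ ≤ B
    p₅ = p0 l8(up hL)𝒢 minimal different s₅(\{F}f q ->(hS F cE≥₁(nt(ad(ad q))), \ x -> lr(ta(sym(nl _))(aB{p = \ x -> not(hA x F)}(ar{not(ha cE F)}(ad q))(aF x)))),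
     negative F(ae(tup(suc n)k)(ar{not(ha cE F)∧ a2(al(suc n))(\ x -> not(hA x F))}q)))
     where
     negative : ∀ F ->(∃ \ v -> v ∈ tup(suc n)k × ay(pa k)(\ p -> F v p ∧ iN p)≡ tu)-> Li.Negative F
     negative F(v , _ , q)= let p , _ , z = ae(pa k)q in v , p , ad z , ar{F v p}z

 abstract
  -- The factor Kc for n variables reappears for n + 1 only divided by M₁, since the new factor is 1
  -- + (4 + Kc)/M₁.
  sI : ∀ M₁ -> ∃ \ N -> ∀{n}-> N ≤ n -> ∀ Kc ->(∀(ℋ : List(Fo n k))->(∀{F}-> F ∈ ℋ -> Mi F)-> Di ℋ -> length ℋ ≤ Kc *(2 ^ n * 2 ^ bi n k))->
   ∀(𝒢 : List(Fo(suc n)k))->(∀{F}-> F ∈ 𝒢 -> Mi F)-> Di 𝒢 -> M₁ * length 𝒢 ≤(M₁ +(4 + Kc))*(2 ^ suc n * 2 ^ bi(suc n)k)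
  sI M₁ = po(classes M₁), \{n}N≤n Kc smaller 𝒢 minimal different -> ca(2 ^ suc n){{m^n≢0 2(suc n)}}(begin
   2 ^ suc n *(M₁ * length 𝒢)≡⟨ sym(ac(2 ^ suc n)M₁(length 𝒢))⟩
   2 ^ suc n * M₁ * length 𝒢 ≤⟨ sign-classes 𝒢(2 ^ suc n * M₁)_(\ σ -> p0(classes M₁)N≤n(map(f7 σ)𝒢)(flipped minimal σ)(f3 σ different)(Kc *(2 ^ n * 2 ^ bi n k))smaller)⟩
   2 ^ suc n *(2 ^ suc n *((M₁ + 4)* 2 ^ bi(suc n)k)+ Kc *(2 ^ n * 2 ^ bi n k)* 2 ^ bi n m)≤⟨ mo(2 ^ suc n)(m2(2 ^ suc n *((M₁ + 4)* 2 ^ bi(suc n)k))(tr(re(ta(r1 Kc(2 ^ n)(2 ^ bi n k)(2 ^ bi n m))(co(\ z -> Kc *(2 ^ n * z))(sym(dr 2(bi n m)(bi n k))))))(mo Kc(mn(2 ^ bi(suc n)k)(mm(2 ^ n)_)))))⟩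
   2 ^ suc n *(2 ^ suc n *((M₁ + 4)* 2 ^ bi(suc n)k)+ Kc *(2 ^ suc n * 2 ^ bi(suc n)k))≡⟨ co(2 ^ suc n *_)(r0(2 ^ suc n)M₁(2 ^ bi(suc n)k)Kc)⟩
   2 ^ suc n *((M₁ +(4 + Kc))*(2 ^ suc n * 2 ^ bi(suc n)k))∎)
   where
   open Re
   r1 : ∀ c a b d -> c *(a * b)* d ≡ c *(a *(d * b))
   r1 = so
   r0 : ∀ a m b c -> a *((m + 4)* b)+ c *(a * b)≡(m +(4 + c))*(a * b)
   r0 = so
   flipped : ∀{n}{𝒢 : List(Fo n k)}->(∀{F}-> F ∈ 𝒢 -> Mi F)-> ∀ σ{F}-> F ∈ map(f7 σ)𝒢 -> Mi F
   flipped minimal σ f with ma(f7 σ)f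
   ... | G , g , refl = flip-minimal σ(minimal g)

 abstract
  Kc : ℕ
  Kc = 12 + 2 ^(po(sI 8)^ k * 2 ^ k)

  Kc≥₁ : 12 ≤ Kc
  Kc≥₁ = mm 12 _

  Kc≥₂ : 2 ^(po(sI 8)^ k * 2 ^ k)≤ Kc
  Kc≥₂ = m5 _ 12

 -- With M₁ = 8 the step turns Kc into (12 + Kc)/8 <= Kc, so a fixed constant persists beyond the
 -- threshold; below it the trivial count has been built into Kc.
 bounded : ∀ n(𝒢 : List(Fo n k))->(∀{F}-> F ∈ 𝒢 -> Mi F)-> Di 𝒢 -> length 𝒢 ≤ Kc *(2 ^ n * 2 ^ bi n k)
 bounded n 𝒢 minimal different = go n 𝒢 minimal different(≤-<-connex n(po(sI 8)))
  where
  open Re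
  go : ∀ n(𝒢 : List(Fo n k))->(∀{F}-> F ∈ 𝒢 -> Mi F)-> Di 𝒢 -> n ≤ po(sI 8)⊎ po(sI 8)< n -> length 𝒢 ≤ Kc *(2 ^ n * 2 ^ bi n k)
  go n 𝒢 minimal different(i1 q)= begin
   length 𝒢 ≤⟨ trivial-count 𝒢 different ⟩
   2 ^(n ^ k * 2 ^ k)≤⟨ m7 _ _(mn(2 ^ k)(m3 k q))⟩
   2 ^(po(sI 8)^ k * 2 ^ k)≤⟨ Kc≥₂ ⟩
   Kc ≡⟨ sym(it Kc)⟩
   Kc * 1 ≤⟨ mo Kc(m0(m9 2 n)(m9 2(bi n k)))⟩
   Kc *(2 ^ n * 2 ^ bi n k)∎
  go(suc n)𝒢 minimal different(i0 q)= ca 8(begin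
   8 * length 𝒢 ≤⟨ p0(sI 8)(≤-pred q)Kc(bounded n)𝒢 minimal different ⟩
   (8 +(4 + Kc))* E ≤⟨ mn E(tr(m4 Kc Kc≥₁)(tr(mm(Kc + Kc)(6 * Kc))(re(r1 Kc))))⟩
   8 * Kc * E ≡⟨ ac 8 Kc E ⟩
   8 *(Kc * E)∎)
   where
   E = 2 ^ suc n * 2 ^ bi(suc n)k
   r1 : ∀ c -> c + c + 6 * c ≡ 8 * c
   r1 = so

 -- Kc does not depend on n, so one more step with M₁ = M (4 + Kc) reduces the error to 1/M.
 upper-bound : ∀ M -> ∃ \ N -> ∀ n -> N ≤ n -> ∀(𝒢 : List(Fo n k))->(∀{F}-> F ∈ 𝒢 -> Mi F)-> Di 𝒢 -> M * length 𝒢 ≤(M + 1)*(2 ^ n * 2 ^ bi n k)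
 upper-bound M = suc(po(sI M₁)), use
  where
  M₁ = M *(4 + Kc)
  use : ∀ n -> suc(po(sI M₁))≤ n -> ∀(𝒢 : List(Fo n k))->(∀{F}-> F ∈ 𝒢 -> Mi F)-> Di 𝒢 -> M * length 𝒢 ≤(M + 1)*(2 ^ n * 2 ^ bi n k)
  use(suc n)N≤n 𝒢 minimal different = ca(4 + Kc)(tr(re(r1(4 + Kc)M(length 𝒢)))(tr(p0(sI M₁)(≤-pred N≤n)Kc(bounded n)𝒢 minimal different)(re(r0(4 + Kc)M(2 ^ suc n * 2 ^ bi(suc n)k)))))
   where
   r1 : ∀ c m l -> c *(m * l)≡ m * c * l
   r1 = so
   r0 : ∀ c m e ->(m * c + c)* e ≡ c *((m + 1)* e)
   r0 = so

theorem1p1 :(k : ℕ)-> 2 ≤ k ->(m : ℕ)-> 1 ≤ m ->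
 Σ ℕ \ N ->(n : ℕ)-> N ≤ n ->
  (L : List(List Bool))-> Unique L ->
  ((T : List Bool)->(T ∈ L)⇔ IsKSATFunction k n T)->
  ((m ∸ 1)* 2 ^(n + n C k)≤ m * length L)
   ×(m * length L ≤(m + 1)* 2 ^(n + n C k))
theorem1p1(suc(suc k₂))(ss(ss zn))m _ = po lower + po upper , \ n N≤n L unique enum ->
 p0 lower n(tr(mm _ _)N≤n)L enum ,
 subst₂(\ l e -> m * l ≤(m + 1)* e)(fg(ksat n L enum))(size₂ n)
  (p0 upper n(tr(m5(po upper)(po lower))N≤n)(forms(ksat n L enum))(f4(ksat n L enum))(fd(ksat n L enum)unique))
 where
 k = suc(suc k₂)
 lower = lower-bound k₂ m
 upper = Bound.upper-bound k₂ m
 ksat : ∀ n L ->((T : List Bool)->(T ∈ L)⇔ IsKSATFunction k n T)-> All.All(IsKSATFunction k n)L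
 ksat n L enum = All.tabulate(\{T}t -> Equivalence.to(enum T)t)
 size₂ : ∀ n -> 2 ^ n * 2 ^ bi n k ≡ 2 ^(n + n C k)
 size₂ n = ta(sym(dr 2 n(bi n k)))(co(\ z -> 2 ^(n + z))(bn n k))
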